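{- Let $t$, $\epsilon$, and $\epsilon'$ be positive constants. SETH implies that there exists no fully dynamic algorithm for $(2-\epsilon)$-approximate all Eccentricities on directed, unweighted graphs with $n$ vertices and $\tilde{O}(n)$ edges which has preprocessing time $p(n)=O(n^t)$, amortized update time $u(n)=O(n^{2-\epsilon'})$, and amortized query time $q(n)=O(n^{2-\epsilon'})$. Moreover, SETH implies that there exists no incremental algorithm, and no decremental algorithm, for this problem with preprocessing time $O(n^t)$, worst-case update time $O(n^{2-\epsilon'})$, and worst-case query time $O(n^{2-\epsilon'})$.
   Context: $\tilde{O}$ suppresses polylogarithmic factors. For a directed graph $G=(V,E)$, $d(u,v)$ is the length of a shortest path from $u$ to $v$ ($\infty$ if there is none); the eccentricity of $v$ is $\varepsilon(v)=\max_{u\in V}d(v,u)$. A fully dynamic algorithm preprocesses an initial graph and then supports edge insertions and edge deletions (updates) as well as queries about the current graph; an incremental (decremental) algorithm supports only edge insertions (only edge deletions). For all Eccentricities, a query asks for estimates of the eccentricities of all vertices. An $\alpha$-approximation algorithm answers each query about a parameter with current value $P$ by a value $\hat P$ with $P\le \hat P\le \alpha P$ (equivalently, after rescaling, $P/\alpha\le\hat P\le P$). The model is the word-RAM with $O(\log n)$-bit words. SETH (Strong Exponential Time Hypothesis): for every $\epsilon>0$ there is a $K$ such that $K$-SAT on $N$ variables cannot be solved in $2^{(1-\epsilon)N}\mathrm{poly}(N)$ time on a word-RAM with $O(\log N)$-bit words, even by randomized algorithms. -}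

module Defs where

open import Data.Bool.Base using (Bool; true; false; if_then_else_)
open import Data.Fin.Base using (Fin; toℕ)
import Data.Fin.Properties as Fin
open import Data.Fin.Subset using (Subset; ∣_∣) renaming (_∈_ to _∈ˢ_)
open import Data.Integer.Base as ℤ using (0ℤ)
open import Data.List.Base using (List; []; _∷_; _∷ʳ_; length; map; filter)
open import Data.List.Membership.Propositional using (_∈_; _∉_)
open import Data.List.Relation.Binary.Pointwise using (Pointwise)
open import Data.List.Relation.Unary.All using (All)
open import Data.List.Relation.Unary.Any using (Any)
open import Data.List.Relation.Unary.Unique.Propositional using (Unique)
open import Data.Nat.Base
open import Data.Nat.DivMod using (_/_; _%_)
open import Data.Nat.ListAction using (sum)
open import Data.Nat.Logarithm using (⌊log₂_⌋)
open import Data.Nat.Properties using (m^n≢0)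
open import Data.Product.Base using (_×_; _,_; proj₁; proj₂; Σ-syntax; ∃-syntax)
open import Data.Product.Properties using (≡-dec)
open import Data.Rational.Base as ℚ using (ℚ; 0ℚ; 1ℚ; ↥_; ↧ₙ_)
open import Data.Sum.Base using (_⊎_)
open import Function.Base using (_∘_)
open import Relation.Binary.Construct.Add.Supremum.NonStrict _≤_ using (_≤⁺_)
open import Relation.Binary.PropositionalEquality.Core using (_≡_; _≢_)
open import Relation.Nullary.Construct.Add.Supremum using (_⁺; ⊤⁺; [_])
open import Relation.Nullary.Decidable.Core using (¬?)
open import Relation.Nullary.Negation.Core using (¬_)

------------------------------------------------------------------------
-- Growth rates

2ℚ : ℚ
2ℚ = 1ℚ ℚ.+ 1ℚ

infix 4 _≤_∙_^ℚ_ _=O[n^_] _=Õ[n]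

-- x ≤ c · b^r for a rational exponent r = s / d, raised to the power d.
-- A negative s is moved to the left-hand side as b^(-s).
_≤_∙_^ℚ_ : ℕ → ℕ → ℕ → ℚ → Set
x ≤ c ∙ b ^ℚ r =
  x ^ ↧ₙ r * b ^ ℤ.∣ ↥ r ℤ.⊓ 0ℤ ∣ ≤ c ^ ↧ₙ r * b ^ ℤ.∣ ↥ r ℤ.⊔ 0ℤ ∣

-- f(n) = O(n^r)
_=O[n^_] : (ℕ → ℕ) → ℚ → Set
f =O[n^ r ] = ∃[ C ] ∃[ n₀ ] ∀ n → n₀ ≤ n → f n ≤ C ∙ n ^ℚ r

-- f(n) = Õ(n)
_=Õ[n] : (ℕ → ℕ) → Set
f =Õ[n] =
  ∃[ C ] ∃[ k ] ∃[ n₀ ] ∀ n → n₀ ≤ n → f n ≤ C * n * ⌊log₂ n ⌋ ^ k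

------------------------------------------------------------------------
-- Word-RAM

-- Programs are structured (sequencing, conditionals, loops).  Words are
-- natural numbers below 2^w.
--
-- A memory address is a finite sequence of words, assembled one word at
-- a time in an address register.  Usual RAM addressing is the case of
-- one-word addresses.  Longer addresses are what lets a machine with
-- O(log N)-bit words use more than poly(N) memory cells, which any
-- exponential-time bound on such a machine presupposes.

data Op : Set where
  add sub mul div and or xor shl shr lt eq : Op

-- Registers, address registers and arrays are each named by a natural
-- number; a program mentions only finitely many.
data Prog : Set where
  skip        : Prog
  _⨾_         : Prog → Prog → Prog
  const       : (r k : ℕ) → Prog            -- r := k
  arith       : (r : ℕ) → Op → (x y : ℕ) → Prog  -- r := x op y
  clear       : (a : ℕ) → Prog              -- a := empty sequence
  push        : (a x : ℕ) → Prog            -- append the word x to a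
  load        : (r m a : ℕ) → Prog          -- r := m[a]
  store       : (m a x : ℕ) → Prog          -- m[a] := x
  flip        : (r : ℕ) → Prog              -- r := random bit
  ifnz_then_else_ : (r : ℕ) → Prog → Prog → Prog
  whilenz_loop_   : (r : ℕ) → Prog → Prog

infixr 5 _⨾_

wrap : (w x : ℕ) → ℕ
wrap w x = _%_ x (2 ^ w) {{m^n≢0 2 w}}

quot : ℕ → ℕ → ℕ
quot x zero      = 0
quot x y@(suc _) = x / y

bool : Bool → ℕ
bool b = if b then 1 else 0

-- Applies f to each of the w lowest binary digits.
bitwise : (ℕ → ℕ → ℕ) → (w x y : ℕ) → ℕ
bitwise f zero    x y = 0
bitwise f (suc w) x y = f (x % 2) (y % 2) + 2 * bitwise f w (x / 2) (y / 2)

evalOp : (w : ℕ) → Op → ℕ → ℕ → ℕ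
evalOp w add x y = wrap w (x + y)
evalOp w sub x y = wrap w ((x + 2 ^ w) ∸ y)
evalOp w mul x y = wrap w (x * y)
evalOp w div x y = wrap w (quot x y)
evalOp w and x y = bitwise _⊓_ w x y
evalOp w or  x y = bitwise _⊔_ w x y
evalOp w xor x y = bitwise ∣_-_∣ w x y
evalOp w shl x y = wrap w (x * 2 ^ y)
evalOp w shr x y = wrap w (quot x (2 ^ y))
evalOp w lt  x y = wrap w (bool (x <ᵇ y))
evalOp w eq  x y = wrap w (bool (x ≡ᵇ y))

record State : Set where
  constructor ⟨_,_,_,_⟩
  field
    regs  : ℕ → ℕ
    addrs : ℕ → List ℕ
    mem   : ℕ → List ℕ → ℕ
    coins : ℕ → Bool         -- outcomes of the flips still to come

open State public

_[_↦_] : {A : Set} → (ℕ → A) → ℕ → A → (ℕ → A)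
(f [ i ↦ x ]) j = if i ≡ᵇ j then x else f j

_≡ᵇˡ_ : List ℕ → List ℕ → Bool
[]       ≡ᵇˡ []       = true
(x ∷ xs) ≡ᵇˡ (y ∷ ys) = if x ≡ᵇ y then xs ≡ᵇˡ ys else false
_        ≡ᵇˡ _        = false

_[_↦ˡ_] : (List ℕ → ℕ) → List ℕ → ℕ → (List ℕ → ℕ)
(f [ i ↦ˡ x ]) j = if i ≡ᵇˡ j then x else f j

setReg : ℕ → ℕ → State → State
setReg r x s = record s { regs = regs s [ r ↦ x ] }

-- w ⊢ P , s ⇓[ t ] s′ : with w-bit words, P started in s halts in s′
-- after time t.  Each instruction and each loop test takes one step; a
-- memory access also pays for the length of the address.
data _⊢_,_⇓[_]_ (w : ℕ) : Prog → State → ℕ → State → Set where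
  skip  : ∀ {s} → w ⊢ skip , s ⇓[ 1 ] s
  seq   : ∀ {P Q s s′ s″ t t′} →
          w ⊢ P , s ⇓[ t ] s′ → w ⊢ Q , s′ ⇓[ t′ ] s″ →
          w ⊢ P ⨾ Q , s ⇓[ t + t′ ] s″
  const : ∀ {r k s} →
          w ⊢ const r k , s ⇓[ 1 ] setReg r (wrap w k) s
  arith : ∀ {r o x y s} →
          w ⊢ arith r o x y , s ⇓[ 1 ]
            setReg r (evalOp w o (regs s x) (regs s y)) s
  clear : ∀ {a s} →
          w ⊢ clear a , s ⇓[ 1 ] record s { addrs = addrs s [ a ↦ [] ] }
  push  : ∀ {a x s} →
          w ⊢ push a x , s ⇓[ 1 ]
            record s { addrs = addrs s [ a ↦ addrs s a ∷ʳ regs s x ] }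
  load  : ∀ {r m a s} →
          w ⊢ load r m a , s ⇓[ suc (length (addrs s a)) ]
            setReg r (mem s m (addrs s a)) s
  store : ∀ {m a x s} →
          w ⊢ store m a x , s ⇓[ suc (length (addrs s a)) ]
            record s { mem = mem s [ m ↦ mem s m [ addrs s a ↦ˡ regs s x ] ] }
  flip  : ∀ {r s} →
          w ⊢ flip r , s ⇓[ 1 ]
            setReg r (wrap w (bool (coins s 0))) (record s { coins = coins s ∘ suc })
  if-nz : ∀ {r P Q s s′ t} → regs s r ≢ 0 → w ⊢ P , s ⇓[ t ] s′ →
          w ⊢ ifnz r then P else Q , s ⇓[ suc t ] s′
  if-z  : ∀ {r P Q s s′ t} → regs s r ≡ 0 → w ⊢ Q , s ⇓[ t ] s′ →
          w ⊢ ifnz r then P else Q , s ⇓[ suc t ] s′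
  loop  : ∀ {r P s s′ s″ t t′} → regs s r ≢ 0 →
          w ⊢ P , s ⇓[ t ] s′ → w ⊢ whilenz r loop P , s′ ⇓[ t′ ] s″ →
          w ⊢ whilenz r loop P , s ⇓[ suc (t + t′) ] s″
  done  : ∀ {r P s} → regs s r ≡ 0 →
          w ⊢ whilenz r loop P , s ⇓[ 1 ] s

-- O(log n)-bit words; the constant c is chosen with the algorithm.
wordSize : (c n : ℕ) → ℕ
wordSize c n = c * suc ⌊log₂ n ⌋

-- Initial state: two words in registers 0 and 1, an input in memory,
-- zero everywhere else.
start : (w x y : ℕ) → (ℕ → List ℕ → ℕ) → (ℕ → Bool) → State
start w x y input ω =
  setReg 0 (wrap w x) (setReg 1 (wrap w y)
    ⟨ (λ _ → 0) , (λ _ → []) , (λ m a → wrap w (input m a)) , ω ⟩)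

-- i-th entry of a list, or a default.
at : {A : Set} → A → List A → ℕ → A
at d []       _       = d
at d (x ∷ _)  zero    = x
at d (_ ∷ xs) (suc i) = at d xs i

------------------------------------------------------------------------
-- K-SAT and the Strong Exponential Time Hypothesis

Literal Clause CNF : ℕ → Set
Literal N = Fin N × Bool
Clause  N = List (Literal N)
CNF     N = List (Clause N)

-- Clauses are pairwise distinct, so that for fixed K the input has size
-- poly(N) and a time bound in terms of N alone is meaningful.
IsKCNF : (K : ℕ) {N : ℕ} → CNF N → Set
IsKCNF K F = All (λ C → length C ≤ K) F × Unique F

Satisfies : {N : ℕ} → (Fin N → Bool) → CNF N → Set
Satisfies σ = All (Any (λ l → σ (proj₁ l) ≡ proj₂ l))

Satisfiable : {N : ℕ} → CNF N → Set
Satisfiable F = ∃[ σ ] Satisfies σ F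

litCode : {N : ℕ} → Literal N → ℕ
litCode (x , b) = 2 * toℕ x + bool b

-- Array 0 holds the clause lengths, array 1 the literals of clause i at
-- the addresses (i , j).
cnfInput : {N : ℕ} → CNF N → ℕ → List ℕ → ℕ
cnfInput F 0 (i ∷ [])     = at 0 (map length F) i
cnfInput F 1 (i ∷ j ∷ []) = at 0 (map litCode (at [] F i)) j
cnfInput F _ _            = 0

startSAT : {N : ℕ} (w : ℕ) → CNF N → (ℕ → Bool) → State
startSAT {N} w F = start w N (length F) (cnfInput F)

-- Register 0 holds the answer.
CorrectAnswer : {N : ℕ} → CNF N → State → Set
CorrectAnswer F s =
  (regs s 0 ≡ 1 × Satisfiable F) ⊎ (regs s 0 ≡ 0 × ¬ Satisfiable F)

-- The coin sequence given by the binary digits of k.  For k uniform in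
-- Fin (2 ^ T) these are T independent fair coins, and a computation of
-- at most T steps flips no more than T of them.
digits : ℕ → ℕ → Bool
digits k i = quot k (2 ^ i) % 2 ≡ᵇ 1

-- The randomized program P decides K-SAT in time T with error
-- probability at most 1/3.
DecidesSAT : (K c : ℕ) → Prog → (ℕ → ℕ) → Set
DecidesSAT K c P T =
  ∀ N (F : CNF N) → IsKCNF K F → let w = wordSize c N in
  Σ[ good ∈ Subset (2 ^ T N) ]
    2 * 2 ^ T N ≤ 3 * ∣ good ∣ ×
    (∀ (ω : Fin (2 ^ T N)) → ∃[ t ] ∃[ s ]
       w ⊢ P , startSAT w F (digits (toℕ ω)) ⇓[ t ] s ×
       t ≤ T N ×
       (ω ∈ˢ good → CorrectAnswer F s))

SETH : Set
SETH =
  ∀ (ε : ℚ) → 0ℚ ℚ.< ε → ∃[ K ]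
    ¬ (∃[ c ] ∃[ P ] ∃[ T ]
         DecidesSAT K c P T ×
         (∃[ A ] ∃[ B ] ∀ N → T N ≤ A * suc N ^ B ∙ 2 ^ N ^ℚ (1ℚ ℚ.- ε)))

------------------------------------------------------------------------
-- Directed graphs and eccentricities

Edge : ℕ → Set
Edge n = Fin n × Fin n

-- A directed graph on the vertex set Fin n, listed without repetition
-- (Unique) where it is used as an input.
Digraph : ℕ → Set
Digraph n = List (Edge n)

remove : {n : ℕ} → Edge n → Digraph n → Digraph n
remove e = filter (λ f → ¬? (≡-dec Fin._≟_ Fin._≟_ f e))

data Walk {n : ℕ} (G : Digraph n) : ℕ → Fin n → Fin n → Set where
  nil  : ∀ {u} → Walk G 0 u u
  cons : ∀ {k u v x} → (u , v) ∈ G → Walk G k v x → Walk G (suc k) u x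

-- ℕ ⁺ is ℕ with a top element ⊤⁺, playing the role of ∞.
IsDistance : {n : ℕ} → Digraph n → Fin n → Fin n → ℕ ⁺ → Set
IsDistance G u v [ k ] = Walk G k u v × (∀ l → Walk G l u v → k ≤ l)
IsDistance G u v ⊤⁺    = ∀ l → ¬ Walk G l u v

IsEccentricity : {n : ℕ} → Digraph n → Fin n → ℕ ⁺ → Set
IsEccentricity G v e =
  (∃[ u ] IsDistance G v u e) × (∀ u d → IsDistance G v u d → d ≤⁺ e)

fromℕ : ℕ → ℚ
fromℕ k = ℤ.+ k ℚ./ 1

-- Approx α P P̂ : P ≤ P̂ ≤ α P, an infinite value being answered by ∞.
-- Integer estimates lose nothing: P is an integer, so rounding P̂ down
-- preserves both inequalities.
data Approx (α : ℚ) : ℕ ⁺ → ℕ ⁺ → Set where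
  finite   : ∀ {P P̂} → P ≤ P̂ → fromℕ P̂ ℚ.≤ α ℚ.* fromℕ P →
             Approx α [ P ] [ P̂ ]
  infinite : Approx α ⊤⁺ ⊤⁺

------------------------------------------------------------------------
-- Dynamic algorithms for all Eccentricities

data Mode : Set where
  fullyDynamic incremental decremental : Mode

data DynOp (n : ℕ) : Set where
  insert delete : Edge n → DynOp n
  query         : DynOp n

-- Sequences of operations that the given mode supports, starting from a
-- given graph and keeping the number of edges at most m.
data Valid (mode : Mode) (m : ℕ) {n : ℕ} : Digraph n → List (DynOp n) → Set where
  []     : ∀ {G} → Valid mode m G []
  insert : ∀ {G e ops} → mode ≢ decremental → e ∉ G → length (e ∷ G) ≤ m →
           Valid mode m (e ∷ G) ops → Valid mode m G (insert e ∷ ops)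
  delete : ∀ {G e ops} → mode ≢ incremental → e ∈ G →
           Valid mode m (remove e G) ops → Valid mode m G (delete e ∷ ops)
  query  : ∀ {G ops} → Valid mode m G ops → Valid mode m G (query ∷ ops)

-- In the incremental (decremental) mode onDelete (onInsert) is never
-- called.
record DynAlg : Set where
  field
    wordConst  : ℕ
    preprocess : Prog
    onInsert   : Prog
    onDelete   : Prog
    onQuery    : Prog

open DynAlg public

-- Array 0 holds the endpoints of the i-th edge at addresses (i , 0) and
-- (i , 1).
graphInput : {n : ℕ} → Digraph n → ℕ → List ℕ → ℕ
graphInput G 0 (i ∷ 0 ∷ []) = at 0 (map (toℕ ∘ proj₁) G) i
graphInput G 0 (i ∷ 1 ∷ []) = at 0 (map (toℕ ∘ proj₂) G) i
graphInput G _ _            = 0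

startGraph : {n : ℕ} (w : ℕ) → Digraph n → (ℕ → Bool) → State
startGraph {n} w G = start w n (length G) (graphInput G)

passEdge : {n : ℕ} (w : ℕ) → Edge n → State → State
passEdge w (u , v) s = setReg 0 (wrap w (toℕ u)) (setReg 1 (wrap w (toℕ v)) s)

-- The estimate for vertex v is read from array 1 at address v, where the
-- word 0 stands for ∞ and k + 1 for k.
estimate : {n : ℕ} → State → Fin n → ℕ ⁺
estimate s v with mem s 1 (toℕ v ∷ [])
... | zero  = ⊤⁺
... | suc k = [ k ]

CorrectEstimates : {n : ℕ} → ℚ → Digraph n → State → Set
CorrectEstimates α G s =
  ∀ v e → IsEccentricity G v e → Approx α e (estimate s v)

-- Handles A α G s ops ts : from state s and current graph G, algorithm A
-- processes ops in order, spending the times ts and answering every query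
-- within factor α.
data Handles (A : DynAlg) (α : ℚ) {n : ℕ} :
             Digraph n → State → List (DynOp n) → List ℕ → Set where
  []     : ∀ {G s} → Handles A α G s [] []
  insert : ∀ {G s s′ e t ops ts} → let w = wordSize (wordConst A) n in
           w ⊢ onInsert A , passEdge w e s ⇓[ t ] s′ →
           Handles A α (e ∷ G) s′ ops ts →
           Handles A α G s (insert e ∷ ops) (t ∷ ts)
  delete : ∀ {G s s′ e t ops ts} → let w = wordSize (wordConst A) n in
           w ⊢ onDelete A , passEdge w e s ⇓[ t ] s′ →
           Handles A α (remove e G) s′ ops ts →
           Handles A α G s (delete e ∷ ops) (t ∷ ts)
  query  : ∀ {G s s′ t ops ts} → let w = wordSize (wordConst A) n in
           w ⊢ onQuery A , s ⇓[ t ] s′ →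
           CorrectEstimates α G s′ →
           Handles A α G s′ ops ts →
           Handles A α G s (query ∷ ops) (t ∷ ts)

budget : {n : ℕ} (u q : ℕ) → DynOp n → ℕ
budget u q (insert _) = u
budget u q (delete _) = u
budget u q query      = q

-- A bound on the time t₀ of preprocessing and the times ts of the
-- operations ops, given preprocessing, update and query times p, u and q.
TimeBound : Set₁
TimeBound = {n : ℕ} (p u q t₀ : ℕ) → List (DynOp n) → List ℕ → Set

-- Preprocessing may leave credit for later operations (a potential
-- function that is positive on the initial graph).
Amortized : TimeBound
Amortized p u q t₀ ops ts = t₀ + sum ts ≤ p + sum (map (budget u q) ops)

WorstCase : TimeBound
WorstCase p u q t₀ ops ts =
  t₀ ≤ p × Pointwise _≤_ ts (map (budget u q) ops)

-- A is an α-approximation algorithm for all Eccentricities on directed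
-- graphs with n vertices and at most m(n) edges, with preprocessing,
-- update and query times p(n), u(n) and q(n).  Both guarantees hold for
-- every outcome ω of the coins the algorithm may flip.
Approximates : Mode → TimeBound → ℚ → (m p u q : ℕ → ℕ) → DynAlg → Set
Approximates mode bound α m p u q A =
  ∀ n (G : Digraph n) → Unique G → length G ≤ m n → ∀ (ω : ℕ → Bool) →
  let w = wordSize (wordConst A) n in
  ∃[ t₀ ] ∃[ s₀ ]
    w ⊢ preprocess A , startGraph w G ω ⇓[ t₀ ] s₀ ×
    (∀ ops → Valid mode (m n) G ops →
       ∃[ ts ] Handles A α G s₀ ops ts × bound (p n) (u n) (q n) t₀ ops ts)

HasAlgorithm : Mode → TimeBound → (α : ℚ) (m : ℕ → ℕ) (a b c : ℚ) → Set
HasAlgorithm mode bound α m a b c =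
  ∃[ A ] ∃[ p ] ∃[ u ] ∃[ q ]
    Approximates mode bound α m p u q A ×
    p =O[n^ a ] × u =O[n^ b ] × q =O[n^ c ]

{-# OPTIONS --safe #-}
module Submission where

-- Write an assignment of the N variables as (u , v , w), where u and v fix
-- a = N / q variables each.  A graph on n ≈ 2 ^ a vertices has an edge from u
-- to the clause c if u falsifies c, an edge from a copy of c to v if v
-- falsifies c, and, as the only dynamic edges, those from a clause to its copy
-- if w falsifies it.  A path of length L hangs on every v.  If no v completes
-- (u , w) to a satisfying assignment, u has eccentricity at most 3 + L;
-- otherwise the end of the path of such a v is reached only through the path
-- of an additional vertex, from whose end edges lead to all vertices outside
-- the paths, and u has eccentricity at least 3 + 2 L.  A (2 - ε)-approximation
-- tells the cases apart if L is large.  The 2 ^ (N - 2 a) choices of w are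
-- handled one after the other, each with few updates and one query; in total
-- this takes about 2 ^ (N - 2 a) n ^ (2 - ε′) ≪ 2 ^ N steps.  Instead of
-- undoing the updates for w, which is impossible in the incremental and
-- decremental modes and not covered by their worst-case bounds, the simulated
-- memory is rolled back: a memory cell has one version for each w and a common
-- one that shows the state after preprocessing.
--
-- The machine that decides K-SAT has words of O(log N) bits only.  It keeps
-- numbers of W = O(N) bits as arrays of bits and interprets the dynamic
-- algorithm on them.

open import Defs
open import Data.Bool.Base using (Bool; true; false; if_then_else_; not; _∧_; _∨_; T) renaming (_xor_ to infixr 5 _⊕_)
open import Data.Bool.Properties using (∨-zeroʳ; ∨-identityʳ; ∧-zeroʳ; ∨-conicalˡ; ∨-conicalʳ)
open import Data.Empty using (⊥; ⊥-elim)
import Data.Fin.Base as Fin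
open import Data.Fin.Base using (Fin; toℕ; fromℕ<)
import Data.Fin.Properties as Fin
open import Data.Fin.Properties using (toℕ<n; toℕ-fromℕ<; fromℕ<-toℕ; toℕ-injective; injective⇒≤)
open import Data.Fin.Subset using () renaming (⊤ to full)
open import Data.Fin.Subset.Properties using (∣⊤∣≡n)
import Data.Integer.Base as ℤ
import Data.Integer.Properties as ℤ
open import Data.List.Base using (List; []; _∷_; _∷ʳ_; _++_; length; map; lookup)
open import Data.List.Membership.Propositional using (_∈_; _∉_; lose)
open import Data.List.Membership.Propositional.Properties using (∈-++⁺ˡ; ∈-++⁺ʳ; ∈-++⁻; ∈-lookup; ∈-filter⁺; ∈-filter⁻; ∈-map⁺; ∈-map⁻)
open import Data.List.Properties using (∷-injective; ∷ʳ-injective; ++-assoc; ++-identityʳ; length-++; map-++; length-map; filter-notAll)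
open import Data.List.Relation.Binary.Pointwise using (Pointwise; []; _∷_)
import Data.List.Relation.Unary.All as All
open import Data.List.Relation.Unary.All using (All; []; _∷_)
import Data.List.Relation.Unary.All.Properties as All
open import Data.List.Relation.Unary.AllPairs using ([]; _∷_)
import Data.List.Relation.Unary.AllPairs.Properties as AllPairs
import Data.List.Relation.Unary.Any as Any
open import Data.List.Relation.Unary.Any using (Any; here; there)
open import Data.List.Relation.Unary.Unique.Propositional using (Unique)
open import Data.Nat.Base hiding (_/_; _%_)
open import Data.Nat.DivMod hiding (_div_)
open import Data.Nat.Divisibility using (divides)
open import Data.Nat.ListAction using (sum)
open import Data.Nat.ListAction.Properties using (sum-++)
open import Data.Nat.Logarithm using (⌊log₂_⌋; ⌊log₂[2^n]⌋≡n; ⌊log₂⌋-mono-≤)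
open import Data.Nat.Properties
open import Data.Nat.Tactic.RingSolver using (solve-∀)
open import Data.Product.Base using (_×_; _,_; proj₁; proj₂; Σ-syntax; ∃-syntax)
open import Data.Product.Properties using (≡-dec)
import Data.Rational.Base as ℚ
open import Data.Rational.Base using (ℚ)
import Data.Rational.Properties as ℚ
import Data.Rational.Unnormalised.Base as ℚᵘ
import Data.Rational.Unnormalised.Properties as ℚᵘ
open import Data.Sum.Base using (_⊎_; inj₁; inj₂; [_,_]′)
open import Data.Unit.Base using (⊤; tt)
open import Function.Base using (_∘_; id; case_of_)
open import Relation.Binary.Construct.Add.Supremum.NonStrict _≤_ using (_≤⁺_; [_]; _≤⊤⁺)
open import Relation.Binary.PropositionalEquality using (_≡_; _≢_; refl; sym; trans; cong; cong₂; subst; subst₂; module ≡-Reasoning)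
open import Relation.Nullary.Construct.Add.Supremum using (_⁺; ⊤⁺; [_])
open import Relation.Nullary.Decidable.Core using (Dec; yes; no; ¬?)
open import Relation.Nullary.Negation.Core using (¬_; contradiction)

-- The parts u and v receive only N / (t + 1) variables each, where the integer t bounds the
-- exponent of the preprocessing time. Then n ^ t is about 2 ^ (N t / (t + 1)): preprocessing is
-- affordable, and the remaining variables are left to w. Up to 2 A d edges join the A partial
-- assignments u and v to the d clauses and their copies. They stay linear in n because the rows of
-- the graph are padded to a width of at least d A; for fixed K this enlarges n only by a factor
-- polynomial in N. Rolling back the memory fits worst-case bounds only: under an amortized bound an
-- expensive operation could recur after every rollback. In the fully dynamic mode the edges for w
-- are therefore inserted and deleted again, within one long sequence of operations. The guarantees
-- hold for every coin sequence, so the simulation fixes all coins to `false` and the resulting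
-- procedure is deterministic. Eccentricities are shown to exist only up to double negation, which
-- is enough to determine Boolean values.

≡≤ : ∀ {m n o} → m ≡ n → n ≤ o → m ≤ o
≡≤ refl = id

≤≡ : ∀ {m n o} → m ≤ n → n ≡ o → m ≤ o
≤≡ m≤n refl = m≤n

-- Binary digits of natural numbers

half : ℕ → ℕ
half x = x / 2

odd : ℕ → Bool
odd x = x % 2 ≡ᵇ 1

bit : ℕ → ℕ → Bool
bit zero x = odd x
bit (suc i) x = bit i (half x)

halves : ℕ → ℕ → ℕ
halves zero x = x
halves (suc i) x = halves i (half x)

fromBits : ℕ → (ℕ → Bool) → ℕ
fromBits zero g = 0
fromBits (suc w) g = bool (g 0) + 2 * fromBits w (g ∘ suc)

bits : ℕ → ℕ → List ℕ
bits zero x = []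
bits (suc w) x = bool (odd x) ∷ bits w (half x)

bool<2 : ∀ b → bool b < 2
bool<2 true = s≤s (s≤s z≤n)
bool<2 false = s≤s z≤n

≤ᵇ-false : ∀ {m n} → n < m → (m ≤ᵇ n) ≡ false
≤ᵇ-false {m} {n} n<m with m ≤ᵇ n in e
... | false = refl
... | true = ⊥-elim (<⇒≱ n<m (≤ᵇ⇒≤ m n (subst T (sym e) tt)))

not-true : ∀ {b} → not b ≡ true → b ≡ false
not-true {false} _ = refl

not-false : ∀ {b} → not b ≡ false → b ≡ true
not-false {true} _ = refl

%2≡odd : ∀ x → x % 2 ≡ bool (odd x)
%2≡odd x with x % 2 | m%n<n x 2
... | 0 | _ = refl
... | 1 | _ = refl
... | suc (suc _) | s≤s (s≤s ())

odd+2half : ∀ x → x ≡ bool (odd x) + 2 * half x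
odd+2half x = trans (m≡m%n+[m/n]*n x 2) (cong₂ _+_ (%2≡odd x) (*-comm (half x) 2))

odd-bool+2* : ∀ b x → odd (bool b + 2 * x) ≡ b
odd-bool+2* b x = trans (cong (_≡ᵇ 1) (trans (cong (λ y → (bool b + y) % 2) (*-comm 2 x)) ([m+kn]%n≡m%n (bool b) x 2))) (odd-bool b)
 where
 odd-bool : ∀ b → odd (bool b) ≡ b
 odd-bool true = refl
 odd-bool false = refl

half-bool+2* : ∀ b x → half (bool b + 2 * x) ≡ x
half-bool+2* b x = *-cancelˡ-≡ _ _ 2 (+-cancelˡ-≡ (bool b) _ _ (begin
 bool b + 2 * half (bool b + 2 * x)
  ≡⟨ cong (λ c → bool c + 2 * half (bool b + 2 * x)) (sym (odd-bool+2* b x)) ⟩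
 bool (odd (bool b + 2 * x)) + 2 * half (bool b + 2 * x)
  ≡⟨ sym (odd+2half (bool b + 2 * x)) ⟩
 bool b + 2 * x ∎))
 where open ≡-Reasoning

half-< : ∀ {w x} → x < 2 ^ suc w → half x < 2 ^ w
half-< {w} {x} x< = m<n*o⇒m/o<n (subst (x <_) (*-comm 2 (2 ^ w)) x<)

0<2^ : ∀ w → 0 < 2 ^ w
0<2^ w = m^n>0 2 w

<2^0 : ∀ {x} → x < 2 ^ 0 → x ≡ 0
<2^0 {zero} _ = refl
<2^0 {suc x} (s≤s ())

fromBits< : ∀ w g → fromBits w g < 2 ^ w
fromBits< zero g = s≤s z≤n
fromBits< (suc w) g = begin-strict
 bool (g 0) + 2 * fromBits w (g ∘ suc) <⟨ +-monoˡ-< (2 * fromBits w (g ∘ suc)) (bool<2 (g 0)) ⟩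
 2 + 2 * fromBits w (g ∘ suc) ≡⟨ solve-lem (fromBits w (g ∘ suc)) ⟩
 2 * suc (fromBits w (g ∘ suc)) ≤⟨ *-monoʳ-≤ 2 (fromBits< w (g ∘ suc)) ⟩
 2 * 2 ^ w ∎
 where
 open ≤-Reasoning
 solve-lem : ∀ n → 2 + 2 * n ≡ 2 * suc n
 solve-lem = solve-∀

bit-fromBits : ∀ w g i → i < w → bit i (fromBits w g) ≡ g i
bit-fromBits (suc w) g zero i< = odd-bool+2* (g 0) (fromBits w (g ∘ suc))
bit-fromBits (suc w) g (suc i) (s≤s i<) =
 trans (cong (bit i) (half-bool+2* (g 0) (fromBits w (g ∘ suc)))) (bit-fromBits w (g ∘ suc) i i<)

fromBits-cong : ∀ w {g h} → (∀ i → i < w → g i ≡ h i) → fromBits w g ≡ fromBits w h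
fromBits-cong zero e = refl
fromBits-cong (suc w) e = cong₂ (λ b n → bool b + 2 * n) (e 0 (s≤s z≤n)) (fromBits-cong w (λ i i< → e (suc i) (s≤s i<)))

fromBits-bit : ∀ w x → x < 2 ^ w → fromBits w (λ i → bit i x) ≡ x
fromBits-bit zero x x< = sym (<2^0 x<)
fromBits-bit (suc w) x x< =
 trans (cong (λ n → bool (odd x) + 2 * n) (fromBits-bit w (half x) (half-< {w} x<))) (sym (odd+2half x))

halves-suc : ∀ i x → halves (suc i) x ≡ half (halves i x)
halves-suc zero x = refl
halves-suc (suc i) x = halves-suc i (half x)

bit≡odd-halves : ∀ i x → bit i x ≡ odd (halves i x)
bit≡odd-halves zero x = refl
bit≡odd-halves (suc i) x = bit≡odd-halves i (half x)

halves-0 : ∀ w x → x < 2 ^ w → halves w x ≡ 0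
halves-0 zero x x< = <2^0 x<
halves-0 (suc w) x x< = halves-0 w (half x) (half-< {w} x<)

halves≤ : ∀ i x → halves i x ≤ x
halves≤ zero x = ≤-refl
halves≤ (suc i) x = ≤-trans (halves≤ i (half x)) (m/n≤m x 2)

bits-∷ʳ : ∀ i x → bits i x ∷ʳ bool (bit i x) ≡ bits (suc i) x
bits-∷ʳ zero x = refl
bits-∷ʳ (suc i) x = cong (bool (odd x) ∷_) (bits-∷ʳ i (half x))

length-bits : ∀ w x → length (bits w x) ≡ w
length-bits zero x = refl
length-bits (suc w) x = cong suc (length-bits w (half x))

bool-injective : ∀ {b c} → bool b ≡ bool c → b ≡ c
bool-injective {true} {true} _ = refl
bool-injective {false} {false} _ = refl

-- Both numbers are written with exactly w digits, so the end of the first block is known. This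
-- makes table keys that concatenate two indices unambiguous.
bits-injective : ∀ w {x y ks ls} → x < 2 ^ w → y < 2 ^ w →
         bits w x ++ ks ≡ bits w y ++ ls → x ≡ y × ks ≡ ls
bits-injective zero x< y< e = trans (<2^0 x<) (sym (<2^0 y<)) , e
bits-injective (suc w) {x} {y} x< y< e with ∷-injective e
... | e₁ , e₂ with bits-injective w (half-< {w} x<) (half-< {w} y<) e₂
... | h , ks≡ls = trans (odd+2half x) (trans (cong₂ (λ a b → a + 2 * b) e₁ h) (sym (odd+2half y))) , ks≡ls

-- Digitwise arithmetic with a carry

-- A transducer maps the current bits of two numbers and a carry to an
-- output bit and the next carry, least significant bit first.
Transducer : Set
Transducer = Bool → Bool → Bool → Bool × Bool

carryAt : Transducer → Bool → ℕ → ℕ → ℕ → Bool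
carryAt f c x y zero = c
carryAt f c x y (suc i) = proj₂ (f (bit i x) (bit i y) (carryAt f c x y i))

outAt : Transducer → Bool → ℕ → ℕ → ℕ → Bool
outAt f c x y i = proj₁ (f (bit i x) (bit i y) (carryAt f c x y i))

transduce : ℕ → Transducer → Bool → ℕ → ℕ → ℕ
transduce w f c x y = fromBits w (outAt f c x y)

carryAt-suc : ∀ f c x y i →
 carryAt f c x y (suc i) ≡ carryAt f (proj₂ (f (odd x) (odd y) c)) (half x) (half y) i
carryAt-suc f c x y zero = refl
carryAt-suc f c x y (suc i) =
 cong (λ c' → proj₂ (f (bit i (half x)) (bit i (half y)) c')) (carryAt-suc f c x y i)

transduce-suc : ∀ w f c x y → let r = f (odd x) (odd y) c in
 transduce (suc w) f c x y ≡ bool (proj₁ r) + 2 * transduce w f (proj₂ r) (half x) (half y)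
transduce-suc w f c x y = cong (λ n → bool (proj₁ (f (odd x) (odd y) c)) + 2 * n) (fromBits-cong w λ i _ →
 cong (λ c' → proj₁ (f (bit i (half x)) (bit i (half y)) c')) (carryAt-suc f c x y i))

<ᵇ-true : ∀ {m n} → m < n → (m <ᵇ n) ≡ true
<ᵇ-true {m} {n} m<n with m <ᵇ n | <⇒<ᵇ m<n
... | true | _ = refl

<ᵇ-false : ∀ {m n} → n ≤ m → (m <ᵇ n) ≡ false
<ᵇ-false {m} {n} n≤m with m <ᵇ n in e
... | false = refl
... | true = ⊥-elim (≤⇒≯ n≤m (<ᵇ⇒< m n (subst T (sym e) tt)))

-- The carry is that of an addition, the borrow of a subtraction and, in `neqT`, the record that
-- differing digits have been seen. Comparisons are read off from the last carry.
addT subT copyT zeroT neqT andT orT xorT : Transducer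
addT p q c = ((p ⊕ q) ⊕ c) , ((p ∧ q) ∨ (c ∧ (p ∨ q)))
subT p q c = ((p ⊕ q) ⊕ c) , ((not p ∧ (q ∨ c)) ∨ (q ∧ c))
copyT p q c = p , c
zeroT p q c = false , c
neqT p q c = false , (c ∨ (p ⊕ q))
andT p q c = (p ∧ q) , c
orT p q c = (p ∨ q) , c
xorT p q c = (p ⊕ q) , c

-- Unary variants, with second operand 0. Started with the carry `true`, they make addition and
-- subtraction count up and down by one.
ignoring : Transducer → Transducer
ignoring f p q c = f p false c

incT decT nonzeroT : Transducer
incT = ignoring addT
decT = ignoring subT
nonzeroT = ignoring neqT

bit-0 : ∀ i → bit i 0 ≡ false
bit-0 zero = refl
bit-0 (suc i) = bit-0 i

carryAt-ignoring : ∀ f c x y i → carryAt (ignoring f) c x y i ≡ carryAt f c x 0 i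
carryAt-ignoring f c x y zero = refl
carryAt-ignoring f c x y (suc i) = cong₂ (λ b c → proj₂ (f (bit i x) b c)) (sym (bit-0 i)) (carryAt-ignoring f c x y i)

transduce-ignoring : ∀ w f c x y → transduce w (ignoring f) c x y ≡ transduce w f c x 0
transduce-ignoring w f c x y = fromBits-cong w λ i _ → cong₂ (λ b c → proj₁ (f (bit i x) b c)) (sym (bit-0 i)) (carryAt-ignoring f c x y i)

add-bits : ∀ p q c → bool (proj₁ (addT p q c)) + 2 * bool (proj₂ (addT p q c)) ≡ bool p + bool q + bool c
add-bits true true true = refl
add-bits true true false = refl
add-bits true false true = refl
add-bits true false false = refl
add-bits false true true = refl
add-bits false true false = refl
add-bits false false true = refl
add-bits false false false = refl

transduce-add : ∀ w c x y → x < 2 ^ w → y < 2 ^ w → transduce w addT c x y + 2 ^ w * bool (carryAt addT c x y w) ≡ x + y + bool c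
transduce-add zero c x y x< y< rewrite <2^0 x< | <2^0 y< = +-identityʳ (bool c)
transduce-add (suc w) c x y x< y< = begin
 transduce (suc w) addT c x y + 2 ^ suc w * bool (carryAt addT c x y (suc w))
  ≡⟨ cong₂ (λ a b → a + 2 ^ suc w * bool b) (transduce-suc w addT c x y) (carryAt-suc addT c x y w) ⟩
 bool o + 2 * t + 2 * 2 ^ w * k
  ≡⟨ l₁ (bool o) t (2 ^ w) k ⟩
 bool o + 2 * (t + 2 ^ w * k)
  ≡⟨ cong (λ n → bool o + 2 * n) (transduce-add w c' (half x) (half y) (half-< {w} x<) (half-< {w} y<)) ⟩
 bool o + 2 * (half x + half y + bool c')
  ≡⟨ l₂ (bool o) (half x) (half y) (bool c') ⟩
 (bool o + 2 * bool c') + 2 * half x + 2 * half y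
  ≡⟨ cong (λ n → n + 2 * half x + 2 * half y) (add-bits (odd x) (odd y) c) ⟩
 (bool (odd x) + bool (odd y) + bool c) + 2 * half x + 2 * half y
  ≡⟨ l₃ (bool (odd x)) (bool (odd y)) (bool c) (half x) (half y) ⟩
 (bool (odd x) + 2 * half x) + (bool (odd y) + 2 * half y) + bool c
  ≡⟨ cong₂ (λ a b → a + b + bool c) (sym (odd+2half x)) (sym (odd+2half y)) ⟩
 x + y + bool c ∎
 where
 open ≡-Reasoning
 o = proj₁ (addT (odd x) (odd y) c)
 c' = proj₂ (addT (odd x) (odd y) c)
 t = transduce w addT c' (half x) (half y)
 k = bool (carryAt addT c' (half x) (half y) w)
 l₁ : ∀ a b p k → a + 2 * b + 2 * p * k ≡ a + 2 * (b + p * k)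
 l₁ = solve-∀
 l₂ : ∀ a x y c → a + 2 * (x + y + c) ≡ (a + 2 * c) + 2 * x + 2 * y
 l₂ = solve-∀
 l₃ : ∀ p q c x y → (p + q + c) + 2 * x + 2 * y ≡ (p + 2 * x) + (q + 2 * y) + c
 l₃ = solve-∀

-- Adding y back to a difference restores the digits of x, and the carries
-- are the borrows.
sub-bits : ∀ p q c → addT (proj₁ (subT p q c)) q c ≡ (p , proj₂ (subT p q c))
sub-bits true true true = refl
sub-bits true true false = refl
sub-bits true false true = refl
sub-bits true false false = refl
sub-bits false true true = refl
sub-bits false true false = refl
sub-bits false false true = refl
sub-bits false false false = refl

transduce-sub : ∀ w c x y → x < 2 ^ w → y < 2 ^ w → transduce w subT c x y + y + bool c ≡ x + 2 ^ w * bool (carryAt subT c x y w)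
transduce-sub w c x y x< y< = trans (sym (transduce-add w c t y (fromBits< w (outAt subT c x y)) y<))
 (cong₂ (λ a b → a + 2 ^ w * bool b) (trans (fromBits-cong w λ i i< → cong proj₁ (digit i i<)) (fromBits-bit w x x<)) (carries w ≤-refl))
 where
 t = transduce w subT c x y
 carries : ∀ i → i ≤ w → carryAt addT c t y i ≡ carryAt subT c x y i
 digit : ∀ i → i < w → addT (bit i t) (bit i y) (carryAt addT c t y i) ≡ (bit i x , carryAt subT c x y (suc i))
 carries zero _ = refl
 carries (suc i) i< = cong proj₂ (digit i i<)
 digit i i< = trans (cong₂ (λ p c → addT p (bit i y) c) (bit-fromBits w (outAt subT c x y) i i<) (carries i (<⇒≤ i<)))
  (sub-bits (bit i x) (bit i y) (carryAt subT c x y i))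

fromBits-false : ∀ w → fromBits w (λ _ → false) ≡ 0
fromBits-false zero = refl
fromBits-false (suc w) = cong (2 *_) (fromBits-false w)

transduce-zero : ∀ w c x y → transduce w zeroT c x y ≡ 0
transduce-zero w c x y = fromBits-false w

transduce-copy : ∀ w c x y → x < 2 ^ w → transduce w copyT c x y ≡ x
transduce-copy w c x y x< = fromBits-bit w x x<

transduce-add-exact : ∀ w x y c → x + y + bool c < 2 ^ w → transduce w addT c x y ≡ x + y + bool c
transduce-add-exact w x y c s< = absorbed (carryAt addT c x y w)
 (transduce-add w c x y (≤-<-trans (≤-trans (m≤m+n x y) (m≤m+n (x + y) _)) s<) (≤-<-trans (≤-trans (m≤n+m y x) (m≤m+n (x + y) _)) s<))
 where
 absorbed : ∀ {z} b → z + 2 ^ w * bool b ≡ x + y + bool c → z ≡ x + y + bool c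
 absorbed {z} false e = trans (sym (trans (cong (z +_) (*-zeroʳ (2 ^ w))) (+-identityʳ z))) e
 absorbed {z} true e = contradiction (≤≡ (m≤n+m (2 ^ w) z) (trans (cong (z +_) (sym (*-identityʳ (2 ^ w)))) e)) (<⇒≱ s<)

transduce-inc-exact : ∀ w x y → suc x < 2 ^ w → transduce w incT true x y ≡ suc x
transduce-inc-exact w x y s< = trans (transduce-ignoring w addT true x y) (trans (transduce-add-exact w x 0 true (subst (_< 2 ^ w) (sym x+1) s<)) x+1)
 where
 x+1 : x + 0 + 1 ≡ suc x
 x+1 = trans (cong (_+ 1) (+-identityʳ x)) (+-comm x 1)

-- As t < P, the equation leaves no choice: without a borrow z ≤ x, and with one x + P < P + z.
-- Hence the last borrow of a subtraction is the comparison.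
borrow : ∀ {P t x z} b → t < P → t + z ≡ x + P * bool b → b ≡ (x <ᵇ z)
borrow {P} {t} {x} {z} false _ e = sym (<ᵇ-false (≤≡ (m≤n+m z t) (trans e (trans (cong (x +_) (*-zeroʳ P)) (+-identityʳ x)))))
borrow {P} {t} {x} {z} true t< e = sym (<ᵇ-true (+-cancelʳ-< P x z (≤-<-trans (≤-reflexive (trans (cong (x +_) (sym (*-identityʳ P))) (sym e)))
 (<-≤-trans (+-monoˡ-< z t<) (≤-reflexive (+-comm P z))))))

carryAt-sub : ∀ w c x y → x < 2 ^ w → y < 2 ^ w → carryAt subT c x y w ≡ (x <ᵇ y + bool c)
carryAt-sub w c x y x< y< = borrow {z = y + bool c} (carryAt subT c x y w) (fromBits< w (outAt subT c x y)) (trans (sym (+-assoc (transduce w subT c x y) y (bool c))) (transduce-sub w c x y x< y<))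

transduce-sub-exact : ∀ w c x y → y + bool c ≤ x → x < 2 ^ w → transduce w subT c x y ≡ x ∸ (y + bool c)
transduce-sub-exact w c x y z≤x x< = begin
 t ≡⟨ sym (m+n∸n≡m t z) ⟩
 t + z ∸ z ≡⟨ cong (_∸ z) (trans (sym (+-assoc t y _)) (transduce-sub w c x y x< y<)) ⟩
 x + 2 ^ w * bool (carryAt subT c x y w) ∸ z ≡⟨ cong (λ b → x + 2 ^ w * bool b ∸ z) (trans (carryAt-sub w c x y x< y<) (<ᵇ-false z≤x)) ⟩
 x + 2 ^ w * 0 ∸ z ≡⟨ cong (_∸ z) (trans (cong (x +_) (*-zeroʳ (2 ^ w))) (+-identityʳ x)) ⟩
 x ∸ z ∎
 where
 open ≡-Reasoning
 t = transduce w subT c x y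
 z = y + bool c
 y< = ≤-<-trans (≤-trans (m≤m+n y (bool c)) z≤x) x<

transduce-dec-exact : ∀ w x y → suc x < 2 ^ w → transduce w decT true (suc x) y ≡ x
transduce-dec-exact w x y x< = trans (transduce-ignoring w subT true (suc x) y) (transduce-sub-exact w true (suc x) 0 (s≤s z≤n) x<)

carryAt-neq : ∀ w c x y → x < 2 ^ w → y < 2 ^ w →
 (x ≡ y → carryAt neqT c x y w ≡ c) × (x ≢ y → carryAt neqT c x y w ≡ true)
carryAt-neq zero c x y x< y< = (λ _ → refl) , λ x≢y → contradiction (trans (<2^0 x<) (sym (<2^0 y<))) x≢y
carryAt-neq (suc w) c x y x< y< rewrite carryAt-suc neqT c x y w
 with carryAt-neq w (c ∨ (odd x ⊕ odd y)) (half x) (half y) (half-< {w} x<) (half-< {w} y<)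
... | eqn , ne = (λ { refl → trans (eqn refl) (xor-self c (odd x)) }) , ne'
 where
 xor-self : ∀ c b → c ∨ (b ⊕ b) ≡ c
 xor-self true b = refl
 xor-self false true = refl
 xor-self false false = refl
 xor-≢ : ∀ c a b → a ≢ b → c ∨ (a ⊕ b) ≡ true
 xor-≢ true a b _ = refl
 xor-≢ false true true n = ⊥-elim (n refl)
 xor-≢ false true false n = refl
 xor-≢ false false true n = refl
 xor-≢ false false false n = ⊥-elim (n refl)
 ne' : x ≢ y → carryAt neqT (c ∨ (odd x ⊕ odd y)) (half x) (half y) w ≡ true
 ne' x≢y with half x ≟ half y
 ... | no h≢ = ne h≢
 ... | yes h≡ = trans (eqn h≡) (xor-≢ c (odd x) (odd y) λ o≡ → x≢y
    (trans (odd+2half x) (trans (cong₂ (λ a b → bool a + 2 * b) o≡ h≡) (sym (odd+2half y)))))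

carryAt-neq-≡ᵇ : ∀ w x y → x < 2 ^ w → y < 2 ^ w → carryAt neqT false x y w ≡ not (x ≡ᵇ y)
carryAt-neq-≡ᵇ w x y x< y< with x ≡ᵇ y in eqn | carryAt-neq w false x y x< y<
... | true | e , _ = e (≡ᵇ⇒≡ x y (subst T (sym eqn) tt))
... | false | _ , n = n λ x≡y → subst T eqn (≡⇒≡ᵇ x y x≡y)

carryAt-nonzero-≡ᵇ : ∀ w x y → x < 2 ^ w → carryAt nonzeroT false x y w ≡ not (x ≡ᵇ 0)
carryAt-nonzero-≡ᵇ w x y x< = trans (carryAt-ignoring neqT false x y w) (carryAt-neq-≡ᵇ w x 0 x< (0<2^ w))

BitwiseLike : Transducer → (ℕ → ℕ → ℕ) → Set
BitwiseLike f g = ∀ p q c → bool (proj₁ (f p q c)) ≡ g (bool p) (bool q)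

-- The simulated words have v digits, the registers w of them. The digits in excess are 0 in both
-- operands, and `g 0 0 ≡ 0` keeps them 0 in the result.
bitwise-transduce : ∀ {f g} → BitwiseLike f g → g 0 0 ≡ 0 → ∀ w {v} → v ≤ w → ∀ c x y →
 x < 2 ^ v → y < 2 ^ v → transduce w f c x y ≡ bitwise g v x y
bitwise-transduce {f} {g} bl g0 zero z≤n c x y x< y< = refl
bitwise-transduce {f} {g} bl g0 (suc w) {zero} z≤n c x y x< y< rewrite <2^0 x< | <2^0 y< =
 trans (transduce-suc w f c 0 0)
  (cong₂ (λ a b → a + 2 * b) (trans (bl false false c) g0)
   (bitwise-transduce {f} {g} bl g0 w {0} z≤n (proj₂ (f false false c)) 0 0 (s≤s z≤n) (s≤s z≤n)))
bitwise-transduce {f} {g} bl g0 (suc w) {suc v} (s≤s v≤) c x y x< y< =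
 trans (transduce-suc w f c x y)
  (cong₂ (λ a b → a + 2 * b)
   (trans (bl (odd x) (odd y) c) (cong₂ g (sym (%2≡odd x)) (sym (%2≡odd y))))
   (bitwise-transduce {f} {g} bl g0 w v≤ (proj₂ (f (odd x) (odd y) c)) (half x) (half y) (half-< {v} x<) (half-< {v} y<)))

and-like : BitwiseLike andT _⊓_
and-like true true c = refl
and-like true false c = refl
and-like false q c = refl

or-like : BitwiseLike orT _⊔_
or-like true true c = refl
or-like true false c = refl
or-like false q c = refl

xor-like : BitwiseLike xorT ∣_-_∣
xor-like true true c = refl
xor-like true false c = refl
xor-like false true c = refl
xor-like false false c = refl

-- Native programs on arrays of bits

arrR arrT : ℕ → ℕ
arrR r = 2 + 2 * r
arrT t = 3 + 2 * t

-- Native registers: 0 is the flag, 1 holds the width W, 2 and 3 hold the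
-- numbers of variables and clauses; the others are scratch.
next : Prog
next = const 8 1 ⨾ arith 5 add 5 8 ⨾ arith 4 sub 4 8

-- Register 5 is the position of the current digit, and register 4 counts the digits that remain.
forBits : Prog → Prog
forBits P = const 5 0 ⨾ arith 4 add 1 5 ⨾ whilenz 4 loop (P ⨾ next)

leaf : Bool × Bool → Prog
leaf (o , c) = const 6 (bool o) ⨾ const 0 (bool c)

tree : Transducer → Prog
tree f =
 ifnz 6
  then (ifnz 7 then (ifnz 0 then leaf (f true true true) else leaf (f true true false))
         else (ifnz 0 then leaf (f true false true) else leaf (f true false false)))
  else (ifnz 7 then (ifnz 0 then leaf (f false true true) else leaf (f false true false))
         else (ifnz 0 then leaf (f false false true) else leaf (f false false false)))

-- The flag in register 0 serves as the carry, so it supplies the initial carry and is left holding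
-- the last one.
scanP : Transducer → (z x y : ℕ) → Prog
scanP f z x y = forBits (
 clear 0 ⨾ push 0 5 ⨾ load 6 (arrR x) 0 ⨾ load 7 (arrR y) 0 ⨾ tree f ⨾ store (arrR z) 0 6)

pushBits : ℕ → Prog
pushBits x = const 10 0 ⨾ arith 9 add 1 10 ⨾ whilenz 9 loop (
 clear 1 ⨾ push 1 10 ⨾ load 11 (arrR x) 1 ⨾ push 0 11 ⨾ const 8 1 ⨾ arith 10 add 10 8 ⨾ arith 9 sub 9 8)

-- Indices of a table have W digits and do not fit into one native word. They become part of an
-- address digit by digit, after the position of the digit that is accessed.
keyP : (x y : ℕ) → Prog
keyP x y = clear 0 ⨾ push 0 5 ⨾ pushBits x ⨾ pushBits y

ldP : (z t x y : ℕ) → Prog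
ldP z t x y = forBits (
 keyP x y ⨾ load 6 (arrT t) 0 ⨾
 clear 0 ⨾ push 0 5 ⨾ store (arrR z) 0 6)

stP : (t x y v : ℕ) → Prog
stP t x y v = forBits (
 clear 0 ⨾ push 0 5 ⨾ load 6 (arrR v) 0 ⨾
 keyP x y ⨾ store (arrT t) 0 6)

importP : ℕ → Prog
importP z = forBits (
 const 8 2 ⨾ arith 7 div 12 8 ⨾ arith 11 mul 7 8 ⨾ arith 6 sub 12 11 ⨾
 clear 0 ⨾ push 0 5 ⨾ store (arrR z) 0 6 ⨾ const 13 0 ⨾ arith 12 add 7 13)

exportP : ℕ → Prog
exportP x = const 5 0 ⨾ arith 4 add 1 5 ⨾ const 12 0 ⨾ whilenz 4 loop (
 const 8 1 ⨾ arith 5 sub 4 8 ⨾ clear 0 ⨾ push 0 5 ⨾ load 6 (arrR x) 0 ⨾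
 arith 12 add 12 12 ⨾ arith 12 add 12 6 ⨾ arith 4 sub 4 8)

rd0P : (z x : ℕ) → Prog
rd0P z x = exportP x ⨾ clear 2 ⨾ push 2 12 ⨾ load 12 0 2 ⨾ importP z

rd1P : (z x y : ℕ) → Prog
rd1P z x y = exportP x ⨾ clear 2 ⨾ push 2 12 ⨾ exportP y ⨾ push 2 12 ⨾ load 12 1 2 ⨾ importP z

setFP : Bool → Prog
setFP b = const 0 (bool b)

importNP importdP : ℕ → Prog
importNP z = const 13 0 ⨾ arith 12 add 2 13 ⨾ importP z
importdP z = const 13 0 ⨾ arith 12 add 3 13 ⨾ importP z
importWP : ℕ → Prog
importWP z = const 13 0 ⨾ arith 12 add 1 13 ⨾ importP z

-- Updates of registers and memories

≡ᵇ-refl : ∀ n → (n ≡ᵇ n) ≡ true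
≡ᵇ-refl zero = refl
≡ᵇ-refl (suc n) = ≡ᵇ-refl n

≡ᵇ-true : ∀ {m n} → (m ≡ᵇ n) ≡ true → m ≡ n
≡ᵇ-true {m} {n} e = ≡ᵇ⇒≡ m n (subst T (sym e) tt)

≢⇒≡ᵇ : ∀ {m n} → m ≢ n → (m ≡ᵇ n) ≡ false
≢⇒≡ᵇ {m} {n} m≢n with m ≡ᵇ n in e
... | false = refl
... | true = contradiction (≡ᵇ⇒≡ m n (subst T (sym e) tt)) m≢n

≡ᵇˡ-refl : ∀ xs → (xs ≡ᵇˡ xs) ≡ true
≡ᵇˡ-refl [] = refl
≡ᵇˡ-refl (x ∷ xs) rewrite ≡ᵇ-refl x = ≡ᵇˡ-refl xs

≢⇒≡ᵇˡ : ∀ {xs ys} → xs ≢ ys → (xs ≡ᵇˡ ys) ≡ false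
≢⇒≡ᵇˡ {[]} {[]} n = contradiction refl n
≢⇒≡ᵇˡ {[]} {y ∷ ys} n = refl
≢⇒≡ᵇˡ {x ∷ xs} {[]} n = refl
≢⇒≡ᵇˡ {x ∷ xs} {y ∷ ys} n with x ≡ᵇ y in e
... | false = refl
... | true = ≢⇒≡ᵇˡ λ e' → n (cong₂ _∷_ (≡ᵇ⇒≡ x y (subst T (sym e) tt)) e')

↦-same : ∀ {A : Set} (f : ℕ → A) i {x} → (f [ i ↦ x ]) i ≡ x
↦-same f i rewrite ≡ᵇ-refl i = refl

↦-other : ∀ {A : Set} (f : ℕ → A) {i j x} → i ≢ j → (f [ i ↦ x ]) j ≡ f j
↦-other f i≢j rewrite ≢⇒≡ᵇ i≢j = refl

Memory : Set
Memory = ℕ → List ℕ → ℕ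

put : Memory → ℕ → List ℕ → ℕ → Memory
put h m a v = h [ m ↦ h m [ a ↦ˡ v ] ]

put-same : ∀ h m a v → put h m a v m a ≡ v
put-same h m a v rewrite ≡ᵇ-refl m | ≡ᵇˡ-refl a = refl

put-other : ∀ h m a v {m' a'} → (m ≡ m' → a ≡ a' → ⊥) → put h m a v m' a' ≡ h m' a'
put-other h m a v {m'} {a'} n with m ≡ᵇ m' in e
... | false = refl
... | true with refl ← ≡ᵇ⇒≡ m m' (subst T (sym e) tt) rewrite ≢⇒≡ᵇˡ (n refl) = refl

-- The machine with W-bit registers and tables

Tables : Set
Tables = ℕ → ℕ → ℕ → ℕ

set : ℕ → ℕ → ℕ → ℕ → Tables → Tables
set t x y v T t' x' y' = if (t ≡ᵇ t') ∧ ((x ≡ᵇ x') ∧ (y ≡ᵇ y')) then v else T t' x' y'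

-- The abstract state that the arrays of bits implement. All later programs are analysed at this
-- level, where registers and table entries are numbers below 2 ^ W.
record Mid : Set where
 constructor mid
 field
  reg : ℕ → ℕ
  tbl : Tables
  flag : Bool

open Mid public

setR : ℕ → ℕ → Mid → Mid
setR r v M = record M { reg = reg M [ r ↦ v ] }

setF : Bool → Mid → Mid
setF b M = record M { flag = b }

setT : ℕ → ℕ → ℕ → ℕ → Mid → Mid
setT t x y v M = record M { tbl = set t x y v (tbl M) }

-- Native words have w = O(log N) bits, while the numbers kept as arrays have W = O(N) digits; d is
-- the number of clauses and `inp` the formula in memory.
record Config : Set where
 field
  w W N d : ℕ
  inp : Memory
  W< : W < 2 ^ w
  2< : 2 < 2 ^ w
  N< : N < 2 ^ w
  d< : d < 2 ^ w
  inp< : ∀ m a → inp m a < 2 ^ w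

 1< : 1 < 2 ^ w
 1< = <-trans (n<1+n 1) 2<

Ends : ℕ → Prog → State → ℕ → (State → Set) → Set
Ends w P S b Q = ∃[ t ] ∃[ S' ] w ⊢ P , S ⇓[ t ] S' × t ≤ b × Q S'

module _ {w : ℕ} where

 step : ∀ {P P' S S' t b Q} → w ⊢ P , S ⇓[ t ] S' → Ends w P' S' b Q → Ends w (P ⨾ P') S (t + b) Q
 step {t = t} r (t' , S'' , r' , t≤ , q) = t + t' , S'' , seq r r' , +-monoʳ-≤ t t≤ , q

 ends : ∀ {P S S' t Q} → w ⊢ P , S ⇓[ t ] S' → Q S' → Ends w P S t Q
 ends {t = t} r q = t , _ , r , ≤-refl , q

 ends-⨾ : ∀ {P P' S b b' Q Q'} → Ends w P S b Q → (∀ {S'} → Q S' → Ends w P' S' b' Q') →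
      Ends w (P ⨾ P') S (b + b') Q'
 ends-⨾ (t , S' , r , t≤ , q) h with h q
 ... | t' , S'' , r' , t'≤ , q' = t + t' , S'' , seq r r' , +-mono-≤ t≤ t'≤ , q'

 ends-≤ : ∀ {P S b b' Q} → b ≤ b' → Ends w P S b Q → Ends w P S b' Q
 ends-≤ b≤ (t , S' , r , t≤ , q) = t , S' , r , ≤-trans t≤ b≤ , q

 ends-map : ∀ {P S b} {Q Q' : State → Set} → (∀ {S'} → Q S' → Q' S') → Ends w P S b Q → Ends w P S b Q'
 ends-map f (t , S' , r , t≤ , q) = t , S' , r , t≤ , f q

 loop-ends : ∀ {r P} (Inv : ℕ → State → Set) b → (∀ {k S} → Inv k S → regs S r ≡ k) →
  (∀ {k S} → Inv (suc k) S → Ends w P S b (Inv k)) →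
  ∀ k {S} → Inv k S → Ends w (whilenz r loop P) S (suc (k * suc b)) (Inv 0)
 loop-ends Inv b cnt body zero inv = 1 , _ , done (cnt inv) , ≤-refl , inv
 loop-ends Inv b cnt body (suc k) inv with body inv
 ... | t , S' , r , t≤ , inv' with loop-ends Inv b cnt body k inv'
 ... | t' , S'' , r' , t'≤ , q =
  suc (t + t') , S'' , loop (λ z → case trans (sym z) (cnt inv) of λ ()) r r' ,
  s≤s (≤≡ (+-mono-≤ t≤ t'≤) (+-suc b (k * suc b))) , q

record Written (m : ℕ) (key : List ℕ) (g : ℕ → Bool) (i : ℕ) (S S' : State) : Set where
 constructor written
 field
  new : ∀ j → j < i → mem S' m (j ∷ key) ≡ bool (g j)
  old : ∀ m' a → (∀ j → j < i → m ≡ m' → j ∷ key ≡ a → ⊥) → mem S' m' a ≡ mem S m' a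

written-zero : ∀ {m key g S S'} → mem S' ≡ mem S → Written m key g 0 S S'
written-zero e = written (λ j ()) (λ m' a _ → cong (λ h → h m' a) e)

written-suc : ∀ {m key g i S S' S''} → Written m key g i S S' →
 mem S'' ≡ put (mem S') m (i ∷ key) (bool (g i)) → Written m key g (suc i) S S''
written-suc {m} {key} {g} {i} {S} {S'} {S''} (written new old) e = written new' old'
 where
 at-put : ∀ m' a → mem S'' m' a ≡ put (mem S') m (i ∷ key) (bool (g i)) m' a
 at-put m' a = cong (λ h → h m' a) e
 new' : ∀ j → j < suc i → mem S'' m (j ∷ key) ≡ bool (g j)
 new' j j< with i ≟ j
 ... | yes refl = trans (at-put m (i ∷ key)) (put-same (mem S') m (i ∷ key) (bool (g i)))
 ... | no i≢j = trans (at-put m (j ∷ key)) (trans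
    (put-other (mem S') m (i ∷ key) (bool (g i)) λ _ e' → i≢j (proj₁ (∷-injective e')))
    (new j (≤∧≢⇒< (s≤s⁻¹ j<) (i≢j ∘ sym))))
 old' : ∀ m' a → (∀ j → j < suc i → m ≡ m' → j ∷ key ≡ a → ⊥) → mem S'' m' a ≡ mem S m' a
 old' m' a n = trans (at-put m' a) (trans (put-other (mem S') m (i ∷ key) (bool (g i)) (n i (n<1+n i)))
  (old m' a λ j j< → n j (m<n⇒m<1+n j<)))

wrap-id : ∀ {w x} → x < 2 ^ w → wrap w x ≡ x
wrap-id {w} x< = m<n⇒m%n≡m {{m^n≢0 2 w}} x<

wrap< : ∀ w x → wrap w x < 2 ^ w
wrap< w x = m%n<n x (2 ^ w) {{m^n≢0 2 w}}

arrR-injective : ∀ {r r'} → arrR r ≡ arrR r' → r ≡ r'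
arrR-injective e = *-cancelˡ-≡ _ _ 2 (suc-injective (suc-injective e))

arrT-injective : ∀ {r r'} → arrT r ≡ arrT r' → r ≡ r'
arrT-injective e = *-cancelˡ-≡ _ _ 2 (suc-injective (suc-injective (suc-injective e)))

arrR≢arrT : ∀ r t → arrR r ≢ arrT t
arrR≢arrT r t e = contradiction (trans (sym (odd-2* true t)) (trans (cong odd (sym (suc-injective (suc-injective e)))) (odd-2* false r))) λ ()
 where
 odd-2* : ∀ b n → odd (bool b + 2 * n) ≡ b
 odd-2* = odd-bool+2*

-- Arithmetic programs and what they leave unchanged

ltT : Transducer
ltT p q c = false , proj₂ (subT p q c)

carryAt-ltT : ∀ c x y i → carryAt ltT c x y i ≡ carryAt subT c x y i
carryAt-ltT c x y zero = refl
carryAt-ltT c x y (suc i) = cong (λ c' → proj₂ (subT (bit i x) (bit i y) c')) (carryAt-ltT c x y i)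

-- Discarding the last carry gives the final state a simple closed form, with the flag always
-- `false`.
resetP : Prog → Prog
resetP P = P ⨾ setFP false

zeroP : ℕ → Prog
zeroP z = resetP (scanP zeroT z z z)

copyP : (z x : ℕ) → Prog
copyP z x = resetP (scanP copyT z x x)

addP subP : (z x y : ℕ) → Prog
addP z x y = setFP false ⨾ resetP (scanP addT z x y)
subP z x y = setFP false ⨾ resetP (scanP subT z x y)

bitP : Transducer → (z x y : ℕ) → Prog
bitP f z x y = setFP false ⨾ resetP (scanP f z x y)

incP decP : ℕ → Prog
incP x = setFP true ⨾ resetP (scanP incT x x x)
decP x = setFP true ⨾ resetP (scanP decT x x x)

-- The flag is deliberately kept: it is the leading digit that has just been shifted out, which
-- multiplication and division consume next.
dblP : ℕ → Prog
dblP x = setFP false ⨾ scanP addT x x x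

-- Only the carry matters; register 63 receives the output digits, which are all 0.
ltP neqP : (x y : ℕ) → Prog
ltP x y = setFP false ⨾ scanP ltT 63 x y
neqP x y = setFP false ⨾ scanP neqT 63 x y

nzP : ℕ → Prog
nzP x = setFP false ⨾ scanP nonzeroT 63 x x

constP : (z k : ℕ) → Prog
constP z zero = zeroP z
constP z (suc k) = constP z k ⨾ incP z

flagP : Prog → Prog → Prog
flagP P Q = ifnz 0 then P else Q

forP : (i lim : ℕ) → Prog → Prog
forP i lim P = zeroP i ⨾ ltP i lim ⨾ whilenz 0 loop (P ⨾ incP i ⨾ ltP i lim)

-- Arithmetic routines leave their results in registers 50 and 51 and use
-- the registers from 50 on; register 30 holds the width W.
mulP : (x y : ℕ) → Prog
mulP x y = zeroP 50 ⨾ copyP 51 x ⨾ forP 52 30 (addP 50 50 50 ⨾ dblP 51 ⨾ flagP (addP 50 50 y) skip)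

divP : (x y : ℕ) → Prog
divP x y = zeroP 50 ⨾ zeroP 51 ⨾ copyP 52 x ⨾
 forP 53 30 (addP 50 50 50 ⨾ addP 51 51 51 ⨾ dblP 52 ⨾ flagP (incP 51) skip ⨾
  ltP 51 y ⨾ flagP skip (subP 51 51 y ⨾ incP 50))

-- There are `lim` rounds, and only those numbered below y double. So the exponent is the minimum of
-- both, and the time does not depend on y, which may be an arbitrary word.
powP : (y lim : ℕ) → Prog
powP y lim = constP 50 1 ⨾ forP 53 lim (ltP 53 y ⨾ flagP (addP 50 50 50) skip)

-- The bound on the register is a Boolean test, so that it is proved by `tt` for each concrete
-- register.
record FrameOn (b : ℕ) (r : ℕ → ℕ) (t : ℕ → ℕ → ℕ → ℕ) (r' : ℕ → ℕ) (t' : ℕ → ℕ → ℕ → ℕ) : Set where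
 constructor frame
 field
  fr : ∀ i → T (i <ᵇ b) → r' i ≡ r i
  ft : t' ≡ t

open FrameOn public

Frame : ℕ → Mid → Mid → Set
Frame b M M' = FrameOn b (reg M) (tbl M) (reg M') (tbl M')

frame-refl : ∀ {b r t} → FrameOn b r t r t
frame-refl = frame (λ _ _ → refl) refl

frame-trans : ∀ {b r t r' t' r'' t''} → FrameOn b r t r' t' → FrameOn b r' t' r'' t'' → FrameOn b r t r'' t''
frame-trans f g = frame (λ i i< → trans (fr g i i<) (fr f i i<)) (trans (ft g) (ft f))

frame-setR : ∀ {b r t r' t'} z {v} → T (b ≤ᵇ z) → FrameOn b r t r' t' → FrameOn b r t (r' [ z ↦ v ]) t'
frame-setR {b} {r' = r'} z {v} b≤ f = frame
 (λ i i< → trans (↦-other r' {z} {i} {v} λ { refl → <⇒≱ (<ᵇ⇒< i b i<) (≤ᵇ⇒≤ b i b≤) }) (fr f i i<))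
 (ft f)

frame-weaken : ∀ {b b' r t r' t'} → b' ≤ b → FrameOn b r t r' t' → FrameOn b' r t r' t'
frame-weaken {b} {b'} b≤ f = frame (λ i i< → fr f i (<⇒<ᵇ (<-≤-trans (<ᵇ⇒< i b' i<) b≤))) (ft f)

-- Here hi is the part of X that has left a register of W digits after j doublings. At most W
-- doublings cannot bring out more than X itself, and exactly W of them bring out all of it.
quotient-≤ : ∀ {W j X hi r} → X * 2 ^ j ≡ hi * 2 ^ W + r → j ≤ W → hi ≤ X
quotient-≤ {W} {j} {X} {hi} {r} e j≤ = *-cancelʳ-≤ hi X (2 ^ W) {{m^n≢0 2 W}} (begin
 hi * 2 ^ W ≤⟨ m≤m+n _ r ⟩
 hi * 2 ^ W + r ≡⟨ sym e ⟩
 X * 2 ^ j ≤⟨ *-monoʳ-≤ X (^-monoʳ-≤ 2 j≤) ⟩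
 X * 2 ^ W ∎)
 where open ≤-Reasoning

quotient-≡ : ∀ {W X hi r} → X * 2 ^ W ≡ hi * 2 ^ W + r → r < 2 ^ W → hi ≡ X
quotient-≡ {W} {X} {hi} {r} e r< = ≤-antisym (quotient-≤ {W} {W} {X} {hi} {r} e ≤-refl)
 (s≤s⁻¹ (*-cancelʳ-< (2 ^ W) X (suc hi) (begin-strict
  X * 2 ^ W ≡⟨ e ⟩
  hi * 2 ^ W + r <⟨ +-monoʳ-< (hi * 2 ^ W) r< ⟩
  hi * 2 ^ W + 2 ^ W ≡⟨ +-comm (hi * 2 ^ W) _ ⟩
  suc hi * 2 ^ W ∎)))
 where open ≤-Reasoning

divMod-unique : ∀ {x q r y} .{{_ : NonZero y}} → x ≡ q * y + r → r < y → q ≡ x / y × r ≡ x % y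
divMod-unique {x} {q} {r} {y} refl r< = q≡ , r≡
 where
 r≡ : r ≡ (q * y + r) % y
 r≡ = sym (trans (cong (_% y) (+-comm (q * y) r)) (trans ([m+kn]%n≡m%n r q y) (m<n⇒m%n≡m r<)))
 q≡ : q ≡ (q * y + r) / y
 q≡ = *-cancelʳ-≡ q _ y (+-cancelʳ-≡ r _ _ (begin
  q * y + r ≡⟨ m≡m%n+[m/n]*n (q * y + r) y ⟩
  (q * y + r) % y + (q * y + r) / y * y ≡⟨ cong (_+ (q * y + r) / y * y) (sym r≡) ⟩
  r + (q * y + r) / y * y ≡⟨ +-comm r _ ⟩
  (q * y + r) / y * y + r ∎))
  where open ≡-Reasoning

-- Arithmetic of the simulated machine

-- Registers 40 and 41 hold the operands and 42 receives the result; 30 to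
-- 33 hold W, 0, 2 ^ V and V, where V is the simulated word length.
exactP : Op → Prog
exactP add = addP 42 40 41
exactP sub = addP 42 40 32 ⨾ subP 42 42 41
exactP mul = mulP 40 41 ⨾ copyP 42 50
exactP div = nzP 41 ⨾ flagP (divP 40 41 ⨾ copyP 42 50) (zeroP 42)
exactP and = bitP andT 42 40 41
exactP or = bitP orT 42 40 41
exactP xor = bitP xorT 42 40 41
exactP shl = powP 41 33 ⨾ copyP 43 50 ⨾ mulP 40 43 ⨾ copyP 42 50
exactP shr = powP 41 33 ⨾ copyP 43 50 ⨾ divP 40 43 ⨾ copyP 42 50
exactP lt = ltP 40 41 ⨾ flagP (constP 42 1) (zeroP 42)
exactP eq = neqP 40 41 ⨾ flagP (zeroP 42) (constP 42 1)

modP : Prog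
modP = divP 42 32 ⨾ copyP 42 51

evalP : Op → Prog
evalP o = exactP o ⨾ modP

quot-/ : ∀ x y .{{_ : NonZero y}} → quot x y ≡ x / y
quot-/ x (suc y) = refl

-- Capping the shift at V keeps the power of two small and changes nothing: from V on, the product
-- is a multiple of 2 ^ V.
wrap-shl : ∀ V x y → wrap V (x * 2 ^ (V ⊓ y)) ≡ wrap V (x * 2 ^ y)
wrap-shl V x y with ≤-total V y
... | inj₂ y≤V = cong (λ z → wrap V (x * 2 ^ z)) (m≥n⇒m⊓n≡n y≤V)
... | inj₁ V≤y = begin
 wrap V (x * 2 ^ (V ⊓ y)) ≡⟨ cong (λ z → wrap V (x * 2 ^ z)) (m≤n⇒m⊓n≡m V≤y) ⟩
 wrap V (x * 2 ^ V) ≡⟨ m*n%n≡0 x (2 ^ V) {{m^n≢0 2 V}} ⟩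
 0 ≡⟨ sym (m*n%n≡0 (x * 2 ^ (y ∸ V)) (2 ^ V) {{m^n≢0 2 V}}) ⟩
 wrap V (x * 2 ^ (y ∸ V) * 2 ^ V) ≡⟨ cong (wrap V) (trans (*-assoc x _ _) (cong (x *_) (sym (^-distribˡ-+-* 2 (y ∸ V) V)))) ⟩
 wrap V (x * 2 ^ (y ∸ V + V)) ≡⟨ cong (λ z → wrap V (x * 2 ^ z)) (m∸n+n≡m V≤y) ⟩
 wrap V (x * 2 ^ y) ∎
 where open ≡-Reasoning

-- The cap is harmless here because x < 2 ^ V, so that shifting by V or more gives 0.
quot-shr : ∀ V x y → x < 2 ^ V → quot x (2 ^ (V ⊓ y)) ≡ quot x (2 ^ y)
quot-shr V x y x< with ≤-total V y
... | inj₂ y≤V = cong (λ z → quot x (2 ^ z)) (m≥n⇒m⊓n≡n y≤V)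
... | inj₁ V≤y = trans (cong (λ z → quot x (2 ^ z)) (m≤n⇒m⊓n≡m V≤y))
 (trans (zero' V x<) (sym (zero' y (<-≤-trans x< (^-monoʳ-≤ 2 V≤y)))))
 where
 zero' : ∀ v → x < 2 ^ v → quot x (2 ^ v) ≡ 0
 zero' v x< = trans (quot-/ x (2 ^ v) {{m^n≢0 2 v}}) (m<n⇒m/n≡0 {{m^n≢0 2 v}} x<)

-- Memory of the simulated machine: overlays and a trie of addresses

-- Registers, address registers and memory of the simulated machine.  An
-- address is replaced by the number of its node in a trie (table 0).
data Cell : Set where
 regC adrC memC : ℕ → Cell

-- The kinds of cells are interleaved modulo 3. Codes start at 2 because table 0 holds the trie and
-- table 1 the set of edges.
offset code : Cell → ℕ
offset (regC r) = 0 + r * 3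
offset (adrC a) = 1 + a * 3
offset (memC m) = 2 + m * 3
code c = 2 + offset c

code-injective : ∀ {c c'} → code c ≡ code c' → c ≡ c'
code-injective {c} {c'} e = go c c' (suc-injective (suc-injective e))
 where
 rest : ∀ {k m n} → k + m * 3 ≡ k + n * 3 → m ≡ n
 rest {k} e = *-cancelʳ-≡ _ _ 3 (+-cancelˡ-≡ k _ _ e)
 residue : ∀ j k m n → j + m * 3 ≡ k + n * 3 → j % 3 ≡ k % 3
 residue j k m n e = trans (sym ([m+kn]%n≡m%n j m 3)) (trans (cong (_% 3) e) ([m+kn]%n≡m%n k n 3))
 go : ∀ c c' → offset c ≡ offset c' → c ≡ c'
 go (regC m) (regC n) e = cong regC (rest {0} e)
 go (adrC m) (adrC n) e = cong adrC (rest {1} e)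
 go (memC m) (memC n) e = cong memC (rest {2} e)
 go (regC m) (adrC n) e = case residue 0 1 m n e of λ ()
 go (regC m) (memC n) e = case residue 0 2 m n e of λ ()
 go (adrC m) (regC n) e = case residue 1 0 m n e of λ ()
 go (adrC m) (memC n) e = case residue 1 2 m n e of λ ()
 go (memC m) (regC n) e = case residue 2 0 m n e of λ ()
 go (memC m) (adrC n) e = case residue 2 1 m n e of λ ()

code≢0 : ∀ c → code c ≢ 0
code≢0 c ()

set-same : ∀ t x y v T → set t x y v T t x y ≡ v
set-same t x y v T rewrite ≡ᵇ-refl t | ≡ᵇ-refl x | ≡ᵇ-refl y = refl

set-other : ∀ {t x y v T t' x' y'} → (t ≡ t' → x ≡ x' → y ≡ y' → ⊥) → set t x y v T t' x' y' ≡ T t' x' y'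
set-other {t} {x} {y} {v} {T} {t'} {x'} {y'} n with t ≡ᵇ t' in te | x ≡ᵇ x' in xe | y ≡ᵇ y' in ye
... | false | _ | _ = refl
... | true | false | _ = refl
... | true | true | false = refl
... | true | true | true =
 ⊥-elim (n (≡ᵇ-true te) (≡ᵇ-true xe) (≡ᵇ-true ye))

-- Entries are stored plus one.  A row of an overlay is consulted first and
-- the row 0 where the overlay is empty, so that dropping the overlay undoes
-- all changes made since it was opened.
overlay : ℕ → ℕ → ℕ
overlay zero b = pred b
overlay (suc v) b = v

cell : Tables → Cell → ℕ → ℕ → ℕ
cell T c ph i = overlay (T (code c) ph i) (T (code c) 0 i)

overlay-self : ∀ b → overlay b b ≡ pred b
overlay-self zero = refl
overlay-self (suc b) = refl

-- Register 34 holds the number of the current row; register 31 holds 0, the number of the common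
-- row.
getP : ℕ → ℕ → ℕ → Prog
getP t i z = ldP z t 34 i ⨾ nzP z ⨾ flagP (decP z) (ldP z t 31 i ⨾ nzP z ⨾ flagP (decP z) skip)

putP : ℕ → ℕ → ℕ → Prog
putP t i x = copyP 37 x ⨾ incP 37 ⨾ stP t 34 i 37

-- Register 35 holds the last node allocated. The entry 0 can stand for a missing child because node
-- 0 is the root.
childP : Prog
childP = ldP 42 0 40 41 ⨾ nzP 42 ⨾ flagP skip (incP 35 ⨾ stP 0 40 41 35 ⨾ copyP 42 35)

testP : ℕ → Prog
testP r = getP (code (regC r)) 31 42 ⨾ nzP 42

-- The interpreter takes the form of a compiler, by recursion on the program. A `flip` becomes 0, in
-- accordance with the coins all being `false`.
simP : Prog → Prog
simP skip = skip
simP (P ⨾ Q) = simP P ⨾ simP Q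
simP (const r k) = constP 42 k ⨾ modP ⨾ putP (code (regC r)) 31 42
simP (arith r o x y) = getP (code (regC x)) 31 40 ⨾ getP (code (regC y)) 31 41 ⨾ evalP o ⨾ putP (code (regC r)) 31 42
simP (clear a) = zeroP 42 ⨾ putP (code (adrC a)) 31 42
simP (push a x) = getP (code (adrC a)) 31 40 ⨾ getP (code (regC x)) 31 41 ⨾ childP ⨾ putP (code (adrC a)) 31 42
simP (load r m a) = getP (code (adrC a)) 31 40 ⨾ getP (code (memC m)) 40 42 ⨾ putP (code (regC r)) 31 42
simP (store m a x) = getP (code (adrC a)) 31 40 ⨾ getP (code (regC x)) 31 42 ⨾ putP (code (memC m)) 40 42
simP (flip r) = zeroP 42 ⨾ putP (code (regC r)) 31 42
simP (ifnz r then P else Q) = testP r ⨾ flagP (simP P) (simP Q)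
simP (whilenz r loop P) = testP r ⨾ whilenz 0 loop (simP P ⨾ testP r)

-- A constant is produced by counting up to it, so a bound on all constants enters the time for one
-- simulated step, and it must fit into W digits.
ConstsBelow : ℕ → Prog → Set
ConstsBelow K (P ⨾ Q) = ConstsBelow K P × ConstsBelow K Q
ConstsBelow K (const r k) = k ≤ K
ConstsBelow K (ifnz r then P else Q) = ConstsBelow K P × ConstsBelow K Q
ConstsBelow K (whilenz r loop P) = ConstsBelow K P
ConstsBelow K _ = ⊤

constSum : Prog → ℕ
constSum (P ⨾ Q) = constSum P + constSum Q
constSum (const r k) = k
constSum (ifnz r then P else Q) = constSum P + constSum Q
constSum (whilenz r loop P) = constSum P
constSum _ = 0

consts-below : ∀ {K} P → constSum P ≤ K → ConstsBelow K P
consts-below skip h = tt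
consts-below (P ⨾ Q) h = consts-below P (≤-trans (m≤m+n _ _) h) , consts-below Q (≤-trans (m≤n+m _ _) h)
consts-below (const r k) h = h
consts-below (arith r x x₁ y) h = tt
consts-below (clear a) h = tt
consts-below (push a x) h = tt
consts-below (load r m a) h = tt
consts-below (store m a x) h = tt
consts-below (flip r) h = tt
consts-below (ifnz r then P else Q) h = consts-below P (≤-trans (m≤m+n _ _) h) , consts-below Q (≤-trans (m≤n+m _ _) h)
consts-below (whilenz r loop P) h = consts-below P h

-- `node` gives the address that each of the `len` nodes stands for. Closure under prefixes,
-- `parent`, is what shows that a newly allocated node has no children yet; `freshᵐ` makes its
-- memory cells read as 0.
record Trie (T : Tables) (node : ℕ → List ℕ) (len : ℕ) : Set where
 constructor trie
 field
  root : node 0 ≡ []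
  0<len : 0 < len
  inj : ∀ {i j} → i < len → j < len → node i ≡ node j → i ≡ j
  child⁺ : ∀ {i x c} → i < len → T 0 i x ≡ suc c → suc c < len × node (suc c) ≡ node i ∷ʳ x
  child⁰ : ∀ {i x} → i < len → T 0 i x ≡ 0 → ∀ {j} → j < len → node j ≢ node i ∷ʳ x
  parent : ∀ {j} → j < len → node j ≡ [] ⊎ ∃[ i ] ∃[ x ] (i < len × node j ≡ node i ∷ʳ x)
  fresh⁰ : ∀ {i x} → len ≤ i → T 0 i x ≡ 0
  freshᵐ : ∀ m ph {i} → len ≤ i → T (code (memC m)) ph i ≡ 0

-- Memory is stored at nodes only. An address without a node must therefore hold 0, which is `vm⁰`;
-- for this reason the input graph, too, is entered through the trie.
record View (ph : ℕ) (T : Tables) (node : ℕ → List ℕ) (len : ℕ) (s : State) : Set where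
 constructor view
 field
  vr : ∀ r → cell T (regC r) ph 0 ≡ regs s r
  va< : ∀ a → cell T (adrC a) ph 0 < len
  va : ∀ a → node (cell T (adrC a) ph 0) ≡ addrs s a
  vm : ∀ m {i} → i < len → cell T (memC m) ph i ≡ mem s m (node i)
  vm⁰ : ∀ m {a} → (∀ {i} → i < len → node i ≢ a) → mem s m a ≡ 0

record Bounded (V : ℕ) (s : State) : Set where
 constructor bnd
 field
  br : ∀ r → regs s r < 2 ^ V
  bm : ∀ m a → mem s m a < 2 ^ V
  bc : ∀ i → coins s i ≡ false

record Extends (node : ℕ → List ℕ) (len : ℕ) (node' : ℕ → List ℕ) (len' : ℕ) : Set where
 constructor extends
 field
  len≤ : len ≤ len'
  node≡ : ∀ {i} → i < len → node' i ≡ node i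

∷ʳ≢[] : ∀ {A : Set} {x : A} xs → xs ∷ʳ x ≢ []
∷ʳ≢[] [] ()
∷ʳ≢[] (_ ∷ _) ()

∷ʳ≢self : ∀ {A : Set} {x : A} xs → xs ≢ xs ∷ʳ x
∷ʳ≢self [] ()
∷ʳ≢self (x ∷ xs) e = ∷ʳ≢self xs (proj₂ (∷-injective e))

-- Phases whose rows of the tables are the same have the same view.
view-extend : ∀ {ph T T' node len node' len' s} → Trie T node len →
 (∀ {i j} → i < len' → j < len' → node' i ≡ node' j → i ≡ j) →
 Extends node len node' len' → (∀ c i → T' (code c) ph i ≡ T (code c) ph i) → (∀ c i → T' (code c) 0 i ≡ T (code c) 0 i) →
 View ph T node len s → View ph T' node' len' s
view-extend {ph} {T} {T'} {node} {len} {node'} {len'} {s} tr inj' (extends len≤ node≡) ep e0 (view vr va< va vm vm⁰) = view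
 (λ r → trans (cell≡ (regC r) 0) (vr r))
 (λ a → <-≤-trans (subst (_< len) (sym (cell≡ (adrC a) 0)) (va< a)) len≤)
 (λ a → trans (cong node' (cell≡ (adrC a) 0)) (trans (node≡ (va< a)) (va a)))
 vm'
 (λ m n → vm⁰ m λ i< e → n (<-≤-trans i< len≤) (trans (node≡ i<) e))
 where
 cell≡ : ∀ c i → cell T' c ph i ≡ cell T c ph i
 cell≡ c i = cong₂ overlay (ep c i) (e0 c i)
 vm' : ∀ m {i} → i < len' → cell T' (memC m) ph i ≡ mem s m (node' i)
 vm' m {i} i< with i <? len
 ... | yes i<len = trans (cell≡ (memC m) i) (trans (vm m i<len) (cong (mem s m) (sym (node≡ i<len))))
 -- A new node: its cells are empty, and by `vm⁰` the memory at its address is still 0.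
 ... | no i≮ = trans (cell≡ (memC m) i)
    (trans (cong₂ overlay (Trie.freshᵐ tr m ph (≮⇒≥ i≮)) (Trie.freshᵐ tr m 0 (≮⇒≥ i≮)))
    (sym (vm⁰ m λ j< e → i≮ (subst (_< len) (inj' (<-≤-trans j< len≤) i< (trans (node≡ j<) e)) j<))))

trie-alloc : ∀ {T node len i x} → Trie T node len → i < len → T 0 i x ≡ 0 →
 Trie (set 0 i x len T) (node [ len ↦ node i ∷ʳ x ]) (suc len)
trie-alloc {T} {node} {len} {i} {x} (trie root 0<len inj child⁺ child⁰ parent fresh⁰ freshᵐ) i< e0 = trie
 (trans (old 0<len) root) (s≤s z≤n) inj' child⁺' child⁰' parent'
 (λ {j} l → trans (set-other {0} {i} {x} {len} {T} λ { _ refl _ → <⇒≱ i< (<⇒≤ l) }) (fresh⁰ (<⇒≤ l)))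
 (λ m ph l → trans (set-other {0} {i} {x} {len} {T} λ ()) (freshᵐ m ph (<⇒≤ l)))
 where
 node' = node [ len ↦ node i ∷ʳ x ]
 old : ∀ {j} → j < len → node' j ≡ node j
 old j< = ↦-other node (λ e → <⇒≢ j< (sym e))
 new : node' len ≡ node i ∷ʳ x
 new = ↦-same node len
 split : ∀ {j} → j < suc len → j < len ⊎ j ≡ len
 split j< = m≤n⇒m<n∨m≡n (s≤s⁻¹ j<)
 inj' : ∀ {j k} → j < suc len → k < suc len → node' j ≡ node' k → j ≡ k
 inj' j< k< e with split j< | split k<
 ... | inj₁ j<' | inj₁ k<' = inj j<' k<' (trans (sym (old j<')) (trans e (old k<')))
 ... | inj₁ j<' | inj₂ refl = ⊥-elim (child⁰ i< e0 j<' (trans (sym (old j<')) (trans e new)))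
 ... | inj₂ refl | inj₁ k<' = ⊥-elim (child⁰ i< e0 k<' (trans (sym (old k<')) (trans (sym e) new)))
 ... | inj₂ refl | inj₂ refl = refl
 child⁺' : ∀ {j y c} → j < suc len → set 0 i x len T 0 j y ≡ suc c → suc c < suc len × node' (suc c) ≡ node' j ∷ʳ y
 child⁺' {j} {y} {c} j< e with i ≟ j | x ≟ y
 ... | yes refl | yes refl with refl ← trans (sym (set-same 0 i x len T)) e = n<1+n len , trans new (cong (_∷ʳ x) (sym (old i<)))
 child⁺' {j} {y} {c} j< e | no i≢j | _ with split j< | trans (sym (set-other {0} {i} {x} {len} {T} {0} {j} {y} λ _ e' _ → i≢j e')) e
 ... | inj₁ j<' | e' = let (c< , ne) = child⁺ j<' e' in <-trans c< (n<1+n len) , trans (old c<) (trans ne (cong (_∷ʳ y) (sym (old j<'))))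
 ... | inj₂ refl | e' = case trans (sym (fresh⁰ ≤-refl)) e' of λ ()
 child⁺' {j} {y} {c} j< e | yes _ | no x≢y with split j< | trans (sym (set-other {0} {i} {x} {len} {T} {0} {j} {y} λ _ _ e' → x≢y e')) e
 ... | inj₁ j<' | e' = let (c< , ne) = child⁺ j<' e' in <-trans c< (n<1+n len) , trans (old c<) (trans ne (cong (_∷ʳ y) (sym (old j<'))))
 ... | inj₂ refl | e' = case trans (sym (fresh⁰ ≤-refl)) e' of λ ()
 ≢key : ∀ {j y} → set 0 i x len T 0 j y ≡ 0 → i ≡ j → x ≡ y → ⊥
 ≢key e refl refl = <⇒≢ 0<len (sym (trans (sym (set-same 0 i x len T)) e))
 child⁰' : ∀ {j y} → j < suc len → set 0 i x len T 0 j y ≡ 0 → ∀ {k} → k < suc len → node' k ≢ node' j ∷ʳ y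
 child⁰' {j} {y} j< e {k} k< ne with split j< | split k<
 ... | inj₁ j<' | inj₁ k<' = child⁰ j<' (trans (sym (set-other {0} {i} {x} {len} {T} {0} {j} {y} λ _ → ≢key e)) e) k<'
                (trans (sym (old k<')) (trans ne (cong (_∷ʳ y) (old j<'))))
 ... | inj₁ j<' | inj₂ refl with ∷ʳ-injective (node i) (node j) (trans (sym new) (trans ne (cong (_∷ʳ y) (old j<'))))
 ... | n≡ , x≡y = ≢key e (inj i< j<' n≡) x≡y
 child⁰' {j} {y} j< e {k} k< ne | inj₂ refl | inj₂ refl = ∷ʳ≢self (node' len) ne
 -- An old node that extends the new address would have an old parent at the new address itself, but
 -- node i had no child x.
 child⁰' {j} {y} j< e {k} k< ne | inj₂ refl | inj₁ k<' with parent k<'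
 ... | inj₁ k≡[] = ∷ʳ≢[] (node' len) (trans (sym ne) (trans (old k<') k≡[]))
 ... | inj₂ (l , z , l< , k≡) with ∷ʳ-injective (node l) (node i ∷ʳ x) (trans (sym k≡) (trans (sym (old k<')) (trans ne (cong (_∷ʳ y) new))))
 ... | l≡ , _ = child⁰ i< e0 l< l≡
 parent' : ∀ {j} → j < suc len → node' j ≡ [] ⊎ ∃[ k ] ∃[ y ] (k < suc len × node' j ≡ node' k ∷ʳ y)
 parent' j< with split j<
 ... | inj₂ refl = inj₂ (i , x , <-trans i< (n<1+n len) , trans new (cong (_∷ʳ x) (sym (old i<))))
 ... | inj₁ j<' with parent j<'
 ... | inj₁ e = inj₁ (trans (old j<') e)
 ... | inj₂ (k , y , k< , e) = inj₂ (k , y , <-trans k< (n<1+n len) , trans (old j<') (trans e (cong (_∷ʳ y) (sym (old k<)))))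

trie-put : ∀ {T node len c ph i v} → (∀ m → c ≡ memC m → i < len) → Trie T node len → Trie (set (code c) ph i v T) node len
trie-put {T} {node} {len} {c} {ph} {i} {v} ok (trie root 0<len inj child⁺ child⁰ parent fresh⁰ freshᵐ) = trie root 0<len inj
 (λ i< e → child⁺ i< (trans (sym same⁰) e)) (λ i< e → child⁰ i< (trans (sym same⁰) e)) parent
 (λ l → trans same⁰ (fresh⁰ l))
 (λ m ph' {j} l → trans (set-other {code c} {ph} {i} {v} {T} λ e _ i≡ → <⇒≱ (ok m (code-injective e)) (subst (len ≤_) (sym i≡) l)) (freshᵐ m ph' l))
 where
 same⁰ : ∀ {j y} → set (code c) ph i v T 0 j y ≡ T 0 j y
 same⁰ = set-other {code c} {ph} {i} {v} {T} λ e → ⊥-elim (code≢0 c e)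

cell-put-same : ∀ T c ph i v → cell (set (code c) ph i (suc v) T) c ph i ≡ v
cell-put-same T c ph i v = cong (λ u → overlay u (set (code c) ph i (suc v) T (code c) 0 i)) (set-same (code c) ph i (suc v) T)

cell-put-other : ∀ T c ph i v {c' i'} → (c ≡ c' → i ≡ i' → ⊥) → cell (set (code c) ph i v T) c' ph i' ≡ cell T c' ph i'
cell-put-other T c ph i v n = cong₂ overlay
 (set-other {code c} {ph} {i} {v} {T} λ e _ i≡ → n (code-injective e) i≡)
 (set-other {code c} {ph} {i} {v} {T} λ e _ i≡ → n (code-injective e) i≡)

view-setReg : ∀ {ph T node len s} r v → View ph T node len s → View ph (set (code (regC r)) ph 0 (suc v) T) node len (setReg r v s)
view-setReg {ph} {T} {node} {len} {s} r v (view vr va< va vm vm⁰) = view vr'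
 (λ a → subst (_< len) (sym (other {adrC a} λ ())) (va< a))
 (λ a → trans (cong node (other {adrC a} λ ())) (va a))
 (λ m i< → trans (other {memC m} λ ()) (vm m i<)) vm⁰
 where
 other : ∀ {c i} → (regC r ≡ c → 0 ≡ i → ⊥) → cell (set (code (regC r)) ph 0 (suc v) T) c ph i ≡ cell T c ph i
 other {c} {i} = cell-put-other T (regC r) ph 0 (suc v) {c} {i}
 vr' : ∀ r' → cell (set (code (regC r)) ph 0 (suc v) T) (regC r') ph 0 ≡ (regs s [ r ↦ v ]) r'
 vr' r' with r ≟ r'
 ... | yes refl = trans (cell-put-same T (regC r) ph 0 v) (sym (↦-same (regs s) r))
 ... | no r≢ = trans (other {regC r'} λ { refl → ⊥-elim (r≢ refl) }) (trans (vr r') (sym (↦-other (regs s) r≢)))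

view-setAdr : ∀ {ph T node len s} a i xs → i < len → node i ≡ xs → View ph T node len s →
 View ph (set (code (adrC a)) ph 0 (suc i) T) node len (record s { addrs = addrs s [ a ↦ xs ] })
view-setAdr {ph} {T} {node} {len} {s} a i xs i< ni (view vr va< va vm vm⁰) = view
 (λ r → trans (other {regC r} λ ()) (vr r)) va<' va'
 (λ m i< → trans (other {memC m} λ ()) (vm m i<)) vm⁰
 where
 T' = set (code (adrC a)) ph 0 (suc i) T
 other : ∀ {c j} → (adrC a ≡ c → 0 ≡ j → ⊥) → cell T' c ph j ≡ cell T c ph j
 other {c} {j} = cell-put-other T (adrC a) ph 0 (suc i) {c} {j}
 va<' : ∀ a' → cell T' (adrC a') ph 0 < len
 va<' a' with a ≟ a'
 ... | yes refl = subst (_< len) (sym (cell-put-same T (adrC a) ph 0 i)) i<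
 ... | no a≢ = subst (_< len) (sym (other {adrC a'} λ { refl → ⊥-elim (a≢ refl) })) (va< a')
 va' : ∀ a' → node (cell T' (adrC a') ph 0) ≡ (addrs s [ a ↦ xs ]) a'
 va' a' with a ≟ a'
 ... | yes refl = trans (cong node (cell-put-same T (adrC a) ph 0 i)) (trans ni (sym (↦-same (addrs s) a)))
 ... | no a≢ = trans (cong node (other {adrC a'} λ { refl → ⊥-elim (a≢ refl) })) (trans (va a') (sym (↦-other (addrs s) a≢)))

view-setMem : ∀ {ph T node len s} m i a v → Trie T node len → i < len → node i ≡ a → View ph T node len s →
 View ph (set (code (memC m)) ph i (suc v) T) node len (record s { mem = put (mem s) m a v })
view-setMem {ph} {T} {node} {len} {s} m i a v tr i< refl (view vr va< va vm vm⁰) = view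
 (λ r → trans (other {regC r} λ ()) (vr r))
 (λ a → subst (_< len) (sym (other {adrC a} λ ())) (va< a))
 (λ a → trans (cong node (other {adrC a} λ ())) (va a)) vm'
 (λ m' n → trans (put-other (mem s) m (node i) v λ { _ refl → n i< refl }) (vm⁰ m' n))
 where
 T' = set (code (memC m)) ph i (suc v) T
 other : ∀ {c j} → (memC m ≡ c → i ≡ j → ⊥) → cell T' c ph j ≡ cell T c ph j
 other {c} {j} = cell-put-other T (memC m) ph i (suc v) {c} {j}
 vm' : ∀ m' {j} → j < len → cell T' (memC m') ph j ≡ put (mem s) m (node i) v m' (node j)
 vm' m' {j} j< with m ≟ m' | i ≟ j
 ... | yes refl | yes refl = trans (cell-put-same T (memC m) ph i v) (sym (put-same (mem s) m (node i) v))
 ... | no m≢ | _ = trans (other {memC m'} λ { refl → ⊥-elim (m≢ refl) }) (trans (vm m' j<) (sym (put-other (mem s) m (node i) v λ m≡ → ⊥-elim (m≢ m≡))))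
 ... | yes refl | no i≢ = trans (other {memC m'} λ _ i≡ → i≢ i≡) (trans (vm m' j<) (sym (put-other (mem s) m (node i) v λ _ e → i≢ (Trie.inj tr i< j< e))))

record RFrameOn (b : ℕ) (f f' : ℕ → ℕ) : Set where
 constructor rframe
 field
  rf : ∀ r → T (r <ᵇ b) → f' r ≡ f r

open RFrameOn public

RFrame : ℕ → Mid → Mid → Set
RFrame b M M' = RFrameOn b (reg M) (reg M')

below : ∀ {r b z} → T (r <ᵇ b) → T (b ≤ᵇ z) → r ≢ z
below {r} {b} r<b b≤z refl = <⇒≱ (<ᵇ⇒< r b r<b) (≤ᵇ⇒≤ b r b≤z)

T-trans : ∀ {r b z} → T (r <ᵇ b) → T (b ≤ᵇ z) → T (r <ᵇ z)
T-trans {r} {b} {z} r<b b≤z = <⇒<ᵇ (<-≤-trans (<ᵇ⇒< r b r<b) (≤ᵇ⇒≤ b z b≤z))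

rframe-refl : ∀ {b f} → RFrameOn b f f
rframe-refl = rframe λ _ _ → refl

rframe-trans : ∀ {b f f' f''} → RFrameOn b f f' → RFrameOn b f' f'' → RFrameOn b f f''
rframe-trans p q = rframe λ r r< → trans (rf q r r<) (rf p r r<)

rframe-setR : ∀ {b f f'} z {v} → T (b ≤ᵇ z) → RFrameOn b f f' → RFrameOn b f (f' [ z ↦ v ])
rframe-setR {b} {f' = f'} z {v} b≤ p = rframe λ r r< → trans (↦-other f' {z} {r} {v} λ e → below {r} {b} {z} r< b≤ (sym e)) (rf p r r<)

rframe-weaken : ∀ {b f f'} b' → T (b' ≤ᵇ b) → RFrameOn b f f' → RFrameOn b' f f'
rframe-weaken {b} b' b≤ p = rframe λ r r< → rf p r (T-trans {r} {b'} {b} r< b≤)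

frame-rframe : ∀ {b r t r' t'} → FrameOn b r t r' t' → RFrameOn b r r'
frame-rframe f = rframe (fr f)

-- Work in row `ph` leaves the cells of all other rows alone. The trie is shared and only grows. The
-- rollback rests on these two facts.
record Evolved (ph : ℕ) (M M' : Mid) (node : ℕ → List ℕ) (len : ℕ) (node' : ℕ → List ℕ) (len' : ℕ) : Set where
 constructor evolved
 field
  ext : Extends node len node' len'
  rows : ∀ c {ph'} i → ph' ≢ ph → tbl M' (code c) ph' i ≡ tbl M (code c) ph' i
  regs≡ : RFrame 35 M M'

evolved-trans : ∀ {ph M M' M'' node len node' len' node'' len''} →
 Evolved ph M M' node len node' len' → Evolved ph M' M'' node' len' node'' len'' → Evolved ph M M'' node len node'' len''
evolved-trans (evolved (extends l n) r f) (evolved (extends l' n') r' f') = evolved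
 (extends (≤-trans l l') λ i< → trans (n' (<-≤-trans i< l)) (n i<))
 (λ c i n → trans (r' c i n) (r c i n)) (rframe-trans f f')

-- Eccentricities of finite graphs, up to double negation

¬¬-map : {A B : Set} → (A → B) → ¬ ¬ A → ¬ ¬ B
¬¬-map f h k = h (k ∘ f)

¬¬-∀ : ∀ {n} {P : Fin n → Set} → (∀ i → ¬ ¬ P i) → ¬ ¬ (∀ i → P i)
¬¬-∀ {zero} h k = k λ ()
¬¬-∀ {suc n} h k = h Fin.zero λ p → ¬¬-∀ (h ∘ Fin.suc) λ q → k λ { Fin.zero → p ; (Fin.suc i) → q i }

-- P need not be decidable; it will be the existence of a walk of a given length. If there is no
-- least witness, strong induction excludes all witnesses.
¬¬-least : {P : ℕ → Set} → ¬ ¬ (∃[ k ] (P k × (∀ l → P l → k ≤ l)) ⊎ (∀ l → ¬ P l))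
¬¬-least {P} h = h (inj₂ λ l p → <-rec l p)
 where
 none : ∀ m l → l < m → ¬ P l
 none (suc m) l l<m p = h (inj₁ (l , p , λ k q → ≮⇒≥ λ k<l → none m k (<-≤-trans k<l (s≤s⁻¹ l<m)) q))
 <-rec : ∀ l → ¬ P l
 <-rec l = none (suc l) l ≤-refl

¬¬-distance : ∀ {n} (G : Digraph n) u v → ¬ ¬ (∃[ e ] IsDistance G u v e)
¬¬-distance G u v = ¬¬-map (λ { (inj₁ (k , p)) → [ k ] , p ; (inj₂ q) → ⊤⁺ , q }) ¬¬-least

≤⁺-refl : ∀ x → x ≤⁺ x
≤⁺-refl ⊤⁺ = ⊤⁺ ≤⊤⁺
≤⁺-refl [ x ] = [ ≤-refl ]

≤⁺-total : ∀ x y → x ≤⁺ y ⊎ y ≤⁺ x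
≤⁺-total x ⊤⁺ = inj₁ (x ≤⊤⁺)
≤⁺-total ⊤⁺ [ y ] = inj₂ ([ y ] ≤⊤⁺)
≤⁺-total [ x ] [ y ] with ≤-total x y
... | inj₁ p = inj₁ [ p ]
... | inj₂ p = inj₂ [ p ]

≤⁺-trans : ∀ {x y z} → x ≤⁺ y → y ≤⁺ z → x ≤⁺ z
≤⁺-trans {z = ⊤⁺} p (y ≤⊤⁺) = _ ≤⊤⁺
≤⁺-trans [ p ] [ q ] = [ ≤-trans p q ]

maximum⁺ : ∀ {n} (f : Fin (suc n) → ℕ ⁺) → ∃[ i ] ∀ j → f j ≤⁺ f i
maximum⁺ {zero} f = Fin.zero , λ { Fin.zero → ≤⁺-refl (f Fin.zero) }
maximum⁺ {suc n} f with maximum⁺ (f ∘ Fin.suc)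
... | i , max with ≤⁺-total (f Fin.zero) (f (Fin.suc i))
... | inj₁ p = Fin.suc i , λ { Fin.zero → p ; (Fin.suc j) → max j }
... | inj₂ p = Fin.zero , λ { Fin.zero → ≤⁺-refl (f Fin.zero) ; (Fin.suc j) → ≤⁺-trans (max j) p }

distance-unique-≤ : ∀ {n} {G : Digraph n} {u v d e} → IsDistance G u v d → IsDistance G u v e → d ≤⁺ e
distance-unique-≤ {e = ⊤⁺} p q = _ ≤⊤⁺
distance-unique-≤ {d = [ k ]} {[ l ]} (w , min) (w' , _) = [ min l w' ]
distance-unique-≤ {d = ⊤⁺} {[ l ]} none (w' , _) = ⊥-elim (none l w')

¬¬-eccentricity : ∀ {n} (G : Digraph n) v → ¬ ¬ (∃[ e ] IsEccentricity G v e)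
¬¬-eccentricity {suc n} G v = ¬¬-map ecc (¬¬-∀ (¬¬-distance G v))
 where
 ecc : (∀ u → ∃[ e ] IsDistance G v u e) → ∃[ e ] IsEccentricity G v e
 ecc dist with maximum⁺ (proj₁ ∘ dist)
 ... | i , max = proj₁ (dist i) , (i , proj₂ (dist i)) , λ u d isd → ≤⁺-trans (distance-unique-≤ {G = G} isd (proj₂ (dist u))) (max u)

-- The word 0 stands for ∞ and k + 1 for k.
far : ℕ → ℕ → Bool
far L word = (word ≡ᵇ 0) ∨ (4 + 2 * L ≤ᵇ word)

-- An estimate is never below the eccentricity, and ∞, which also counts as far, is encoded by 0.
-- The eccentricity exists only up to double negation, but an equation between Booleans is stable.
estimate-far : ∀ {n} α L {G : Digraph n} {s v} → CorrectEstimates α G s →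
 (∀ {e} → IsEccentricity G v e → [ 3 + 2 * L ] ≤⁺ e) → far L (mem s 1 (toℕ v ∷ [])) ≡ true
estimate-far α L {G} {s} {v} ok big = stable λ ne → ¬¬-eccentricity G v λ (e , ecc) → ne (decide e (ok v e ecc) (big ecc))
 where
 stable : ∀ {b} → ¬ ¬ (b ≡ true) → b ≡ true
 stable {true} _ = refl
 stable {false} h = ⊥-elim (h λ ())
 T⇒≡ : ∀ {b} → T b → b ≡ true
 T⇒≡ {true} _ = refl
 decide : ∀ e → Approx α e (estimate s v) → [ 3 + 2 * L ] ≤⁺ e → far L (mem s 1 (toℕ v ∷ [])) ≡ true
 decide e ap le with mem s 1 (toℕ v ∷ [])
 ... | zero = refl
 decide .([ _ ]) (finite p _) [ q ] | suc k = T⇒≡ (≤⇒≤ᵇ (s≤s (≤-trans q p)))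

-- All vertices are within 3 + L, so the eccentricity is finite and at most 3 + L; the approximation
-- factor cannot stretch it to 3 + 2 L.
estimate-near : ∀ {n} α L {G : Digraph n} {s v} → CorrectEstimates α G s →
 (∀ P P̂ → fromℕ P̂ ℚ.≤ α ℚ.* fromℕ P → P ≤ 3 + L → P̂ < 3 + 2 * L) →
 (∀ u → ∃[ l ] (l ≤ 3 + L × Walk G l v u)) → far L (mem s 1 (toℕ v ∷ [])) ≡ false
estimate-near α L {G} {s} {v} ok gap reach = stable λ ne → ¬¬-eccentricity G v λ (e , ecc) → ne (decide e (ok v e ecc) (proj₁ ecc))
 where
 stable : ∀ {b} → ¬ ¬ (b ≡ false) → b ≡ false
 stable {false} _ = refl
 stable {true} h = ⊥-elim (h λ ())
 decide : ∀ e → Approx α e (estimate s v) → ∃[ u ] IsDistance G v u e → far L (mem s 1 (toℕ v ∷ [])) ≡ false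
 decide ⊤⁺ ap (u , none) = let (l , _ , wk) = reach u in ⊥-elim (none l wk)
 decide [ k ] ap (u , wk , min) with mem s 1 (toℕ v ∷ [])
 decide [ k ] (finite p q) (u , wk , min) | suc k̂ = let (l , l≤ , wk') = reach u in
  ≤ᵇ-false {4 + 2 * L} (s≤s (gap k k̂ q (≤-trans (min l wk') l≤)))

-- Bounds on distances, and the gadget graph

data Path (E : ℕ → ℕ → Set) : ℕ → ℕ → ℕ → Set where
 nil : ∀ {x} → Path E 0 x x
 _∷ʳᵖ_ : ∀ {k x y z} → Path E k x y → E y z → Path E (suc k) x z

record Represents {n} (G : Digraph n) (E : ℕ → ℕ → Set) : Set where
 constructor represents
 field
  sound : ∀ {x y} → (x , y) ∈ G → E (toℕ x) (toℕ y)
  complete : ∀ {x y} → E (toℕ x) (toℕ y) → (x , y) ∈ G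

walk-∷ʳ : ∀ {n} {G : Digraph n} {k x y z} → Walk G k x y → (y , z) ∈ G → Walk G (suc k) x z
walk-∷ʳ nil e = cons e nil
walk-∷ʳ (cons e' wk) e = cons e' (walk-∷ʳ wk e)

-- Paths grow at their end because all those of the gadget start at the same u. The bound on sources
-- turns their inner numbers into vertices.
path-walk : ∀ {n} {G : Digraph n} {E} → Represents G E → (∀ {x y} → E x y → x < n) →
 ∀ {k x y} → Path E k (toℕ x) (toℕ y) → Walk G k x y
path-walk {n} {G} {E} R bound {x = x} p = go p refl
 where
 go : ∀ {k y'} → Path E k (toℕ x) y' → ∀ {y} → y' ≡ toℕ y → Walk G k x y
 go nil e = subst (Walk G 0 x) (toℕ-injective e) nil
 go (p ∷ʳᵖ e) refl = walk-∷ʳ (go p (sym (toℕ-fromℕ< (bound e)))) (Represents.complete R (subst (λ z → E z _) (sym (toℕ-fromℕ< (bound e))) e))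

-- A function that rises by at most 1 along each edge certifies a lower bound on distances edge by
-- edge, without any analysis of the shape of walks.
potential-bound : ∀ {n} {G : Digraph n} {E} (φ : ℕ → ℕ) → Represents G E → (∀ {x y} → E x y → φ y ≤ suc (φ x)) →
 ∀ {k x y} → Walk G k x y → φ (toℕ y) ≤ k + φ (toℕ x)
potential-bound φ R step nil = ≤-refl
potential-bound φ R step {suc k} {x} {y} (cons {v = z} e wk) =
 ≤-trans (potential-bound φ R step wk) (≤≡ (+-monoʳ-≤ k (step (Represents.sound R e))) (+-suc k _))

-- The vertices form R rows of width B. Row 0 holds the u, rows 1 and 2 the clauses and their
-- copies. In the rows 3 to 3 + L, the columns below A are the paths of the v and column A is the
-- path of the additional vertex. All other vertices are padding, reached by `back`.
module Gadget (A B R L d : ℕ) {{B≢0 : NonZero B}} (A<B : A < B) (d≤B : d ≤ B) (L<R : 3 + L < R) (fU fV : ℕ → ℕ → Bool) where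

 vtx : ℕ → ℕ → ℕ
 vtx r c = r * B + c

 Tail : ℕ → Set
 Tail y = 3 ≤ y / B × y / B ≤ 3 + L × y % B ≤ A

 data Static : ℕ → ℕ → Set where
  enter : ∀ {s} → s < A → Static (vtx 0 s) (vtx 3 A)
  out : ∀ {s c} → s < A → c < d → fU s c ≡ true → Static (vtx 0 s) (vtx 1 c)
  into : ∀ {s c} → s < A → c < d → fV s c ≡ true → Static (vtx 2 c) (vtx 3 s)
  along : ∀ {r c} → 3 ≤ r → r < 3 + L → c ≤ A → Static (vtx r c) (vtx (suc r) c)
  back : ∀ {y} → y < R * B → ¬ Tail y → Static (vtx (3 + L) A) y

 data Edges (act : ℕ → Bool) : ℕ → ℕ → Set where
  static : ∀ {x y} → Static x y → Edges act x y
  dynamic : ∀ {c} → c < d → act c ≡ true → Edges act (vtx 1 c) (vtx 2 c)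

 vtx< : ∀ {r c} → r < R → c < B → vtx r c < R * B
 vtx< {r} {c} r< c< = begin-strict
  r * B + c <⟨ +-monoʳ-< (r * B) c< ⟩
  r * B + B ≡⟨ +-comm (r * B) B ⟩
  suc r * B ≤⟨ *-monoˡ-≤ B r< ⟩
  R * B ∎
  where open ≤-Reasoning

 vtx-/ : ∀ r {c} → c < B → vtx r c / B ≡ r
 vtx-/ r c< = sym (proj₁ (divMod-unique {q = r} refl c<))

 vtx-% : ∀ r {c} → c < B → vtx r c % B ≡ c
 vtx-% r c< = sym (proj₂ (divMod-unique {q = r} refl c<))

 decode : ∀ y → y ≡ vtx (y / B) (y % B)
 decode y = trans (m≡m%n+[m/n]*n y B) (+-comm (y % B) _)

 private
  <R : ∀ {r} → r ≤ 3 + L → r < R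
  <R r≤ = ≤-<-trans r≤ L<R

 static-source< : ∀ {x y} → Static x y → x < R * B
 static-source< (enter s<) = vtx< {0} (<R z≤n) (<-trans s< A<B)
 static-source< (out s< _ _) = vtx< {0} (<R z≤n) (<-trans s< A<B)
 static-source< (into _ c< _) = vtx< (<R (m≤m+n 2 _)) (<-≤-trans c< d≤B)
 static-source< (along _ r< c≤) = vtx< (<R (<⇒≤ r<)) (≤-<-trans c≤ A<B)
 static-source< (back _ _) = vtx< (<R ≤-refl) A<B

 source< : ∀ {act x y} → Edges act x y → x < R * B
 source< (static e) = static-source< e
 source< (dynamic c< _) = vtx< (<R (m≤m+n 1 _)) (<-≤-trans c< d≤B)

 module Yes (act : ℕ → Bool) (u v : ℕ) (u<A : u < A) (v<A : v < A)
  (good : ∀ c → c < d → fU u c ≡ true → fV v c ≡ true → act c ≡ true → ⊥) where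

  -- Only the path of the chosen v and the detour in column A need true bounds. The other paths have
  -- no edge that leaves them, so the trivial value 0 does no harm there.
  tail-potential : ℕ → ℕ → ℕ
  tail-potential i c = if L <ᵇ i then 0 else (if c ≡ᵇ v then 3 + L + i else (if c ≡ᵇ A then suc i else 0))

  -- Vertices on the direct way from u through falsified clauses get their level 0, 1 or 2. The
  -- others outside the paths get 2 + L: one edge into the detour, L along it, one back.
  ψ : ℕ → ℕ → ℕ
  ψ 0 c = if c ≡ᵇ u then 0 else 2 + L
  ψ 1 c = if fU u c then 1 else 2 + L
  ψ 2 c = if fU u c ∧ act c then 2 else 2 + L
  ψ (suc (suc (suc i))) c = tail-potential i c

  -- A lower bound for the distance from u.
  φ : ℕ → ℕ
  φ y = ψ (y / B) (y % B)

  φ-vtx : ∀ r {c} → c < B → φ (vtx r c) ≡ ψ r c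
  φ-vtx r c< = cong₂ ψ (vtx-/ r c<) (vtx-% r c<)

  private
   tail-v : ∀ {i} → i ≤ L → tail-potential i v ≡ 3 + L + i
   tail-v {i} i≤ rewrite <ᵇ-false i≤ | ≡ᵇ-refl v = refl

   tail-A : ∀ {i} → i ≤ L → tail-potential i A ≡ suc i
   tail-A {i} i≤ rewrite <ᵇ-false i≤ | ≢⇒≡ᵇ {A} {v} (λ e → <⇒≢ v<A (sym e)) | ≡ᵇ-refl A = refl

   tail-other : ∀ i {c} → c ≢ v → c ≢ A → tail-potential i c ≡ 0
   tail-other i {c} c≢v c≢A rewrite ≢⇒≡ᵇ c≢v | ≢⇒≡ᵇ c≢A with L <ᵇ i
   ... | true = refl
   ... | false = refl

   tail-step : ∀ {i} c → i < L → tail-potential (suc i) c ≤ suc (tail-potential i c)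
   tail-step {i} c i< with c ≟ v | c ≟ A
   ... | yes refl | _ = ≤-reflexive (trans (tail-v i<) (trans (+-suc (3 + L) i) (cong suc (sym (tail-v (<⇒≤ i<))))))
   ... | no _ | yes refl = ≤-reflexive (trans (tail-A i<) (cong suc (sym (tail-A (<⇒≤ i<)))))
   ... | no c≢v | no c≢A = ≡≤ (tail-other (suc i) c≢v c≢A) z≤n

   low : ∀ r c → r ≤ 2 → ψ r c ≤ 2 + L
   low 0 c _ with c ≡ᵇ u
   ... | true = z≤n
   ... | false = ≤-refl
   low 1 c _ with fU u c
   ... | true = m≤m+n 1 (1 + L)
   ... | false = ≤-refl
   low 2 c _ with fU u c ∧ act c
   ... | true = m≤m+n 2 L
   ... | false = ≤-refl
   low (suc (suc (suc _))) c (s≤s (s≤s ()))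

   back-low : ∀ r c → ¬ (3 ≤ r × r ≤ 3 + L × c ≤ A) → ψ r c ≤ 2 + L
   back-low 0 c _ = low 0 c z≤n
   back-low 1 c _ = low 1 c (s≤s z≤n)
   back-low 2 c _ = low 2 c ≤-refl
   back-low (suc (suc (suc i))) c nt with c ≤? A
   ... | no c≰ = ≡≤ (tail-other i {c} (λ { refl → c≰ (<⇒≤ v<A) }) λ { refl → c≰ ≤-refl }) z≤n
   ... | yes c≤ with L <ᵇ i in e
   ... | true = z≤n
   ... | false = ⊥-elim (nt (m≤m+n 3 i , +-monoʳ-≤ 3 (≮⇒≥ λ l → subst T e (<⇒<ᵇ l)) , c≤))

   out-step : ∀ {s} c → fU s c ≡ true → ψ 1 c ≤ suc (ψ 0 s)
   out-step {s} c f with s ≟ u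
   ... | yes refl rewrite ≡ᵇ-refl s | f = ≤-refl
   ... | no s≢u rewrite ≢⇒≡ᵇ s≢u = m≤n⇒m≤1+n (low 1 c (s≤s z≤n))

   into-step : ∀ {s c} → s < A → c < d → fV s c ≡ true → ψ 3 s ≤ suc (ψ 2 c)
   into-step {s} {c} s< c< f with s ≟ v
   ... | no s≢v = ≡≤ (tail-other 0 s≢v (<⇒≢ s<)) z≤n
   ... | yes refl with fU u c in fu | act c in ac
   -- The only edge that could enter the path of v early, from level 2. It would need a clause that
   -- u, v and w all falsify.
   ... | true | true = ⊥-elim (good c c< fu f ac)
   ... | true | false = ≤-reflexive (trans (tail-v z≤n) (+-identityʳ (3 + L)))
   ... | false | _ = ≤-reflexive (trans (tail-v z≤n) (+-identityʳ (3 + L)))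

   dyn-step : ∀ c → act c ≡ true → ψ 2 c ≤ suc (ψ 1 c)
   dyn-step c ac with fU u c
   ... | true rewrite ac = ≤-refl
   ... | false = n≤1+n _

   vtx-step : ∀ {r c r' c'} → c < B → c' < B → ψ r' c' ≤ suc (ψ r c) → φ (vtx r' c') ≤ suc (φ (vtx r c))
   vtx-step {r} {c} {r'} {c'} c< c'< p = subst₂ (λ x y → x ≤ suc y) (sym (φ-vtx r' c'<)) (sym (φ-vtx r c<)) p

  φ-step : ∀ {x y} → Edges act x y → φ y ≤ suc (φ x)
  φ-step (static (enter {s} s<)) = vtx-step {0} {s} {3} (<-trans s< A<B) A<B (≡≤ (tail-A z≤n) (s≤s z≤n))
  φ-step (static (out {s} {c} s< c< f)) = vtx-step {0} {s} {1} {c} (<-trans s< A<B) (<-≤-trans c< d≤B) (out-step {s} c f)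
  φ-step (static (into {s} {c} s< c< f)) = vtx-step {2} {c} {3} {s} (<-≤-trans c< d≤B) (<-trans s< A<B) (into-step s< c< f)
  φ-step (static (along {suc (suc (suc i))} {c} 3≤r (s≤s (s≤s (s≤s i<))) c≤)) =
   vtx-step {3 + i} {c} {4 + i} {c} (≤-<-trans c≤ A<B) (≤-<-trans c≤ A<B) (tail-step c i<)
  φ-step (static (along {1} (s≤s ()) _ _))
  φ-step (static (along {2} (s≤s (s≤s ())) _ _))
  φ-step (static (back {y} y< nt)) = ≤≡ (back-low (y / B) (y % B) nt)
   (cong suc (sym (trans (φ-vtx (3 + L) A<B) (tail-A ≤-refl))))
  φ-step (dynamic {c} c< ac) = vtx-step {1} {c} {2} {c} (<-≤-trans c< d≤B) (<-≤-trans c< d≤B) (dyn-step c ac)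

  φ-source : φ u ≡ 0
  φ-source = trans (φ-vtx 0 (<-trans u<A A<B)) (cong (λ b → if b then 0 else 2 + L) (≡ᵇ-refl u))

  φ-target : φ (vtx (3 + L) v) ≡ 3 + 2 * L
  φ-target = trans (φ-vtx (3 + L) (<-trans v<A A<B)) (trans (tail-v ≤-refl) (l L))
   where
   l : ∀ L → 3 + L + L ≡ 3 + 2 * L
   l = solve-∀

  eccentricity≥ : ∀ {G : Digraph (R * B)} {x e} → Represents G (Edges act) → toℕ x ≡ u → IsEccentricity G x e → [ 3 + 2 * L ] ≤⁺ e
  eccentricity≥ {G} {x} {⊤⁺} rep _ _ = [ 3 + 2 * L ] ≤⊤⁺
  eccentricity≥ {G} {x} {[ k ]} rep refl (_ , max) = [ stable (λ k≱ → ¬¬-distance G x target λ (e , dist) → k≱ (bound e dist (max target e dist))) ]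
   where
   target : Fin (R * B)
   target = fromℕ< (vtx< L<R (<-trans v<A A<B))
   stable : ¬ ¬ (3 + 2 * L ≤ k) → 3 + 2 * L ≤ k
   stable h with 3 + 2 * L ≤? k
   ... | yes p = p
   ... | no ¬p = ⊥-elim (h ¬p)
   bound : ∀ e → IsDistance G x target e → e ≤⁺ [ k ] → 3 + 2 * L ≤ k
   bound [ l ] (wk , _) [ l≤k ] = ≤-trans (begin
    3 + 2 * L ≡⟨ sym φ-target ⟩
    φ (vtx (3 + L) v) ≡⟨ cong φ (sym (toℕ-fromℕ< _)) ⟩
    φ (toℕ target) ≤⟨ potential-bound φ rep φ-step wk ⟩
    l + φ (toℕ x) ≡⟨ trans (cong (l +_) φ-source) (+-identityʳ l) ⟩
    l ∎) l≤k
    where open ≤-Reasoning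

 module No (act : ℕ → Bool) (u : ℕ) (u<A : u < A)
  (bad : ∀ v → v < A → ∃[ c ] (c < d × fU u c ≡ true × fV v c ≡ true × act c ≡ true)) where

  private
   E = Edges act

   climb : ∀ {k c} → c ≤ A → Path E k u (vtx 3 c) → ∀ i → i ≤ L → Path E (i + k) u (vtx (3 + i) c)
   climb c≤ p zero _ = p
   climb c≤ p (suc i) i< = climb c≤ p i (<⇒≤ i<) ∷ʳᵖ static (along (m≤m+n 3 i) (+-monoʳ-< 3 i<) c≤)

   through : ∀ v → v < A → Path E 3 u (vtx 3 v)
   through v v< with bad v v<
   ... | c , c< , fu , fv , ac = ((nil ∷ʳᵖ static (out u<A c< fu)) ∷ʳᵖ dynamic c< ac) ∷ʳᵖ static (into v< c< fv)

   special : Path E 1 u (vtx 3 A)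
   special = nil ∷ʳᵖ static (enter u<A)

   tail-path : ∀ r c → 3 ≤ r → r ≤ 3 + L → c ≤ A → ∃[ l ] (l ≤ 3 + L × Path E l u (vtx r c))
   tail-path (suc (suc (suc i))) c _ (s≤s (s≤s (s≤s i≤))) c≤ with m≤n⇒m<n∨m≡n c≤
   ... | inj₁ c< = i + 3 , ≤≡ (+-monoˡ-≤ 3 i≤) (+-comm L 3) , climb c≤ (through c c<) i i≤
   ... | inj₂ refl = i + 1 , ≤-trans (+-monoˡ-≤ 1 i≤) (≡≤ (+-comm L 1) (m≤n+m (1 + L) 2)) , climb c≤ special i i≤
   tail-path 1 c (s≤s ())
   tail-path 2 c (s≤s (s≤s ()))

   escape : ∀ {y} → y < R * B → ¬ Tail y → ∃[ l ] (l ≤ 3 + L × Path E l u y)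
   escape y< nt = suc (L + 1) , ≡≤ (cong suc (+-comm L 1)) (n≤1+n _) ,
    climb ≤-refl special L ≤-refl ∷ʳᵖ static (back y< nt)

  path : ∀ y → y < R * B → ∃[ l ] (l ≤ 3 + L × Path E l u y)
  path y y< with 3 ≤? y / B | y / B ≤? 3 + L | y % B ≤? A
  ... | yes p | yes q | yes r = subst (λ z → ∃[ l ] (l ≤ 3 + L × Path E l u z)) (sym (decode y)) (tail-path (y / B) (y % B) p q r)
  ... | no ¬p | _ | _ = escape y< (¬p ∘ proj₁)
  ... | yes _ | no ¬q | _ = escape y< (¬q ∘ proj₁ ∘ proj₂)
  ... | yes _ | yes _ | no ¬r = escape y< (¬r ∘ proj₂ ∘ proj₂)

  walks≤ : ∀ {G : Digraph (R * B)} {x} → Represents G E → toℕ x ≡ u → ∀ y → ∃[ l ] (l ≤ 3 + L × Walk G l x y)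
  walks≤ rep refl y with path (toℕ y) (toℕ<n y)
  ... | l , l≤ , p = l , l≤ , path-walk rep source< p

-- Clauses under the three parts of an assignment

anyBelow : ℕ → (ℕ → Bool) → Bool
anyBelow zero p = false
anyBelow (suc k) p = anyBelow k p ∨ p k

anyBelow⁺ : ∀ {k p j} → j < k → p j ≡ true → anyBelow k p ≡ true
anyBelow⁺ {suc k} {p} {j} j< e with m≤n⇒m<n∨m≡n (s≤s⁻¹ j<)
... | inj₁ j<k rewrite anyBelow⁺ {k} {p} j<k e = refl
... | inj₂ refl rewrite e = ∨-zeroʳ (anyBelow j p)

anyBelow⁻ : ∀ k {p} → anyBelow k p ≡ true → ∃[ j ] (j < k × p j ≡ true)
anyBelow⁻ (suc k) {p} e with anyBelow k p in eqn
... | true  = let (j , j< , pj) = anyBelow⁻ k eqn in j , <-trans j< (n<1+n k) , pj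
... | false = k , n<1+n k , e

anyBelow-false : ∀ k {p} → anyBelow k p ≡ false → ∀ j → j < k → p j ≡ false
anyBelow-false k {p} e j j< with p j in eqn
... | false = refl
... | true  = case trans (sym e) (anyBelow⁺ {k} {p} j< eqn) of λ ()

-- Whether a literal, given by its code, involves a variable in [lo, hi)
-- and is true when the binary digits of val are assigned to these variables.
holds : (lo hi val code : ℕ) → Bool
holds lo hi val code = (lo ≤ᵇ half code) ∧ ((half code <ᵇ hi) ∧ (bool (bit (half code ∸ lo) val) ≡ᵇ bool (odd code)))

partSat : (ℕ → ℕ) → (ℕ → ℕ → ℕ) → (lo hi val c : ℕ) → Bool
partSat size lit lo hi val c = anyBelow (size c) (λ j → holds lo hi val (lit c j))

-- The three parts of an assignment and the bounds of their variables.
satisfied : (ℕ → ℕ) → (ℕ → ℕ → ℕ) → (a N u v w c : ℕ) → Bool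
satisfied size lit a N u v w c =
 partSat size lit 0 a u c ∨ (partSat size lit a (a + a) v c ∨ partSat size lit (a + a) N w c)

∧-true : ∀ {b c} → b ∧ c ≡ true → b ≡ true × c ≡ true
∧-true {true} e = refl , e

≡true⇒T : ∀ {b} → b ≡ true → T b
≡true⇒T refl = tt

T⇒≡true : ∀ {b} → T b → b ≡ true
T⇒≡true {true} _ = refl

holds⁻ : ∀ {lo hi val code} → holds lo hi val code ≡ true → lo ≤ half code × half code < hi × bit (half code ∸ lo) val ≡ odd code
holds⁻ {lo} {hi} {val} {code} e with ∧-true {lo ≤ᵇ half code} e
... | e₁ , e₂ with ∧-true {half code <ᵇ hi} e₂
... | e₃ , e₄ = ≤ᵇ⇒≤ lo _ (≡true⇒T e₁) , <ᵇ⇒< _ hi (≡true⇒T e₃) , bool-injective (≡ᵇ-true e₄)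

holds⁺ : ∀ {lo hi val code} → lo ≤ half code → half code < hi → bit (half code ∸ lo) val ≡ odd code → holds lo hi val code ≡ true
holds⁺ {lo} {hi} {val} {code} l h e rewrite T⇒≡true (≤⇒≤ᵇ l) | T⇒≡true (<⇒<ᵇ h) | e = ≡ᵇ-refl (bool (odd code))

at-map : ∀ {A : Set} {l xs} (P : A → Set) → Any P xs → ∃[ j ] (j < length xs × ∃[ y ] (P y × (∀ (f : A → ℕ) → at l (map f xs) j ≡ f y)))
at-map P (here p) = 0 , s≤s z≤n , _ , p , λ f → refl
at-map P (there a) with at-map P a
... | j , j< , y , p , e = suc j , s≤s j< , y , p , e

at-any : ∀ {A : Set} {l} (f : A → ℕ) (P : A → Set) xs j → j < length xs → (∀ y → at l (map f xs) j ≡ f y → P y) → Any P xs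
at-any f P (x ∷ xs) zero j< h = here (h x refl)
at-any f P (x ∷ xs) (suc j) (s≤s j<) h = there (at-any f P xs j j< h)

at-all : ∀ {A : Set} {x : A} (P : A → Set) xs → (∀ j → j < length xs → P (at x xs j)) → All P xs
at-all P [] h = []
at-all P (x ∷ xs) h = h 0 (s≤s z≤n) ∷ at-all P xs (λ j j< → h (suc j) (s≤s j<))

all-at : ∀ {A : Set} {x : A} {P : A → Set} {xs} → All P xs → ∀ j → j < length xs → P (at x xs j)
all-at (p ∷ ps) zero _ = p
all-at (p ∷ ps) (suc j) (s≤s j<) = all-at ps j j<

module Encoding {N : ℕ} (F : CNF N) (a : ℕ) (2a≤N : a + a ≤ N) where

 size : ℕ → ℕ
 size c = at 0 (map length F) c

 lit : ℕ → ℕ → ℕ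
 lit c j = at 0 (map litCode (at [] F c)) j

 size-at : ∀ {c} → c < length F → size c ≡ length (at [] F c)
 size-at = go F
  where
  go : ∀ (F : CNF N) {c} → c < length F → at 0 (map length F) c ≡ length (at [] F c)
  go (C ∷ F) {zero} _ = refl
  go (C ∷ F) {suc c} (s≤s c<) = go F c<

 half-lit : ∀ (l : Literal N) → half (litCode l) ≡ toℕ (proj₁ l)
 half-lit (x , b) = trans (cong half (+-comm (2 * toℕ x) (bool b))) (half-bool+2* b (toℕ x))

 odd-lit : ∀ (l : Literal N) → odd (litCode l) ≡ proj₂ l
 odd-lit (x , b) = trans (cong odd (+-comm (2 * toℕ x) (bool b))) (odd-bool+2* b (toℕ x))

 assign : (u v w : ℕ) → ℕ → Bool
 assign u v w x = if x <ᵇ a then bit x u else (if x <ᵇ a + a then bit (x ∸ a) v else bit (x ∸ (a + a)) w)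

 assign₁ : ∀ {u v w x} → x < a → assign u v w x ≡ bit x u
 assign₁ x< rewrite <ᵇ-true x< = refl

 assign₂ : ∀ {u v w x} → a ≤ x → x < a + a → assign u v w x ≡ bit (x ∸ a) v
 assign₂ a≤ x< rewrite <ᵇ-false a≤ | <ᵇ-true x< = refl

 assign₃ : ∀ {u v w x} → a + a ≤ x → assign u v w x ≡ bit (x ∸ (a + a)) w
 assign₃ a≤ rewrite <ᵇ-false (≤-trans (m≤m+n a a) a≤) | <ᵇ-false a≤ = refl

 True : (ℕ → Bool) → Literal N → Set
 True τ l = τ (toℕ (proj₁ l)) ≡ proj₂ l

 clause⁻ : ∀ {lo hi val c} {τ} → c < length F → (∀ x → lo ≤ x → x < hi → τ x ≡ bit (x ∸ lo) val) →
      partSat size lit lo hi val c ≡ true → Any (True τ) (at [] F c)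
 clause⁻ {lo} {hi} {val} {c} {τ} c< agree e with anyBelow⁻ (size c) e
 ... | j , j< , h = at-any litCode (True τ) (at [] F c) j (subst (j <_) (size-at c<) j<) λ l el →
  let (p , q , r) = holds⁻ {lo} {hi} {val} {litCode l} (trans (cong (holds lo hi val) (sym el)) h) in
  trans (agree _ (subst (lo ≤_) (half-lit l) p) (subst (_< hi) (half-lit l) q))
   (trans (cong (λ x → bit (x ∸ lo) val) (sym (half-lit l))) (trans r (odd-lit l)))

 clause⁺ : ∀ {u v w c} → c < length F → Any (True (assign u v w)) (at [] F c) → satisfied size lit a N u v w c ≡ true
 clause⁺ {u} {v} {w} {c} c< any with at-map {l = 0} (True (assign u v w)) any
 ... | j , j< , l , tr , el = cases
  where
  x = toℕ (proj₁ l)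
  in-part : ∀ lo hi val → lo ≤ x → x < hi → assign u v w x ≡ bit (x ∸ lo) val → partSat size lit lo hi val c ≡ true
  in-part lo hi val p q r = anyBelow⁺ {size c} {λ j → holds lo hi val (lit c j)} (subst (j <_) (sym (size-at c<)) j<)
   (trans (cong (holds lo hi val) (el litCode)) (holds⁺ {lo} {hi} {val} {litCode l}
    (subst (lo ≤_) (sym (half-lit l)) p) (subst (_< hi) (sym (half-lit l)) q)
    (trans (cong (λ x → bit (x ∸ lo) val) (half-lit l)) (trans (sym r) (trans tr (sym (odd-lit l)))))))
  cases : satisfied size lit a N u v w c ≡ true
  cases with x <? a | x <? a + a
  ... | yes p | _ rewrite in-part 0 a u z≤n p (assign₁ {u} {v} {w} p) = refl
  ... | no ¬p | yes q rewrite in-part a (a + a) v (≮⇒≥ ¬p) q (assign₂ {u} {v} {w} (≮⇒≥ ¬p) q) = ∨-zeroʳ _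
  ... | no ¬p | no ¬q rewrite in-part (a + a) N w (≮⇒≥ ¬q) (toℕ<n (proj₁ l)) (assign₃ {u} {v} {w} (≮⇒≥ ¬q)) =
   trans (cong (partSat size lit 0 a u c ∨_) (∨-zeroʳ (partSat size lit a (a + a) v c))) (∨-zeroʳ _)

 satisfiable⁺ : ∀ u v w → (∀ c → c < length F → satisfied size lit a N u v w c ≡ true) → Satisfiable F
 satisfiable⁺ u v w sat = (λ x → assign u v w (toℕ x)) , at-all {x = []} (Any (True (assign u v w))) F λ c c< → clause c c< (sat c c<)
  where
  clause : ∀ c → c < length F → satisfied size lit a N u v w c ≡ true → Any (True (assign u v w)) (at [] F c)
  clause c c< e with partSat size lit 0 a u c in e₁ | partSat size lit a (a + a) v c in e₂
  ... | true | _ = clause⁻ {0} {a} {u} {τ = assign u v w} c< (λ x _ x< → assign₁ {u} {v} {w} x<) e₁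
  ... | false | true = clause⁻ {a} {a + a} {v} {τ = assign u v w} c< (λ x l x< → assign₂ {u} {v} {w} l x<) e₂
  ... | false | false = clause⁻ {a + a} {N} {w} {τ = assign u v w} c< (λ x l _ → assign₃ {u} {v} {w} l) e

 satisfiable⁻ : Satisfiable F → ∃[ u ] ∃[ v ] ∃[ w ] (u < 2 ^ a × v < 2 ^ a × w < 2 ^ (N ∸ (a + a)) × (∀ c → c < length F → satisfied size lit a N u v w c ≡ true))
 satisfiable⁻ (σ , sat) = u , v , w , fromBits< a _ , fromBits< a _ , fromBits< b _ , λ c c< →
   clause⁺ {u} {v} {w} c< (Any.map (λ {l} e → trans (agree (proj₁ l)) e) (all-at {x = []} sat c c<))
  where
  b = N ∸ (a + a)
  -- Extended by `false` to all numbers, so that the three parts can be cut out as blocks of digits.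
  σ' : ℕ → Bool
  σ' x with x <? N
  ... | yes x< = σ (fromℕ< x<)
  ... | no _ = false
  σ'-toℕ : ∀ x → σ' (toℕ x) ≡ σ x
  σ'-toℕ x with toℕ x <? N
  ... | yes x< = cong σ (fromℕ<-toℕ x x<)
  ... | no x≮ = ⊥-elim (x≮ (toℕ<n x))
  u = fromBits a σ'
  v = fromBits a (λ i → σ' (a + i))
  w = fromBits b (λ i → σ' (a + a + i))
  agree : ∀ x → assign u v w (toℕ x) ≡ σ x
  agree x with toℕ x <? a | toℕ x <? a + a
  ... | yes p | _ = trans (assign₁ {u} {v} {w} p) (trans (bit-fromBits a _ _ p) (σ'-toℕ x))
  ... | no ¬p | yes q = trans (assign₂ {u} {v} {w} (≮⇒≥ ¬p) q) (trans (bit-fromBits a _ _ (+-cancelˡ-< a _ _ (subst (_< a + a) (sym (m+[n∸m]≡n (≮⇒≥ ¬p))) q)))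
      (trans (cong σ' (m+[n∸m]≡n (≮⇒≥ ¬p))) (σ'-toℕ x)))
  ... | no ¬p | no ¬q = trans (assign₃ {u} {v} {w} (≮⇒≥ ¬q)) (trans (bit-fromBits b _ _ (+-cancelˡ-< (a + a) _ _
       (subst₂ _<_ (sym (m+[n∸m]≡n (≮⇒≥ ¬q))) (sym (m+[n∸m]≡n 2a≤N)) (toℕ<n x))))
      (trans (cong σ' (m+[n∸m]≡n (≮⇒≥ ¬q))) (σ'-toℕ x)))

-- Evaluation of a clause by the machine

mulTo divTo remTo powTo : (z x y : ℕ) → Prog
mulTo z x y = mulP x y ⨾ copyP z 50
divTo z x y = divP x y ⨾ copyP z 50
remTo z x y = divP x y ⨾ copyP z 51
powTo z y lim = powP y lim ⨾ copyP z 50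

-- Evaluates clause (register 16) under the part of an assignment given by
-- the registers 22 to 24; the outcome is left in register 25.
literalP evP : Prog
literalP =
 rd1P 39 16 38 ⨾ divTo 44 39 12 ⨾ remTo 45 39 12 ⨾
 ltP 44 22 ⨾ flagP skip (
 ltP 44 23 ⨾ flagP (
  subP 46 44 22 ⨾ powTo 47 46 30 ⨾ divTo 47 24 47 ⨾ remTo 47 47 12 ⨾
  neqP 47 45 ⨾ flagP skip (constP 25 1)) skip)
evP = zeroP 25 ⨾ rd0P 36 16 ⨾ forP 38 36 literalP

halves-/ : ∀ k x → halves k x ≡ _/_ x (2 ^ k) {{m^n≢0 2 k}}
halves-/ zero x = sym (n/1≡n x)
halves-/ (suc k) x = trans (halves-/ k (half x)) (m/n/o≡m/[n*o] x 2 (2 ^ k) {{_}} {{m^n≢0 2 k}} {{m^n≢0 2 (suc k)}})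

frame-cong : ∀ {b f t f' t'} z v → FrameOn b f t f' t' → FrameOn b (f [ z ↦ v ]) t (f' [ z ↦ v ]) t'
frame-cong {b} {f} {t} {f'} z v F = frame go (ft F)
 where
 go : ∀ i → T (i <ᵇ b) → (f' [ z ↦ v ]) i ≡ (f [ z ↦ v ]) i
 go i i< with z ≡ᵇ i
 ... | true = refl
 ... | false = fr F i i<

frame-base : ∀ {b f t f' t'} z {v} → f z ≡ v → FrameOn b f t f' t' → FrameOn b (f [ z ↦ v ]) t f' t'
frame-base {b} {f} {t} {f'} z {v} e F = frame (λ i i< → trans (fr F i i<) (sym (same i))) (ft F)
 where
 same : ∀ i → (f [ z ↦ v ]) i ≡ f i
 same i with z ≡ᵇ i in q
 ... | true = trans (sym e) (cong f (≡ᵇ-true q))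
 ... | false = refl

frame-collapse : ∀ {b f t f' t'} z {u v} → FrameOn b ((f [ z ↦ u ]) [ z ↦ v ]) t f' t' → FrameOn b (f [ z ↦ v ]) t f' t'
frame-collapse {b} {f} {t} {f'} z {u} {v} F = frame (λ i i< → trans (fr F i i<) (same i)) (ft F)
 where
 same : ∀ i → ((f [ z ↦ u ]) [ z ↦ v ]) i ≡ (f [ z ↦ v ]) i
 same i with z ≡ᵇ i
 ... | true = refl
 ... | false = refl

-- Lists of edges and their layout in memory

Pair : Set
Pair = ℕ × ℕ

_∈?_ : (e : Pair) (Es : List Pair) → Dec (e ∈ Es)
e ∈? Es = Any.any? (≡-dec _≟_ _≟_ e) Es

-- Appending at the end makes positions in the list agree with the indices in memory. Skipping
-- duplicates makes the list unique whatever edges are emitted.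
insertEdge : Pair → List Pair → List Pair
insertEdge e Es with e ∈? Es
... | yes _ = Es
... | no _ = Es ∷ʳ e

insertEdges : List Pair → List Pair → List Pair
insertEdges [] Es = Es
insertEdges (e ∷ es) Es = insertEdges es (insertEdge e Es)

insertEdges-++ : ∀ xs ys Es → insertEdges (xs ++ ys) Es ≡ insertEdges ys (insertEdges xs Es)
insertEdges-++ [] ys Es = refl
insertEdges-++ (x ∷ xs) ys Es = insertEdges-++ xs ys (insertEdge x Es)

-- The memory that lists the edges as a graph input does.
edgeMemory : List Pair → Memory
edgeMemory Es 0 (i ∷ 0 ∷ []) = at 0 (map proj₁ Es) i
edgeMemory Es 0 (i ∷ 1 ∷ []) = at 0 (map proj₂ Es) i
edgeMemory Es _ _ = 0

at-∷ʳ-same : ∀ {A : Set} (f : A → ℕ) xs x → at 0 (map f (xs ∷ʳ x)) (length xs) ≡ f x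
at-∷ʳ-same f [] x = refl
at-∷ʳ-same f (_ ∷ xs) x = at-∷ʳ-same f xs x

at-∷ʳ-other : ∀ {A : Set} (f : A → ℕ) xs x i → i ≢ length xs → at 0 (map f (xs ∷ʳ x)) i ≡ at 0 (map f xs) i
at-∷ʳ-other f [] x zero n = contradiction refl n
at-∷ʳ-other f [] x (suc i) n = refl
at-∷ʳ-other f (_ ∷ xs) x zero n = refl
at-∷ʳ-other f (_ ∷ xs) x (suc i) n = at-∷ʳ-other f xs x i (n ∘ cong suc)

edgeMemory-∷ʳ : ∀ V Es x y m a → let i = length Es in
 put (put (λ m a → wrap V (edgeMemory Es m a)) 0 (i ∷ 0 ∷ []) (wrap V x)) 0 (i ∷ 1 ∷ []) (wrap V y) m a
  ≡ wrap V (edgeMemory (Es ∷ʳ (x , y)) m a)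
edgeMemory-∷ʳ V Es x y = go
 where
 i = length Es
 h = λ m a → wrap V (edgeMemory Es m a)
 h₁ = put h 0 (i ∷ 0 ∷ []) (wrap V x)
 h₂ = put h₁ 0 (i ∷ 1 ∷ []) (wrap V y)
 other : ∀ m a → (0 ≡ m → i ∷ 0 ∷ [] ≡ a → ⊥) → (0 ≡ m → i ∷ 1 ∷ [] ≡ a → ⊥) → h₂ m a ≡ h m a
 other m a n n' = trans (put-other h₁ 0 (i ∷ 1 ∷ []) (wrap V y) n') (put-other h 0 (i ∷ 0 ∷ []) (wrap V x) n)
 go : ∀ m a → h₂ m a ≡ wrap V (edgeMemory (Es ∷ʳ (x , y)) m a)
 go 0 (j ∷ 0 ∷ []) with j ≟ i
 ... | yes refl = trans (put-other h₁ 0 (i ∷ 1 ∷ []) (wrap V y) {0} {i ∷ 0 ∷ []} λ _ ()) (trans (put-same h 0 (i ∷ 0 ∷ []) (wrap V x)) (cong (wrap V) (sym (at-∷ʳ-same proj₁ Es (x , y)))))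
 ... | no j≢ = trans (other 0 (j ∷ 0 ∷ []) (λ { _ refl → j≢ refl }) λ _ ()) (cong (wrap V) (sym (at-∷ʳ-other proj₁ Es (x , y) j j≢)))
 go 0 (j ∷ 1 ∷ []) with j ≟ i
 ... | yes refl = trans (put-same h₁ 0 (i ∷ 1 ∷ []) (wrap V y)) (cong (wrap V) (sym (at-∷ʳ-same proj₂ Es (x , y))))
 ... | no j≢ = trans (other 0 (j ∷ 1 ∷ []) (λ _ ()) λ { _ refl → j≢ refl }) (cong (wrap V) (sym (at-∷ʳ-other proj₂ Es (x , y) j j≢)))
 go 0 [] = other 0 [] (λ _ ()) λ _ ()
 go 0 a@(_ ∷ []) = other 0 a (λ _ ()) λ _ ()
 go 0 a@(_ ∷ suc (suc _) ∷ []) = other 0 a (λ _ ()) λ _ ()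
 go 0 a@(_ ∷ 0 ∷ _ ∷ _) = other 0 a (λ _ ()) λ _ ()
 go 0 a@(_ ∷ 1 ∷ _ ∷ _) = other 0 a (λ _ ()) λ _ ()
 go 0 a@(_ ∷ suc (suc _) ∷ _ ∷ _) = other 0 a (λ _ ()) λ _ ()
 go (suc m) a = other (suc m) a (λ ()) λ ()

edgeState : ℕ → List Pair → State
edgeState V Es = ⟨ (λ _ → 0) , (λ _ → []) , (λ m a → wrap V (edgeMemory Es m a)) , (λ _ → false) ⟩

view-≗ : ∀ {ph U node len s s'} → (∀ r → regs s r ≡ regs s' r) → (∀ a → addrs s a ≡ addrs s' a) → (∀ m a → mem s m a ≡ mem s' m a) →
 View ph U node len s → View ph U node len s'
view-≗ er ea em (view vr va< va vm vm⁰) = view (λ r → trans (vr r) (er r)) va< (λ a → trans (va a) (ea a))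
 (λ m i< → trans (vm m i<) (em m _)) (λ m n → trans (sym (em m _)) (vm⁰ m n))

bounded-≗ : ∀ {V s s'} → (∀ r → regs s r ≡ regs s' r) → (∀ m a → mem s m a ≡ mem s' m a) → (∀ i → coins s' i ≡ false) → Bounded V s → Bounded V s'
bounded-≗ {V} er em ec (bnd br bm _) = bnd (λ r → subst (_< 2 ^ V) (er r) (br r)) (λ m a → subst (_< 2 ^ V) (em m a) (bm m a)) ec

-- Register 26 holds the trie node of the current edge.
endP : ℕ → ℕ → Prog
endP k src = copyP 40 26 ⨾ constP 41 k ⨾ childP ⨾ copyP 27 42 ⨾ copyP 42 src ⨾ modP ⨾ putP (code (memC 0)) 27 42

-- Appends the edge in registers 20 and 21, unless table 1 tells that it is
-- present; register 28 counts the edges.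
emitP : Prog
emitP = ldP 42 1 20 21 ⨾ nzP 42 ⨾ flagP skip (
 constP 42 1 ⨾ stP 1 20 21 42 ⨾ zeroP 40 ⨾ copyP 41 28 ⨾ childP ⨾ copyP 26 42 ⨾ endP 0 20 ⨾ endP 1 21 ⨾ incP 28)

lookup-injective : ∀ {A : Set} {xs : List A} → Unique xs → ∀ i j → lookup xs i ≡ lookup xs j → i ≡ j
lookup-injective (u ∷ us) Fin.zero Fin.zero e = refl
lookup-injective (u ∷ us) Fin.zero (Fin.suc j) e = ⊥-elim (All.lookup u (∈-lookup j) e)
lookup-injective (u ∷ us) (Fin.suc i) Fin.zero e = ⊥-elim (All.lookup u (∈-lookup i) (sym e))
lookup-injective (u ∷ us) (Fin.suc i) (Fin.suc j) e = cong Fin.suc (lookup-injective us i j e)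

-- Pigeonhole principle: the positions of xs inject into `Fin m`.
unique-bound : ∀ {m} (xs : List ℕ) → Unique xs → All (_< m) xs → length xs ≤ m
unique-bound {m} xs uq al = injective⇒≤ {f = f} λ {i} {j} e → lookup-injective uq i j
  (trans (sym (toℕ-fromℕ< (All.lookup al (∈-lookup i)))) (trans (cong toℕ e) (toℕ-fromℕ< (All.lookup al (∈-lookup j)))))
 where
 f : Fin (length xs) → Fin m
 f i = fromℕ< (All.lookup al (∈-lookup i))

unique-map : ∀ {A B : Set} {P : A → Set} (f : A → B) {xs} → (∀ {x y} → P x → P y → f x ≡ f y → x ≡ y) → All P xs → Unique xs → Unique (map f xs)
unique-map f inj [] [] = []
unique-map f inj (p ∷ ps) (u ∷ us) = All.map⁺ (All.map (λ { (q , n) e → n (inj p q e) }) (All.zip (ps , u))) ∷ unique-map f inj ps us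

InRange : ℕ → Pair → Set
InRange n (x , y) = x < n × y < n

edges-bound : ∀ n .{{_ : NonZero n}} Es → Unique Es → All (InRange n) Es → length Es ≤ n * n
edges-bound n Es uq al = subst (_≤ n * n) (length-map index Es)
 (unique-bound (map index Es) (unique-map index (λ {e} {e'} → inj {e} {e'}) al uq) (All.map⁺ (All.map bound al)))
 where
 index : Pair → ℕ
 index (x , y) = x * n + y
 bound : ∀ {e} → InRange n e → index e < n * n
 bound {x , y} (x< , y<) = <-≤-trans (+-monoʳ-< (x * n) y<) (≡≤ (+-comm (x * n) n) (*-monoˡ-≤ n x<))
 inj : ∀ {e e'} → InRange n e → InRange n e' → index e ≡ index e' → e ≡ e'
 inj {x , y} {x' , y'} (_ , y<) (_ , y'<) eqn with divMod-unique {q = x} refl y< | divMod-unique {q = x'} refl y'<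
 ... | a , b | a' , b' = cong₂ _,_ (trans a (trans (cong (_/ n) eqn) (sym a'))) (trans b (trans (cong (_% n) eqn) (sym b')))

unique-∷ʳ : ∀ {A : Set} {xs : List A} {x} → Unique xs → x ∉ xs → Unique (xs ∷ʳ x)
unique-∷ʳ {xs = xs} {x} uq n = AllPairs.++⁺ uq ([] ∷ []) (All.tabulate λ {y} y∈ → (λ { refl → n y∈ }) ∷ [])

trie-≗ : ∀ {U U' node len} → (∀ t x y → t ≢ 1 → U' t x y ≡ U t x y) → Trie U node len → Trie U' node len
trie-≗ e (trie root 0<len inj child⁺ child⁰ parent fresh⁰ freshᵐ) = trie root 0<len inj
 (λ i< p → child⁺ i< (trans (sym (e 0 _ _ λ ())) p)) (λ i< p → child⁰ i< (trans (sym (e 0 _ _ λ ())) p)) parent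
 (λ l → trans (e 0 _ _ λ ()) (fresh⁰ l)) (λ m ph l → trans (e _ ph _ (λ ())) (freshᵐ m ph l))

-- Construction of the graph

forL : ℕ → (ℕ → List Pair) → List Pair
forL zero f = []
forL (suc k) f = forL k f ++ f k

unless : Bool → Pair → List Pair
unless b e = if b then [] else (e ∷ [])

condEmitP : Prog → Prog → Prog
condEmitP args edge = (args ⨾ evP) ⨾ nzP 25 ⨾ flagP skip (edge ⨾ emitP)

tailP : Prog
tailP = zeroP 25 ⨾ ltP 22 14 ⨾ flagP skip (ltP 11 22 ⨾ flagP skip (ltP 5 23 ⨾ flagP skip (constP 25 1)))

-- The edges of the paths and the edges back are listed by their target y: a vertex outside the
-- paths is the target of one edge back, one on a path is the target of the edge from the vertex B
-- below, unless it lies in row 3.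
rowUP rowYP rowDP : Prog
rowUP = ((copyP 20 15 ⨾ addP 21 10 5) ⨾ emitP) ⨾ forP 16 2 (
 condEmitP (zeroP 22 ⨾ copyP 23 3 ⨾ copyP 24 15) (copyP 20 15 ⨾ addP 21 6 16) ⨾
 condEmitP (copyP 22 3 ⨾ copyP 23 4 ⨾ copyP 24 15) (addP 20 9 16 ⨾ addP 21 10 15))
rowYP = (divTo 22 15 6 ⨾ remTo 23 15 6 ⨾ tailP) ⨾ nzP 25 ⨾
 flagP (neqP 22 14 ⨾ flagP ((subP 20 15 6 ⨾ copyP 21 15) ⨾ emitP) skip) ((copyP 20 8 ⨾ copyP 21 15) ⨾ emitP)
rowDP = (addP 20 6 16 ⨾ addP 21 9 16) ⨾ emitP

-- A decremental algorithm can only remove dynamic edges, so its graph must start with all of them.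
buildP : Bool → Prog
buildP dense = forP 15 5 rowUP ⨾ forP 15 7 rowYP ⨾ (if dense then forP 16 2 rowDP else skip)

record KeepOn (q : ℕ → Bool) (f g : ℕ → ℕ) : Set where
 constructor keepOn
 field
  kp : ∀ r → T (q r) → g r ≡ f r

open KeepOn public

keep-refl : ∀ {q f} → KeepOn q f f
keep-refl = keepOn λ _ _ → refl

keep-trans : ∀ {q f g h} → KeepOn q f g → KeepOn q g h → KeepOn q f h
keep-trans a b = keepOn λ r r∈ → trans (kp b r r∈) (kp a r r∈)

keep-setR : ∀ {q f g} z {v} → T (not (q z)) → KeepOn q f g → KeepOn q f (g [ z ↦ v ])
keep-setR {q} {f} {g} z {v} z∉ k = keepOn λ r r∈ → trans (↦-other g {z} {r} {v} (λ { refl → contra (q z) r∈ z∉ })) (kp k r r∈)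
 where
 contra : ∀ b → T b → T (not b) → ⊥
 contra true _ ()

-- The registers that building and evaluating leave alone.
quiet : ℕ → Bool
quiet r = (r <ᵇ 20) ∨ ((26 ≤ᵇ r) ∧ (r <ᵇ 36))

quiet<36 : ∀ r → T (quiet r) → T (r <ᵇ 36)
quiet<36 r h with r <ᵇ 20 in e
... | true = T-trans {r} {20} {36} (≡true⇒T e) tt
... | false with 26 ≤ᵇ r
... | true = h

<20⇒quiet : ∀ r → T (r <ᵇ 20) → T (quiet r)
<20⇒quiet r h with r <ᵇ 20
... | true = tt

record Quiet (M M' : Mid) : Set where
 constructor quietly
 field
  qr : KeepOn quiet (reg M) (reg M')
  qt : tbl M' ≡ tbl M

open Quiet public

quiet-trans : ∀ {M M' M''} → Quiet M M' → Quiet M' M'' → Quiet M M''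
quiet-trans (quietly a b) (quietly a' b') = quietly (keep-trans a a') (trans b' b)

quiet-sy : ∀ {M M' f} → FrameOn 36 f (tbl M) (reg M') (tbl M') → KeepOn quiet (reg M) f → Quiet M M'
quiet-sy F K = quietly (keep-trans K (keepOn λ r r∈ → fr F r (quiet<36 r r∈))) (ft F)

∈-forL⁺ : ∀ {k f j e} → j < k → e ∈ f j → e ∈ forL k f
∈-forL⁺ {suc k} {f} j< e∈ with m≤n⇒m<n∨m≡n (s≤s⁻¹ j<)
... | inj₁ j<k = ∈-++⁺ˡ (∈-forL⁺ j<k e∈)
... | inj₂ refl = ∈-++⁺ʳ (forL k f) e∈

∈-forL⁻ : ∀ k {f e} → e ∈ forL k f → ∃[ j ] (j < k × e ∈ f j)
∈-forL⁻ (suc k) {f} e∈ with ∈-++⁻ (forL k f) e∈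
... | inj₂ p = k , n<1+n k , p
... | inj₁ p with ∈-forL⁻ k p
... | j , j< , q = j , <-trans j< (n<1+n k) , q

∈-unless⁺ : ∀ {b e} → b ≡ false → e ∈ unless b e
∈-unless⁺ refl = here refl

∈-unless⁻ : ∀ {b e e'} → e ∈ unless b e' → b ≡ false × e ≡ e'
∈-unless⁻ {false} (here e) = refl , e

∈-insertEdge⁺ : ∀ {e e' Es} → e ≡ e' ⊎ e ∈ Es → e ∈ insertEdge e' Es
∈-insertEdge⁺ {e} {e'} {Es} h with e' ∈? Es
... | yes p = [ (λ { refl → p }) , id ]′ h
... | no _ = [ (λ { refl → ∈-++⁺ʳ Es (here refl) }) , ∈-++⁺ˡ ]′ h

∈-insertEdge⁻ : ∀ {e e' Es} → e ∈ insertEdge e' Es → e ≡ e' ⊎ e ∈ Es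
∈-insertEdge⁻ {e} {e'} {Es} h with e' ∈? Es
... | yes _ = inj₂ h
... | no _ with ∈-++⁻ Es h
... | inj₁ p = inj₂ p
... | inj₂ (here refl) = inj₁ refl

∈-insertEdges⁺ : ∀ {e} es {Es} → e ∈ es ⊎ e ∈ Es → e ∈ insertEdges es Es
∈-insertEdges⁺ [] (inj₂ p) = p
∈-insertEdges⁺ (_ ∷ es) {Es} (inj₁ (here refl)) = ∈-insertEdges⁺ es (inj₂ (∈-insertEdge⁺ {Es = Es} (inj₁ refl)))
∈-insertEdges⁺ (_ ∷ es) (inj₁ (there p)) = ∈-insertEdges⁺ es (inj₁ p)
∈-insertEdges⁺ (e' ∷ es) {Es} (inj₂ p) = ∈-insertEdges⁺ es (inj₂ (∈-insertEdge⁺ {e' = e'} {Es} (inj₂ p)))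

∈-insertEdges⁻ : ∀ {e} es {Es} → e ∈ insertEdges es Es → e ∈ es ⊎ e ∈ Es
∈-insertEdges⁻ [] p = inj₂ p
∈-insertEdges⁻ (e' ∷ es) {Es} p with ∈-insertEdges⁻ es p
... | inj₁ q = inj₁ (there q)
... | inj₂ q with ∈-insertEdge⁻ {e' = e'} {Es} q
... | inj₁ refl = inj₁ (here refl)
... | inj₂ r = inj₂ r

length-insertEdges : ∀ es Es → length (insertEdges es Es) ≤ length es + length Es
length-insertEdges [] Es = ≤-refl
length-insertEdges (e ∷ es) Es = ≤-trans (length-insertEdges es (insertEdge e Es))
 (≤≡ (+-monoʳ-≤ (length es) grow) (+-suc (length es) (length Es)))
 where
 grow : length (insertEdge e Es) ≤ suc (length Es)
 grow with e ∈? Es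
 ... | yes _ = n≤1+n _
 ... | no _ = ≤-reflexive (trans (length-++ Es) (+-comm (length Es) 1))

length-forL : ∀ k f b → (∀ j → j < k → length (f j) ≤ b) → length (forL k f) ≤ k * b
length-forL zero f b h = z≤n
length-forL (suc k) f b h = ≡≤ (length-++ (forL k f))
 (≤≡ (+-mono-≤ (length-forL k f b λ j j< → h j (<-trans j< (n<1+n k))) (h k (n<1+n k))) (+-comm (k * b) b))

-- Unlike `forL` it unfolds at the front: operations are consumed from the front, and what remains
-- to be done is the loop invariant.
upL : {X : Set} → ℕ → ℕ → (ℕ → List X) → List X
upL k zero f = []
upL k (suc m) f = f k ++ upL (suc k) m f

-- Sequences of updates

apply : ∀ {n} → List (DynOp n) → Digraph n → Digraph n
apply [] G = G
apply (insert e ∷ ops) G = apply ops (e ∷ G)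
apply (delete e ∷ ops) G = apply ops (remove e G)
apply (query ∷ ops) G = apply ops G

apply-++ : ∀ {n} (xs ys : List (DynOp n)) G → apply (xs ++ ys) G ≡ apply ys (apply xs G)
apply-++ [] ys G = refl
apply-++ (insert e ∷ ops) ys G = apply-++ ops ys (e ∷ G)
apply-++ (delete e ∷ ops) ys G = apply-++ ops ys (remove e G)
apply-++ (query ∷ ops) ys G = apply-++ ops ys G

ValidPrefix : Mode → ℕ → ∀ {n} → Digraph n → List (DynOp n) → Set
ValidPrefix mode m G ops = ∀ {rest} → Valid mode m (apply ops G) rest → Valid mode m G (ops ++ rest)

countBelow : ℕ → (ℕ → Bool) → ℕ
countBelow zero act = 0
countBelow (suc k) act = bool (act k) + countBelow k act

countBelow-≤ : ∀ k act → countBelow k act ≤ k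
countBelow-≤ zero act = z≤n
countBelow-≤ (suc k) act = +-mono-≤ (s≤s⁻¹ (bool<2 (act k))) (countBelow-≤ k act)

countBelow-cong : ∀ k {act act'} → (∀ c → c < k → act c ≡ act' c) → countBelow k act ≡ countBelow k act'
countBelow-cong zero e = refl
countBelow-cong (suc k) e = cong₂ (λ b c → bool b + c) (e k (n<1+n k)) (countBelow-cong k λ c c< → e c (<-trans c< (n<1+n k)))

countBelow-set : ∀ {k c act} → c < k → act c ≡ false → countBelow k (act [ c ↦ true ]) ≡ suc (countBelow k act)
countBelow-set {suc k} {c} {act} c< e with m≤n⇒m<n∨m≡n (s≤s⁻¹ c<)
... | inj₂ refl = cong₂ (λ b n → bool b + n) (↦-same act c) (countBelow-cong c λ j j< → ↦-other act {c} {j} {true} λ { refl → <-irrefl refl j< })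
          ⟨ trans ⟩ cong (λ b → suc (bool b + countBelow c act)) (sym e)
 where
 _⟨_⟩_ : {X Y Z : Set} → X → (X → Y → Z) → Y → Z
 x ⟨ f ⟩ y = f x y
... | inj₁ c<k = trans (cong₂ (λ b n → bool b + n) (↦-other act (<⇒≢ c<k)) (countBelow-set c<k e)) (+-suc (bool (act k)) (countBelow k act))

countBelow-clear : ∀ {k c act} → c < k → act c ≡ true → suc (countBelow k (act [ c ↦ false ])) ≡ countBelow k act
countBelow-clear {k} {c} {act} c< e = trans (sym (countBelow-set {k} {c} {act [ c ↦ false ]} c< (↦-same act c)))
 (countBelow-cong k λ j _ → restore j)
 where
 restore : ∀ j → ((act [ c ↦ false ]) [ c ↦ true ]) j ≡ act j
 restore j with c ≟ j
 ... | yes refl = trans (↦-same (act [ c ↦ false ]) c) (sym e)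
 ... | no c≢j = trans (↦-other (act [ c ↦ false ]) c≢j) (↦-other act c≢j)

-- The driver programs

wrapRegP : ℕ → Prog
wrapRegP r = modP ⨾ putP (code (regC r)) 31 42

argumentsP : Prog
argumentsP = addP 42 9 16 ⨾ wrapRegP 1 ⨾ addP 42 6 16 ⨾ wrapRegP 0

-- With `sel = false` the clauses falsified by w are visited, to insert their edges or to take them
-- out again. With `sel = true` the satisfied ones are visited, whose edges a decremental algorithm
-- has to delete.
sweepP : Bool → Prog → Prog
sweepP sel P = forP 16 2 (((copyP 22 4 ⨾ copyP 23 1 ⨾ copyP 24 15) ⨾ evP) ⨾ nzP 25 ⨾
 flagP (if sel then argumentsP ⨾ simP P else skip) (if sel then skip else argumentsP ⨾ simP P))

-- The address of an estimate is a single word, hence a child of the root; a missing child means the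
-- word 0. Register 13 holds 3 + 2 L, and words are estimates plus one, hence the strict comparison.
estimateP : Prog
estimateP = ldP 42 0 31 17 ⨾ (nzP 42 ⨾ flagP (getP (code (memC 1)) 42 43) (zeroP 43)) ⨾
 nzP 43 ⨾ flagP (ltP 13 43 ⨾ flagP (constP 29 1) skip) (constP 29 1)

checkP : Prog
checkP = forP 17 5 estimateP

select : Bool → Bool → Bool
select sel p = if sel then p else not p

operationP : DynAlg → Bool → Prog
operationP A v = if v then onInsert A else onDelete A

phaseP : DynAlg → Bool → Bool → Prog
phaseP A sel v = sweepP sel (operationP A v) ⨾ simP (onQuery A) ⨾ checkP

-- `Evolved` without its claim about registers, since the driver changes its own counters.
record Drift (ph : ℕ) (M M' : Mid) (node : ℕ → List ℕ) (len : ℕ) (node' : ℕ → List ℕ) (len' : ℕ) : Set where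
 constructor drift
 field
  dext : Extends node len node' len'
  drows : ∀ c {ph'} i → ph' ≢ ph → tbl M' (code c) ph' i ≡ tbl M (code c) ph' i

drift-trans : ∀ {ph M M' M'' node len node' len' node'' len''} →
 Drift ph M M' node len node' len' → Drift ph M' M'' node' len' node'' len'' → Drift ph M M'' node len node'' len''
drift-trans (drift (extends l n) r) (drift (extends l' n') r') =
 drift (extends (≤-trans l l') λ i< → trans (n' (<-≤-trans i< l)) (n i<)) (λ c i n → trans (r' c i n) (r c i n))

evolved-drift : ∀ {ph M M' node len node' len'} → Evolved ph M M' node len node' len' → Drift ph M M' node len node' len'
evolved-drift (evolved e r _) = drift e r

drift-refl : ∀ {ph M M' node len} → tbl M' ≡ tbl M → Drift ph M M' node len node len
drift-refl e = drift (extends ≤-refl λ _ → refl) (λ c i _ → cong (λ t → t (code c) _ i) e)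

-- An amortized bound covers one uninterrupted sequence of operations, so the edges for w are
-- deleted before the next w is treated.
fullP : DynAlg → Prog
fullP A = forP 15 0 (phaseP A false true ⨾ sweepP false (onDelete A))

-- Row w + 1 is used for w, because row 0 is the common one. Turning to the next row, still empty,
-- is the whole rollback.
rollbackP : DynAlg → Bool → Bool → Prog
rollbackP A sel v = forP 15 0 ((copyP 34 15 ⨾ incP 34) ⨾ phaseP A sel v)

anyBelow-cong : ∀ k {p q} → (∀ j → j < k → p j ≡ q j) → anyBelow k p ≡ anyBelow k q
anyBelow-cong zero e = refl
anyBelow-cong (suc k) e = cong₂ _∨_ (anyBelow-cong k λ j j< → e j (<-trans j< (n<1+n k))) (e k (n<1+n k))

-- A phase without entries shows the contents of row 0.
view-rephase : ∀ {ph U node len s} → (∀ c i → U (code c) ph i ≡ 0) → View 0 U node len s → View ph U node len s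
view-rephase {ph} {U} {node} {len} {s} empty (view vr va< va vm vm⁰) = view
 (λ r → trans (cell≡ (regC r) 0) (vr r))
 (λ a → subst (_< len) (sym (cell≡ (adrC a) 0)) (va< a))
 (λ a → trans (cong node (cell≡ (adrC a) 0)) (va a))
 (λ m {i} i< → trans (cell≡ (memC m) i) (vm m i<)) vm⁰
 where
 cell≡ : ∀ c i → cell U c ph i ≡ cell U c 0 i
 cell≡ c i = trans (cong (λ z → overlay z (U (code c) 0 i)) (empty c i)) (sym (overlay-self (U (code c) 0 i)))

private
 time₁ : ∀ u q s y z c → 7 + (u * s + y + z) + (q * s + c) ≡ (u + q) * s + (y + (7 + z + c))
 time₁ = solve-∀

 time₂ : ∀ u v w s o p q z → (u * s + o) + ((v * s + p) + (7 + ((w * s + q) + z))) ≡ (u + v + w) * s + ((p + (7 + (q + z))) + o)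
 time₂ = solve-∀

 sum₁ : ∀ a b c d → (a + b) + c + d ≡ a + (b + (c + d))
 sum₁ = solve-∀

 sum₂ : ∀ a b c d → (a + b) + c + d ≡ a + (b + c + d)
 sum₂ = solve-∀

 sum₃ : ∀ a b c → a + (6 + (b + c)) ≡ (b + (6 + c)) + a
 sum₃ = solve-∀

-- Logarithm and initialization

-- The least exponent e ≤ k with N < 2 ^ e, if there is one.
lgLoop : ℕ → ℕ → ℕ
lgLoop N zero = 0
lgLoop N (suc k) = if 2 ^ lgLoop N k <ᵇ suc N then suc (lgLoop N k) else lgLoop N k

lg : ℕ → ℕ
lg N = lgLoop N N

n<2^n : ∀ n → n < 2 ^ n
n<2^n zero = s≤s z≤n
n<2^n (suc n) = ≤≡ (+-mono-≤ (0<2^ n) (n<2^n n)) (cong (2 ^ n +_) (sym (+-identityʳ (2 ^ n))))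

lgLoop-≤ : ∀ N k → lgLoop N k ≤ k
lgLoop-≤ N zero = z≤n
lgLoop-≤ N (suc k) with 2 ^ lgLoop N k <ᵇ suc N
... | true = s≤s (lgLoop-≤ N k)
... | false = m≤n⇒m≤1+n (lgLoop-≤ N k)

-- The last doubling started from a number of at most N. This keeps 2 ^ (K lg N) polynomial in N.
2^lgLoop-≤ : ∀ N k → 2 ^ lgLoop N k ≤ 2 * suc N
2^lgLoop-≤ N zero = s≤s z≤n
2^lgLoop-≤ N (suc k) with 2 ^ lgLoop N k <ᵇ suc N in e
... | true = *-monoʳ-≤ 2 (<⇒≤ (<ᵇ⇒< (2 ^ lgLoop N k) (suc N) (≡true⇒T e)))
... | false = 2^lgLoop-≤ N k

lgLoop-full : ∀ N k → 2 ^ lgLoop N k < suc N → lgLoop N k ≡ k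
lgLoop-full N zero _ = refl
lgLoop-full N (suc k) h with 2 ^ lgLoop N k <ᵇ suc N in e
... | true = cong suc (lgLoop-full N k (<ᵇ⇒< (2 ^ lgLoop N k) (suc N) (≡true⇒T e)))
... | false = ⊥-elim (case trans (sym (<ᵇ-true h)) e of λ ())

N<2^lg : ∀ N → N < 2 ^ lg N
N<2^lg N with suc N ≤? 2 ^ lg N
... | yes p = p
... | no ¬p = ⊥-elim (¬p (subst (λ e → suc N ≤ 2 ^ e) (sym (lgLoop-full N N (≰⇒> ¬p))) (n<2^n N)))

prologueP : ℕ → Prog
prologueP Cw = const 4 0 ⨾ arith 2 add 0 4 ⨾ arith 3 add 1 4 ⨾ const 5 1 ⨾ const 6 Cw ⨾ arith 7 add 2 5 ⨾ arith 1 mul 7 6 ⨾ const 0 0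

lgP : Prog
lgP = constP 42 1 ⨾ forP 43 1 (ltP 42 40 ⨾ flagP (addP 42 42 42 ⨾ incP 41) skip)

-- a = N / q, then g = K (lg N) + K + 1, b = g + a and ℓ = ρ + b.
initP : (q K L ρ cA : ℕ) → Prog
initP q K L ρ cA =
 (importNP 1 ⨾ importdP 2 ⨾ importWP 30 ⨾ constP 12 2 ⨾ constP 14 3 ⨾ constP 11 (3 + L) ⨾ constP 13 (3 + 2 * L) ⨾
  constP 40 q ⨾ divTo 3 1 40 ⨾ addP 4 3 3 ⨾ powTo 5 3 30 ⨾ copyP 40 1 ⨾ incP 40 ⨾ lgP) ⨾
 constP 44 K ⨾ mulTo 41 44 41 ⨾ constP 44 (suc K) ⨾ addP 41 41 44 ⨾ addP 41 41 3 ⨾ powTo 6 41 30 ⨾ addP 9 6 6 ⨾ addP 10 9 6 ⨾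
 mulTo 8 11 6 ⨾ addP 8 8 5 ⨾ constP 44 ρ ⨾ addP 41 44 41 ⨾ powTo 7 41 30 ⨾ incP 41 ⨾ constP 44 cA ⨾ mulTo 33 44 41 ⨾ powTo 32 33 30 ⨾
 subP 41 1 4 ⨾ powTo 0 41 30

startP : Prog
startP = zeroP 29 ⨾ copyP 42 28 ⨾ wrapRegP 1 ⨾ copyP 42 7 ⨾ wrapRegP 0

emptyMid : Mid
emptyMid = mid (λ _ → 0) (λ _ _ _ → 0) false

-- Polynomial bounds on running times

-- Upper bounds of the form a ≤ X ^ i * Y, closed under sums and products.
module Powers (X : ℕ) (64≤X : 64 ≤ X) where

 record Bd (i Y a : ℕ) : Set where
  constructor bd
  field
   ≤bd : a ≤ X ^ i * Y

 open Bd public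

 X≢0 : NonZero X
 X≢0 = >-nonZero (≤-trans (s≤s z≤n) 64≤X)

 private
  pow-mono : ∀ {i j} → i ≤ j → X ^ i ≤ X ^ j
  pow-mono = ^-monoʳ-≤ X {{X≢0}}

 infixr 6 _+ᵇ_
 infixr 7 _*ᵇ_

 _+ᵇ_ : ∀ {i j Y a b} → Bd i Y a → Bd j Y b → Bd (suc (i ⊔ j)) Y (a + b)
 _+ᵇ_ {i} {j} {Y} (bd p) (bd q) = bd (≤-trans (+-mono-≤ (≤-trans p (*-monoˡ-≤ Y (pow-mono (m≤m⊔n i j)))) (≤-trans q (*-monoˡ-≤ Y (pow-mono (m≤n⊔m i j)))))
  (≡≤ (cong (X ^ (i ⊔ j) * Y +_) (sym (+-identityʳ _))) (≤≡ (*-monoˡ-≤ (X ^ (i ⊔ j) * Y) (≤-trans (m≤m+n 2 62) 64≤X)) (sym (*-assoc X (X ^ (i ⊔ j)) Y)))))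

 _*ᵇ_ : ∀ {i j Y a b} → Bd i Y a → Bd j 1 b → Bd (i + j) Y (a * b)
 _*ᵇ_ {i} {j} {Y} (bd p) (bd q) = bd (≤≡ (*-mono-≤ p (≤≡ q (*-identityʳ (X ^ j))))
  (trans (l (X ^ i) Y (X ^ j)) (cong (_* Y) (sym (^-distribˡ-+-* X i j)))))
  where
  l : ∀ x y z → x * y * z ≡ x * z * y
  l = solve-∀

 -- The numerals in the time bounds handled this way are at most 64, whence the demand that X be at
 -- least 64.
 #ᵇ : ∀ c {Y} {{_ : NonZero Y}} {h : T (c ≤ᵇ 64)} → Bd 1 Y c
 #ᵇ c {Y} {h} = bd (≤-trans (≤-trans (≤ᵇ⇒≤ c 64 h) 64≤X) (≡≤ (sym (*-identityʳ X)) (m≤m*n (X ^ 1) Y)))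

 varᵇ : ∀ {a} → a ≤ X → Bd 1 1 a
 varᵇ a≤ = bd (≤≡ a≤ (sym (trans (*-identityʳ _) (*-identityʳ X))))

 sucᵇ : ∀ {i Y a} {{_ : NonZero Y}} → Bd i Y a → Bd (suc (1 ⊔ i)) Y (suc a)
 sucᵇ p = #ᵇ 1 +ᵇ p

 unitᵇ : ∀ {Y a} → a ≤ Y → Bd 0 Y a
 unitᵇ {Y} a≤ = bd (≤≡ a≤ (sym (*-identityˡ Y)))

 liftᵇ : ∀ {i Y a} {{_ : NonZero Y}} → Bd i 1 a → Bd i Y a
 liftᵇ {i} {Y} (bd p) = bd (≤-trans p (*-monoʳ-≤ (X ^ i) (>-nonZero⁻¹ Y)))

 widenᵇ : ∀ {i a} Y Z → Bd i Y a → Bd i (Z * Y) (Z * a)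
 widenᵇ {i} Y Z (bd p) = bd (≤≡ (*-monoʳ-≤ Z p) (l Z (X ^ i) Y))
  where
  l : ∀ z x y → z * (x * y) ≡ x * (z * y)
  l = solve-∀

 growᵇ : ∀ {i Y Z a} → Y ≤ Z → Bd i Y a → Bd i Z a
 growᵇ {i} Y≤ (bd p) = bd (≤-trans p (*-monoʳ-≤ (X ^ i) Y≤))

 -- Rounds an exponent up to a chosen literal. The literals 25, 40, 110 and so on in later bounds
 -- are such ceilings and not meant to be sharp.
 exponentᵇ : ∀ {i Y a} j → {_ : T (i ≤ᵇ j)} → Bd i Y a → Bd j Y a
 exponentᵇ {i} {Y} j {h} (bd p) = bd (≤-trans p (*-monoˡ-≤ Y (pow-mono (≤ᵇ⇒≤ i j h))))

-- Size of the input

edgeMemory-[] : ∀ m a → edgeMemory [] m a ≡ 0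
edgeMemory-[] 0 [] = refl
edgeMemory-[] 0 (_ ∷ []) = refl
edgeMemory-[] 0 (_ ∷ 0 ∷ []) = refl
edgeMemory-[] 0 (_ ∷ 1 ∷ []) = refl
edgeMemory-[] 0 (_ ∷ suc (suc _) ∷ []) = refl
edgeMemory-[] 0 (_ ∷ 0 ∷ _ ∷ _) = refl
edgeMemory-[] 0 (_ ∷ 1 ∷ _ ∷ _) = refl
edgeMemory-[] 0 (_ ∷ suc (suc _) ∷ _ ∷ _) = refl
edgeMemory-[] (suc m) a = refl

litCode< : ∀ {N} (l : Literal N) → litCode l < 2 * N
litCode< {N} (x , b) = <-≤-trans (+-monoʳ-< (2 * toℕ x) (bool<2 b)) (≡≤ (trans (+-comm (2 * toℕ x) 2) (sym (*-suc 2 (toℕ x)))) (*-monoʳ-≤ 2 (toℕ<n x)))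

cnfInput≤ : ∀ {N K} (F : CNF N) → IsKCNF K F → ∀ m a → cnfInput F m a ≤ K + 2 * N
cnfInput≤ {N} {K} F (short , _) = go
 where
 at≤ : ∀ {A : Set} (f : A → ℕ) {b} xs → All (λ x → f x ≤ b) xs → ∀ i → at 0 (map f xs) i ≤ b
 at≤ f [] [] i = z≤n
 at≤ f (x ∷ xs) (p ∷ ps) zero = p
 at≤ f (x ∷ xs) (p ∷ ps) (suc i) = at≤ f xs ps i
 go : ∀ m a → cnfInput F m a ≤ K + 2 * N
 go 0 [] = z≤n
 go 0 (i ∷ []) = ≤-trans (at≤ length F short i) (m≤m+n K _)
 go 0 (_ ∷ _ ∷ _) = z≤n
 go 1 [] = z≤n
 go 1 (_ ∷ []) = z≤n
 go 1 (i ∷ j ∷ []) = ≤-trans (at≤ litCode (at [] F i) (All.universal (λ l → <⇒≤ (litCode< l)) _) j) (m≤n+m _ K)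
 go 1 (_ ∷ _ ∷ _ ∷ _) = z≤n
 go (suc (suc m)) a = z≤n

-- A clause as a number in base 2 N + 1, whose digits are its literals.
clauseCode : ∀ {N} → Clause N → ℕ
clauseCode [] = 0
clauseCode {N} (l ∷ C) = suc (litCode l) + clauseCode C * suc (2 * N)

clauseCode< : ∀ {N} K (C : Clause N) → length C ≤ K → clauseCode C < suc (2 * N) ^ K
clauseCode< {N} K [] _ = m^n>0 (suc (2 * N)) K
clauseCode< {N} (suc K) (l ∷ C) (s≤s len) = ≤-trans (s≤s (+-monoˡ-≤ (clauseCode C * suc (2 * N)) (litCode< l)))
 (≤≡ (*-monoˡ-≤ (suc (2 * N)) (clauseCode< K C len)) (*-comm (suc (2 * N) ^ K) (suc (2 * N))))

litCode-injective : ∀ {N} {l l' : Literal N} → litCode l ≡ litCode l' → l ≡ l'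
litCode-injective {l = x , b} {x' , b'} e = cong₂ _,_
 (toℕ-injective (trans (sym (half-bool+2* b (toℕ x))) (trans (cong half (trans (+-comm (bool b) _) (trans e (+-comm _ (bool b'))))) (half-bool+2* b' (toℕ x')))))
 (trans (sym (odd-bool+2* b (toℕ x))) (trans (cong odd (trans (+-comm (bool b) _) (trans e (+-comm _ (bool b'))))) (odd-bool+2* b' (toℕ x'))))

clauseCode-injective : ∀ {N} {C C' : Clause N} → clauseCode C ≡ clauseCode C' → C ≡ C'
clauseCode-injective {C = []} {[]} _ = refl
clauseCode-injective {N} {l ∷ C} {l' ∷ C'} e = cong₂ _∷_
 (litCode-injective (suc-injective (trans (sym (digit l C)) (trans (cong (_% suc (2 * N)) e) (digit l' C')))))
 (clauseCode-injective (trans (sym (rest l C)) (trans (cong (_/ suc (2 * N)) e) (rest l' C'))))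
 where
 digit : ∀ (l : Literal N) C → clauseCode (l ∷ C) % suc (2 * N) ≡ suc (litCode l)
 digit l C = trans ([m+kn]%n≡m%n (suc (litCode l)) (clauseCode C) (suc (2 * N))) (m<n⇒m%n≡m (s≤s (litCode< l)))
 rest : ∀ (l : Literal N) C → clauseCode (l ∷ C) / suc (2 * N) ≡ clauseCode C
 rest l C = trans (+-distrib-/-∣ʳ (suc (litCode l)) (divides (clauseCode C) refl))
  (cong₂ _+_ (m<n⇒m/n≡0 (s≤s (litCode< l))) (m*n/n≡m (clauseCode C) (suc (2 * N))))

-- Distinct clauses have distinct codes, and a code has at most K digits in base 2 N + 1. So a row
-- that has room for all clauses costs only a polynomial factor.
clauses≤ : ∀ {N} K (F : CNF N) → IsKCNF K F → length F ≤ suc (2 * N) ^ K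
clauses≤ {N} K F (short , uniq) = subst (_≤ suc (2 * N) ^ K) (length-map clauseCode F)
 (unique-bound (map clauseCode F) (unique-map clauseCode (λ _ _ → clauseCode-injective) short uniq) (All.map⁺ (All.map (λ {C} → clauseCode< K C) short)))

-- The complete decision procedure

solverP : (Cw q K L ρ : ℕ) → DynAlg → Bool → Prog → Prog
solverP Cw q K L ρ A dense main =
 prologueP Cw ⨾ initP q K L ρ (wordConst A) ⨾ buildP dense ⨾ startP ⨾ simP (preprocess A) ⨾ main ⨾ nzP 29

boundFor : Mode → TimeBound
boundFor fullyDynamic = Amortized
boundFor incremental = WorstCase
boundFor decremental = WorstCase

denseFor : Mode → Bool
denseFor fullyDynamic = false
denseFor incremental = false
denseFor decremental = true

phasesFor : Mode → DynAlg → Prog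
phasesFor fullyDynamic A = fullP A
phasesFor incremental A = rollbackP A false true
phasesFor decremental A = rollbackP A true false

valid-≤ : ∀ {mode m m' n} {G : Digraph n} {ops} → m ≤ m' → Valid mode m G ops → Valid mode m' G ops
valid-≤ m≤ [] = []
valid-≤ m≤ (insert ok e l v) = insert ok e (≤-trans l m≤) (valid-≤ m≤ v)
valid-≤ m≤ (delete ok e v) = delete ok e (valid-≤ m≤ v)
valid-≤ m≤ (query v) = query (valid-≤ m≤ v)

opsCost : ∀ {n} → ℕ → ℕ → List (DynOp n) → ℕ
opsCost u c ops = sum (map (budget u c) ops)

cost-++ : ∀ {n} u c (xs : List (DynOp n)) ys → opsCost u c (xs ++ ys) ≡ opsCost u c xs + opsCost u c ys
cost-++ u c xs ys = trans (cong sum (map-++ (budget u c) xs ys)) (sum-++ (map (budget u c) xs) _)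

cost-upL : ∀ {n} u c b k m (f : ℕ → List (DynOp n)) → (∀ j → opsCost u c (f j) ≤ b) → opsCost u c (upL k m f) ≤ m * b
cost-upL u c b k zero f h = z≤n
cost-upL u c b k (suc m) f h = ≡≤ (cost-++ u c (f k) _) (+-mono-≤ (h k) (cost-upL u c b (suc k) m f h))

sum-mono : ∀ {xs ys} → Pointwise _≤_ xs ys → sum xs ≤ sum ys
sum-mono [] = z≤n
sum-mono (p ∷ ps) = +-mono-≤ p (sum-mono ps)

-- Correctness and running time of the programs on bit arrays

module Machine (cfg : Config) where
 open Config cfg public

 -- Arrays 0 and 1 keep the formula. Even numbers from 2 on belong to arrays for the digits of
 -- registers, odd ones from 3 on to arrays for those of table entries.
 record Rep (M : Mid) (S : State) : Set where
  constructor rep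
  field
   r0 : regs S 0 ≡ bool (flag M)
   r1 : regs S 1 ≡ W
   r2 : regs S 2 ≡ N
   r3 : regs S 3 ≡ d
   rr : ∀ r i → i < W → mem S (arrR r) (i ∷ []) ≡ bool (bit i (reg M r))
   rr< : ∀ r → reg M r < 2 ^ W
   rt : ∀ t x y i → x < 2 ^ W → y < 2 ^ W → i < W →
       mem S (arrT t) (i ∷ bits W x ++ bits W y) ≡ bool (bit i (tbl M t x y))
   rt< : ∀ t x y → tbl M t x y < 2 ^ W
   in0 : ∀ a → mem S 0 a ≡ inp 0 a
   in1 : ∀ a → mem S 1 a ≡ inp 1 a

 rep-reg : ∀ {M S S' z g} c → Rep M S → Written (arrR z) [] g W S S' →
  regs S' 0 ≡ bool c → regs S' 1 ≡ W → regs S' 2 ≡ N → regs S' 3 ≡ d →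
  Rep (setR z (fromBits W g) (setF c M)) S'
 rep-reg {M} {S} {S'} {z} {g} c R (written new old) e0 e1 e2 e3 = rep e0 e1 e2 e3 rr' rr<'
  (λ t x y i x< y< i< → trans (old (arrT t) _ λ j _ e → ⊥-elim (arrR≢arrT z t e)) (rt t x y i x< y< i<))
  rt<
  (λ a → trans (old 0 a λ j _ ()) (in0 a))
  (λ a → trans (old 1 a λ j _ ()) (in1 a))
  where
  open Rep R
  rr' : ∀ r i → i < W → mem S' (arrR r) (i ∷ []) ≡ bool (bit i ((reg M [ z ↦ fromBits W g ]) r))
  rr' r i i< with z ≟ r
  ... | yes refl rewrite ↦-same (reg M) z {fromBits W g} = trans (new i i<) (cong bool (sym (bit-fromBits W g i i<)))
  ... | no z≢r rewrite ↦-other (reg M) {x = fromBits W g} z≢r =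
     trans (old (arrR r) (i ∷ []) λ j _ e _ → z≢r (arrR-injective e)) (rr r i i<)
  rr<' : ∀ r → (reg M [ z ↦ fromBits W g ]) r < 2 ^ W
  rr<' r with z ≡ᵇ r
  ... | true = fromBits< W g
  ... | false = rr< r

 rep-tbl : ∀ {M S S' t x y v} → Rep M S → x < 2 ^ W → y < 2 ^ W → v < 2 ^ W →
  Written (arrT t) (bits W x ++ bits W y) (λ i → bit i v) W S S' →
  regs S' 0 ≡ bool (flag M) → regs S' 1 ≡ W → regs S' 2 ≡ N → regs S' 3 ≡ d →
  Rep (setT t x y v M) S'
 rep-tbl {M} {S} {S'} {t} {x} {y} {v} R x< y< v< (written new old) e0 e1 e2 e3 = rep e0 e1 e2 e3
  (λ r i i< → trans (old (arrR r) _ λ j _ e → ⊥-elim (arrR≢arrT r t (sym e))) (rr r i i<))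
  rr< rt' rt<'
  (λ a → trans (old 0 a λ j _ ()) (in0 a))
  (λ a → trans (old 1 a λ j _ ()) (in1 a))
  where
  open Rep R
  rt' : ∀ t' x' y' i → x' < 2 ^ W → y' < 2 ^ W → i < W →
     mem S' (arrT t') (i ∷ bits W x' ++ bits W y') ≡ bool (bit i (set t x y v (tbl M) t' x' y'))
  rt' t' x' y' i x'< y'< i< with t ≡ᵇ t' in te | x ≡ᵇ x' in xe | y ≡ᵇ y' in ye
  ... | true | true | true
     with refl ← ≡ᵇ⇒≡ t t' (subst T (sym te) tt)
       | refl ← ≡ᵇ⇒≡ x x' (subst T (sym xe) tt)
       | refl ← ≡ᵇ⇒≡ y y' (subst T (sym ye) tt) = new i i<
  ... | false | _ | _ = trans (old _ _ λ { j _ e _ → subst T te (≡⇒≡ᵇ t t' (arrT-injective e)) }) (rt t' x' y' i x'< y'< i<)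
  ... | true | false | _ = trans (old _ _ λ { j _ _ e → subst T xe (≡⇒≡ᵇ x x'
      (proj₁ (bits-injective W x< x'< (proj₂ (∷-injective e))))) }) (rt t' x' y' i x'< y'< i<)
  ... | true | true | false = trans (old _ _ λ { j _ _ e → subst T ye (≡⇒≡ᵇ y y'
      (proj₁ (bits-injective W y< y'< (cong (_++ []) (proj₂ (bits-injective W x< x'< (proj₂ (∷-injective e)))))))) }) (rt t' x' y' i x'< y'< i<)
  rt<' : ∀ t' x' y' → set t x y v (tbl M) t' x' y' < 2 ^ W
  rt<' t' x' y' with (t ≡ᵇ t') ∧ ((x ≡ᵇ x') ∧ (y ≡ᵇ y'))
  ... | true = v<
  ... | false = rt< t' x' y'

 bool< : ∀ b → bool b < 2 ^ w
 bool< true = 1<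
 bool< false = <-trans (n<1+n 0) 1<

 wrap-bool : ∀ b → wrap w (bool b) ≡ bool b
 wrap-bool b = wrap-id {w} (bool< b)

 wrap-suc : ∀ {x i} → x ≡ i → suc i < 2 ^ w → wrap w (x + wrap w 1) ≡ suc i
 wrap-suc {i = i} refl i< = trans (cong (λ o → wrap w (i + o)) (wrap-bool true)) (trans (cong (wrap w) (+-comm i 1)) (wrap-id {w} i<))

 wrap-pred : ∀ {x k} → x ≡ suc k → k < 2 ^ w → wrap w ((x + 2 ^ w) ∸ wrap w 1) ≡ k
 wrap-pred {k = k} refl k< = trans (cong (λ o → wrap w ((suc k + 2 ^ w) ∸ o)) (wrap-bool true))
  (trans ([m+n]%n≡m%n k (2 ^ w) {{m^n≢0 2 w}}) (wrap-id {w} k<))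

 wrap-W : ∀ {x} → x ≡ W → wrap w (x + wrap w 0) ≡ W
 wrap-W refl = trans (cong (λ o → wrap w (W + o)) (wrap-bool false)) (trans (cong (wrap w) (+-identityʳ W)) (wrap-id {w} W<))

 private
  nz : ∀ {x n} → x ≡ suc n → x ≢ 0
  nz refl ()

 leafState : Bool × Bool → State → State
 leafState (o , c) S = setReg 0 (wrap w (bool c)) (setReg 6 (wrap w (bool o)) S)

 tree-run : ∀ f {S} p q c → regs S 6 ≡ bool p → regs S 7 ≡ bool q → regs S 0 ≡ bool c →
       w ⊢ tree f , S ⇓[ 5 ] leafState (f p q c) S
 tree-run f true true true e6 e7 e0 = if-nz (nz e6) (if-nz (nz e7) (if-nz (nz e0) (seq const const)))
 tree-run f true true false e6 e7 e0 = if-nz (nz e6) (if-nz (nz e7) (if-z e0 (seq const const)))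
 tree-run f true false true e6 e7 e0 = if-nz (nz e6) (if-z e7 (if-nz (nz e0) (seq const const)))
 tree-run f true false false e6 e7 e0 = if-nz (nz e6) (if-z e7 (if-z e0 (seq const const)))
 tree-run f false true true e6 e7 e0 = if-z e6 (if-nz (nz e7) (if-nz (nz e0) (seq const const)))
 tree-run f false true false e6 e7 e0 = if-z e6 (if-nz (nz e7) (if-z e0 (seq const const)))
 tree-run f false false true e6 e7 e0 = if-z e6 (if-z e7 (if-nz (nz e0) (seq const const)))
 tree-run f false false false e6 e7 e0 = if-z e6 (if-z e7 (if-z e0 (seq const const)))

 index< : ∀ {k i} → suc k + i ≡ W → i < W
 index< {k} {i} refl = s≤s (m≤n+m i k)

 record StoresBit (m : ℕ) (key : List ℕ) (b : Bool) (E : ℕ → ℕ → Set) (i : ℕ) (S S' : State) : Set where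
  constructor storesBit
  field
   mem≡ : mem S' ≡ put (mem S) m (i ∷ key) (bool b)
   k1 : regs S' 1 ≡ regs S 1
   k2 : regs S' 2 ≡ regs S 2
   k3 : regs S' 3 ≡ regs S 3
   k4 : regs S' 4 ≡ regs S 4
   k5 : regs S' 5 ≡ regs S 5
   e : E (regs S' 0) (regs S' 12)

 record Done (m : ℕ) (key : List ℕ) (g : ℕ → Bool) (E : ℕ → ℕ → ℕ → Set) (S : State) (i : ℕ) (S' : State) : Set where
  constructor doneUpTo
  field
   wr : Written m key g i S S'
   r1 : regs S' 1 ≡ W
   r2 : regs S' 2 ≡ regs S 2
   r3 : regs S' 3 ≡ regs S 3
   e : E i (regs S' 0) (regs S' 12)

 -- `E` is the part of the invariant that differs between loops: it speaks of the carry in register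
 -- 0 or of the number in register 12 that is being split into digits.
 forBits-ends : ∀ {P S} m key g (E : ℕ → ℕ → ℕ → Set) b → regs S 1 ≡ W → E 0 (regs S 0) (regs S 12) →
  (∀ {i S'} → i < W → regs S' 5 ≡ i → Done m key g E S i S' →
    Ends w P S' b (StoresBit m key (g i) (E (suc i)) i S')) →
  Ends w (forBits P) S (2 + suc (W * suc (b + 3))) (Done m key g E S W)
 forBits-ends {P} {S} m key g E b e1 e0 body =
  step const (step arith (ends-map finish (loop-ends Inv (b + 3) (proj₁ ∘ proj₂ ∘ proj₂) loop-body W
   (0 , +-identityʳ W , wrap-W e1 , wrap-bool false , doneUpTo (written-zero refl) e1 refl refl e0))))
  where
  Inv : ℕ → State → Set
  Inv k S' = ∃[ i ] (k + i ≡ W × regs S' 4 ≡ k × regs S' 5 ≡ i × Done m key g E S i S')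
  finish : ∀ {S'} → Inv 0 S' → Done m key g E S W S'
  finish (i , refl , _ , _ , dn) = dn
  loop-body : ∀ {k S'} → Inv (suc k) S' → Ends w (P ⨾ next) S' (b + 3) (Inv k)
  loop-body {k} {S'} (i , k+i , e4 , e5 , dn@(doneUpTo wr r1 r2 r3 e)) =
   ends-⨾ (body (index< k+i) e5 dn) λ (storesBit mem≡ k1 k2 k3 k4 k5 e') →
    step const (step arith (ends arith
     (suc i , trans (+-suc k i) k+i , wrap-pred (trans k4 e4) (<-trans k<W W<)
     , wrap-suc (trans k5 e5) (≤-<-trans (index< k+i) W<)
     , doneUpTo (written-suc wr mem≡) (trans k1 r1) (trans k2 r2) (trans k3 r3) e')))
   where
   k<W : k < W
   k<W = subst (suc k ≤_) k+i (s≤s (m≤m+n k i))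

 forBits-time : ℕ → ℕ
 forBits-time b = 2 + suc (W * suc (b + 3))

 Reads : Mid → ℕ → State → Set
 Reads M x S = ∀ i → i < W → mem S (arrR x) (i ∷ []) ≡ bool (bit i (reg M x))

 scan-ends : ∀ f z x y {M S} → Rep M S →
  Ends w (scanP f z x y) S (forBits-time 13)
   (Rep (setR z (transduce W f (flag M) (reg M x) (reg M y)) (setF (carryAt f (flag M) (reg M x) (reg M y) W) M)))
 scan-ends f z x y {M} {S} R =
  ends-map (λ (doneUpTo wr e1 e2 e3 e) → rep-reg {z = z} {g = g} _ R wr e e1 (trans e2 r2) (trans e3 r3))
   (forBits-ends (arrR z) [] g (λ i r _ → r ≡ bool (carryAt f c u v i)) 13 r1 r0 body)
  where
  open Rep R
  c = flag M
  u = reg M x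
  v = reg M y
  g = outAt f c u v
  body : ∀ {i S'} → i < W → regs S' 5 ≡ i → Done (arrR z) [] g (λ i r _ → r ≡ bool (carryAt f c u v i)) S i S' →
      Ends w (clear 0 ⨾ push 0 5 ⨾ load 6 (arrR x) 0 ⨾ load 7 (arrR y) 0 ⨾ tree f ⨾ store (arrR z) 0 6) S' 13
       (StoresBit (arrR z) [] (g i) (λ r _ → r ≡ bool (carryAt f c u v (suc i))) i S')
  body {i} {S'} i< refl (doneUpTo (written new old) _ _ _ e) =
   step clear (step push (step load (step load (step (tree-run f (bit i u) (bit i v) (carryAt f c u v i) (get x) (get y) e)
    (ends store (storesBit (cong (put (mem S') (arrR z) (i ∷ [])) (wrap-bool _)) refl refl refl refl refl (wrap-bool _)))))))
   where
   -- Only positions below i have been overwritten so far, so z may be one of the operands.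
   get : ∀ x → mem S' (arrR x) (i ∷ []) ≡ bool (bit i (reg M x))
   get x = trans (old (arrR x) (i ∷ []) (λ j j< _ e → <⇒≢ j< (proj₁ (∷-injective e)))) (rr x i i<)

 record Keeps (S S' : State) : Set where
  constructor keeps
  field
   mem≡ : mem S' ≡ mem S
   k0 : regs S' 0 ≡ regs S 0
   k1 : regs S' 1 ≡ regs S 1
   k2 : regs S' 2 ≡ regs S 2
   k3 : regs S' 3 ≡ regs S 3
   k4 : regs S' 4 ≡ regs S 4
   k5 : regs S' 5 ≡ regs S 5
   k6 : regs S' 6 ≡ regs S 6
   k12 : regs S' 12 ≡ regs S 12

 push-time : ℕ
 push-time = 2 + suc (W * 9)

 pushBits-ends : ∀ x {M S} → Reads M x S → regs S 1 ≡ W →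
  Ends w (pushBits x) S push-time (λ S' → addrs S' 0 ≡ addrs S 0 ++ bits W (reg M x) × Keeps S S')
 pushBits-ends x {M} {S} rx e1 = step const (step arith (ends-map finish
   (loop-ends Inv 8 (proj₁ ∘ proj₂ ∘ proj₂) body W
    (0 , +-identityʳ W , wrap-W e1 , wrap-bool false , sym (++-identityʳ (addrs S 0)) , keeps refl refl refl refl refl refl refl refl refl))))
  where
  Inv : ℕ → State → Set
  Inv k S' = ∃[ i ] (k + i ≡ W × regs S' 9 ≡ k × regs S' 10 ≡ i × addrs S' 0 ≡ addrs S 0 ++ bits i (reg M x) × Keeps S S')
  finish : ∀ {S'} → Inv 0 S' → addrs S' 0 ≡ addrs S 0 ++ bits W (reg M x) × Keeps S S'
  finish (i , refl , _ , _ , a , k) = a , k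
  body : ∀ {k S'} → Inv (suc k) S' → Ends w (clear 1 ⨾ push 1 10 ⨾ load 11 (arrR x) 1 ⨾ push 0 11 ⨾ const 8 1 ⨾ arith 10 add 10 8 ⨾ arith 9 sub 9 8) S' 8 (Inv k)
  body {k} {S'} (i , k+i , e9 , refl , a , keeps mem≡ k0 k1 k2 k3 k4 k5 k6 k12) =
   step clear (step push (step load (step push (step const (step arith (ends arith
    (suc i , trans (+-suc k i) k+i , wrap-pred e9 (<-trans k<W W<) , wrap-suc refl (≤-<-trans (index< k+i) W<)
    , adr , keeps mem≡ k0 k1 k2 k3 k4 k5 k6 k12)))))))
   where
   k<W : k < W
   k<W = subst (suc k ≤_) k+i (s≤s (m≤m+n k i))
   adr : addrs S' 0 ∷ʳ mem S' (arrR x) (i ∷ []) ≡ addrs S 0 ++ bits (suc i) (reg M x)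
   adr = trans (cong₂ _∷ʳ_ a (trans (cong (λ h → h (arrR x) (i ∷ [])) mem≡) (rx i (index< k+i))))
       (trans (++-assoc (addrs S 0) (bits i (reg M x)) _) (cong (addrs S 0 ++_) (bits-∷ʳ i (reg M x))))

 key-time : ℕ
 key-time = 2 + (push-time + push-time)

 key-ends : ∀ x y {M S i} → Reads M x S → Reads M y S → regs S 1 ≡ W → regs S 5 ≡ i →
  Ends w (keyP x y) S key-time
   (λ S' → addrs S' 0 ≡ i ∷ bits W (reg M x) ++ bits W (reg M y) × Keeps S S')
 key-ends x y {M} {S} rx ry e1 refl = step clear (step push (ends-⨾ (pushBits-ends x {M} rx e1)
  λ { (a , keeps m≡ k0 k1 k2 k3 k4 k5 k6 k12) →
   ends-map (λ { (a' , keeps m≡' k0' k1' k2' k3' k4' k5' k6' k12') →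
     trans a' (cong (_++ bits W (reg M y)) a)
    , keeps (trans m≡' m≡) (trans k0' k0) (trans k1' k1) (trans k2' k2) (trans k3' k3) (trans k4' k4) (trans k5' k5) (trans k6' k6) (trans k12' k12) })
   (pushBits-ends y {M} (λ i i< → trans (cong (λ h → h (arrR y) (i ∷ [])) m≡) (ry i i<)) (trans k1 e1)) }))

 length-key : ∀ i x y → length (i ∷ bits W x ++ bits W y) ≡ suc (W + W)
 length-key i x y = cong suc (trans (length-++ (bits W x)) (cong₂ _+_ (length-bits W x) (length-bits W y)))

 ld-time : ℕ
 ld-time = forBits-time (key-time + (suc (suc (W + W)) + 4))

 -- All digits of both indices are read again for each digit of the result, so the target must not
 -- be one of the indices.
 ld-ends : ∀ z t x y {M S} → z ≢ x → z ≢ y → Rep M S →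
  Ends w (ldP z t x y) S ld-time (Rep (setR z (tbl M t (reg M x) (reg M y)) M))
 ld-ends z t x y {M} {S} z≢x z≢y R =
  ends-map (λ (doneUpTo wr e1 e2 e3 e) → subst (λ v → Rep (setR z v M) _) (fromBits-bit W _ (rt< t (reg M x) (reg M y)))
        (rep-reg {z = z} {g = g} (flag M) R wr (trans e r0) e1 (trans e2 r2) (trans e3 r3)))
   (forBits-ends (arrR z) [] g (λ i r _ → r ≡ regs S 0) _ r1 refl body)
  where
  open Rep R
  g : ℕ → Bool
  g i = bit i (tbl M t (reg M x) (reg M y))
  body : ∀ {i S'} → i < W → regs S' 5 ≡ i → Done (arrR z) [] g (λ i r _ → r ≡ regs S 0) S i S' →
      Ends w (keyP x y ⨾ load 6 (arrT t) 0 ⨾ clear 0 ⨾ push 0 5 ⨾ store (arrR z) 0 6) S' (key-time + (suc (suc (W + W)) + 4))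
       (StoresBit (arrR z) [] (g i) (λ r _ → r ≡ regs S 0) i S')
  body {i} {S'} i< e5 (doneUpTo (written new old) e1 _ _ e) =
   ends-⨾ (key-ends x y {M} (get x z≢x) (get y z≢y) e1 e5)
    λ { {S''} (a , keeps m≡ k0 k1 k2 k3 k4 k5 k6 k12) →
     ends-≤ (+-monoˡ-≤ 4 (≤-reflexive (cong suc (trans (cong length a) (length-key i (reg M x) (reg M y))))))
     (step load (step clear (step push (ends store
      (storesBit (trans (cong₂ (λ k v → put (mem S'') (arrR z) (k ∷ []) v) (trans k5 e5) (bitval {S''} a m≡))
               (cong (λ h → put h (arrR z) (i ∷ []) (bool (g i))) m≡))
        k1 k2 k3 k4 k5 (trans k0 e)))))) }
   where
   get : ∀ x → z ≢ x → Reads M x S'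
   get x z≢x j j< = trans (old (arrR x) (j ∷ []) (λ _ _ e _ → z≢x (arrR-injective e))) (rr x j j<)
   bitval : ∀ {S''} → addrs S'' 0 ≡ i ∷ bits W (reg M x) ++ bits W (reg M y) → mem S'' ≡ mem S' →
        mem S'' (arrT t) (addrs S'' 0) ≡ bool (g i)
   bitval a m≡ = trans (cong₂ (λ h k → h (arrT t) k) m≡ a)
    (trans (old (arrT t) _ λ _ _ e _ → arrR≢arrT z t e) (rt t (reg M x) (reg M y) i (rr< x) (rr< y) i<))

 st-time : ℕ
 st-time = forBits-time (4 + (key-time + (suc (suc (W + W)))))

 st-ends : ∀ t x y v {M S} → Rep M S →
  Ends w (stP t x y v) S st-time (Rep (setT t (reg M x) (reg M y) (reg M v) M))
 st-ends t x y v {M} {S} R =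
  ends-map (λ (doneUpTo wr e1 e2 e3 e) → rep-tbl {t = t} R (rr< x) (rr< y) (rr< v) wr (trans e r0) e1 (trans e2 r2) (trans e3 r3))
   (forBits-ends (arrT t) key g (λ i r _ → r ≡ regs S 0) _ r1 refl body)
  where
  open Rep R
  g : ℕ → Bool
  g i = bit i (reg M v)
  key : List ℕ
  key = bits W (reg M x) ++ bits W (reg M y)
  body : ∀ {i S'} → i < W → regs S' 5 ≡ i → Done (arrT t) key g (λ i r _ → r ≡ regs S 0) S i S' →
      Ends w (clear 0 ⨾ push 0 5 ⨾ load 6 (arrR v) 0 ⨾ keyP x y ⨾ store (arrT t) 0 6) S' (4 + (key-time + (suc (suc (W + W)))))
       (StoresBit (arrT t) key (g i) (λ r _ → r ≡ regs S 0) i S')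
  body {i} {S'} i< refl (doneUpTo (written new old) e1 _ _ e) =
   step clear (step push (step load
    (ends-⨾ (key-ends x y {M} (get x) (get y) e1 refl)
    λ { {S''} (a , keeps m≡ k0 k1 k2 k3 k4 k5 k6 k12) →
     ends-≤ (≤-reflexive (cong suc (trans (cong length a) (length-key i (reg M x) (reg M y)))))
     (ends store
      (storesBit (trans (cong₂ (λ k v → put (mem S'') (arrT t) k v) a (trans k6 (get v i i<)))
               (cong (λ h → put h (arrT t) (i ∷ key) (bool (g i))) m≡))
        k1 k2 k3 k4 k5 (trans k0 e))) })))
   where
   get : ∀ x → Reads M x S'
   get x j j< = trans (old (arrR x) (j ∷ []) (λ _ _ e _ → arrR≢arrT x t (sym e))) (rr x j j<)

 wrap-half : ∀ {h} → h < 2 ^ w → wrap w (quot h (wrap w 2)) ≡ half h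
 wrap-half {h} h< = trans (cong (λ o → wrap w (quot h o)) (wrap-id {w} 2<)) (wrap-id {w} (≤-<-trans (m/n≤m h 2) h<))

 wrap-odd : ∀ {h} → h < 2 ^ w →
  wrap w ((h + 2 ^ w) ∸ wrap w (wrap w (quot h (wrap w 2)) * wrap w 2)) ≡ bool (odd h)
 wrap-odd {h} h< = begin
  wrap w ((h + 2 ^ w) ∸ wrap w (wrap w (quot h (wrap w 2)) * wrap w 2))
   ≡⟨ cong (λ o → wrap w ((h + 2 ^ w) ∸ wrap w o)) (trans (cong₂ _*_ (wrap-half h<) (wrap-id {w} 2<)) (*-comm (half h) 2)) ⟩
  wrap w ((h + 2 ^ w) ∸ wrap w (2 * half h))
   ≡⟨ cong (λ o → wrap w ((h + 2 ^ w) ∸ o)) (wrap-id {w} (≤-<-trans (≤≡ (m≤n+m (2 * half h) (bool (odd h))) (sym (odd+2half h))) h<)) ⟩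
  wrap w ((h + 2 ^ w) ∸ 2 * half h)
   ≡⟨ cong (λ o → wrap w ((o + 2 ^ w) ∸ 2 * half h)) (odd+2half h) ⟩
  wrap w ((bool (odd h) + 2 * half h + 2 ^ w) ∸ 2 * half h)
   ≡⟨ cong (λ o → wrap w (o ∸ 2 * half h)) (l (bool (odd h)) (2 * half h) (2 ^ w)) ⟩
  wrap w ((bool (odd h) + 2 ^ w) + 2 * half h ∸ 2 * half h)
   ≡⟨ cong (wrap w) (m+n∸n≡m (bool (odd h) + 2 ^ w) (2 * half h)) ⟩
  wrap w (bool (odd h) + 2 ^ w)
   ≡⟨ [m+n]%n≡m%n (bool (odd h)) (2 ^ w) {{m^n≢0 2 w}} ⟩
  wrap w (bool (odd h))
   ≡⟨ wrap-bool (odd h) ⟩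
  bool (odd h) ∎
  where
  open ≡-Reasoning
  l : ∀ a b c → a + b + c ≡ (a + c) + b
  l = solve-∀

 import-ends : ∀ z v {M S} → Rep M S → regs S 12 ≡ v → v < 2 ^ W → v < 2 ^ w →
  Ends w (importP z) S (forBits-time 10) (Rep (setR z v M))
 import-ends z v {M} {S} R e12 v<W v< =
  ends-map (λ (doneUpTo wr e1 e2 e3 (e , _)) → subst (λ v → Rep (setR z v M) _) (fromBits-bit W v v<W)
        (rep-reg {z = z} {g = g} (flag M) R wr (trans e r0) e1 (trans e2 r2) (trans e3 r3)))
   (forBits-ends (arrR z) [] g E _ r1 (refl , e12) body)
  where
  open Rep R
  g : ℕ → Bool
  g i = bit i v
  E : ℕ → ℕ → ℕ → Set
  E i r h = r ≡ regs S 0 × h ≡ halves i v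
  body : ∀ {i S'} → i < W → regs S' 5 ≡ i → Done (arrR z) [] g E S i S' →
      Ends w (const 8 2 ⨾ arith 7 div 12 8 ⨾ arith 11 mul 7 8 ⨾ arith 6 sub 12 11 ⨾
          clear 0 ⨾ push 0 5 ⨾ store (arrR z) 0 6 ⨾ const 13 0 ⨾ arith 12 add 7 13) S' 10
       (StoresBit (arrR z) [] (g i) (E (suc i)) i S')
  body {i} {S'} i< refl (doneUpTo wr e1 _ _ (e , h)) =
   step const (step arith (step arith (step arith (step clear (step push (step store (step const (ends arith
    (storesBit (cong (put (mem S') (arrR z) (i ∷ [])) (trans (wrap-odd h<) (cong bool (trans (cong odd h) (sym (bit≡odd-halves i v))))))
     refl refl refl refl refl
     (e , trans (cong₂ (λ a b → wrap w (a + b)) (wrap-half h<) (wrap-bool false))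
         (trans (cong (wrap w) (+-identityʳ _)) (trans (wrap-id {w} (≤-<-trans (m/n≤m _ 2) h<))
          (trans (cong half h) (sym (halves-suc i v)))))))))))))))
   where
   h< : regs S' 12 < 2 ^ w
   h< = ≤-<-trans (≡≤ h (halves≤ i v)) v<

 export-time : ℕ
 export-time = 3 + suc (W * 10)

 record Unchanged (S S' : State) : Set where
  constructor unchanged
  field
   mem≡ : mem S' ≡ mem S
   k0 : regs S' 0 ≡ regs S 0
   k1 : regs S' 1 ≡ regs S 1
   k2 : regs S' 2 ≡ regs S 2
   k3 : regs S' 3 ≡ regs S 3

 rep-unchanged : ∀ {M S S'} → Rep M S → Unchanged S S' → Rep M S'
 rep-unchanged {M} (rep r0 r1 r2 r3 rr rr< rt rt< in0 in1) (unchanged m≡ k0 k1 k2 k3) =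
  rep (trans k0 r0) (trans k1 r1) (trans k2 r2) (trans k3 r3)
   (λ r i i< → trans (m≡' _ _) (rr r i i<)) rr<
   (λ t x y i x< y< i< → trans (m≡' _ _) (rt t x y i x< y< i<)) rt<
   (λ a → trans (m≡' _ _) (in0 a)) (λ a → trans (m≡' _ _) (in1 a))
  where m≡' = λ m a → cong (λ h → h m a) m≡

 -- Horner's scheme from the leading digit: while k digits remain, register 12 holds `halves k v`,
 -- which never exceeds the value.
 export-ends : ∀ x {M S} → Rep M S → reg M x < 2 ^ w →
  Ends w (exportP x) S export-time (λ S' → regs S' 12 ≡ reg M x × addrs S' 2 ≡ addrs S 2 × Unchanged S S')
 export-ends x {M} {S} R v< = step const (step arith (step const (ends-map (λ (_ , v , a , u , _) → v , a , u)
  (loop-ends Inv 9 proj₁ body W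
   (wrap-W r1 , trans (wrap-bool false) (sym (halves-0 W (reg M x) (rr< x))) , refl , unchanged refl refl refl refl refl , ≤-refl)))))
  where
  open Rep R
  v = reg M x
  Inv : ℕ → State → Set
  Inv k S' = regs S' 4 ≡ k × regs S' 12 ≡ halves k v × addrs S' 2 ≡ addrs S 2 × Unchanged S S' × k ≤ W
  body : ∀ {k S'} → Inv (suc k) S' → Ends w (const 8 1 ⨾ arith 5 sub 4 8 ⨾ clear 0 ⨾ push 0 5 ⨾ load 6 (arrR x) 0 ⨾
       arith 12 add 12 12 ⨾ arith 12 add 12 6 ⨾ arith 4 sub 4 8) S' 9 (Inv k)
  body {k} {S'} (e4 , e12 , a2 , unchanged m≡ k0 k1 k2 k3 , k≤) =
   step const (step arith (step clear (step push (step load (step arith (step arith (ends arith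
    (e5 , val , a2 , unchanged m≡ k0 k1 k2 k3 , <⇒≤ k≤))))))))
   where
   e5 = wrap-pred e4 (<-trans k≤ W<)
   b≡ : mem S' (arrR x) (wrap w (regs S' 4 + 2 ^ w ∸ wrap w 1) ∷ []) ≡ bool (bit k v)
   b≡ = trans (cong₂ (λ h j → h (arrR x) (j ∷ [])) m≡ e5) (rr x k k≤)
   hk : bool (odd (halves k v)) + 2 * halves (suc k) v ≡ halves k v
   hk = trans (cong (λ h → bool (odd (halves k v)) + 2 * h) (halves-suc k v)) (sym (odd+2half (halves k v)))
   hk< : bool (odd (halves k v)) + 2 * halves (suc k) v < 2 ^ w
   hk< = ≤-<-trans (≤-reflexive hk) (≤-<-trans (halves≤ k v) v<)
   val : wrap w (wrap w (regs S' 12 + regs S' 12) + mem S' (arrR x) (wrap w (regs S' 4 + 2 ^ w ∸ wrap w 1) ∷ [])) ≡ halves k v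
   val = begin
    wrap w (wrap w (regs S' 12 + regs S' 12) + mem S' (arrR x) (wrap w (regs S' 4 + 2 ^ w ∸ wrap w 1) ∷ []))
     ≡⟨ cong₂ (λ a b → wrap w (wrap w a + b)) (trans (cong (λ h → h + h) e12) (dbl (halves (suc k) v)))
        (trans b≡ (cong bool (bit≡odd-halves k v))) ⟩
    wrap w (wrap w (2 * halves (suc k) v) + bool (odd (halves k v)))
     ≡⟨ cong (λ a → wrap w (a + bool (odd (halves k v)))) (wrap-id {w} (≤-<-trans (m≤n+m (2 * halves (suc k) v) (bool (odd (halves k v)))) hk<)) ⟩
    wrap w (2 * halves (suc k) v + bool (odd (halves k v)))
     ≡⟨ cong (wrap w) (trans (+-comm (2 * halves (suc k) v) _) hk) ⟩
    wrap w (halves k v) ≡⟨ wrap-id {w} (≤-<-trans (halves≤ k v) v<) ⟩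
    halves k v ∎
    where
    open ≡-Reasoning
    dbl : ∀ h → h + h ≡ 2 * h
    dbl = solve-∀

 rd0-time rd1-time : ℕ
 rd0-time = export-time + (1 + (1 + (2 + forBits-time 10)))
 rd1-time = export-time + (1 + (1 + (export-time + (1 + (3 + forBits-time 10)))))

 rd0-ends : ∀ z x {M S} → Rep M S → reg M x < 2 ^ w → inp 0 (reg M x ∷ []) < 2 ^ W →
  Ends w (rd0P z x) S rd0-time (Rep (setR z (inp 0 (reg M x ∷ [])) M))
 rd0-ends z x {M} {S} R x< v< = ends-⨾ (export-ends x R x<) λ { (e12 , a2 , unchanged m≡ k0 k1 k2 k3) →
   step clear (step push (step load (import-ends z (inp 0 (reg M x ∷ []))
    (rep-unchanged R (unchanged m≡ k0 k1 k2 k3))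
    (trans (cong₂ (λ h k → h 0 (k ∷ [])) m≡ e12) (Rep.in0 R _)) v< (inp< 0 _)))) }

 rd1-ends : ∀ z x y {M S} → Rep M S → reg M x < 2 ^ w → reg M y < 2 ^ w → inp 1 (reg M x ∷ reg M y ∷ []) < 2 ^ W →
  Ends w (rd1P z x y) S rd1-time (Rep (setR z (inp 1 (reg M x ∷ reg M y ∷ [])) M))
 rd1-ends z x y {M} {S} R x< y< v< = ends-⨾ (export-ends x R x<) λ { (e12 , a2 , unchanged m≡ k0 k1 k2 k3) →
   step clear (step push (ends-⨾ (export-ends y (rep-unchanged R (unchanged m≡ k0 k1 k2 k3)) y<)
    λ { (e12' , a2' , unchanged m≡' k0' k1' k2' k3') →
     step push (ends-≤ (+-monoˡ-≤ (forBits-time 10) (≤-reflexive (cong (suc ∘ length) (cong (_∷ʳ _) a2'))))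
      (step load (import-ends z (inp 1 (reg M x ∷ reg M y ∷ []))
      (rep-unchanged R (unchanged (trans m≡' m≡) (trans k0' k0) (trans k1' k1) (trans k2' k2) (trans k3' k3)))
      (trans (cong₂ (λ h k → h 1 k) (trans m≡' m≡) (trans (cong₂ _∷ʳ_ a2' e12') (cong (λ a → a ∷ reg M y ∷ []) e12)))
       (Rep.in1 R _)) v< (inp< 1 _)))) })) }

 -- One unit of time, large enough for every primitive on bit arrays. From here on programs are
 -- measured in units.
 κ : ℕ
 κ = 1 + forBits-time 13 + ld-time + st-time + (2 + forBits-time 10) + rd0-time + rd1-time

 -- Rules for programs on the machine with W-bit registers

 record Exec (P : Prog) (M : Mid) (k : ℕ) (M' : Mid) : Set where
  constructor exec
  field
   run : ∀ {S} → Rep M S → Ends w P S (k * κ) (Rep M')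

 -- The final state is part of the record and does not depend on a native state. Hence its
 -- postcondition is available even before any native run is considered.
 record Run (P : Prog) (M : Mid) (k : ℕ) (Q : Mid → Set) : Set where
  constructor _,,_
  field
   {M'} : Mid
   exec' : Exec P M k M'
   post : Q M'

 open Exec public

 private
  in-one : ∀ {P S b Q} → b ≤ κ → Ends w P S b Q → Ends w P S (1 * κ) Q
  in-one b≤ e = ends-≤ (≤≡ b≤ (sym (*-identityˡ κ))) e

  κ₁ : 1 ≤ κ
  κ₁ = s≤s z≤n

  within : ∀ {a b} rest → a ≤ b → a ≤ b + rest
  within rest a≤b = ≤-trans a≤b (m≤m+n _ rest)

  κ-scan : forBits-time 13 ≤ κ
  κ-scan = within rd1-time (within rd0-time (within (2 + forBits-time 10) (within st-time (within ld-time (n≤1+n _)))))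
  κ-ld : ld-time ≤ κ
  κ-ld = within rd1-time (within rd0-time (within (2 + forBits-time 10) (within st-time (m≤n+m ld-time (1 + forBits-time 13)))))
  κ-st : st-time ≤ κ
  κ-st = within rd1-time (within rd0-time (within (2 + forBits-time 10) (m≤n+m _ (1 + forBits-time 13 + ld-time))))
  κ-im : 2 + forBits-time 10 ≤ κ
  κ-im = within rd1-time (within rd0-time (m≤n+m _ (1 + forBits-time 13 + ld-time + st-time)))
  κ-rd0 : rd0-time ≤ κ
  κ-rd0 = within rd1-time (m≤n+m _ (1 + forBits-time 13 + ld-time + st-time + (2 + forBits-time 10)))
  κ-rd1 : rd1-time ≤ κ
  κ-rd1 = m≤n+m _ (1 + forBits-time 13 + ld-time + st-time + (2 + forBits-time 10) + rd0-time)

 rep-≗ : ∀ {M M' S} → (∀ r → reg M r ≡ reg M' r) → (∀ t x y → tbl M t x y ≡ tbl M' t x y) → flag M ≡ flag M' →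
     Rep M S → Rep M' S
 rep-≗ er et ef (rep rf r1 r2 r3 rr rr< rt rt< in0 in1) = rep (trans rf (cong bool ef)) r1 r2 r3
  (λ r i i< → trans (rr r i i<) (cong (bool ∘ bit i) (er r)))
  (λ r → subst (_< 2 ^ W) (er r) (rr< r))
  (λ t x y i x< y< i< → trans (rt t x y i x< y< i<) (cong (bool ∘ bit i) (et t x y)))
  (λ t x y → subst (_< 2 ^ W) (et t x y) (rt< t x y)) in0 in1

 exec-⨾ : ∀ {P Q M M' M'' k k'} → Exec P M k M' → Exec Q M' k' M'' → Exec (P ⨾ Q) M (k + k') M''
 exec-⨾ {k = k} {k'} e e' .run R =
  ends-≤ (≤-reflexive (sym (*-distribʳ-+ κ k k'))) (ends-⨾ (e .run R) (e' .run))

 exec-≤ : ∀ {P M M' k k'} → k ≤ k' → Exec P M k M' → Exec P M k' M'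
 exec-≤ k≤ e .run R = ends-≤ (*-monoˡ-≤ κ k≤) (e .run R)

 exec-≗ : ∀ {P M M' M'' k} → (∀ r → reg M' r ≡ reg M'' r) → (∀ t x y → tbl M' t x y ≡ tbl M'' t x y) → flag M' ≡ flag M'' →
      Exec P M k M' → Exec P M k M''
 exec-≗ er et ef e .run R = ends-map (rep-≗ er et ef) (e .run R)

 exec-skip : ∀ {M} → Exec skip M 1 M
 exec-skip .run R = in-one κ₁ (ends skip R)

 exec-setF : ∀ b {M} → Exec (setFP b) M 1 (setF b M)
 exec-setF b .run (rep rf r1 r2 r3 rr rr< rt rt< in0 in1) =
  in-one κ₁ (ends const (rep (wrap-bool b) r1 r2 r3 rr rr< rt rt< in0 in1))

 exec-scan : ∀ f z x y {M} → Exec (scanP f z x y) M 1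
  (setR z (transduce W f (flag M) (reg M x) (reg M y)) (setF (carryAt f (flag M) (reg M x) (reg M y) W) M))
 exec-scan f z x y .run R = in-one κ-scan (scan-ends f z x y R)

 private
  revalue : ∀ {P M M' k z v v'} → v ≡ v' → Exec P M k (setR z v M') → Exec P M k (setR z v' M')
  revalue refl e = e

  -- Every represented state has its registers below 2 ^ W, so this bound may be assumed instead of
  -- being carried as a premise.
  if-bounded : ∀ {P M k M'} → ((∀ r → reg M r < 2 ^ W) → Exec P M k M') → Exec P M k M'
  if-bounded f .run R = f (Rep.rr< R) .run R

 exec-scan-reset : ∀ f z x y {M v} → transduce W f (flag M) (reg M x) (reg M y) ≡ v →
  Exec (resetP (scanP f z x y)) M 2 (setR z v (setF false M))
 exec-scan-reset f z x y {M} e = revalue {M' = setF false M} {z = z} e (exec-⨾ (exec-scan f z x y) (exec-setF false))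

 exec-zero : ∀ z {M} → Exec (zeroP z) M 3 (setR z 0 (setF false M))
 exec-zero z {M} = exec-≤ (n≤1+n 2) (exec-scan-reset zeroT z z z (transduce-zero W (flag M) (reg M z) (reg M z)))

 exec-copy : ∀ z x {M} → Exec (copyP z x) M 3 (setR z (reg M x) (setF false M))
 exec-copy z x {M} = if-bounded λ b → exec-≤ (n≤1+n 2) (exec-scan-reset copyT z x x (transduce-copy W (flag M) (reg M x) (reg M x) (b x)))

 exec-add : ∀ z x y {M v} → reg M x + reg M y ≡ v → v < 2 ^ W → Exec (addP z x y) M 3 (setR z v (setF false M))
 exec-add z x y {M} refl s< = exec-⨾ (exec-setF false) (exec-scan-reset addT z x y
  (trans (transduce-add-exact W (reg M x) (reg M y) false (subst (_< 2 ^ W) (sym (+-identityʳ _)) s<)) (+-identityʳ _)))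

 exec-sub : ∀ z x y {M} → reg M y ≤ reg M x → Exec (subP z x y) M 3 (setR z (reg M x ∸ reg M y) (setF false M))
 exec-sub z x y {M} y≤ = if-bounded λ b → exec-⨾ (exec-setF false) (exec-scan-reset subT z x y
  (trans (transduce-sub-exact W false (reg M x) (reg M y) (≡≤ (+-identityʳ _) y≤) (b x)) (cong (reg M x ∸_) (+-identityʳ (reg M y)))))

 exec-bit : ∀ f z x y {M v} → transduce W f false (reg M x) (reg M y) ≡ v → Exec (bitP f z x y) M 3 (setR z v (setF false M))
 exec-bit f z x y e = exec-⨾ (exec-setF false) (exec-scan-reset f z x y e)

 exec-inc : ∀ x {M v} → reg M x ≡ v → suc v < 2 ^ W → Exec (incP x) M 3 (setR x (suc v) (setF false M))
 exec-inc x {M} refl s< = exec-⨾ (exec-setF true) (exec-scan-reset incT x x x (transduce-inc-exact W (reg M x) (reg M x) s<))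

 exec-dec : ∀ x {M v} → reg M x ≡ suc v → Exec (decP x) M 3 (setR x v (setF false M))
 exec-dec x {M} {v} e = if-bounded λ b → exec-⨾ (exec-setF true) (exec-scan-reset decT x x x
  (trans (cong (λ u → transduce W decT true u (reg M x)) e)
   (transduce-dec-exact W v (reg M x) (subst (_< 2 ^ W) e (b x)))))

 exec-dbl : ∀ x {M} → Exec (dblP x) M 3
  (setR x (transduce W addT false (reg M x) (reg M x)) (setF (carryAt addT false (reg M x) (reg M x) W) M))
 exec-dbl x = exec-≤ (n≤1+n 2) (exec-⨾ (exec-setF false) (exec-scan addT x x x))

 private
  exec-test : ∀ f x y {M b} → (∀ p q c → proj₁ (f p q c) ≡ false) →
   (reg M x < 2 ^ W → reg M y < 2 ^ W → carryAt f false (reg M x) (reg M y) W ≡ b) →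
   Exec (setFP false ⨾ scanP f 63 x y) M 3 (setR 63 0 (setF b M))
  exec-test f x y {M} out e = if-bounded λ b → exec-≤ (n≤1+n 2) (exec-⨾ (exec-setF false)
   (subst (λ c → Exec (scanP f 63 x y) (setF false M) 1 (setR 63 0 (setF c M))) (e (b x) (b y))
    (revalue {M' = setF (carryAt f false (reg M x) (reg M y) W) M} {z = 63}
     (trans (fromBits-cong W λ i _ → out (bit i (reg M x)) (bit i (reg M y)) (carryAt f false (reg M x) (reg M y) i)) (fromBits-false W))
     (exec-scan f 63 x y))))

 exec-lt : ∀ x y {M b} → (reg M x <ᵇ reg M y) ≡ b → Exec (ltP x y) M 3 (setR 63 0 (setF b M))
 exec-lt x y {M} refl = exec-test ltT x y (λ _ _ _ → refl) λ x< y< →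
  trans (carryAt-ltT false (reg M x) (reg M y) W) (trans (carryAt-sub W false (reg M x) (reg M y) x< y<) (cong (reg M x <ᵇ_) (+-identityʳ (reg M y))))

 exec-neq : ∀ x y {M b} → not (reg M x ≡ᵇ reg M y) ≡ b → Exec (neqP x y) M 3 (setR 63 0 (setF b M))
 exec-neq x y {M} refl = exec-test neqT x y (λ _ _ _ → refl) (carryAt-neq-≡ᵇ W (reg M x) (reg M y))

 exec-nz : ∀ x {M b} → not (reg M x ≡ᵇ 0) ≡ b → Exec (nzP x) M 3 (setR 63 0 (setF b M))
 exec-nz x {M} refl = exec-test nonzeroT x x (λ _ _ _ → refl) λ x< _ → carryAt-nonzero-≡ᵇ W (reg M x) (reg M x) x<

 ↦-↦ : ∀ {A : Set} (f : ℕ → A) i x y r → ((f [ i ↦ x ]) [ i ↦ y ]) r ≡ (f [ i ↦ y ]) r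
 ↦-↦ f i x y r with i ≡ᵇ r
 ... | true = refl
 ... | false = refl

 exec-const : ∀ z k {M} → k < 2 ^ W → Exec (constP z k) M (3 * suc k) (setR z k (setF false M))
 exec-const z zero k< = exec-zero z
 exec-const z (suc k) {M} k< = exec-≗ (↦-↦ (reg M) z k (suc k)) (λ _ _ _ → refl) refl
  (exec-≤ (≤-reflexive (trans (+-comm (3 * suc k) 3) (sym (*-suc 3 (suc k)))))
   (exec-⨾ (exec-const z k (<-trans (n<1+n k) k<)) (exec-inc z (↦-same (reg M) z) k<)))

 exec-ld : ∀ z t x y {M v} → z ≢ x → z ≢ y → tbl M t (reg M x) (reg M y) ≡ v → Exec (ldP z t x y) M 1 (setR z v M)
 exec-ld z t x y z≢x z≢y refl .run R = in-one κ-ld (ld-ends z t x y z≢x z≢y R)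

 exec-st : ∀ t x y v {M} → Exec (stP t x y v) M 1 (setT t (reg M x) (reg M y) (reg M v) M)
 exec-st t x y v .run R = in-one κ-st (st-ends t x y v R)

 exec-rd0 : ∀ z x {M i v} → reg M x ≡ i → i < 2 ^ w → inp 0 (i ∷ []) ≡ v → v < 2 ^ W → Exec (rd0P z x) M 1 (setR z v M)
 exec-rd0 z x refl i< refl v< .run R = in-one κ-rd0 (rd0-ends z x R i< v<)

 exec-rd1 : ∀ z x y {M i j v} → reg M x ≡ i → reg M y ≡ j → i < 2 ^ w → j < 2 ^ w →
  inp 1 (i ∷ j ∷ []) ≡ v → v < 2 ^ W → Exec (rd1P z x y) M 1 (setR z v M)
 exec-rd1 z x y refl refl i< j< refl v< .run R = in-one κ-rd1 (rd1-ends z x y R i< j< v<)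

 private
  exec-import : ∀ z q v {M} → v < 2 ^ W → v < 2 ^ w → (∀ {S} → Rep M S → regs (setReg 13 (wrap w 0) S) q ≡ v) →
   Exec (const 13 0 ⨾ arith 12 add q 13 ⨾ importP z) M 1 (setR z v M)
  exec-import z q v {M} v<W v< e .run {S} R@(rep rf r1 r2 r3 rr rr< rt rt< in0 in1) =
   in-one κ-im (step const (step arith (import-ends z v
    (rep rf r1 r2 r3 rr rr< rt rt< in0 in1)
    (trans (cong₂ (λ a b → wrap w (a + b)) (e R) (wrap-bool false)) (trans (cong (wrap w) (+-identityʳ v)) (wrap-id {w} v<))) v<W v<)))

 exec-importW : ∀ z {M} → W < 2 ^ W → Exec (importWP z) M 1 (setR z W M)
 exec-importW z W<W = exec-import z 1 W W<W W< Rep.r1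

 exec-importN : ∀ z {M} → N < 2 ^ W → Exec (importNP z) M 1 (setR z N M)
 exec-importN z N<W = exec-import z 2 N N<W N< Rep.r2

 exec-importd : ∀ z {M} → d < 2 ^ W → Exec (importdP z) M 1 (setR z d M)
 exec-importd z d<W = exec-import z 3 d d<W d< Rep.r3

 infixr 4 _,,_
 infixr 3 _▸_ _▸▸_

 _▸_ : ∀ {P P' M M' k k' Q} → Exec P M k M' → Run P' M' k' Q → Run (P ⨾ P') M (k + k') Q
 e ▸ (e' ,, q) = exec-⨾ e e' ,, q

 _▸▸_ : ∀ {P P' M k k' Q Q'} → Run P M k Q → (∀ {M'} → Q M' → Run P' M' k' Q') → Run (P ⨾ P') M (k + k') Q'
 (e ,, q) ▸▸ f with f q
 ... | e' ,, q' = exec-⨾ e e' ,, q'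

 run-≤ : ∀ {P M k k' Q} → k ≤ k' → Run P M k Q → Run P M k' Q
 run-≤ k≤ (e ,, q) = exec-≤ k≤ e ,, q

 run-map : ∀ {P M k} {Q Q' : Mid → Set} → (∀ {M'} → Q M' → Q' M') → Run P M k Q → Run P M k Q'
 run-map f (e ,, q) = e ,, f q

 run-if : ∀ {P P' M k Q} b → flag M ≡ b → (b ≡ true → Run P M k Q) → (b ≡ false → Run P' M k Q) →
      Run (flagP P P') M (suc k) Q
 run-if {P} {P'} {M} {k} true f h h' with h refl
 ... | e ,, q = (λ where .run R → lift R (e .run R)) ,, q
  where
  lift : ∀ {S M'} → Rep M S → Ends w P S (k * κ) (Rep M') → Ends w (flagP P P') S (suc k * κ) (Rep M')
  lift R (t , S' , r , t≤ , q) = suc t , S' , if-nz (λ z → case trans (sym z) (trans (Rep.r0 R) (cong bool f)) of λ ()) r , +-mono-≤ κ₁ t≤ , q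
 run-if {P} {P'} {M} {k} false f h h' with h' refl
 ... | e ,, q = (λ where .run R → lift R (e .run R)) ,, q
  where
  lift : ∀ {S M'} → Rep M S → Ends w P' S (k * κ) (Rep M') → Ends w (flagP P P') S (suc k * κ) (Rep M')
  lift R (t , S' , r , t≤ , q) = suc t , S' , if-z (trans (Rep.r0 R) (cong bool f)) r , +-mono-≤ κ₁ t≤ , q

 run-done : ∀ {P M} {Q : Mid → Set} → flag M ≡ false → Q M → Run (whilenz 0 loop P) M 1 Q
 run-done f q = (λ where .run R → in-one κ₁ (ends (done (trans (Rep.r0 R) (cong bool f))) R)) ,, q

 run-loop : ∀ {P M k k' Q Q'} → flag M ≡ true → Run P M k Q → (∀ {M'} → Q M' → Run (whilenz 0 loop P) M' k' Q') →
       Run (whilenz 0 loop P) M (suc (k + k')) Q'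
 run-loop {P} {M} {k} {k'} f (e ,, q) h with h q
 ... | e' ,, q' = (λ where .run R → lift R (e .run R) (e' .run)) ,, q'
  where
  lift : ∀ {S M' M''} → Rep M S → Ends w P S (k * κ) (Rep M') → (∀ {S} → Rep M' S → Ends w (whilenz 0 loop P) S (k' * κ) (Rep M'')) →
      Ends w (whilenz 0 loop P) S (suc (k + k') * κ) (Rep M'')
  lift R (t , S' , r , t≤ , R') g with g R'
  ... | t' , S'' , r' , t'≤ , R'' = suc (t + t') , S'' , loop (λ z → case trans (sym z) (trans (Rep.r0 R) (cong bool f)) of λ ()) r r'
   , +-mono-≤ κ₁ (≤≡ (+-mono-≤ t≤ t'≤) (sym (*-distribʳ-+ κ k k'))) , R''

 -- The cost c is chosen by each iteration, and the invariant sees their sum τ. This is what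
 -- amortized operations need, as their single costs have no useful common bound.
 run-for-τ : ∀ {i lim P M n} (Inv : ℕ → ℕ → Mid → Set) → n < 2 ^ W → i ≢ lim → 63 ≢ i → 63 ≢ lim →
  (∀ {k τ M b} → Inv k τ M → Inv k τ (setR 63 0 (setF b M))) →
  (∀ {k τ M v} → Inv k τ M → Inv k τ (setR i v (setF false M))) →
  (∀ {k τ M} → k < n → reg M i ≡ k → reg M lim ≡ n → Inv k τ M →
    ∃[ c ] Run P M c (λ M' → Inv (suc k) (τ + c) M' × reg M' i ≡ k × reg M' lim ≡ n)) →
  Inv 0 0 M → reg M lim ≡ n →
  ∃[ τ ] Run (forP i lim P) M (7 + (τ + n * 7)) (Inv n τ)
 run-for-τ {i} {lim} {P} {M} {n} Inv n< i≢lim t≢i t≢lim stab stabi body inv elim =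
  let M₁ = setR i 0 (setF false M)
      e₁ : reg M₁ i ≡ 0
      e₁ = ↦-same (reg M) i
      e₂ : reg M₁ lim ≡ n
      e₂ = trans (↦-other (reg M) i≢lim) elim
      δ , run = go n 0 0 refl refl (trans (↦-other (reg M₁) t≢i) e₁) (trans (↦-other (reg M₁) t≢lim) e₂) (stab (stabi inv))
  in δ , (exec-zero i ▸ exec-lt i lim (cong₂ _<ᵇ_ e₁ e₂) ▸ run)
  where
  cost : ∀ c δ m → suc (c + (3 + 3) + (1 + (δ + m))) ≡ 1 + ((c + δ) + (7 + m))
  cost = solve-∀
  go : ∀ m k τ {M} → k + m ≡ n → flag M ≡ (k <ᵇ n) → reg M i ≡ k → reg M lim ≡ n → Inv k τ M →
     ∃[ δ ] Run (whilenz 0 loop (P ⨾ incP i ⨾ ltP i lim)) M (1 + (δ + m * 7)) (Inv n (τ + δ))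
  go zero k τ {M} k+m f ei el inv with refl ← trans (sym (+-identityʳ k)) k+m =
   0 , run-done (trans f (<ᵇ-false (≤-refl {k}))) (subst (λ t → Inv k t M) (sym (+-identityʳ τ)) inv)
  go (suc m) k τ {M} k+m f ei el inv = iterate (body k<n ei el inv)
   where
   k<n : k < n
   k<n = subst (k <_) k+m (≤≡ (s≤s (m≤m+n k m)) (sym (+-suc k m)))
   iterate : ∃[ c ] Run P M c (λ M' → Inv (suc k) (τ + c) M' × reg M' i ≡ k × reg M' lim ≡ n) →
        ∃[ δ ] Run (whilenz 0 loop (P ⨾ incP i ⨾ ltP i lim)) M (1 + (δ + suc m * 7)) (Inv n (τ + δ))
   iterate (c , _,,_ {M₁} e (inv' , ei' , el')) =
    c + proj₁ rest , run-≤ (≤-reflexive (cost c (proj₁ rest) (m * 7)))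
     (run-loop {Q = _≡ M₃} (trans f (<ᵇ-true k<n))
      (exec-⨾ e (exec-⨾ (exec-inc i ei' (≤-<-trans k<n n<)) (exec-lt i lim (cong₂ _<ᵇ_ e₁ e₂))) ,, refl)
      λ { refl → run-map (λ {M'} → subst (λ t → Inv n t M') (+-assoc τ c (proj₁ rest))) (proj₂ rest) })
    where
    M₂ M₃ : Mid
    M₂ = setR i (suc k) (setF false M₁)
    M₃ = setR 63 0 (setF (suc k <ᵇ n) M₂)
    e₁ : reg M₂ i ≡ suc k
    e₁ = ↦-same (reg M₁) i
    e₂ : reg M₂ lim ≡ n
    e₂ = trans (↦-other (reg M₁) i≢lim) el'
    rest = go m (suc k) (τ + c) {M₃} (trans (sym (+-suc k m)) k+m) refl
     (trans (↦-other (reg M₂) t≢i) e₁) (trans (↦-other (reg M₂) t≢lim) e₂) (stab (stabi inv'))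

 run-for : ∀ {i lim P M n} c (Inv : ℕ → Mid → Set) → n < 2 ^ W → i ≢ lim → 63 ≢ i → 63 ≢ lim →
  (∀ {k M b} → Inv k M → Inv k (setR 63 0 (setF b M))) →
  (∀ {k M v} → Inv k M → Inv k (setR i v (setF false M))) →
  (∀ {k M} → k < n → reg M i ≡ k → reg M lim ≡ n → Inv k M →
    Run P M c (λ M' → Inv (suc k) M' × reg M' i ≡ k × reg M' lim ≡ n)) →
  Inv 0 M → reg M lim ≡ n →
  Run (forP i lim P) M (7 + n * (c + 7)) (Inv n)
 run-for {n = n} c Inv n< i≢ t≢i t≢l stab stabi body inv el
  with run-for-τ (λ k τ M → Inv k M × τ ≡ k * c) n< i≢ t≢i t≢l (λ (i , t) → stab i , t) (λ (i , t) → stabi i , t)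
      (λ k< e e' (i , t) → c , run-map (λ (i' , r) → (i' , trans (cong (_+ c) t) (+-comm _ c)) , r) (body k< e e' i)) (inv , refl) el
 ... | τ , run = run-≤ (≤-reflexive (cong (7 +_) (trans (cong (_+ n * 7) (proj₂ (Run.post run))) (sym (*-distribˡ-+ n c 7))))) (run-map proj₁ run)

 -- Multiplication, division and powers

 -- While x is shifted out of the register xx, its leading part hi has
 -- already been processed.
 Shifted : ℕ → ℕ → ℕ → ℕ → Set
 Shifted x j hi xx = x * 2 ^ j ≡ hi * 2 ^ W + xx

 shifted-dbl : ∀ {x j hi xx} → xx < 2 ^ W → Shifted x j hi xx →
  Shifted x (suc j) (2 * hi + bool (carryAt addT false xx xx W)) (transduce W addT false xx xx)
 shifted-dbl {x} {j} {hi} {xx} xx< e = begin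
  x * (2 * 2 ^ j) ≡⟨ l₁ x (2 ^ j) ⟩
  2 * (x * 2 ^ j) ≡⟨ cong (2 *_) e ⟩
  2 * (hi * 2 ^ W + xx) ≡⟨ l₂ hi (2 ^ W) xx ⟩
  2 * hi * 2 ^ W + (xx + xx + 0) ≡⟨ cong (2 * hi * 2 ^ W +_) (sym (transduce-add W false xx xx xx< xx<)) ⟩
  2 * hi * 2 ^ W + (v + 2 ^ W * b) ≡⟨ l₃ (2 * hi) (2 ^ W) v b ⟩
  (2 * hi + b) * 2 ^ W + v ∎
  where
  open ≡-Reasoning
  v = transduce W addT false xx xx
  b = bool (carryAt addT false xx xx W)
  l₁ : ∀ x y → x * (2 * y) ≡ 2 * (x * y)
  l₁ = solve-∀
  l₂ : ∀ h p x → 2 * (h * p + x) ≡ 2 * h * p + (x + x + 0)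
  l₂ = solve-∀
  l₃ : ∀ h p v b → h * p + (v + p * b) ≡ (h + b) * p + v
  l₃ = solve-∀

 mul-time : ℕ
 mul-time = 6 + (7 + W * (10 + 7))

 -- Double and add, from the leading digit of u: the accumulator is hi times v for the leading part
 -- hi of u. As hi ≤ u, it never exceeds the final product.
 run-mul : ∀ {M} x y {u v} → T (x <ᵇ 50) → T (y <ᵇ 50) → reg M 30 ≡ W → W < 2 ^ W →
  reg M x ≡ u → reg M y ≡ v → u < 2 ^ W → u * v < 2 ^ W →
  Run (mulP x y) M mul-time (λ M' → reg M' 50 ≡ u * v × Frame 50 M M')
 run-mul {M} x y {u} {v} x<50 y<50 eW W<W ex ey u< uv< =
  exec-zero 50 ▸ exec-copy 51 x ▸ run-map (λ { (hi , e50 , sh , xx< , f) →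
    trans e50 (cong (_* v) (quotient-≡ {W} {u} {hi} sh xx<)) , f })
   (run-for 10 Inv W<W (λ ()) (λ ()) (λ ())
    (λ (hi , a , b , c , f) → hi , a , b , c , frame-setR {50} 63 tt f)
    (λ (hi , a , b , c , f) → hi , a , b , c , frame-setR {50} 52 tt f)
    body
    (0 , refl , trans (*-identityʳ u) (sym (keep50 ex)) , subst (_< 2 ^ W) (sym (keep50 ex)) u< , f₀)
    (trans (fr f₀ 30 tt) eW))
  where
  M₁ = setR 51 (reg (setR 50 0 (setF false M)) x) (setF false (setR 50 0 (setF false M)))
  f₀ : Frame 50 M M₁
  f₀ = frame-setR {50} 51 tt (frame-setR {50} 50 tt frame-refl)
  keep50 : ∀ {a} → reg M x ≡ a → reg (setR 50 0 M) x ≡ a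
  keep50 e = trans (fr (frame-setR {50} {reg M} {tbl M} 50 {0} tt frame-refl) x x<50) e
  Inv : ℕ → Mid → Set
  Inv j M' = ∃[ hi ] (reg M' 50 ≡ hi * v × Shifted u j hi (reg M' 51) × reg M' 51 < 2 ^ W × Frame 50 M M')
  l₁ : ∀ h v → h * v + h * v ≡ (2 * h + 0) * v
  l₁ = solve-∀
  l₂ : ∀ h v → (2 * h + 0) * v + v ≡ (2 * h + 1) * v
  l₂ = solve-∀
  body : ∀ {k M'} → k < W → reg M' 52 ≡ k → reg M' 30 ≡ W → Inv k M' →
   Run (addP 50 50 50 ⨾ dblP 51 ⨾ flagP (addP 50 50 y) skip) M' 10 (λ M'' → Inv (suc k) M'' × reg M'' 52 ≡ k × reg M'' 30 ≡ W)
  body {k} {M'} k< ek el (hi , e50 , sh , xx< , f) =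
   exec-add 50 50 50 (trans (cong₂ _+_ e50 e50) (l₁ hi v)) (le 0 z≤n) ▸ exec-dbl 51 ▸
   run-if b refl
    (λ b≡ → exec-add 50 50 y (trans (cong ((2 * hi + 0) * v +_) (trans (fr f' y y<50) ey)) (l₂ hi v)) (le 1 (subst (λ b → 1 ≤ bool b) (sym b≡) ≤-refl)) ,,
        (2 * hi + 1 , refl , subst (λ b → Shifted u (suc k) (2 * hi + bool b) xx') b≡ sh' , fromBits< W _ , frame-setR {50} 50 tt f') , ek , el)
    (λ b≡ → exec-≤ (s≤s z≤n) exec-skip ,,
        (2 * hi + 0 , refl , subst (λ b → Shifted u (suc k) (2 * hi + bool b) xx') b≡ sh' , fromBits< W _ , f') , ek , el)
   where
   xx = reg M' 51
   xx' = transduce W addT false xx xx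
   b = carryAt addT false xx xx W
   sh' = shifted-dbl {u} {k} {hi} xx< sh
   le : ∀ c → c ≤ bool b → (2 * hi + c) * v < 2 ^ W
   le c c≤ = ≤-<-trans (*-monoˡ-≤ v (≤-trans (+-monoʳ-≤ (2 * hi) c≤) (quotient-≤ {W} {suc k} {u} sh' k<))) uv<
   f' : Frame 50 M (setR 51 (transduce W addT false xx xx) (setF b (setR 50 ((2 * hi + 0) * v) (setF false M'))))
   f' = frame-setR {50} 51 tt (frame-setR {50} 50 tt f)

 div-time : ℕ
 div-time = 9 + (7 + W * (23 + 7))

 -- Long division: the leading part of u is kept as quotient times v plus remainder. Before the
 -- comparison the doubled remainder can come close to 2 v, whence the condition 2 v ≤ 2 ^ W.
 run-div : ∀ {M} x y {u v} .{{_ : NonZero v}} → T (x <ᵇ 50) → T (y <ᵇ 50) → reg M 30 ≡ W → W < 2 ^ W →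
  reg M x ≡ u → reg M y ≡ v → u < 2 ^ W → 2 * v ≤ 2 ^ W →
  Run (divP x y) M div-time (λ M' → reg M' 50 ≡ u / v × reg M' 51 ≡ u % v × Frame 50 M M')
 run-div {M} x y {u} {v} x<50 y<50 eW W<W ex ey u< 2v≤ =
  exec-zero 50 ▸ exec-zero 51 ▸ exec-copy 52 x ▸ run-map (λ {M'} → finish {M'})
   (run-for 23 Inv W<W (λ ()) (λ ()) (λ ())
    (λ (hi , sh , e , r< , xx< , f) → hi , sh , e , r< , xx< , frame-setR {50} 63 tt f)
    (λ (hi , sh , e , r< , xx< , f) → hi , sh , e , r< , xx< , frame-setR {50} 53 tt f)
    body
    (0 , trans (*-identityʳ u) (sym ex₁) , refl , >-nonZero⁻¹ v , subst (_< 2 ^ W) (sym ex₁) u< , f₀)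
    (trans (fr f₀ 30 tt) eW))
  where
  ex₁ : reg (setR 51 0 (setR 50 0 M)) x ≡ u
  ex₁ = trans (fr (frame-setR {50} {reg M [ 50 ↦ 0 ]} {tbl M} 51 {0} tt frame-refl) x x<50)
      (trans (fr (frame-setR {50} {reg M} {tbl M} 50 {0} tt frame-refl) x x<50) ex)
  f₀ : Frame 50 M (setR 52 (reg (setR 51 0 (setR 50 0 M)) x) (setR 51 0 (setR 50 0 M)))
  f₀ = frame-setR {50} 52 tt (frame-setR {50} 51 tt (frame-setR {50} 50 tt frame-refl))
  Inv : ℕ → Mid → Set
  Inv j M' = ∃[ hi ] (Shifted u j hi (reg M' 52) × hi ≡ reg M' 50 * v + reg M' 51 × reg M' 51 < v × reg M' 52 < 2 ^ W × Frame 50 M M')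
  finish : ∀ {M'} → Inv W M' → reg M' 50 ≡ u / v × reg M' 51 ≡ u % v × Frame 50 M M'
  finish {M'} (hi , sh , e , r< , xx< , f) with divMod-unique {u} {reg M' 50} {reg M' 51} {v} (trans (sym (quotient-≡ {W} {u} {hi} sh xx<)) e) r<
  ... | q≡ , r≡ = q≡ , r≡ , f
  body : ∀ {k M'} → k < W → reg M' 53 ≡ k → reg M' 30 ≡ W → Inv k M' →
   Run (addP 50 50 50 ⨾ addP 51 51 51 ⨾ dblP 52 ⨾ flagP (incP 51) skip ⨾ ltP 51 y ⨾ flagP skip (subP 51 51 y ⨾ incP 50))
    M' 23 (λ M'' → Inv (suc k) M'' × reg M'' 53 ≡ k × reg M'' 30 ≡ W)
  body {k} {M'} k< ek el (hi , sh , e , r< , xx< , f) =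
   exec-add 50 50 50 refl (≤-<-trans (≤-trans q₁≤ hi'≤) u<) ▸
   exec-add 51 51 51 refl (≤-<-trans (m≤m+n (r + r) (bool b)) r₁<2^W) ▸
   exec-dbl 52 ▸
   (run-if {Q = Mid₁} b refl
    (λ b≡ → exec-inc 51 refl (subst (_< 2 ^ W) (inc≡ b≡) r₁<2^W) ,,
        (refl , sym (inc≡ b≡) , refl , frame-setR {50} 51 tt f' , ek , el))
    (λ b≡ → exec-≤ (s≤s z≤n) exec-skip ,, (refl , sym (skip≡ b≡) , refl , f' , ek , el)) ▸▸
   λ { {M₁} (e50 , e51 , e52 , f₁ , ek₁ , el₁) →
    let ey₁ = trans (fr f₁ y y<50) ey in
    exec-lt 51 y (cong₂ _<ᵇ_ e51 ey₁) ▸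
    run-if (r₁ <ᵇ v) refl
     (λ l → exec-≤ (s≤s z≤n) exec-skip ,,
      ((hi' , subst (Shifted u (suc k) hi') (sym e52) sh' , trans hi≡ (sym (cong₂ (λ q r → q * v + r) e50 e51))
       , subst (_< v) (sym e51) (<ᵇ⇒< r₁ v (subst T (sym l) tt)) , subst (_< 2 ^ W) (sym e52) (fromBits< W _)
       , frame-setR {50} 63 tt f₁) , ek₁ , el₁))
     (λ l → let v≤ = ≮⇒≥ λ lt' → subst T l (<⇒<ᵇ lt')
                ey₂ = trans (fr (frame-setR {50} 63 {0} tt f₁) y y<50) ey in
      exec-sub 51 51 y (subst₂ _≤_ (sym ey₂) (sym e51) v≤) ▸
      (exec-inc 50 e50 (≤-<-trans (≤-trans (q₂≤ v≤) hi'≤) u<) ,,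
      ((hi' , subst (Shifted u (suc k) hi') (sym e52) sh'
       , trans (hi≡₂ v≤) (cong (suc q₁ * v +_) (sym (cong₂ _∸_ e51 ey₂)))
       , subst (_< v) (sym (cong₂ _∸_ e51 ey₂)) (+-cancelʳ-< v _ v (subst₂ _<_ (sym (m∸n+n≡m v≤)) (l₀ v) r₁<))
       , subst (_< 2 ^ W) (sym e52) (fromBits< W _)
       , frame-setR {50} 50 tt (frame-setR {50} 51 tt (frame-setR {50} 63 tt f₁))) , ek₁ , el₁))) })
   where
   q = reg M' 50
   r = reg M' 51
   xx = reg M' 52
   b = carryAt addT false xx xx W
   xx' = transduce W addT false xx xx
   sh' = shifted-dbl {u} {k} {hi} xx< sh
   hi' = 2 * hi + bool b
   q₁ = q + q
   r₁ = r + r + bool b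
   l₀ : ∀ v → 2 * v ≡ v + v
   l₀ = solve-∀
   hi≡ : hi' ≡ q₁ * v + r₁
   hi≡ = trans (cong (λ h → 2 * h + bool b) e) (l q v r (bool b))
    where
    l : ∀ q v r b → 2 * (q * v + r) + b ≡ (q + q) * v + (r + r + b)
    l = solve-∀
   hi'≤ : hi' ≤ u
   hi'≤ = quotient-≤ {W} {suc k} {u} sh' k<
   r₁< : r₁ < 2 * v
   r₁< = begin-strict
    r + r + bool b ≤⟨ +-monoʳ-≤ (r + r) (s≤s⁻¹ (bool<2 b)) ⟩
    r + r + 1 <⟨ ≤-reflexive (l r) ⟩
    suc r + suc r ≤⟨ +-mono-≤ r< r< ⟩
    v + v ≡⟨ sym (l₀ v) ⟩
    2 * v ∎
    where
    open ≤-Reasoning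
    l : ∀ r → suc (r + r + 1) ≡ suc r + suc r
    l = solve-∀
   r₁<2^W : r₁ < 2 ^ W
   r₁<2^W = <-≤-trans r₁< 2v≤
   q₁≤ : q₁ ≤ hi'
   q₁≤ = ≤-trans (m≤m*n q₁ v) (≤≡ (m≤m+n (q₁ * v) r₁) (sym hi≡))
   hi≡₂ : v ≤ r₁ → hi' ≡ suc q₁ * v + (r₁ ∸ v)
   hi≡₂ v≤ = trans hi≡ (trans (cong (q₁ * v +_) (sym (m+[n∸m]≡n v≤))) (l (q₁ * v) v (r₁ ∸ v)))
    where
    l : ∀ a v s → a + (v + s) ≡ (v + a) + s
    l = solve-∀
   q₂≤ : v ≤ r₁ → suc q₁ ≤ hi'
   q₂≤ v≤ = ≤-trans (m≤m*n (suc q₁) v) (≤≡ (m≤m+n (suc q₁ * v) (r₁ ∸ v)) (sym (hi≡₂ v≤)))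
   inc≡ : b ≡ true → r₁ ≡ suc (r + r)
   inc≡ b≡ = trans (cong (λ b → r + r + bool b) b≡) (+-comm (r + r) 1)
   skip≡ : b ≡ false → r₁ ≡ r + r
   skip≡ b≡ = trans (cong (λ b → r + r + bool b) b≡) (+-identityʳ (r + r))
   Mid₁ : Mid → Set
   Mid₁ M₁ = reg M₁ 50 ≡ q₁ × reg M₁ 51 ≡ r₁ × reg M₁ 52 ≡ xx' × Frame 50 M M₁ × reg M₁ 53 ≡ k × reg M₁ 30 ≡ W
   f' : Frame 50 M (setR 52 xx' (setR 51 (r + r) (setR 50 (q + q) M')))
   f' = frame-setR {50} 52 tt (frame-setR {50} 51 tt (frame-setR {50} 50 tt f))

 pow-time : ℕ → ℕ
 pow-time n = 6 + (7 + n * (7 + 7))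

 run-pow : ∀ {M} y lim {v n} → T (y <ᵇ 50) → T (lim <ᵇ 50) → reg M y ≡ v → reg M lim ≡ n → n < 2 ^ W → 1 < 2 ^ W →
  2 ^ (n ⊓ v) < 2 ^ W →
  Run (powP y lim) M (pow-time n) (λ M' → reg M' 50 ≡ 2 ^ (n ⊓ v) × Frame 50 M M')
 run-pow {M} y lim {v} {n} y<50 l<50 ey el n< 1<W p< =
  exec-const 50 1 1<W ▸
   run-for 7 Inv n< (λ { refl → l<50 }) (λ ()) (λ { refl → l<50 })
    (λ (e , f) → e , frame-setR {50} 63 tt f)
    (λ (e , f) → e , frame-setR {50} 53 tt f)
    body (refl , f₀) (trans (fr f₀ lim l<50) el)
  where
  f₀ : Frame 50 M (setR 50 1 M)
  f₀ = frame-setR {50} 50 tt frame-refl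
  Inv : ℕ → Mid → Set
  Inv j M' = reg M' 50 ≡ 2 ^ (j ⊓ v) × Frame 50 M M'
  body : ∀ {k M'} → k < n → reg M' 53 ≡ k → reg M' lim ≡ n → Inv k M' →
   Run (ltP 53 y ⨾ flagP (addP 50 50 50) skip) M' 7 (λ M'' → Inv (suc k) M'' × reg M'' 53 ≡ k × reg M'' lim ≡ n)
  body {k} {M'} k< ek _ (e , f) = exec-lt 53 y (cong₂ _<ᵇ_ ek (trans (fr f y y<50) ey)) ▸
   run-if (k <ᵇ v) refl
    (λ l → exec-add 50 50 50 (trans (cong₂ _+_ e e) (dbl l)) (≤-<-trans (^-monoʳ-≤ 2 (⊓-monoˡ-≤ v k<)) p<) ,,
        (refl , frame-setR {50} 50 tt (frame-setR {50} 63 tt f)) , ek , trans (fr (frame-setR {50} 50 tt (frame-setR {50} 63 tt f)) lim l<50) el)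
    (λ l → exec-≤ (s≤s z≤n) exec-skip ,, (trans e (cong (2 ^_) (trans (m≥n⇒m⊓n≡n (v≤ l)) (sym (m≥n⇒m⊓n≡n (m≤n⇒m≤1+n (v≤ l))))))
        , frame-setR {50} 63 tt f) , ek , trans (fr (frame-setR {50} 63 tt f) lim l<50) el)
   where
   v≤ : (k <ᵇ v) ≡ false → v ≤ k
   v≤ l = ≮⇒≥ λ lt' → subst T l (<⇒<ᵇ lt')
   dbl : (k <ᵇ v) ≡ true → 2 ^ (k ⊓ v) + 2 ^ (k ⊓ v) ≡ 2 ^ (suc k ⊓ v)
   dbl l = let k<v = <ᵇ⇒< k v (subst T (sym l) tt) in
    trans (cong (λ z → 2 ^ z + 2 ^ z) (m≤n⇒m⊓n≡m (<⇒≤ k<v))) (trans (cong (2 ^ k +_) (sym (+-identityʳ (2 ^ k)))) (cong (2 ^_) (sym (m≤n⇒m⊓n≡m k<v))))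

 -- Operations on V-bit words

 record Constants (V : ℕ) (M : Mid) : Set where
  constructor constants
  field
   c30 : reg M 30 ≡ W
   c31 : reg M 31 ≡ 0
   c32 : reg M 32 ≡ 2 ^ V
   c33 : reg M 33 ≡ V

 constants-frame : ∀ {V M M'} b → 34 ≤ b → Frame b M M' → Constants V M → Constants V M'
 constants-frame b 34≤ f (constants a b' c d) = constants (trans (fr f' 30 tt) a) (trans (fr f' 31 tt) b') (trans (fr f' 32 tt) c) (trans (fr f' 33 tt) d)
  where f' = frame-weaken 34≤ f

 exact-time eval-time : ℕ
 exact-time = 10 + (mul-time + (div-time + pow-time W))
 eval-time = exact-time + (div-time + 3)

 -- Results are computed exactly and reduced modulo 2 ^ V afterwards. Registers of more than 2 V
 -- digits hold every unreduced result, in particular a product of two words.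
 module _ {V : ℕ} (2V≤ : suc (V + V) ≤ W) (W<W : W < 2 ^ W) where

  private
   P = 2 ^ V

   instance
    P≢0 : NonZero P
    P≢0 = m^n≢0 2 V

  2P≤ : 2 * P ≤ 2 ^ W
  2P≤ = ^-monoʳ-≤ 2 (≤-trans (s≤s (m≤m+n V V)) 2V≤)

  P≤ : P ≤ 2 ^ W
  P≤ = ≤-trans (m≤m+n P _) 2P≤

  P<2^W : P < 2 ^ W
  P<2^W = ^-monoʳ-< 2 ≤-refl (≤-trans (s≤s (m≤m+n V V)) 2V≤)

  PP≤ : P * P ≤ 2 ^ W
  PP≤ = ≡≤ (sym (^-distribˡ-+-* 2 V V)) (^-monoʳ-≤ 2 (≤-trans (n≤1+n _) 2V≤))

  1<2^W : 1 < 2 ^ W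
  1<2^W = ≤-trans (≤-trans (*-monoʳ-≤ 2 (0<2^ V)) ≤-refl) 2P≤

  <2P : ∀ {a b} → a < P → b ≤ P → a + b < 2 ^ W
  <2P {a} {b} a< b≤ = <-≤-trans (+-mono-<-≤ a< b≤) (≡≤ (cong (P +_) (sym (+-identityʳ P))) 2P≤)

  *<2^W : ∀ {a b} → a < P → b ≤ P → a * b < 2 ^ W
  *<2^W {a} {b} a< b≤ = <-≤-trans (≤-<-trans (*-monoʳ-≤ a b≤) (*-monoˡ-< P a<)) PP≤

  run-mod : ∀ {M e} → Constants V M → reg M 42 ≡ e → e < 2 ^ W →
   Run modP M (div-time + 3) (λ M' → reg M' 42 ≡ wrap V e × Frame 42 M M')
  run-mod c e42 e< = run-div 42 32 tt tt (c30 c) W<W e42 (c32 c) e< 2P≤ ▸▸ λ (_ , r , f) →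
   exec-copy 42 51 ,, (r , frame-setR {42} 42 tt (frame-weaken (m≤m+n 42 8) f))
   where open Constants

  exact : Op → ℕ → ℕ → ℕ
  exact add x y = x + y
  exact sub x y = (x + P) ∸ y
  exact mul x y = x * y
  exact div x y = quot x y
  exact and x y = bitwise _⊓_ V x y
  exact or x y = bitwise _⊔_ V x y
  exact xor x y = bitwise ∣_-_∣ V x y
  exact shl x y = x * 2 ^ (V ⊓ y)
  exact shr x y = quot x (2 ^ y)
  exact lt x y = bool (x <ᵇ y)
  exact eq x y = bool (x ≡ᵇ y)

  bitwise< : ∀ {f g} → BitwiseLike f g → ∀ v x y → bitwise g v x y < 2 ^ v
  bitwise< {f} {g} bl v x y = go v x y
   where
   go : ∀ v x y → bitwise g v x y < 2 ^ v
   go zero x y = s≤s z≤n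
   go (suc v) x y rewrite %2≡odd x | %2≡odd y | sym (bl (odd x) (odd y) false) with proj₁ (f (odd x) (odd y) false)
   ... | true = <-≤-trans (s≤s (s≤s (≤-reflexive refl))) (≡≤ (l (bitwise g v (x / 2) (y / 2))) (*-monoʳ-≤ 2 (go v (x / 2) (y / 2))))
    where
    l : ∀ n → suc (suc (2 * n)) ≡ 2 * suc n
    l = solve-∀
   ... | false = *-monoʳ-< 2 (go v (x / 2) (y / 2))

  evalOp-exact : ∀ o {x y} → x < P → y < P → evalOp V o x y ≡ wrap V (exact o x y)
  evalOp-exact add _ _ = refl
  evalOp-exact sub _ _ = refl
  evalOp-exact mul _ _ = refl
  evalOp-exact div _ _ = refl
  evalOp-exact and {x} {y} _ _ = sym (wrap-id {V} (bitwise< {andT} and-like V x y))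
  evalOp-exact or {x} {y} _ _ = sym (wrap-id {V} (bitwise< {orT} or-like V x y))
  evalOp-exact xor {x} {y} _ _ = sym (wrap-id {V} (bitwise< {xorT} xor-like V x y))
  evalOp-exact shl {x} {y} _ _ = sym (wrap-shl V x y)
  evalOp-exact shr _ _ = refl
  evalOp-exact lt _ _ = refl
  evalOp-exact eq _ _ = refl

  private
   V≤W : V ≤ W
   V≤W = ≤-trans (m≤m+n V V) (≤-trans (n≤1+n _) 2V≤)

   quot≤ : ∀ x y → quot x y ≤ x
   quot≤ x zero = z≤n
   quot≤ x (suc y) = m/n≤m x (suc y)

   bool<2^W : ∀ b → bool b < 2 ^ W
   bool<2^W true = 1<2^W
   bool<2^W false = <-trans (s≤s z≤n) 1<2^W

   pow-mono : pow-time V ≤ pow-time W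
   pow-mono = +-monoʳ-≤ 13 (*-monoˡ-≤ 14 V≤W)

  exact< : ∀ o {x y} → x < P → y < P → exact o x y < 2 ^ W
  exact< add x< y< = <2P x< (<⇒≤ y<)
  exact< sub {x} {y} x< y< = ≤-<-trans (m∸n≤m (x + P) y) (<2P x< ≤-refl)
  exact< mul x< y< = *<2^W x< (<⇒≤ y<)
  exact< div {x} {y} x< y< = <-≤-trans (≤-<-trans (quot≤ x y) x<) P≤
  exact< and {x} {y} x< y< = <-≤-trans (bitwise< {andT} and-like V x y) P≤
  exact< or {x} {y} x< y< = <-≤-trans (bitwise< {orT} or-like V x y) P≤
  exact< xor {x} {y} x< y< = <-≤-trans (bitwise< {xorT} xor-like V x y) P≤
  exact< shl {x} {y} x< y< = *<2^W x< (^-monoʳ-≤ 2 (m⊓n≤m V y))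
  exact< shr {x} {y} x< y< = <-≤-trans (≤-<-trans (quot≤ x (2 ^ y)) x<) P≤
  exact< lt {x} {y} x< y< = bool<2^W (x <ᵇ y)
  exact< eq {x} {y} x< y< = bool<2^W (x ≡ᵇ y)

  run-exact : ∀ o {M x y} → Constants V M → reg M 40 ≡ x → reg M 41 ≡ y → x < P → y < P →
   Run (exactP o) M exact-time (λ M' → reg M' 42 ≡ exact o x y × Frame 42 M M')
  run-exact o {M} {x} {y} cs@(constants c0 c1 c2 c3) ex ey x< y< = go o
   where
   x<W : x < 2 ^ W
   x<W = <-≤-trans x< P≤
   up : ∀ {k} → k ≤ 3 → k ≤ exact-time
   up k≤ = ≤-trans k≤ (m≤m+n 3 _)
   f42 : ∀ {b r t r' t' v} → 42 ≤ b → FrameOn b r t r' t' → FrameOn 42 r t (r' [ 42 ↦ v ]) t'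
   f42 b≤ f = frame-setR {42} 42 tt (frame-weaken b≤ f)
   bits-case : ∀ f g → BitwiseLike f g → g 0 0 ≡ 0 → Run (bitP f 42 40 41) M exact-time (λ M' → reg M' 42 ≡ bitwise g V x y × Frame 42 M M')
   bits-case f g bl g0 = run-≤ (up ≤-refl) (exec-bit f 42 40 41
    (trans (cong₂ (transduce W f false) ex ey) (bitwise-transduce {f} {g} bl g0 W V≤W false x y x< y<)) ,, (refl , frame-setR {42} 42 tt frame-refl))
   flag-case : ∀ {P Q M'} b (v w : ℕ) → flag M' ≡ b → Frame 42 M M' → (b ≡ true → Exec P M' 6 (setR 42 v (setF false M'))) → (b ≡ false → Exec Q M' 6 (setR 42 w (setF false M'))) →
    Run (flagP P Q) M' 7 (λ M'' → reg M'' 42 ≡ (if b then v else w) × Frame 42 M M'')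
   flag-case b v w f fr e e' = run-if b f (λ { refl → e refl ,, (refl , f42 ≤-refl fr) }) (λ { refl → e' refl ,, (refl , f42 ≤-refl fr) })
   t10 : ∀ {k} → k ≤ 10 → k ≤ exact-time
   t10 k≤ = ≤-trans k≤ (m≤m+n 10 (mul-time + (div-time + pow-time W)))
   shift-cost : ∀ a b → a + (3 + (b + 3)) ≡ 6 + (b + a)
   shift-cost = solve-∀
   p≤ : 2 ^ (V ⊓ y) ≤ P
   p≤ = ^-monoʳ-≤ 2 (m⊓n≤m V y)
   p<W = ≤-<-trans p≤ P<2^W
   go : ∀ o → Run (exactP o) M exact-time (λ M' → reg M' 42 ≡ exact o x y × Frame 42 M M')
   go add = run-≤ (up ≤-refl) (exec-add 42 40 41 (cong₂ _+_ ex ey) (<2P x< (<⇒≤ y<)) ,, (refl , frame-setR {42} 42 tt frame-refl))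
   go sub = run-≤ (t10 (m≤m+n 6 4)) (exec-add 42 40 32 (cong₂ _+_ ex c2) (<2P x< ≤-refl) ▸
    (exec-sub 42 42 41 (subst (_≤ x + P) (sym ey) (≤-trans (<⇒≤ y<) (m≤n+m P x))) ,,
    (cong (x + P ∸_) ey , frame-setR {42} 42 tt (frame-setR {42} 42 tt frame-refl))))
   go mul = run-≤ (≡≤ (+-comm mul-time 3) (+-mono-≤ (m≤m+n 3 7) (m≤m+n mul-time (div-time + pow-time W))))
    (run-mul 40 41 tt tt c0 W<W ex ey x<W (*<2^W x< (<⇒≤ y<)) ▸▸ λ (e , f) → exec-copy 42 50 ,, (e , f42 (m≤m+n 42 8) f))
   go div = run-≤ (≡≤ (l div-time) (+-mono-≤ (m≤m+n 7 3) (≤-trans (m≤m+n div-time (pow-time W)) (m≤n+m (div-time + pow-time W) mul-time))))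
    (exec-nz 41 {b = not (y ≡ᵇ 0)} (cong (λ y → not (y ≡ᵇ 0)) ey) ▸ nonzero y refl y<)
    where
    l : ∀ d → 3 + suc (d + 3) ≡ 7 + d
    l = solve-∀
    nonzero : ∀ y' → y ≡ y' → y' < P → Run (flagP (divP 40 41 ⨾ copyP 42 50) (zeroP 42)) (setR 63 0 (setF (not (y ≡ᵇ 0)) M)) (suc (div-time + 3)) (λ M' → reg M' 42 ≡ quot x y × Frame 42 M M')
    nonzero zero refl _ = run-if false refl (λ ()) λ _ → run-≤ (m≤n+m 3 div-time)
     (exec-zero 42 ,, (refl , frame-setR {42} 42 tt (frame-setR {42} 63 tt frame-refl)))
    nonzero (suc y) refl y< = run-if true refl (λ _ →
     run-div 40 41 tt tt c0 W<W ex ey x<W (≤-trans (*-monoʳ-≤ 2 (<⇒≤ y<)) 2P≤) ▸▸ λ (e , _ , f) →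
      exec-copy 42 50 ,, (e , f42 (m≤m+n 42 8) (frame-trans (frame-setR {50} 63 tt frame-refl) f))) λ ()
   go and = bits-case andT _⊓_ and-like refl
   go or = bits-case orT _⊔_ or-like refl
   go xor = bits-case xorT ∣_-_∣ xor-like refl
   go shl = run-≤ (≡≤ (shift-cost (pow-time V) mul-time) (+-mono-≤ (m≤m+n 6 4) (+-monoʳ-≤ mul-time (≤-trans pow-mono (m≤n+m (pow-time W) div-time)))))
    (run-pow 41 33 tt tt ey c3 (≤-<-trans V≤W W<W) 1<2^W p<W ▸▸ λ (e , f) →
     exec-copy 43 50 ▸
     (run-mul 40 43 tt tt (trans (fr f 30 tt) c0) W<W (trans (fr f 40 tt) ex) e x<W (*<2^W x< p≤) ▸▸ λ (e' , f') →
     exec-copy 42 50 ,, (e' , f42 ≤-refl (frame-trans (frame-setR {42} 43 tt (frame-weaken (m≤m+n 42 8) f)) (frame-weaken (m≤m+n 42 8) f')))))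
   go shr = run-≤ (≡≤ (shift-cost (pow-time V) div-time) (+-mono-≤ (m≤m+n 6 4) (≤-trans (+-monoʳ-≤ div-time pow-mono) (m≤n+m (div-time + pow-time W) mul-time))))
    (run-pow 41 33 tt tt ey c3 (≤-<-trans V≤W W<W) 1<2^W p<W ▸▸ λ (e , f) →
     exec-copy 43 50 ▸
     (run-div 40 43 {v = 2 ^ (V ⊓ y)} {{m^n≢0 2 (V ⊓ y)}} tt tt (trans (fr f 30 tt) c0) W<W (trans (fr f 40 tt) ex) e x<W (≤-trans (*-monoʳ-≤ 2 p≤) 2P≤) ▸▸ λ (e' , _ , f') →
     exec-copy 42 50 ,, (trans e' (trans (sym (quot-/ x (2 ^ (V ⊓ y)) {{m^n≢0 2 (V ⊓ y)}})) (quot-shr V x y x<))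
      , f42 ≤-refl (frame-trans (frame-setR {42} 43 tt (frame-weaken (m≤m+n 42 8) f)) (frame-weaken (m≤m+n 42 8) f')))))
   go lt = run-≤ (t10 ≤-refl) (exec-lt 40 41 (cong₂ _<ᵇ_ ex ey) ▸ flag-case (x <ᵇ y) 1 0 refl (frame-setR {42} 63 tt frame-refl)
    (λ e → exec-const 42 1 1<2^W) (λ e → exec-≤ (m≤m+n 3 3) (exec-zero 42)))
   go eq = run-≤ (t10 ≤-refl) (exec-neq 40 41 (cong₂ (λ a b → not (a ≡ᵇ b)) ex ey) ▸
    run-map (λ (e , f) → trans e (if-not (x ≡ᵇ y)) , f) (flag-case (not (x ≡ᵇ y)) 0 1 refl (frame-setR {42} 63 tt frame-refl)
     (λ e → exec-≤ (m≤m+n 3 3) (exec-zero 42)) (λ e → exec-const 42 1 1<2^W)))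
    where
    if-not : ∀ b → (if not b then 0 else 1) ≡ bool b
    if-not true = refl
    if-not false = refl

  run-eval : ∀ o {M x y} → Constants V M → reg M 40 ≡ x → reg M 41 ≡ y → x < P → y < P →
   Run (evalP o) M eval-time (λ M' → reg M' 42 ≡ evalOp V o x y × Frame 42 M M')
  run-eval o cs ex ey x< y< = run-exact o cs ex ey x< y< ▸▸ λ (e , f) →
   run-map (λ (e' , f') → trans e' (sym (evalOp-exact o x< y<)) , frame-trans f f')
    (run-mod (constants-frame 42 (m≤m+n 34 8) f cs) e (exact< o x< y<))

 open Constants public

 -- Simulation of the dynamic algorithm

 record World (V ph : ℕ) (M : Mid) (node : ℕ → List ℕ) (len : ℕ) (s : State) : Set where
  constructor world
  field
   tr : Trie (tbl M) node len
   vw : View ph (tbl M) node len s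
   nx : suc (reg M 35) ≡ len
   cs : Constants V M
   e34 : reg M 34 ≡ ph
   bd : Bounded V s

 constants-rframe : ∀ {V M M'} b → T (34 ≤ᵇ b) → RFrame b M M' → Constants V M → Constants V M'
 constants-rframe b h f (constants a b' c d) = constants (trans (rf f' 30 tt) a) (trans (rf f' 31 tt) b') (trans (rf f' 32 tt) c) (trans (rf f' 33 tt) d)
  where f' = rframe-weaken {b} 34 h f

 world-regs : ∀ {V ph M M' node len s} → tbl M' ≡ tbl M → RFrame 36 M M' → World V ph M node len s →
  World V ph M' node len s × Evolved ph M M' node len node len
 world-regs {M' = mid _ _ _} refl f (world tr vw nx cs e34 bd) =
  world tr vw (trans (cong suc (rf f 35 tt)) nx) (constants-rframe 36 tt f cs) (trans (rf f 34 tt) e34) bd ,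
  evolved (extends ≤-refl λ _ → refl) (λ _ _ _ → refl) (rframe-weaken 35 tt f)

 world-put : ∀ {V ph M M' node len s s'} c i v → World V ph M node len s → tbl M' ≡ set (code c) ph i (suc v) (tbl M) → RFrame 36 M M' →
  (∀ m → c ≡ memC m → i < len) → View ph (set (code c) ph i (suc v) (tbl M)) node len s' → Bounded V s' →
  World V ph M' node len s' × Evolved ph M M' node len node len
 world-put {ph = ph} {M = M} {M' = mid _ _ _} c i v (world tr vw nx cs e34 bd) refl f ok vw' bd' =
  world (trie-put {c = c} {ph} {i} {suc v} ok tr) vw' (trans (cong suc (rf f 35 tt)) nx) (constants-rframe 36 tt f cs) (trans (rf f 34 tt) e34) bd' ,
  evolved (extends ≤-refl λ _ → refl)
   (λ c' i' n → set-other {code c} {ph} {i} {suc v} {tbl M} λ _ e _ → n (sym e))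
   (rframe-weaken 35 tt f)

 run-get : ∀ c i z {M ph j} → T (34 <ᵇ z) → T (i <ᵇ z) → T (z ≤ᵇ 62) → reg M 34 ≡ ph → reg M 31 ≡ 0 → reg M i ≡ j →
  Run (getP (code c) i z) M 13 (λ M' → reg M' z ≡ cell (tbl M) c ph j × tbl M' ≡ tbl M × RFrame z M M')
 run-get c i z {M} {ph} {j} 34<z i<z z≤ e34 e31 ei = exec-ld z (code c) 34 i z≢34 z≢i eq₀ ▸ loaded _ refl
  where
  eq₀ : tbl M (code c) (reg M 34) (reg M i) ≡ tbl M (code c) ph j
  eq₀ = cong₂ (tbl M (code c)) e34 ei
  ≢z : ∀ {r} → T (r <ᵇ z) → z ≢ r
  ≢z {r} r< e = <⇒≢ (<ᵇ⇒< r z r<) (sym e)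
  31<z = T-trans {31} {34} {z} tt (≤⇒≤ᵇ (<⇒≤ (<ᵇ⇒< 34 z 34<z)))
  z≢34 = ≢z {34} 34<z
  z≢31 = ≢z {31} 31<z
  z≢i = ≢z {i} i<z
  z≤z : T (z ≤ᵇ z)
  z≤z = ≤⇒≤ᵇ (≤-refl {z})
  z≤63 : T (z ≤ᵇ 63)
  z≤63 = ≤⇒≤ᵇ (≤-trans (≤ᵇ⇒≤ z 62 z≤) (n≤1+n 62))
  z62 : ∀ (f : ℕ → ℕ) {v} → (f [ 63 ↦ v ]) z ≡ f z
  z62 f {v} = ↦-other f {63} {z} {v} λ { refl → z≤ }
  M₀ = setR z (tbl M (code c) ph j) M
  M₁ = setR 63 0 (setF false M₀)
  M₂ = setR z (tbl M (code c) 0 j) M₁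
  f₁ : RFrame z M M₁
  f₁ = rframe-setR 63 z≤63 (rframe-setR z z≤z rframe-refl)
  reloaded : ∀ v → tbl M (code c) ph j ≡ 0 → tbl M (code c) 0 j ≡ v → Run (nzP z ⨾ flagP (decP z) skip) M₂ 7
   (λ M' → reg M' z ≡ cell (tbl M) c ph j × tbl M' ≡ tbl M × RFrame z M M')
  reloaded (suc v) ev ev' = exec-nz z {b = true} (cong (λ u → not (u ≡ᵇ 0)) (trans (↦-same (reg M₁) z) ev')) ▸
   run-if true refl (λ _ → exec-dec z {v = v} (trans (z62 (reg M₂)) (trans (↦-same (reg M₁) z) ev')) ,,
    (trans (↦-same (reg (setR 63 0 M₂)) z) (sym (cong₂ overlay ev ev')) , refl
    , rframe-setR z z≤z (rframe-setR 63 z≤63 (rframe-setR z z≤z f₁)))) (λ ())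
  reloaded zero ev ev' = exec-nz z {b = false} (cong (λ u → not (u ≡ᵇ 0)) (trans (↦-same (reg M₁) z) ev')) ▸
   run-if false refl (λ ()) λ _ → exec-≤ (m≤m+n 1 2) exec-skip ,,
    (trans (z62 (reg M₂)) (trans (↦-same (reg M₁) z) (trans ev' (sym (cong₂ overlay ev ev')))) , refl
    , rframe-setR 63 z≤63 (rframe-setR z z≤z f₁))
  loaded : ∀ v → tbl M (code c) ph j ≡ v → Run (nzP z ⨾ flagP (decP z) (ldP z (code c) 31 i ⨾ nzP z ⨾ flagP (decP z) skip)) M₀ 12
   (λ M' → reg M' z ≡ cell (tbl M) c ph j × tbl M' ≡ tbl M × RFrame z M M')
  loaded (suc v) ev = exec-nz z {b = true} (cong (λ u → not (u ≡ᵇ 0)) (trans (↦-same (reg M) z) ev)) ▸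
   run-if true refl (λ _ → run-≤ (m≤m+n 3 5) (exec-dec z {v = v} (trans (z62 (reg M₀)) (trans (↦-same (reg M) z) ev)) ,,
    (trans (↦-same (reg (setR 63 0 M₀)) z) (sym (cong (λ u → overlay u (tbl M (code c) 0 j)) ev)) , refl
    , rframe-setR z z≤z (rframe-setR 63 z≤63 (rframe-setR z z≤z rframe-refl))))) (λ ())
  loaded zero ev = exec-nz z {b = false} (cong (λ u → not (u ≡ᵇ 0)) (trans (↦-same (reg M) z) ev)) ▸
   run-if false refl (λ ()) λ _ →
    exec-ld z (code c) 31 i {v = tbl M (code c) 0 j} z≢31 z≢i
     (cong₂ (tbl M (code c)) (trans (rf f₁ 31 31<z) e31) (trans (rf f₁ i i<z) ei)) ▸
    reloaded _ ev refl

 run-put : ∀ c i x {M ph j v} → T (i <ᵇ 37) ⊎ T (38 ≤ᵇ i) → reg M 34 ≡ ph → reg M i ≡ j → reg M x ≡ v → suc v < 2 ^ W →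
  Run (putP (code c) i x) M 7 (λ M' → tbl M' ≡ set (code c) ph j (suc v) (tbl M) × RFrame 37 M M')
 run-put c i x {M} {ph} {j} {v} i≢ e34 ei ex v< =
  exec-copy 37 x ▸ exec-inc 37 {v = v} ex v< ▸ (exec-st (code c) 34 i 37 ,,
   (cong₂ (λ a b → set (code c) a b (suc v) (tbl M)) e34 (trans same ei) , rframe-setR 37 tt (rframe-setR 37 tt rframe-refl)))
  where
  keep : ∀ i → T (i <ᵇ 37) ⊎ T (38 ≤ᵇ i) → 37 ≢ i
  keep i (inj₁ l) refl = l
  keep i (inj₂ l) refl = l
  same : ((reg M [ 37 ↦ reg M x ]) [ 37 ↦ suc v ]) i ≡ reg M i
  same = trans (↦-other (reg M [ 37 ↦ reg M x ]) (keep i i≢)) (↦-other (reg M) (keep i i≢))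

 record Allocated (M M' : Mid) (node : ℕ → List ℕ) (len : ℕ) (xs : List ℕ) : Set where
  constructor allocated
  field
   {node'} : ℕ → List ℕ
   {len'} : ℕ
   tr' : Trie (tbl M') node' len'
   nx' : suc (reg M' 35) ≡ len'
   child< : reg M' 42 < len'
   child≡ : node' (reg M' 42) ≡ xs
   ext' : Extends node len node' len'
   len'≤ : len' ≤ suc len
   cells≡ : ∀ c ph i → tbl M' (code c) ph i ≡ tbl M (code c) ph i
   others≡ : ∀ t {ph i} → t ≢ 0 → tbl M' t ph i ≡ tbl M t ph i
   frame35 : RFrame 35 M M'

 run-child : ∀ {M node len i x} → Trie (tbl M) node len → suc (reg M 35) ≡ len → reg M 40 ≡ i → reg M 41 ≡ x → i < len → len < 2 ^ W →
  Run childP M 12 (λ M' → Allocated M M' node len (node i ∷ʳ x))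
 run-child {M} {node} {len} {i} {x} tr refl refl refl i< len< = exec-ld 42 0 40 41 {v = tbl M 0 i x} (λ ()) (λ ()) refl ▸ found _ refl
  where
  found : ∀ c → tbl M 0 i x ≡ c → Run (nzP 42 ⨾ flagP skip (incP 35 ⨾ stP 0 40 41 35 ⨾ copyP 42 35)) (setR 42 (tbl M 0 i x) M) 11
   (λ M' → Allocated M M' node len (node i ∷ʳ x))
  found (suc c) e = exec-nz 42 {b = true} (cong (λ u → not (u ≡ᵇ 0)) e) ▸
   run-if true refl (λ _ → exec-≤ (m≤m+n 1 6) exec-skip ,,
    allocated tr refl (subst (_< len) (sym e) (proj₁ (Trie.child⁺ tr i< e))) (trans (cong node e) (proj₂ (Trie.child⁺ tr i< e)))
     (extends ≤-refl λ _ → refl) (n≤1+n len) (λ _ _ _ → refl) (λ _ _ → refl)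
     (rframe-setR 63 tt (rframe-setR 42 tt rframe-refl))) (λ ())
  found zero e = exec-nz 42 {b = false} (cong (λ u → not (u ≡ᵇ 0)) e) ▸
   run-if false refl (λ ()) λ _ → exec-inc 35 refl len< ▸ exec-st 0 40 41 35 ▸ (exec-copy 42 35 ,,
    allocated (trie-alloc {x = x} tr i< e) refl (n<1+n len) (↦-same node len)
     (extends (n≤1+n len) λ j< → ↦-other node λ e' → <⇒≢ j< (sym e')) ≤-refl
     (λ c ph j → set-other {0} {i} {x} {len} {tbl M} λ e' → ⊥-elim (code≢0 c (sym e')))
     (λ t t≢0 → set-other {0} {i} {x} {len} {tbl M} λ e' → ⊥-elim (t≢0 (sym e')))
     (rframe-setR 42 tt (rframe-setR 35 tt (rframe-setR 63 tt (rframe-setR 42 tt rframe-refl)))))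

 evalOp< : ∀ {V} (2V≤ : suc (V + V) ≤ W) (W<W : W < 2 ^ W) o {x y} → x < 2 ^ V → y < 2 ^ V → evalOp V o x y < 2 ^ V
 evalOp< {V} h h' o x< y< = subst (_< 2 ^ V) (sym (evalOp-exact {V} h h' o x< y<)) (wrap< V _)

 bounded-setReg : ∀ {V s v} r → v < 2 ^ V → Bounded V s → Bounded V (setReg r v s)
 bounded-setReg {V} {s} {v} r v< (bnd br bm bc) = bnd br' bm bc
  where
  br' : ∀ q → (regs s [ r ↦ v ]) q < 2 ^ V
  br' q with r ≡ᵇ q
  ... | true = v<
  ... | false = br q

 bounded-put : ∀ {V s v} m a → v < 2 ^ V → Bounded V s → Bounded V (record s { mem = put (mem s) m a v })
 bounded-put {V} {s} {v} m a v< (bnd br bm bc) = bnd br bm' bc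
  where
  bm' : ∀ m' a' → put (mem s) m a v m' a' < 2 ^ V
  bm' m' a' with m ≡ᵇ m'
  ... | false = bm m' a'
  ... | true with a ≡ᵇˡ a'
  ... | true = v<
  ... | false = bm m a'

 -- Units for one simulated step. The summand 3 (K + 1) pays for building a constant by counting.
 σ : ℕ → ℕ
 σ K = 60 + (eval-time + (3 * suc K + div-time))

 module _ {V K : ℕ} (2V≤ : suc (V + V) ≤ W) (W<W : W < 2 ^ W) (K< : K < 2 ^ W) where

  -- A step allocates at most one node, so its time also bounds the growth of the trie. This is how
  -- node numbers are kept below 2 ^ W.
  Simulated : ℕ → Mid → (ℕ → List ℕ) → ℕ → State → ℕ → Mid → Set
  Simulated ph M node len s' t M' = ∃[ node' ] ∃[ len' ] (World V ph M' node' len' s' × Evolved ph M M' node len node' len' × len' ≤ len + t)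

  private
   suc<W : ∀ {v} → v < 2 ^ V → suc v < 2 ^ W
   suc<W v< = <-≤-trans (s≤s v<) (≤-trans (≤≡ (+-monoˡ-≤ (2 ^ V) (0<2^ V)) (cong (2 ^ V +_) (sym (+-identityʳ (2 ^ V))))) (2P≤ {V} 2V≤ W<W))

   σ₆₀ : ∀ {k} → k ≤ 60 → k ≤ 1 * σ K
   σ₆₀ k≤ = ≤-trans k≤ (≤≡ (m≤m+n 60 _) (sym (*-identityˡ (σ K))))

   times : ∀ t {k} .{{_ : NonZero t}} → k ≤ 1 * σ K → k ≤ t * σ K
   times t k≤ = ≤-trans k≤ (*-monoˡ-≤ (σ K) (>-nonZero⁻¹ t))

   sim-put : ∀ {ph M₀ M node node₀ len len₀ t s s'} c i x {j v} → T (i <ᵇ 37) ⊎ T (38 ≤ᵇ i) → reg M i ≡ j → reg M x ≡ v → suc v < 2 ^ W →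
    World V ph M node len s → Evolved ph M₀ M node₀ len₀ node len → len ≤ len₀ + t →
    (∀ m → c ≡ memC m → j < len) → View ph (set (code c) ph j (suc v) (tbl M)) node len s' → Bounded V s' →
    Run (putP (code c) i x) M 7 (Simulated ph M₀ node₀ len₀ s' t)
   sim-put c i x {j} {v} i≢ ei ex v< w ev l≤ ok vw' bd' = run-map
    (λ (e , f) → let w' , ev' = world-put c j v w e (rframe-weaken 36 tt f) ok vw' bd' in
     _ , _ , w' , evolved-trans ev ev' , l≤)
    (run-put c i x i≢ (World.e34 w) ei ex v<)

   bnd-adr : ∀ {s a} → Bounded V s → Bounded V (record s { addrs = a })
   bnd-adr (bnd br bm bc) = bnd br bm bc

   coins-view : ∀ {ph U node len s c} → View ph U node len s → View ph U node len (record s { coins = c })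
   coins-view (view vr va< va vm vm⁰) = view vr va< va vm vm⁰

   coins-bounded : ∀ {s} → Bounded V s → Bounded V (record s { coins = coins s ∘ suc })
   coins-bounded (bnd br bm bc) = bnd br bm (bc ∘ suc)

   ≢0 : ∀ {n} → n ≢ 0 → not (n ≡ᵇ 0) ≡ true
   ≢0 {zero} n = ⊥-elim (n refl)
   ≢0 {suc _} n = refl

   branch : ∀ t → 16 + suc (t * σ K) ≤ suc t * σ K
   branch t = ≡≤ (+-suc 16 (t * σ K)) (+-monoˡ-≤ (t * σ K) (m≤m+n 17 (43 + (eval-time + (3 * suc K + div-time)))))

   while-time : ∀ {r P s t s'} → V ⊢ whilenz r loop P , s ⇓[ t ] s' → 16 ≤ t * σ K
   while-time (loop {t = t} {t'} _ _ _) = times (suc (t + t')) (σ₆₀ (m≤m+n 16 44))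
   while-time (done _) = σ₆₀ (m≤m+n 16 44)

   sim-get : ∀ {ph M node len s j} c i z → T (36 ≤ᵇ z) → T (34 <ᵇ z) → T (i <ᵇ z) → T (z ≤ᵇ 62) → reg M i ≡ j → World V ph M node len s →
    Run (getP (code c) i z) M 13 (λ M' → reg M' z ≡ cell (tbl M) c ph j × RFrame z M M' × World V ph M' node len s × Evolved ph M M' node len node len)
   sim-get c i z 36≤ 34< i< z≤ ei w = run-map (λ (e , e' , f) → e , f , world-regs e' (rframe-weaken 36 36≤ f) w)
    (run-get c i z 34< i< z≤ (World.e34 w) (c31 (World.cs w)) ei)

  sim-test : ∀ {ph M node len s} r → World V ph M node len s →
   Run (testP r) M 16 (λ M' → flag M' ≡ not (regs s r ≡ᵇ 0) × World V ph M' node len s × Evolved ph M M' node len node len)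
  sim-test {M = M} {s = s} r w = run-get (regC r) 31 42 tt tt tt (World.e34 w) (c31 (World.cs w)) (c31 (World.cs w)) ▸▸ λ (e , e' , f) →
   exec-nz 42 (cong (λ u → not (u ≡ᵇ 0)) (trans e (View.vr (World.vw w) r))) ,,
   (refl , world-regs e' (rframe-setR 63 tt (rframe-weaken 36 tt f)) w)

  evolved-refl : ∀ {ph M node len} → Evolved ph M M node len node len
  evolved-refl = evolved (extends ≤-refl λ _ → refl) (λ _ _ _ → refl) rframe-refl

  Room : ℕ → ℕ → Set
  Room len t = len + t < 2 ^ W

  sim-run : ∀ P {s t s'} → ConstsBelow K P → V ⊢ P , s ⇓[ t ] s' → ∀ {ph M node len} → World V ph M node len s → Room len t →
   Run (simP P) M (t * σ K) (Simulated ph M node len s' t)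
  -- The 16 units held back pay for the test that precedes this part of the run: the compiled loop
  -- evaluates its condition once before the loop and again at the end of every iteration.
  sim-loop : ∀ r P {s t s'} → ConstsBelow K P → V ⊢ whilenz r loop P , s ⇓[ t ] s' → ∀ {ph M node len} → World V ph M node len s → Room len t →
   flag M ≡ not (regs s r ≡ᵇ 0) →
   ∃[ k ] (k + 16 ≤ t * σ K × Run (whilenz 0 loop (simP P ⨾ testP r)) M k (Simulated ph M node len s' t))

  sim-run skip cb skip w room = run-≤ (σ₆₀ (s≤s z≤n)) (exec-skip ,, (_ , _ , w , evolved-refl , m≤m+n _ 1))
  sim-run (P ⨾ Q) (cbP , cbQ) (seq {t = t} {t'} r r') {len = len} w room = run-≤ (≤-reflexive (sym (*-distribʳ-+ (σ K) t t')))
   (sim-run P cbP r w (≤-<-trans (+-monoʳ-≤ len (m≤m+n t t')) room) ▸▸ λ (node' , len' , w' , ev , l≤) →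
    run-map (λ (node'' , len'' , w'' , ev' , l≤') → node'' , len'' , w'' , evolved-trans ev ev' , ≤-trans l≤' (≤≡ (+-monoˡ-≤ t' l≤) (+-assoc len t t')))
     (sim-run Q cbQ r' w' (≤-<-trans (+-monoˡ-≤ t' l≤) (subst (_< 2 ^ W) (sym (+-assoc len t t')) room))))
  sim-run (const r k) cb const {len = len} w room = run-≤ bound
   (exec-const 42 k (≤-<-trans cb K<) ▸
   (run-mod 2V≤ W<W (constants-frame 42 (m≤m+n 34 8) (frame-setR {42} 42 tt frame-refl) (World.cs w)) refl (≤-<-trans cb K<) ▸▸ λ (e , f) →
    let f' = frame-trans (frame-setR {42} 42 tt frame-refl) f
        (w' , ev) = world-regs (ft f') (rframe-weaken 36 tt (frame-rframe f')) w
    in sim-put (regC r) 31 42 (inj₁ tt) (c31 (World.cs w')) e (suc<W (wrap< V k)) w' ev (m≤m+n len 1) (λ _ ())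
      (view-setReg r _ (World.vw w')) (bounded-setReg r (wrap< V k) (World.bd w))))
   where
   l : ∀ a d → a + (d + 3 + 7) ≡ 10 + (a + d)
   l = solve-∀
   bound : 3 * suc k + (div-time + 3 + 7) ≤ 1 * σ K
   bound = ≡≤ (l (3 * suc k) div-time) (≤≡ (+-mono-≤ (m≤m+n 10 50)
    (≤-trans (+-monoˡ-≤ div-time (*-monoʳ-≤ 3 (s≤s cb))) (m≤n+m (3 * suc K + div-time) eval-time))) (sym (*-identityˡ (σ K))))
  sim-run (arith r o x y) cb arith {len = len} w room = run-≤ bound
   (sim-get (regC x) 31 40 tt tt tt tt (c31 (World.cs w)) w ▸▸ λ (e , f₁ , w₁ , ev₁) →
    sim-get (regC y) 31 41 tt tt tt tt (c31 (World.cs w₁)) w₁ ▸▸ λ (e' , f₂ , w₂ , ev₂) →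
    run-eval 2V≤ W<W o (World.cs w₂) (trans (rf f₂ 40 tt) (trans e (View.vr (World.vw w) x))) (trans e' (View.vr (World.vw w₁) y))
     (Bounded.br (World.bd w) x) (Bounded.br (World.bd w) y) ▸▸ λ (e'' , f) →
    let (w₃ , ev₃) = world-regs (ft f) (rframe-weaken 36 tt (frame-rframe f)) w₂ in
    sim-put (regC r) 31 42 (inj₁ tt) (c31 (World.cs w₃)) e'' (suc<W (value o)) w₃ (evolved-trans ev₁ (evolved-trans ev₂ ev₃)) (m≤m+n len 1) (λ _ ())
     (view-setReg r _ (World.vw w₃)) (bounded-setReg r (value o) (World.bd w)))
   where
   value = λ o → evalOp< {V} 2V≤ W<W o (Bounded.br (World.bd w) x) (Bounded.br (World.bd w) y)
   l : ∀ e → 13 + (13 + (e + 7)) ≡ 33 + e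
   l = solve-∀
   bound : 13 + (13 + (eval-time + 7)) ≤ 1 * σ K
   bound = ≡≤ (l eval-time) (≤≡ (+-mono-≤ (m≤m+n 33 27) (m≤m+n eval-time (3 * suc K + div-time))) (sym (*-identityˡ (σ K))))
  sim-run (clear a) cb clear {len = len} w room = run-≤ (σ₆₀ (m≤m+n 10 50))
   (exec-zero 42 ▸
    (let (w₁ , ev₁) = world-regs refl (rframe-setR 42 tt rframe-refl) w in
    sim-put (adrC a) 31 42 (inj₁ tt) (c31 (World.cs w₁)) refl (suc<W (0<2^ V)) w₁ ev₁ (m≤m+n len 1) (λ _ ())
     (view-setAdr a 0 [] (Trie.0<len (World.tr w)) (Trie.root (World.tr w)) (World.vw w₁)) (bnd-adr (World.bd w))))
  sim-run (push a x) {s} cb push {len = len} w room = run-≤ (σ₆₀ (m≤m+n 45 15))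
   (sim-get (adrC a) 31 40 tt tt tt tt (c31 (World.cs w)) w ▸▸ λ (e , f₁ , w₁ , ev₁) →
    sim-get (regC x) 31 41 tt tt tt tt (c31 (World.cs w₁)) w₁ ▸▸ λ (e' , f₂ , w₂ , ev₂) →
    run-child (World.tr w₂) (World.nx w₂) (trans (rf f₂ 40 tt) e) (trans e' (View.vr (World.vw w₁) x)) (View.va< (World.vw w) a)
     (≤-<-trans (m≤m+n len 1) room) ▸▸ λ (allocated tr' nx' c< c≡ ext l≤ cells≡ _ f₃) →
    let vw' = view-extend (World.tr w₂) (Trie.inj tr') ext (λ c i → cells≡ c _ i) (λ c i → cells≡ c _ i) (World.vw w₂)
        w₃ = world tr' vw' nx' (constants-rframe 35 tt f₃ (World.cs w₂)) (trans (rf f₃ 34 tt) (World.e34 w₂)) (World.bd w₂)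
        ev₃ = evolved ext (λ c i _ → cells≡ c _ i) f₃
    in sim-put (adrC a) 31 42 (inj₁ tt) (c31 (World.cs w₃)) refl (≤-<-trans (≤-trans c< l≤) (subst (_< 2 ^ W) (+-comm len 1) room))
      w₃ (evolved-trans ev₁ (evolved-trans ev₂ ev₃)) (≤≡ l≤ (+-comm 1 len)) (λ _ ())
      (view-setAdr a _ _ c< (trans c≡ (cong (_∷ʳ regs s x) (View.va (World.vw w) a))) vw') (bnd-adr (World.bd w)))
  sim-run (load r m a) {s} cb load {len = len} w room = run-≤ (times (suc (length (addrs s a))) (σ₆₀ (m≤m+n 33 27)))
   (sim-get (adrC a) 31 40 tt tt tt tt (c31 (World.cs w)) w ▸▸ λ (e , f₁ , w₁ , ev₁) →
    sim-get (memC m) 40 42 tt tt tt tt e w₁ ▸▸ λ (e' , f₂ , w₂ , ev₂) →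
    sim-put (regC r) 31 42 (inj₁ tt) (c31 (World.cs w₂))
     (trans e' (trans (View.vm (World.vw w₁) m (View.va< (World.vw w) a)) (cong (mem s m) (View.va (World.vw w) a))))
     (suc<W (Bounded.bm (World.bd w) m (addrs s a))) w₂ (evolved-trans ev₁ ev₂) (m≤m+n len _) (λ _ ())
     (view-setReg r _ (World.vw w₂)) (bounded-setReg r (Bounded.bm (World.bd w) m (addrs s a)) (World.bd w)))
  sim-run (store m a x) {s} cb store {len = len} w room = run-≤ (times (suc (length (addrs s a))) (σ₆₀ (m≤m+n 33 27)))
   (sim-get (adrC a) 31 40 tt tt tt tt (c31 (World.cs w)) w ▸▸ λ (e , f₁ , w₁ , ev₁) →
    sim-get (regC x) 31 42 tt tt tt tt (c31 (World.cs w₁)) w₁ ▸▸ λ (e' , f₂ , w₂ , ev₂) →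
    sim-put (memC m) 40 42 (inj₂ tt) (trans (rf f₂ 40 tt) e) (trans e' (View.vr (World.vw w₁) x))
     (suc<W (Bounded.br (World.bd w) x)) w₂ (evolved-trans ev₁ ev₂) (m≤m+n len _) (λ _ _ → View.va< (World.vw w) a)
     (view-setMem m _ (addrs s a) _ (World.tr w₂) (View.va< (World.vw w) a) (View.va (World.vw w) a) (World.vw w₂))
     (bounded-put m (addrs s a) (Bounded.br (World.bd w) x) (World.bd w)))
  sim-run (flip r) {s} cb flip {len = len} w room = run-≤ (σ₆₀ (m≤m+n 10 50))
   (exec-zero 42 ▸
    (let (w₁ , ev₁) = world-regs refl (rframe-setR 42 tt rframe-refl) w
         0≡ = trans (sym (wrap-id {V} (0<2^ V))) (cong (wrap V ∘ bool) (sym (Bounded.bc (World.bd w) 0)))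
    in sim-put (regC r) 31 42 (inj₁ tt) (c31 (World.cs w₁)) 0≡ (suc<W (wrap< V _)) w₁ ev₁ (m≤m+n len 1) (λ _ ())
     (coins-view (view-setReg r _ (World.vw w₁))) (coins-bounded (bounded-setReg r (wrap< V _) (World.bd w)))))
  sim-run (ifnz r then P else Q) (cbP , cbQ) (if-nz {t = t} n d) {len = len} w room = run-≤ (branch t)
   (sim-test r w ▸▸ λ (f , w₁ , ev₁) → run-if true (trans f (≢0 n)) (λ _ →
    run-map (λ (node'' , len'' , w'' , ev' , l≤') → node'' , len'' , w'' , evolved-trans ev₁ ev' , ≤-trans l≤' (+-monoʳ-≤ len (n≤1+n t)))
     (sim-run P cbP d w₁ (≤-<-trans (+-monoʳ-≤ len (n≤1+n t)) room))) λ ())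
  sim-run (ifnz r then P else Q) (cbP , cbQ) (if-z {t = t} z d) {len = len} w room = run-≤ (branch t)
   (sim-test r w ▸▸ λ (f , w₁ , ev₁) → run-if false (trans f (cong (λ u → not (u ≡ᵇ 0)) z)) (λ ()) (λ _ →
    run-map (λ (node'' , len'' , w'' , ev' , l≤') → node'' , len'' , w'' , evolved-trans ev₁ ev' , ≤-trans l≤' (+-monoʳ-≤ len (n≤1+n t)))
     (sim-run Q cbQ d w₁ (≤-<-trans (+-monoʳ-≤ len (n≤1+n t)) room))))
  sim-run (whilenz r loop P) {t = t} cb d w room = run-≤ (≤-reflexive (m+[n∸m]≡n (while-time d)))
   (sim-test r w ▸▸ λ (f , w₁ , ev₁) → let (k , k≤ , run) = sim-loop r P cb d w₁ room f in
    run-≤ (m+n≤o⇒m≤o∸n k k≤) (run-map (λ (node'' , len'' , w'' , ev' , l≤') → node'' , len'' , w'' , evolved-trans ev₁ ev' , l≤') run))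

  sim-loop r P cb (done z) {len = len} w room f =
   1 , σ₆₀ (m≤m+n 17 43) , run-done (trans f (cong (λ u → not (u ≡ᵇ 0)) z)) (_ , _ , w , evolved-refl , m≤m+n len 1)
  sim-loop r P cb (loop {_} {_} {_} {s'} {_} {t} {t'} n d d') {ph} {M} {node} {len} w room f =
   suc ((t * σ K + 16) + (t' * σ K ∸ 16)) , cost ,
   run-loop {Q = Body} (trans f (≢0 n))
    (sim-run P cb d w (≤-<-trans (+-monoʳ-≤ len (≤-trans (m≤m+n t t') (n≤1+n _))) room) ▸▸ λ (node' , len' , w' , ev , l≤) →
     run-map (λ (f' , w'' , ev') → node' , len' , w'' , evolved-trans ev ev' , l≤ , f') (sim-test r w'))
    λ (node' , len' , w' , ev , l≤ , f') →
     let (k , k≤ , run) = sim-loop r P cb d' w' (≤-<-trans (len≤ l≤) room) f' in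
     run-≤ (m+n≤o⇒m≤o∸n k k≤) (run-map (λ (node'' , len'' , w'' , ev' , l≤') → node'' , len'' , w'' , evolved-trans ev ev' , ≤-trans l≤' (len≤ l≤)) run)
   where
   Body : Mid → Set
   Body M' = ∃[ node' ] ∃[ len' ] (World V ph M' node' len' s' × Evolved ph M M' node len node' len' × len' ≤ len + t × flag M' ≡ not (regs s' r ≡ᵇ 0))
   len≤ : ∀ {len'} → len' ≤ len + t → len' + t' ≤ len + suc (t + t')
   len≤ l≤ = ≤-trans (+-monoˡ-≤ t' l≤) (≡≤ (+-assoc len t t') (+-monoʳ-≤ len (n≤1+n _)))
   l₁ : ∀ a b → suc ((a + 16) + b) + 16 ≡ 17 + (a + (16 + b))
   l₁ = solve-∀
   cost : suc ((t * σ K + 16) + (t' * σ K ∸ 16)) + 16 ≤ suc (t + t') * σ K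
   cost = ≡≤ (trans (l₁ (t * σ K) (t' * σ K ∸ 16)) (cong (λ z → 17 + (t * σ K + z)) (m+[n∸m]≡n (while-time d'))))
    (+-mono-≤ (m≤m+n 17 (43 + (eval-time + (3 * suc K + div-time)))) (≤-reflexive (sym (*-distribʳ-+ (σ K) t t'))))

 -- Straight-line code is executed symbolically: f records the contents of the registers below 50,
 -- while those from 50 on are scratch for arithmetic.
 Sy : (ℕ → ℕ) → Tables → Mid → Set
 Sy f t M = FrameOn 50 f t (reg M) (tbl M)

 module _ {f : ℕ → ℕ} {t : Tables} where

  s-copy : ∀ z x {v M} → T (x <ᵇ 50) → f x ≡ v → Sy f t M → Run (copyP z x) M 3 (Sy (f [ z ↦ v ]) t)
  s-copy z x {M = M} x< refl F = exec-copy z x ,, subst (λ v → Sy (f [ z ↦ v ]) t (setR z (reg M x) M)) (fr F x x<) (frame-cong z (reg M x) F)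

  s-zero : ∀ z {M} → Sy f t M → Run (zeroP z) M 3 (Sy (f [ z ↦ 0 ]) t)
  s-zero z F = exec-zero z ,, frame-cong z 0 F

  s-const : ∀ z k {M} → k < 2 ^ W → Sy f t M → Run (constP z k) M (3 * suc k) (Sy (f [ z ↦ k ]) t)
  s-const z k k< F = exec-const z k k< ,, frame-cong z k F

  s-add : ∀ z x y {u v M} → T (x <ᵇ 50) → T (y <ᵇ 50) → f x ≡ u → f y ≡ v → u + v < 2 ^ W → Sy f t M →
   Run (addP z x y) M 3 (Sy (f [ z ↦ u + v ]) t)
  s-add z x y x< y< ex ey s< F = exec-add z x y (cong₂ _+_ (trans (fr F x x<) ex) (trans (fr F y y<) ey)) s< ,, frame-cong z _ F

  s-sub : ∀ z x y {u v M} → T (x <ᵇ 50) → T (y <ᵇ 50) → f x ≡ u → f y ≡ v → v ≤ u → Sy f t M →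
   Run (subP z x y) M 3 (Sy (f [ z ↦ u ∸ v ]) t)
  s-sub z x y {M = M} x< y< refl refl v≤ F = exec-sub z x y (subst₂ _≤_ (sym (fr F y y<)) (sym (fr F x x<)) v≤) ,,
   subst (λ v → Sy (f [ z ↦ v ]) t (setR z (reg M x ∸ reg M y) M)) (cong₂ _∸_ (fr F x x<) (fr F y y<)) (frame-cong z (reg M x ∸ reg M y) F)

  s-inc : ∀ x {u M} → T (x <ᵇ 50) → f x ≡ u → suc u < 2 ^ W → Sy f t M → Run (incP x) M 3 (Sy (f [ x ↦ suc u ]) t)
  s-inc x x< ex s< F = exec-inc x (trans (fr F x x<) ex) s< ,, frame-cong x _ F

  s-skip : ∀ {M} → Sy f t M → Run skip M 1 (Sy f t)
  s-skip F = exec-skip ,, F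

  s-mul : ∀ z x y {u v M} → T (x <ᵇ 50) → T (y <ᵇ 50) → W < 2 ^ W → f 30 ≡ W → f x ≡ u → f y ≡ v → u < 2 ^ W → u * v < 2 ^ W → Sy f t M →
   Run (mulTo z x y) M (mul-time + 3) (Sy (f [ z ↦ u * v ]) t)
  s-mul z x y x< y< W<W e30 ex ey u< uv< F =
   run-mul x y x< y< (trans (fr F 30 tt) e30) W<W (trans (fr F x x<) ex) (trans (fr F y y<) ey) u< uv< ▸▸ λ { {M'} (e , G) →
   exec-copy z 50 ,, subst (λ v → Sy (f [ z ↦ v ]) t (setR z (reg M' 50) (setF false M'))) e (frame-cong z (reg M' 50) (frame-trans F G)) }

  private
   s-divMod : ∀ z x y r {u v M} {o : ℕ → ℕ → ℕ} .{{_ : NonZero v}} → T (x <ᵇ 50) → T (y <ᵇ 50) → W < 2 ^ W → f 30 ≡ W → f x ≡ u → f y ≡ v → u < 2 ^ W → 2 * v ≤ 2 ^ W →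
    (∀ {M'} → reg M' 50 ≡ u / v → reg M' 51 ≡ u % v → reg M' r ≡ o u v) → Sy f t M →
    Run (divP x y ⨾ copyP z r) M (div-time + 3) (Sy (f [ z ↦ o u v ]) t)
   s-divMod z x y r x< y< W<W e30 ex ey u< v≤ out F =
    run-div x y x< y< (trans (fr F 30 tt) e30) W<W (trans (fr F x x<) ex) (trans (fr F y y<) ey) u< v≤ ▸▸ λ { {M'} (q , r' , G) →
    exec-copy z r ,, subst (λ v → Sy (f [ z ↦ v ]) t (setR z (reg M' r) (setF false M'))) (out {M'} q r') (frame-cong z (reg M' r) (frame-trans F G)) }

  s-div : ∀ z x y {u v M} .{{_ : NonZero v}} → T (x <ᵇ 50) → T (y <ᵇ 50) → W < 2 ^ W → f 30 ≡ W → f x ≡ u → f y ≡ v → u < 2 ^ W → 2 * v ≤ 2 ^ W → Sy f t M →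
   Run (divTo z x y) M (div-time + 3) (Sy (f [ z ↦ u / v ]) t)
  s-div z x y {u} {v} x< y< W<W e30 ex ey u< v≤ = s-divMod z x y 50 {o = λ _ _ → u / v} x< y< W<W e30 ex ey u< v≤ (λ q _ → q)

  s-rem : ∀ z x y {u v M} .{{_ : NonZero v}} → T (x <ᵇ 50) → T (y <ᵇ 50) → W < 2 ^ W → f 30 ≡ W → f x ≡ u → f y ≡ v → u < 2 ^ W → 2 * v ≤ 2 ^ W → Sy f t M →
   Run (remTo z x y) M (div-time + 3) (Sy (f [ z ↦ u % v ]) t)
  s-rem z x y {u} {v} x< y< W<W e30 ex ey u< v≤ = s-divMod z x y 51 {o = λ _ _ → u % v} x< y< W<W e30 ex ey u< v≤ (λ _ r → r)

  s-pow : ∀ z y {v M} → T (y <ᵇ 50) → W < 2 ^ W → f 30 ≡ W → f y ≡ v → v < W → Sy f t M →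
   Run (powTo z y 30) M (pow-time W + 3) (Sy (f [ z ↦ 2 ^ v ]) t)
  s-pow z y {v} y< W<W e30 ey v< F =
   run-pow y 30 y< tt (trans (fr F y y<) ey) (trans (fr F 30 tt) e30) W<W (one< W v<)
    (subst (λ e → 2 ^ e < 2 ^ W) (sym min≡) (^-monoʳ-< 2 (s≤s (s≤s z≤n)) v<)) ▸▸ λ { {M'} (e , G) →
   exec-copy z 50 ,, subst (λ v → Sy (f [ z ↦ v ]) t (setR z (reg M' 50) (setF false M'))) (trans e (cong (2 ^_) min≡)) (frame-cong z (reg M' 50) (frame-trans F G)) }
   where
   min≡ : W ⊓ v ≡ v
   min≡ = m≥n⇒m⊓n≡n (<⇒≤ v<)
   one< : ∀ W → v < W → 1 < 2 ^ W
   one< (suc W) _ = *-monoʳ-≤ 2 (0<2^ W)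

  s-iflt : ∀ x y {u v M P P' k Q} → T (x <ᵇ 50) → T (y <ᵇ 50) → f x ≡ u → f y ≡ v → Sy f t M →
   (u < v → ∀ {M'} → Sy f t M' → Run P M' k Q) → (v ≤ u → ∀ {M'} → Sy f t M' → Run P' M' k Q) →
   Run (ltP x y ⨾ flagP P P') M (4 + k) Q
  s-iflt x y {u} {v} x< y< ex ey F h h' = exec-lt x y (cong₂ _<ᵇ_ (trans (fr F x x<) ex) (trans (fr F y y<) ey)) ▸
   run-if (u <ᵇ v) refl (λ e → h (<ᵇ⇒< u v (≡true⇒T e)) (frame-setR 63 tt F))
    λ e → h' (≮⇒≥ λ l → case trans (sym (T⇒≡true (<⇒<ᵇ l))) e of λ ()) (frame-setR 63 tt F)

  s-ifneq : ∀ x y {u v M P P' k Q} → T (x <ᵇ 50) → T (y <ᵇ 50) → f x ≡ u → f y ≡ v → Sy f t M →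
   (u ≢ v → ∀ {M'} → Sy f t M' → Run P M' k Q) → (u ≡ v → ∀ {M'} → Sy f t M' → Run P' M' k Q) →
   Run (neqP x y ⨾ flagP P P') M (4 + k) Q
  s-ifneq x y {u} {v} x< y< ex ey F h h' = exec-neq x y (cong₂ (λ a b → not (a ≡ᵇ b)) (trans (fr F x x<) ex) (trans (fr F y y<) ey)) ▸
   run-if (not (u ≡ᵇ v)) refl (λ e → h (λ { refl → case trans (sym e) (cong not (≡ᵇ-refl u)) of λ () }) (frame-setR 63 tt F))
    λ e → h' (≡ᵇ-true (not-false e)) (frame-setR 63 tt F)

  s-ifnz : ∀ x {u M P P' k Q} → T (x <ᵇ 50) → f x ≡ u → Sy f t M →
   (u ≢ 0 → ∀ {M'} → Sy f t M' → Run P M' k Q) → (u ≡ 0 → ∀ {M'} → Sy f t M' → Run P' M' k Q) →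
   Run (nzP x ⨾ flagP P P') M (4 + k) Q
  s-ifnz x {u} x< ex F h h' = exec-nz x (cong (λ a → not (a ≡ᵇ 0)) (trans (fr F x x<) ex)) ▸
   run-if (not (u ≡ᵇ 0)) refl (λ e → h (λ { refl → case e of λ () }) (frame-setR 63 tt F))
    λ e → h' (zero' u e) (frame-setR 63 tt F)
   where
   zero' : ∀ u → not (u ≡ᵇ 0) ≡ false → u ≡ 0
   zero' zero _ = refl

 -- Evaluation of clauses

 size : ℕ → ℕ
 size c = inp 0 (c ∷ [])

 lit : ℕ → ℕ → ℕ
 lit c j = inp 1 (c ∷ j ∷ [])

 literal-time : ℕ
 literal-time = 1 + (div-time + 3 + (div-time + 3 + (4 + (4 + (3 + (pow-time W + 3 + (div-time + 3 + (div-time + 3 + (4 + 6)))))))))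

 ev-time : ℕ → ℕ
 ev-time S = 3 + (1 + (7 + S * (literal-time + 7)))

 record Roomy : Set where
  field
   W<W : W < 2 ^ W
   inp<W : ∀ m a → inp m a < 2 ^ W
   4≤ : 4 ≤ 2 ^ W

 module _ (roomy : Roomy) where
  open Roomy roomy

  literal-run : ∀ {M c j lo hi val} b → c < 2 ^ w → j < 2 ^ w → hi ≤ W → val < 2 ^ W →
   reg M 12 ≡ 2 → reg M 30 ≡ W → reg M 16 ≡ c → reg M 38 ≡ j → reg M 22 ≡ lo → reg M 23 ≡ hi → reg M 24 ≡ val → reg M 25 ≡ bool b →
   Run literalP M literal-time (λ M' → FrameOn 36 (reg M [ 25 ↦ bool (b ∨ holds lo hi val (lit c j)) ]) (tbl M) (reg M') (tbl M')
                     × reg M' 38 ≡ j × reg M' 36 ≡ reg M 36)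
  literal-run {M} {c} {j} {lo} {hi} {val} b c< j< hi≤ val< e12 e30 e16 e38 e22 e23 e24 e25 =
   exec-rd1 39 16 38 e16 e38 c< j< refl (inp<W 1 _) ▸
   (s-div 44 39 12 tt tt W<W e30 refl e12 (inp<W 1 _) 4≤ (frame-refl {50} {reg M [ 39 ↦ code' ]}) ▸▸ λ G₁ →
    s-rem 45 39 12 tt tt W<W e30 refl e12 (inp<W 1 _) 4≤ G₁ ▸▸ λ G₂ →
    s-iflt 44 22 tt tt refl e22 G₂
     (λ h<lo G₃ → run-≤ (m≤m+n 1 _) (run-map (λ {M'} → unchanged-post {M'} (cong (_∧ ((h <ᵇ hi) ∧ (bool (bit (h ∸ lo) val) ≡ᵇ bool (odd code')))) (≤ᵇ-false h<lo)) refl refl K₂) (s-skip G₃)))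
     λ lo≤h G₃ → s-iflt 44 23 tt tt refl e23 G₃
      (λ h<hi G₄ →
       let k<W = ≤-<-trans (m∸n≤m h lo) (<-≤-trans h<hi hi≤) in
       s-sub 46 44 22 tt tt refl e22 lo≤h G₄ ▸▸ λ G₅ →
       s-pow 47 46 tt W<W e30 refl k<W G₅ ▸▸ λ G₆ →
       s-div 47 24 47 {{m^n≢0 2 (h ∸ lo)}} tt tt W<W e30 e24 refl val< (^-monoʳ-≤ 2 k<W) G₆ ▸▸ λ G₇ →
       s-rem 47 47 12 tt tt W<W e30 refl e12 (≤-<-trans (m/n≤m val (2 ^ (h ∸ lo)) {{m^n≢0 2 (h ∸ lo)}}) val<) 4≤ G₇ ▸▸ λ G₈ →
       s-ifneq 47 45 tt tt (value (h ∸ lo)) (%2≡odd code') G₈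
        (λ ne G₉ → run-≤ (m≤m+n 1 5) (run-map (λ {M'} → unchanged-post {M'} (inside lo≤h h<hi (≢⇒≡ᵇ ne)) refl refl K₈) (s-skip G₉)))
        (λ same G₉ → run-map (λ G → frame-trans (set-post (inside lo≤h h<hi (trans (cong (_≡ᵇ bool (odd code')) same) (≡ᵇ-refl (bool (odd code'))))))
           (frame-weaken (m≤m+n 36 14) G) , trans (fr G 38 tt) e38 , fr G 36 tt)
         (s-const 25 1 (<-≤-trans (s≤s (s≤s z≤n)) 4≤) G₉)))
      (λ hi≤h G₄ → run-≤ (m≤m+n 1 _) (run-map (λ {M'} → unchanged-post {M'} (trans (cong (λ z → (lo ≤ᵇ h) ∧ (z ∧ (bool (bit (h ∸ lo) val) ≡ᵇ bool (odd code')))) (<ᵇ-false hi≤h)) (∧-zeroʳ (lo ≤ᵇ h))) refl refl K₂) (s-skip G₄))))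
   where
   code' = lit c j
   h = half code'
   f₂ f₈ : ℕ → ℕ
   f₂ = ((reg M [ 39 ↦ code' ]) [ 44 ↦ code' / 2 ]) [ 45 ↦ code' % 2 ]
   f₈ = (((f₂ [ 46 ↦ h ∸ lo ]) [ 47 ↦ 2 ^ (h ∸ lo) ]) [ 47 ↦ _/_ val (2 ^ (h ∸ lo)) {{m^n≢0 2 (h ∸ lo)}} ]) [ 47 ↦ (_/_ val (2 ^ (h ∸ lo)) {{m^n≢0 2 (h ∸ lo)}}) % 2 ]
   K₂ : FrameOn 36 (reg M) (tbl M) f₂ (tbl M)
   K₂ = frame-setR 45 tt (frame-setR 44 tt (frame-setR 39 tt frame-refl))
   K₈ : FrameOn 36 (reg M) (tbl M) f₈ (tbl M)
   K₈ = frame-setR 47 tt (frame-setR 47 tt (frame-setR 47 tt (frame-setR 46 tt K₂)))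
   value : ∀ k → (_/_ val (2 ^ k) {{m^n≢0 2 k}}) % 2 ≡ bool (bit k val)
   value k = trans (%2≡odd (_/_ val (2 ^ k) {{m^n≢0 2 k}})) (cong bool (trans (cong odd (sym (halves-/ k val))) (sym (bit≡odd-halves k val))))
   inside : ∀ {r} → lo ≤ h → h < hi → (bool (bit (h ∸ lo) val) ≡ᵇ bool (odd code')) ≡ r → holds lo hi val code' ≡ r
   inside l g e = trans (cong₂ (λ p q → p ∧ (q ∧ (bool (bit (h ∸ lo) val) ≡ᵇ bool (odd code')))) (T⇒≡true (≤⇒≤ᵇ l)) (T⇒≡true (<⇒<ᵇ g))) e
   set-post : holds lo hi val code' ≡ true → FrameOn 36 (reg M [ 25 ↦ bool (b ∨ holds lo hi val code') ]) (tbl M) (f₈ [ 25 ↦ 1 ]) (tbl M)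
   set-post e = subst (λ v → FrameOn 36 (reg M [ 25 ↦ bool v ]) (tbl M) (f₈ [ 25 ↦ 1 ]) (tbl M)) (sym (trans (cong (b ∨_) e) (∨-zeroʳ b))) (frame-cong 25 1 K₈)
   unchanged-post : ∀ {M' g} → holds lo hi val code' ≡ false → g 38 ≡ reg M 38 → g 36 ≡ reg M 36 → FrameOn 36 (reg M) (tbl M) g (tbl M) → Sy g (tbl M) M' →
    FrameOn 36 (reg M [ 25 ↦ bool (b ∨ holds lo hi val code') ]) (tbl M) (reg M') (tbl M') × reg M' 38 ≡ j × reg M' 36 ≡ reg M 36
   unchanged-post e g38 g36 K S = frame-base 25 (trans e25 (cong bool (sym (trans (cong (b ∨_) e) (∨-identityʳ b))))) (frame-trans K (frame-weaken (m≤m+n 36 14) S))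
    , trans (fr S 38 tt) (trans g38 e38) , trans (fr S 36 tt) g36

  ev-run : ∀ {M c lo hi val S} → c < 2 ^ w → size c ≤ S → hi ≤ W → val < 2 ^ W →
   reg M 12 ≡ 2 → reg M 30 ≡ W → reg M 16 ≡ c → reg M 22 ≡ lo → reg M 23 ≡ hi → reg M 24 ≡ val →
   Run evP M (ev-time S) (λ M' → FrameOn 36 (reg M [ 25 ↦ bool (partSat size lit lo hi val c) ]) (tbl M) (reg M') (tbl M'))
  ev-run {M} {c} {lo} {hi} {val} {S} c< S≤ hi≤ val< e12 e30 e16 e22 e23 e24 =
   exec-zero 25 ▸ exec-rd0 36 16 e16 c< refl (inp<W 0 _) ▸
   run-≤ (+-monoʳ-≤ 7 (*-monoˡ-≤ (literal-time + 7) S≤))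
    (run-for literal-time Inv (inp<W 0 _) (λ ()) (λ ()) (λ ()) (frame-setR 63 tt) (frame-setR 38 tt) body
     (frame-setR 36 tt frame-refl) refl)
   where
   p : ℕ → Bool
   p j = holds lo hi val (lit c j)
   Inv : ℕ → Mid → Set
   Inv k M' = FrameOn 36 (reg M [ 25 ↦ bool (anyBelow k p) ]) (tbl M) (reg M') (tbl M')
   body : ∀ {k M'} → k < size c → reg M' 38 ≡ k → reg M' 36 ≡ size c → Inv k M' →
    Run literalP M' literal-time (λ M'' → Inv (suc k) M'' × reg M'' 38 ≡ k × reg M'' 36 ≡ size c)
   body {k} {M'} k< e38 e36 F = run-map (λ { (G , g38 , g36) →
     frame-collapse 25 (frame-trans (frame-cong 25 _ F) G) , g38 , trans g36 e36 })
    (literal-run (anyBelow k p) c< (<-trans k< (inp< 0 _)) hi≤ val< (trans (fr F 12 tt) e12) (trans (fr F 30 tt) e30) (trans (fr F 16 tt) e16) e38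
     (trans (fr F 22 tt) e22) (trans (fr F 23 tt) e23) (trans (fr F 24 tt) e24) (fr F 25 tt))

 -- Writing a graph into the simulated memory

 record Same30 (f g : ℕ → ℕ) : Set where
  constructor same
  field
   s30 : g 30 ≡ f 30
   s31 : g 31 ≡ f 31
   s32 : g 32 ≡ f 32
   s33 : g 33 ≡ f 33
   s34 : g 34 ≡ f 34
   s35 : g 35 ≡ f 35

 world-sy : ∀ {V ph M M' node len s f} → World V ph M node len s → Same30 (reg M) f → FrameOn 36 f (tbl M) (reg M') (tbl M') → World V ph M' node len s
 world-sy {M' = mid _ _ _} (world tr vw nx (constants c0 c1 c2 c3) e34 bd) (same s0 s1 s2 s3 s4 s5) F with ft F
 ... | refl = world tr vw (trans (cong suc (trans (fr F 35 tt) s5)) nx)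
  (constants (trans (fr F 30 tt) (trans s0 c0)) (trans (fr F 31 tt) (trans s1 c1)) (trans (fr F 32 tt) (trans s2 c2)) (trans (fr F 33 tt) (trans s3 c3)))
  (trans (fr F 34 tt) (trans s4 e34)) bd

 world-≗ : ∀ {V ph M node len s s'} → (∀ r → regs s r ≡ regs s' r) → (∀ a → addrs s a ≡ addrs s' a) → (∀ m a → mem s m a ≡ mem s' m a) →
  (∀ i → coins s' i ≡ false) → World V ph M node len s → World V ph M node len s'
 world-≗ er ea em ec (world tr vw nx cs e34 bd) = world tr (view-≗ er ea em vw) nx cs e34 (bounded-≗ er em ec bd)

 -- What the graph builder preserves: all rows but row 0 of the simulated
 -- machine, the table of edges and the driver's registers.
 record Kept (M M' : Mid) : Set where
  constructor kept
  field
   krows : ∀ c {ph} i → ph ≢ 0 → tbl M' (code c) ph i ≡ tbl M (code c) ph i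
   kedge : ∀ x y → tbl M' 1 x y ≡ tbl M 1 x y
   kregs : RFrame 27 M M'
   k28 : reg M' 28 ≡ reg M 28

 kept-trans : ∀ {M M' M''} → Kept M M' → Kept M' M'' → Kept M M''
 kept-trans (kept a b c d) (kept a' b' c' d') = kept (λ q i n → trans (a' q i n) (a q i n)) (λ x y → trans (b' x y) (b x y)) (rframe-trans c c') (trans d' d)

 record Grown (V : ℕ) (M₀ M : Mid) (node : ℕ → List ℕ) (len : ℕ) (s : State) (xs : List ℕ) : Set where
  constructor grown
  field
   {node'} : ℕ → List ℕ
   {len'} : ℕ
   gw : World V 0 M node' len' s
   gext : Extends node len node' len'
   glen : len' ≤ suc len
   g< : reg M 42 < len'
   g≡ : node' (reg M 42) ≡ xs
   gkept : Kept M₀ M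

 run-grow : ∀ {V M node len s i x} → World V 0 M node len s → reg M 40 ≡ i → reg M 41 ≡ x → i < len → len < 2 ^ W →
  Run childP M 12 (λ M' → Grown V M M' node len s (node i ∷ʳ x))
 run-grow {M = M} w e40 e41 i< len< = run-map (λ (allocated tr' nx' c< c≡ ext l≤ cells≡ others≡ f) →
   grown (world tr' (view-extend (World.tr w) (Trie.inj tr') ext (λ c i → cells≡ c _ i) (λ c i → cells≡ c _ i) (World.vw w)) nx'
       (constants-rframe 35 tt f (World.cs w)) (trans (rf f 34 tt) (World.e34 w)) (World.bd w))
    ext l≤ c< c≡ (kept (λ c i _ → cells≡ c _ i) (λ x y → others≡ 1 λ ()) (rframe-weaken 27 tt f) (rf f 28 tt)))
  (run-child (World.tr w) (World.nx w) e40 e41 i< len<)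

 kept-sy : ∀ {M M' f} → FrameOn 36 f (tbl M) (reg M') (tbl M') → RFrameOn 27 (reg M) f → f 28 ≡ reg M 28 → Kept M M'
 kept-sy {M' = mid _ _ _} F K e with ft F
 ... | refl = kept (λ _ _ _ → refl) (λ _ _ → refl) (rframe-trans K (rframe-weaken 27 tt (frame-rframe F))) (trans (fr F 28 tt) e)

 end-time : ℕ → ℕ
 end-time k = 3 + (3 * suc k + (12 + (3 + (3 + (div-time + 3 + 7)))))

 module _ {V : ℕ} (2V≤ : suc (V + V) ≤ W) (W<W : W < 2 ^ W) where

  run-end : ∀ {M node len s} k src {i x} → T (src <ᵇ 26) → k < 2 ^ W → World V 0 M node len s → reg M 26 ≡ i → i < len → reg M src ≡ x → x < 2 ^ W → len < 2 ^ W →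
   Run (endP k src) M (end-time k) (λ M' → ∃[ node' ] ∃[ len' ] (World V 0 M' node' len' (record s { mem = put (mem s) 0 (node i ∷ʳ k) (wrap V x) })
    × Extends node len node' len' × len' ≤ suc len × Kept M M'))
  run-end {M} {node} {len} {s} k src {i} {x} src< k< w e26 i< ex x< len< =
   s-copy 40 26 tt e26 (frame-refl {50} {reg M}) ▸▸ λ {M₁} G₁ →
   s-const 41 k k< G₁ ▸▸ λ {M₂} G₂ →
   let F₂ = frame-weaken (m≤m+n 36 14) G₂
       w₂ = world-sy {M' = M₂} w (same refl refl refl refl refl refl) F₂
       k₂ = kept-sy {M' = M₂} F₂ (rframe-setR 41 tt (rframe-setR 40 tt rframe-refl)) refl
   in run-grow w₂ (fr G₂ 40 tt) (fr G₂ 41 tt) i< len< ▸▸ λ {M₃} (grown {node'} {len'} w₃ ext l≤ c< c≡ k₃) →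
   s-copy 27 42 tt refl (frame-refl {50} {reg M₃}) ▸▸ λ {M₄} G₄ →
   let src-eq = trans (rf (Kept.kregs (kept-trans k₂ k₃)) src (T-trans {src} {26} {27} src< tt)) ex
       27≢src : 27 ≢ src
       27≢src = λ { refl → src< }
       src<50 = T-trans {src} {26} {50} src< tt
   in s-copy 42 src src<50 (trans (↦-other (reg M₃) 27≢src) src-eq) G₄ ▸▸ λ {M₅} G₅ →
   let F₅ = frame-weaken (m≤m+n 36 14) G₅
       w₅ = world-sy {M' = M₅} w₃ (same refl refl refl refl refl refl) F₅
       k₅ = kept-sy {M' = M₅} F₅ (rframe-setR 42 tt (rframe-setR 27 tt rframe-refl)) refl
   in run-mod 2V≤ W<W (World.cs w₅) (fr G₅ 42 tt) x< ▸▸ λ {M₆} (e42 , H) →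
   let w₆ , _ = world-regs {M' = M₆} (ft H) (rframe-weaken 36 tt (frame-rframe H)) w₅
       k₆ = kept-sy {M₅} {M₆} (frame-weaken (m≤m+n 36 6) H) rframe-refl refl
       e27 = trans (fr H 27 tt) (fr G₅ 27 tt)
   in run-map (λ {M₇} (te , f) →
      let w₇ , ev₇ = world-put (memC 0) _ _ w₆ te (rframe-weaken 36 tt f) (λ _ _ → c<)
                 (view-setMem 0 _ (node i ∷ʳ k) _ (World.tr w₆) c< c≡ (World.vw w₆))
                 (bounded-put 0 (node i ∷ʳ k) (wrap< V x) (World.bd w₆))
      in node' , len' , w₇ , ext , l≤ , kept-trans k₂ (kept-trans k₃ (kept-trans k₅ (kept-trans k₆
        (kept (Evolved.rows ev₇) (λ x' y' → trans (cong (λ t → t 1 x' y') te) (set-other {code (memC 0)} {0} {reg M₃ 42} {suc (wrap V x)} {tbl M₆} λ ()))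
         (rframe-weaken 27 tt f) (rf f 28 tt))))))
     (run-put (memC 0) 27 42 (inj₁ tt) (World.e34 w₆) e27 e42 (<-≤-trans (s≤s (wrap< V x)) (≡≤ (+-comm 1 (2 ^ V)) (≤-trans (+-monoʳ-≤ (2 ^ V) (0<2^ V)) (≡≤ (cong (2 ^ V +_) (sym (+-identityʳ (2 ^ V)))) (2P≤ {V} 2V≤ W<W))))))

 world-edge : ∀ {V ph M M' node len s} → World V ph M node len s → (∀ t x y → t ≢ 1 → tbl M' t x y ≡ tbl M t x y) → Same30 (reg M) (reg M') → World V ph M' node len s
 world-edge {M' = M'} (world tr vw nx (constants c0 c1 c2 c3) e34 bd) e (same s0 s1 s2 s3 s4 s5) = world (trie-≗ e tr)
  (view-extend tr (Trie.inj tr) (extends ≤-refl λ _ → refl) (λ c i → e (code c) _ i λ ()) (λ c i → e (code c) 0 i λ ()) vw)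
  (trans (cong suc s5) nx) (constants (trans s0 c0) (trans s1 c1) (trans s2 c2) (trans s3 c3)) (trans s4 e34) bd

 -- Edge number i adds nodes for the addresses (i), (i , 0) and (i , 1), whence the factor 3. A
 -- nonzero entry in table 1 marks an edge as present.
 record EdgeWorld (V n : ℕ) (M : Mid) (Es : List Pair) : Set where
  constructor edgeWorld
  field
   {enode} : ℕ → List ℕ
   {elen} : ℕ
   ew : World V 0 M enode elen (edgeState V Es)
   elen≤ : elen ≤ suc (3 * length Es)
   erows : ∀ c {ph} i → ph ≢ 0 → tbl M (code c) ph i ≡ 0
   eold : ∀ {x y} → (x , y) ∈ Es → tbl M 1 x y ≢ 0
   enew : ∀ {x y} → tbl M 1 x y ≢ 0 → (x , y) ∈ Es
   ecount : reg M 28 ≡ length Es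
   euniq : Unique Es
   erange : All (InRange n) Es

 emit-time : ℕ
 emit-time = 1 + (3 + suc (6 + (1 + (3 + (3 + (12 + (3 + (end-time 0 + (end-time 1 + 3)))))))))

 module _ {V n : ℕ} {{_ : NonZero n}} (2V≤ : suc (V + V) ≤ W) (W<W : W < 2 ^ W) (room : 4 + 3 * (n * n) < 2 ^ W) where

  private
   n≤n² : n ≤ n * n
   n≤n² = m≤m*n n n

   n<2^W : n < 2 ^ W
   n<2^W = ≤-<-trans (≤-trans n≤n² (≤-trans (m≤m+n (n * n) _) (m≤n+m (3 * (n * n)) 4))) room

   1<2^W' : 1 < 2 ^ W
   1<2^W' = ≤-<-trans (m≤m+n 1 _) room

  run-emit : ∀ {M Es x y} → EdgeWorld V n M Es → reg M 20 ≡ x → reg M 21 ≡ y → x < n → y < n →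
   Run emitP M emit-time (λ M' → EdgeWorld V n M' (insertEdge (x , y) Es) × RFrame 26 M M')
  run-emit {M} {Es} {x} {y} E@(edgeWorld {node} {len} w len≤ rows old new count uniq range) e20 e21 x< y< =
   exec-ld 42 1 20 21 {v = tbl M 1 x y} (λ ()) (λ ()) (cong₂ (tbl M 1) e20 e21) ▸ found (tbl M 1 x y) refl
   where
   found : ∀ v → tbl M 1 x y ≡ v → Run (nzP 42 ⨾ flagP skip (constP 42 1 ⨾ stP 1 20 21 42 ⨾ zeroP 40 ⨾ copyP 41 28 ⨾ childP ⨾ copyP 26 42 ⨾ endP 0 20 ⨾ endP 1 21 ⨾ incP 28))
    (setR 42 (tbl M 1 x y) M) (3 + suc (6 + (1 + (3 + (3 + (12 + (3 + (end-time 0 + (end-time 1 + 3)))))))))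
    (λ M' → EdgeWorld V n M' (insertEdge (x , y) Es) × RFrame 26 M M')
   found (suc v) ev with (x , y) ∈? Es
   ... | no n∈ = ⊥-elim (n∈ (new λ z → case trans (sym ev) z of λ ()))
   ... | yes _ = exec-nz 42 {b = true} (cong (λ u → not (u ≡ᵇ 0)) ev) ▸
    run-if true refl (λ _ → run-≤ (s≤s z≤n) (exec-skip ,,
     (edgeWorld (world-sy w (same refl refl refl refl refl refl) (frame-setR 63 tt (frame-setR 42 tt frame-refl))) len≤ rows old new count uniq range
     , rframe-setR 63 tt (rframe-setR 42 tt rframe-refl)))) (λ ())
   found zero ev with (x , y) ∈? Es
   ... | yes ∈Es = ⊥-elim (old ∈Es ev)
   ... | no n∈ = exec-nz 42 {b = false} (cong (λ u → not (u ≡ᵇ 0)) ev) ▸ run-if false refl (λ ()) λ _ →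
    exec-const 42 1 1<2^W' ▸ exec-st 1 20 21 42 ▸
    exec-zero 40 ▸ exec-copy 41 28 ▸
    (run-grow {M = M₁} w₁ refl refl (Trie.0<len (World.tr w)) len<₀ ▸▸ λ {M₂} (grown {node₂} {len₂} w₂ ext₂ l₂ c< c≡ k₂) →
     exec-copy 26 42 ▸
     (let M₃ = setR 26 (reg M₂ 42) (setF false M₂)
          w₃ = world-sy {M' = M₃} w₂ (same refl refl refl refl refl refl) (frame-cong 26 (reg M₂ 42) frame-refl)
     in run-end 2V≤ W<W {M₃} 0 20 tt (<-trans (s≤s z≤n) 1<2^W') w₃ refl c< (trans (rf (Kept.kregs k₂) 20 tt) e20) (<-trans x< n<2^W) (len< l₂ (m≤m+n 1 2)) ▸▸
     λ {M₄} (node₄ , len₄ , w₄ , ext₄ , l₄ , k₄) →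
     run-end 2V≤ W<W {M₄} 1 21 tt 1<2^W' w₄ refl (<-≤-trans (subst (_< len₂) (sym (rf (Kept.kregs k₄) 26 tt)) c<) (Extends.len≤ ext₄))
      (trans (rf (Kept.kregs k₄) 21 tt) (trans (rf (Kept.kregs k₂) 21 tt) e21)) (<-trans y< n<2^W) (len< (≤-trans l₄ (s≤s l₂)) (m≤m+n 2 1)) ▸▸
     λ {M₅} (node₅ , len₅ , w₅ , ext₅ , l₅ , k₅) →
     let e28 = trans (Kept.k28 k₅) (trans (Kept.k28 k₄) (trans (Kept.k28 k₂) count))
         key = trans c≡ (cong (_∷ʳ reg M 28) (Trie.root (World.tr w)))
         key₄ = trans (cong node₄ (rf (Kept.kregs k₄) 26 tt)) (trans (Extends.node≡ ext₄ c<) key)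
     in exec-inc 28 e28 (≤-<-trans (≤-trans (s≤s ≤n²) (≤-trans (s≤s (m≤m+n (n * n) _)) (m≤n+m (suc (3 * (n * n))) 3))) room) ,,
      (edgeWorld {enode = node₅} {elen = len₅}
       (world-≗ (λ _ → refl) (λ _ → refl) (mem≡ (node₂ (reg M₂ 42) ∷ʳ 0) (node₄ (reg M₄ 26) ∷ʳ 1)
         (trans (cong (_∷ʳ 0) key) (cong (λ i → i ∷ 0 ∷ []) count)) (trans (cong (_∷ʳ 1) key₄) (cong (λ i → i ∷ 1 ∷ []) count))) (λ _ → refl)
        (world-sy w₅ (same refl refl refl refl refl refl) (frame-cong 28 _ frame-refl)))
       (len-bound len₅ (≤-trans l₅ (s≤s (≤-trans l₄ (s≤s l₂)))))
       (λ c i n → trans (Kept.krows k₅ c i n) (trans (Kept.krows k₄ c i n) (trans (Kept.krows k₂ c i n) (trans (edge-other (code c) _ i (λ ())) (rows c i n)))))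
       (λ {x'} {y'} p z → old₁ p (trans (sym (edge≡ {M₂} {M₄} {M₅} k₂ k₄ k₅ x' y')) z))
       (λ {x'} {y'} z → new₁ (λ z' → z (trans (edge≡ {M₂} {M₄} {M₅} k₂ k₄ k₅ x' y') z')))
       (trans refl (sym (trans (length-++ Es) (+-comm (length Es) 1))))
       (unique-∷ʳ uniq n∈) (All.++⁺ range ((x< , y<) ∷ [])) ,
      rframe-setR 28 tt (rframe-trans rf₁ (rframe-trans (rframe-weaken 26 tt (Kept.kregs k₂)) (rframe-trans (rframe-setR 26 tt rframe-refl)
       (rframe-trans (rframe-weaken 26 tt (Kept.kregs k₄)) (rframe-weaken 26 tt (Kept.kregs k₅)))))))))
    where
    U₁ = set 1 (reg M 20) (reg M 21) 1 (tbl M)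
    M₁ = setR 41 (reg M 28) (setF false (setR 40 0 (setF false (setT 1 (reg M 20) (reg M 21) 1 (setR 42 1 (setF false (setR 63 0 (setF false (setR 42 (tbl M 1 x y) M)))))))))
    edge-other : ∀ t ph i → t ≢ 1 → U₁ t ph i ≡ tbl M t ph i
    edge-other t ph i t≢1 = set-other {1} {reg M 20} {reg M 21} {1} {tbl M} λ e → ⊥-elim (t≢1 (sym e))
    w₁ : World V 0 M₁ node len (edgeState V Es)
    w₁ = world-edge {M' = M₁} w edge-other (same refl refl refl refl refl refl)
    rf₁ : RFrame 26 M M₁
    rf₁ = rframe-setR 41 tt (rframe-setR 40 tt (rframe-setR 42 tt (rframe-setR 63 tt (rframe-setR 42 tt rframe-refl))))
    ≤n² : length Es ≤ n * n
    ≤n² = edges-bound n Es uniq range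
    len< : ∀ {l k} → l ≤ k + len → k ≤ 3 → l < 2 ^ W
    len< {l} {k} l≤ k≤ = ≤-<-trans (≤-trans l≤ (≤≡ (+-mono-≤ k≤ (≤-trans len≤ (s≤s (*-monoʳ-≤ 3 ≤n²)))) (+-suc 3 (3 * (n * n))))) room
    len<₀ : len < 2 ^ W
    len<₀ = len< {k = 0} ≤-refl z≤n
    edge≡ : ∀ {M₂ M₄ M₅} → Kept M₁ M₂ → Kept (setR 26 (reg M₂ 42) (setF false M₂)) M₄ → Kept M₄ M₅ → ∀ x' y' → tbl M₅ 1 x' y' ≡ U₁ 1 x' y'
    edge≡ k₂ k₄ k₅ x' y' = trans (Kept.kedge k₅ x' y') (trans (Kept.kedge k₄ x' y') (Kept.kedge k₂ x' y'))
    U₁-same : U₁ 1 x y ≡ 1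
    U₁-same = trans (cong₂ (U₁ 1) (sym e20) (sym e21)) (set-same 1 (reg M 20) (reg M 21) 1 (tbl M))
    U₁-other : ∀ {x' y'} → (x , y) ≢ (x' , y') → U₁ 1 x' y' ≡ tbl M 1 x' y'
    U₁-other n = set-other {1} {reg M 20} {reg M 21} {1} {tbl M} λ _ a b → n (cong₂ _,_ (trans (sym e20) a) (trans (sym e21) b))
    old₁ : ∀ {x' y'} → (x' , y') ∈ Es ∷ʳ (x , y) → U₁ 1 x' y' ≢ 0
    old₁ p z with ∈-++⁻ Es p
    ... | inj₂ (here refl) = case trans (sym U₁-same) z of λ ()
    ... | inj₁ q = old q (trans (sym (U₁-other λ { refl → n∈ q })) z)
    new₁ : ∀ {x' y'} → U₁ 1 x' y' ≢ 0 → (x' , y') ∈ Es ∷ʳ (x , y)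
    new₁ {x'} {y'} z with ≡-dec _≟_ _≟_ (x , y) (x' , y')
    ... | yes refl = ∈-++⁺ʳ Es (here refl)
    ... | no n = ∈-++⁺ˡ (new λ z' → z (trans (U₁-other n) z'))
    mem≡ : ∀ a b → a ≡ length Es ∷ 0 ∷ [] → b ≡ length Es ∷ 1 ∷ [] → ∀ m c →
     put (put (λ m a → wrap V (edgeMemory Es m a)) 0 a (wrap V x)) 0 b (wrap V y) m c ≡ wrap V (edgeMemory (Es ∷ʳ (x , y)) m c)
    mem≡ a b refl refl m c = edgeMemory-∷ʳ V Es x y m c
    len-bound : ∀ l → l ≤ 3 + len → l ≤ suc (3 * length (Es ∷ʳ (x , y)))
    len-bound l l≤ = ≤-trans l≤ (≤≡ (+-monoʳ-≤ 3 len≤) (trans (lem (length Es))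
     (cong (λ k → suc (3 * k)) (sym (trans (length-++ Es) (+-comm (length Es) 1))))))
     where
     lem : ∀ k → 3 + suc (3 * k) ≡ suc (3 * suc k)
     lem = solve-∀

 -- Building the graph of the reduction

 record Setup : Set where
  field
   Φ a A B R L V : ℕ
   {{B≢0}} : NonZero B
   {{n≢0}} : NonZero (R * B)
   roomy : Roomy
   A<B : A < B
   d≤B : d ≤ B
   L<R : 3 + L < R
   2a≤N : a + a ≤ N
   A≡ : A ≡ 2 ^ a
   N≤W : N ≤ W
   2V≤ : suc (V + V) ≤ W
   room : 4 + 3 * ((R * B) * (R * B)) < 2 ^ W
   size≤ : ℕ
   size-bound : ∀ c → c < d → size c ≤ size≤

  n : ℕ
  n = R * B

  n<2^W : n < 2 ^ W
  n<2^W = ≤-<-trans (≤-trans (m≤m*n n n) (≤-trans (m≤m+n (n * n) _) (m≤n+m (3 * (n * n)) 4))) room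

  open Gadget A B R L d A<B d≤B L<R (λ s c → not (partSat size lit 0 a s c)) (λ s c → not (partSat size lit a (a + a) s c)) public

  -- The contents of the registers 0 to 14.
  environment : ℕ → ℕ
  environment = at 0 (Φ ∷ N ∷ d ∷ a ∷ a + a ∷ A ∷ B ∷ n ∷ (3 + L) * B + A ∷ B + B ∷ B + B + B ∷ 3 + L ∷ 2 ∷ 3 + 2 * L ∷ 3 ∷ [])

  Env : Mid → Set
  Env M = RFrameOn 15 environment (reg M)

  isTail : ℕ → Bool
  isTail y = not (y / B <ᵇ 3) ∧ (not (3 + L <ᵇ y / B) ∧ not (A <ᵇ y % B))

  -- These lists follow the loops of `buildP`, so that the memory built can be described by
  -- `insertEdges`.
  rawC : ℕ → ℕ → List Pair
  rawC s c = unless (partSat size lit 0 a s c) (s , vtx 1 c) ++ unless (partSat size lit a (a + a) s c) (vtx 2 c , vtx 3 s)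

  rawU rawY rawD : ℕ → List Pair
  rawU s = (s , vtx 3 A) ∷ forL d (rawC s)
  rawY y = if isTail y then (if y / B ≡ᵇ 3 then [] else ((y ∸ B , y) ∷ [])) else ((vtx (3 + L) A , y) ∷ [])
  rawD c = (vtx 1 c , vtx 2 c) ∷ []

  raw : Bool → List Pair
  raw dense = forL A rawU ++ (forL n rawY ++ (if dense then forL d rawD else []))

 module Setting (S : Setup) where
  open Setup S
  open Roomy roomy

  U : ℕ
  U = A

  record Built (M : Mid) (Es : List Pair) : Set where
   constructor built
   field
    env : Env M
    edw : EdgeWorld V n M Es

  open Built public

  private
   B≤n : B ≤ n
   B≤n = m≤n*m B R {{>-nonZero (≤-<-trans z≤n L<R)}}

   <R : ∀ {r} → r ≤ 3 + L → r < R
   <R r≤ = ≤-<-trans r≤ L<R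

   c<B : ∀ {c} → c < d → c < B
   c<B c< = <-≤-trans c< d≤B

   W30 : ∀ {M Es} → Built M Es → reg M 30 ≡ W
   W30 b = c30 (World.cs (EdgeWorld.ew (edw b)))

  built-quiet : ∀ {M M' Es} → Built M Es → Quiet M M' → Built M' Es
  built-quiet {M} {M'@(mid _ _ _)} (built env (edgeWorld w l rows old new count uq rg)) (quietly (keepOn k) refl) =
   built (rframe λ r r< → trans (k r (<20⇒quiet r (T-trans {r} {15} {20} r< tt))) (rf env r r<))
    (edgeWorld (world-sy {M' = M'} w (same (k 30 tt) (k 31 tt) (k 32 tt) (k 33 tt) (k 34 tt) (k 35 tt)) frame-refl) l rows old new (trans (k 28 tt) count) uq rg)

  Emits : Mid → List Pair → List Pair → Mid → Set
  Emits M Es es M' = Built M' (insertEdges es Es) × RFrame 20 M M'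

  quiet-20 : ∀ {M M'} → Quiet M M' → RFrame 20 M M'
  quiet-20 q = rframe λ r r< → kp (qr q) r (<20⇒quiet r r<)

  run-edge : ∀ {P M Es x y c} → Built M Es → Run P M c (λ M' → Quiet M M' × reg M' 20 ≡ x × reg M' 21 ≡ y) → x < n → y < n →
   Run (P ⨾ emitP) M (c + emit-time) (Emits M Es ((x , y) ∷ []))
  run-edge b r x< y< = r ▸▸ λ {M₁} (q , e20 , e21) →
   run-map (λ (w , f) → built (rframe-trans (env (built-quiet b q)) (rframe-weaken 15 tt f)) w , rframe-trans (quiet-20 q) (rframe-weaken 20 tt f))
    (run-emit 2V≤ W<W room (edw (built-quiet {M' = M₁} b q)) e20 e21 x< y<)

  emits-trans : ∀ {M M' M'' Es es es'} → Emits M Es es M' → Emits M' (insertEdges es Es) es' M'' → Emits M Es (es ++ es') M''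
  emits-trans {M'' = M''} {Es} {es} {es'} (b , f) (b' , f') = subst (Built M'') (sym (insertEdges-++ es es' Es)) b' , rframe-trans f f'

  Args : ℕ → ℕ → ℕ → Mid → Mid → Set
  Args lo hi val M M' = Quiet M M' × reg M' 22 ≡ lo × reg M' 23 ≡ hi × reg M' 24 ≡ val

  run-ev : ∀ {args M lo hi val c t} → Env M → reg M 30 ≡ W → reg M 16 ≡ c → c < d → hi ≤ W → val < 2 ^ W → Run args M t (Args lo hi val M) →
   Run (args ⨾ evP) M (t + ev-time size≤) (λ M' → Quiet M M' × reg M' 25 ≡ bool (partSat size lit lo hi val c))
  run-ev {c = c} env e30 e16 c< hi≤ val< r = r ▸▸ λ {M₁} (q , e22 , e23 , e24) →
   run-map (λ F → quiet-trans q (quiet-sy F (keep-setR 25 tt keep-refl)) , fr F 25 tt)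
    (ev-run roomy {M₁} (<-trans c< d<) (size-bound c c<) hi≤ val< (trans (kp (qr q) 12 tt) (rf env 12 tt)) (trans (kp (qr q) 30 tt) e30) (trans (kp (qr q) 16 tt) e16) e22 e23 e24)

  bool≡0 : ∀ {b} → bool b ≡ 0 → b ≡ false
  bool≡0 {false} _ = refl
  bool≢0 : ∀ {b} → bool b ≢ 0 → b ≡ true
  bool≢0 {true} _ = refl
  bool≢0 {false} n = ⊥-elim (n refl)

  run-cond : ∀ {args edge M Es lo hi val c x y t t'} → Built M Es → reg M 16 ≡ c → c < d → hi ≤ W → val < 2 ^ W → Run args M t (Args lo hi val M) →
   (∀ {M₁} → Quiet M M₁ → Built M₁ Es → Run edge M₁ t' (λ M' → Quiet M₁ M' × reg M' 20 ≡ x × reg M' 21 ≡ y)) → x < n → y < n →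
   Run (condEmitP args edge) M ((t + ev-time size≤) + (4 + (1 + (t' + emit-time)))) (Emits M Es (unless (partSat size lit lo hi val c) (x , y)))
  run-cond {args} {edge} {M} {Es} {lo} {hi} {val} {c} {x} {y} {t} {t'} b e16 c< hi≤ val< r edge-run x< y< =
   (run-ev (env b) (W30 b) e16 c< hi≤ val< r ▸▸ λ {M₁} (q , e25) →
    let b₁ = built-quiet {M' = M₁} b q in
    s-ifnz 25 tt e25 (frame-refl {50} {reg M₁})
     (λ ne {M₂} G → run-≤ (s≤s z≤n) (exec-skip ,, subst (λ p → Emits M Es (unless p (x , y)) M₂) (sym (bool≢0 ne))
      (built-quiet b (quiet-trans q (quiet₁ {M₁} {M₂} G)) , quiet-20 (quiet-trans q (quiet₁ {M₁} {M₂} G)))))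
     (λ z {M₂} G → run-≤ (n≤1+n _) (run-map (λ {M₃} (b₃ , f₃) → subst (λ p → Emits M Es (unless p (x , y)) M₃) (sym (bool≡0 z)) (b₃ , rframe-trans (quiet-20 (quiet-trans q (quiet₁ {M₁} {M₂} G))) f₃))
      (run-edge (built-quiet {M' = M₂} b (quiet-trans q (quiet₁ {M₁} {M₂} G))) (edge-run (quiet-trans q (quiet₁ {M₁} {M₂} G)) (built-quiet b (quiet-trans q (quiet₁ {M₁} {M₂} G)))) x< y<))))
   where
   quiet₁ : ∀ {M₁ M₂} → Sy (reg M₁) (tbl M₁) M₂ → Quiet M₁ M₂
   quiet₁ {M₁} {M₂} G = quiet-sy {M₁} {M₂} (frame-weaken (m≤m+n 36 14) G) keep-refl

  free : ℕ → Bool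
  free r = not ((r <ᵇ 15) ∨ ((28 ≤ᵇ r) ∧ (r <ᵇ 36)))

  built-setR : ∀ {M Es} z {v b} → T (free z) → Built M Es → Built (setR z v (setF b M)) Es
  built-setR {M} {Es} z {v} {b} z∉ (built env (edgeWorld w l rows old new count uq rg)) =
   built (rframe λ r r< → trans (k r (protect r r<)) (rf env r r<))
    (edgeWorld (world-sy {M' = setR z v (setF b M)} w (same (k 30 tt) (k 31 tt) (k 32 tt) (k 33 tt) (k 34 tt) (k 35 tt)) frame-refl) l rows old new (trans (k 28 tt) count) uq rg)
   where
   kept-free : ℕ → Bool
   kept-free r = (r <ᵇ 15) ∨ ((28 ≤ᵇ r) ∧ (r <ᵇ 36))
   protect : ∀ r → T (r <ᵇ 15) → T (kept-free r)
   protect r h with r <ᵇ 15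
   ... | true = tt
   k : ∀ r → T (kept-free r) → (reg M [ z ↦ v ]) r ≡ reg M r
   k = kp (keep-setR {kept-free} z z∉ keep-refl)

  -- A loop changes no register below its own counter. So the inner loop with counter 16 preserves
  -- the outer counter 15 and the parameters.
  run-emits-for : ∀ {i lim P M Es k} c (f : ℕ → List Pair) → T (free i) → T (lim <ᵇ 15) → T (15 ≤ᵇ i) → T (i <ᵇ 20) → k < 2 ^ W →
   Built M Es → reg M lim ≡ k →
   (∀ {j M' Es'} → j < k → Built M' Es' → reg M' i ≡ j → RFrame i M M' → Run P M' c (λ M'' → Built M'' (insertEdges (f j) Es') × RFrame (suc i) M' M'')) →
   Run (forP i lim P) M (7 + k * (c + 7)) (λ M' → Built M' (insertEdges (forL k f) Es) × RFrame i M M')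
  run-emits-for {i} {lim} {P} {M} {Es} {k} c f i-free lim<15 15≤i i<20 k< b elim body =
   run-for c Inv k< i≢lim (λ { refl → i<20 }) (λ { refl → lim<15 })
    (λ (b , F) → built-setR 63 tt b , rframe-setR 63 (≤⇒≤ᵇ (≤-trans (<⇒≤ (<ᵇ⇒< i 20 i<20)) (m≤m+n 20 43))) F)
    (λ (b , F) → built-setR i i-free b , rframe-setR i (≤⇒≤ᵇ (≤-refl {i})) F)
    (λ {j} {M'} j< ei el (b , F) → run-map (λ {M''} (b' , F') →
      (subst (Built M'') (sym (insertEdges-++ (forL j f) (f j) Es)) b' , rframe-trans F (rframe-weaken i (≤⇒≤ᵇ (n≤1+n i)) F'))
      , trans (rf F' i (<⇒<ᵇ (n<1+n i))) ei , trans (rf F' lim lim<si) el) (body j< b ei F))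
    (b , rframe-refl) elim
   where
   Inv : ℕ → Mid → Set
   Inv j M' = Built M' (insertEdges (forL j f) Es) × RFrame i M M'
   lim<i : lim < i
   lim<i = <-≤-trans (<ᵇ⇒< lim 15 lim<15) (≤ᵇ⇒≤ 15 i 15≤i)
   i≢lim : i ≢ lim
   i≢lim refl = <-irrefl refl lim<i
   lim<si : T (lim <ᵇ suc i)
   lim<si = <⇒<ᵇ (<-trans lim<i (n<1+n i))

  cond₁-time rowU-time : ℕ
  cond₁-time = ((3 + (3 + 3)) + ev-time size≤) + (4 + (1 + ((3 + 3) + emit-time)))
  rowU-time = ((3 + 3) + emit-time) + (7 + d * ((cond₁-time + cond₁-time) + 7))

  private
   quiet₀ : ∀ {M M' f} → KeepOn quiet (reg M) f → Sy f (tbl M) M' → Quiet M M'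
   quiet₀ {M} {M'} K G = quiet-sy {M} {M'} (frame-weaken (m≤m+n 36 14) G) K

   vtx₁ : ∀ c → B + c ≡ vtx 1 c
   vtx₁ c = cong (_+ c) (sym (+-identityʳ B))

   vtx₂ : ∀ c → B + B + c ≡ vtx 2 c
   vtx₂ c = l B c
    where
    l : ∀ b c → b + b + c ≡ 2 * b + c
    l = solve-∀

   vtx₃ : ∀ c → B + B + B + c ≡ vtx 3 c
   vtx₃ c = l B c
    where
    l : ∀ b c → b + b + b + c ≡ 3 * b + c
    l = solve-∀

   row₁< : ∀ {c} → c < B → B + c < n
   row₁< {c} c< = subst (_< n) (sym (vtx₁ c)) (vtx< (<R (m≤m+n 1 _)) c<)
   row₂< : ∀ {c} → c < B → B + B + c < n
   row₂< {c} c< = subst (_< n) (sym (vtx₂ c)) (vtx< (<R (m≤m+n 2 _)) c<)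
   row₃< : ∀ {c} → c < B → B + B + B + c < n
   row₃< {c} c< = subst (_< n) (sym (vtx₃ c)) (vtx< (<R (m≤m+n 3 _)) c<)

  private
   s<n : ∀ {s} → s < A → s < n
   s<n s< = <-≤-trans (<-trans s< A<B) B≤n

   s<2^W : ∀ {s} → s < A → s < 2 ^ W
   s<2^W s< = <-trans (s<n s<) n<2^W

   2a≤W : a + a ≤ W
   2a≤W = ≤-trans 2a≤N N≤W

  run-rowU : ∀ {s M Es} → s < A → Built M Es → reg M 15 ≡ s →
   Run rowUP M rowU-time (λ M' → Built M' (insertEdges (rawU s) Es) × RFrame 16 M M')
  run-rowU {s} {M} {Es} s< b e15 =
   run-edge b (s-copy 20 15 tt e15 (frame-refl {50} {reg M}) ▸▸ λ G → run-map (λ {M'} G' →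
     quiet₀ {M} {M'} (keep-setR 21 tt (keep-setR 20 tt keep-refl)) G' , fr G' 20 tt , trans (fr G' 21 tt) (vtx₃ A))
     (s-add 21 10 5 tt tt (rf (env b) 10 tt) (rf (env b) 5 tt) (<-trans (row₃< A<B) n<2^W) G))
    (s<n s<) (vtx< (<R (m≤m+n 3 _)) A<B) ▸▸ λ {M₁} (b₁ , F₁) →
   let e15₁ = trans (rf F₁ 15 tt) e15 in
   run-map (λ (b₂ , F₂) → b₂ , rframe-trans (rframe-weaken 16 tt F₁) F₂)
    (run-emits-for (cond₁-time + cond₁-time) (rawC s) tt tt tt tt (≤-<-trans d≤B (≤-<-trans B≤n n<2^W)) b₁ (rf (env b₁) 2 tt) (clause {M₁} e15₁))
   where
   clause : ∀ {M₁} → reg M₁ 15 ≡ s → ∀ {c M' Es'} → c < d → Built M' Es' → reg M' 16 ≡ c → RFrame 16 M₁ M' →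
    Run (condEmitP (zeroP 22 ⨾ copyP 23 3 ⨾ copyP 24 15) (copyP 20 15 ⨾ addP 21 6 16) ⨾
       condEmitP (copyP 22 3 ⨾ copyP 23 4 ⨾ copyP 24 15) (addP 20 9 16 ⨾ addP 21 10 15)) M' (cond₁-time + cond₁-time)
     (λ M'' → Built M'' (insertEdges (rawC s c) Es') × RFrame 17 M' M'')
   clause e15₁ {c} {M'} {Es'} c< b' e16 F =
    let e15' = trans (rf F 15 tt) e15₁ in
    run-cond b' e16 c< (≤-trans (m≤m+n a a) 2a≤W) (s<2^W s<)
     (s-zero 22 (frame-refl {50} {reg M'}) ▸▸ λ G₁ → s-copy 23 3 tt (rf (env b') 3 tt) G₁ ▸▸ λ G₂ →
      run-map (λ {M₃} G₃ → quiet₀ {M'} {M₃} (keep-setR 24 tt (keep-setR 23 tt (keep-setR 22 tt keep-refl))) G₃ , fr G₃ 22 tt , fr G₃ 23 tt , fr G₃ 24 tt) (s-copy 24 15 tt e15' G₂))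
     (λ {M₁} q b₁ → s-copy 20 15 tt (trans (kp (qr q) 15 tt) e15') (frame-refl {50} {reg M₁}) ▸▸ λ G₁ →
      run-map (λ {M₃} G₃ → quiet₀ {M₁} {M₃} (keep-setR 21 tt (keep-setR 20 tt keep-refl)) G₃ , fr G₃ 20 tt , trans (fr G₃ 21 tt) (vtx₁ c))
       (s-add 21 6 16 tt tt (rf (env b₁) 6 tt) (trans (kp (qr q) 16 tt) e16) (<-trans (row₁< (c<B c<)) n<2^W) G₁))
     (s<n s<) (vtx< (<R (m≤m+n 1 _)) (c<B c<)) ▸▸ λ {M₂} (b₂ , F₂) →
    let e15₂ = trans (rf F₂ 15 tt) e15'
        e16₂ = trans (rf F₂ 16 tt) e16
    in run-map (λ {M₃} E → let (b₃ , F₃) = emits-trans {M'} {M₂} {M₃} {Es'} {unless (partSat size lit 0 a s c) (s , vtx 1 c)} (b₂ , F₂) E in b₃ , rframe-weaken 17 tt F₃)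
    (run-cond b₂ e16₂ c< 2a≤W (s<2^W s<)
     (s-copy 22 3 tt (rf (env b₂) 3 tt) (frame-refl {50} {reg M₂}) ▸▸ λ G₁ → s-copy 23 4 tt (rf (env b₂) 4 tt) G₁ ▸▸ λ G₂ →
      run-map (λ {M₃} G₃ → quiet₀ {M₂} {M₃} (keep-setR 24 tt (keep-setR 23 tt (keep-setR 22 tt keep-refl))) G₃ , fr G₃ 22 tt , fr G₃ 23 tt , fr G₃ 24 tt) (s-copy 24 15 tt e15₂ G₂))
     (λ {M₁} q b₁ → s-add 20 9 16 tt tt (rf (env b₁) 9 tt) (trans (kp (qr q) 16 tt) e16₂) (<-trans (row₂< (c<B c<)) n<2^W) (frame-refl {50} {reg M₁}) ▸▸ λ G₁ →
      run-map (λ {M₃} G₃ → quiet₀ {M₁} {M₃} (keep-setR 21 tt (keep-setR 20 tt keep-refl)) G₃ , trans (fr G₃ 20 tt) (vtx₂ c) , trans (fr G₃ 21 tt) (vtx₃ s))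
       (s-add 21 10 15 tt tt (rf (env b₁) 10 tt) (trans (kp (qr q) 15 tt) e15₂) (<-trans (row₃< (<-trans s< A<B)) n<2^W) G₁))
     (vtx< (<R (m≤m+n 2 _)) (c<B c<)) (vtx< (<R (m≤m+n 3 _)) (<-trans s< A<B)))

  rowD-time rowY-time : ℕ
  rowD-time = (3 + 3) + emit-time
  rowY-time = ((div-time + 3) + ((div-time + 3) + (3 + (4 + (4 + (4 + 6)))))) + (4 + (4 + (6 + emit-time)))

  run-rowD : ∀ {c M Es} → c < d → Built M Es → reg M 16 ≡ c →
   Run rowDP M rowD-time (λ M' → Built M' (insertEdges (rawD c) Es) × RFrame 17 M M')
  run-rowD {c} {M} {Es} c< b e16 = run-map (λ (b' , F) → b' , rframe-weaken 17 tt F)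
   (run-edge b (s-add 20 6 16 tt tt (rf (env b) 6 tt) e16 (<-trans (row₁< (c<B c<)) n<2^W) (frame-refl {50} {reg M}) ▸▸ λ G → run-map (λ {M'} G' →
     quiet₀ {M} {M'} (keep-setR 21 tt (keep-setR 20 tt keep-refl)) G' , trans (fr G' 20 tt) (vtx₁ c) , trans (fr G' 21 tt) (vtx₂ c))
     (s-add 21 9 16 tt tt (rf (env b) 9 tt) e16 (<-trans (row₂< (c<B c<)) n<2^W) G))
    (vtx< (<R (m≤m+n 1 _)) (c<B c<)) (vtx< (<R (m≤m+n 2 _)) (c<B c<)))

  run-tail : ∀ {y M Es} → y < n → Built M Es → reg M 15 ≡ y →
   Run (divTo 22 15 6 ⨾ remTo 23 15 6 ⨾ tailP) M ((div-time + 3) + ((div-time + 3) + (3 + (4 + (4 + (4 + 6))))))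
    (λ M' → Quiet M M' × reg M' 25 ≡ bool (isTail y) × reg M' 22 ≡ y / B)
  run-tail {y} {M} {Es} y< b e15 =
   s-div 22 15 6 tt tt W<W (W30 b) e15 (rf (env b) 6 tt) (<-trans y< n<2^W) 2B≤ (frame-refl {50} {reg M}) ▸▸ λ G₁ →
   s-rem 23 15 6 tt tt W<W (W30 b) e15 (rf (env b) 6 tt) (<-trans y< n<2^W) 2B≤ G₁ ▸▸ λ G₂ →
   s-zero 25 G₂ ▸▸ λ G₃ →
   s-iflt 22 14 tt tt refl (rf (env b) 14 tt) G₃
    (λ l G₄ → run-≤ (m≤m+n 1 13) (outside (cong (λ z → not z ∧ (not (3 + L <ᵇ y / B) ∧ not (A <ᵇ y % B))) (<ᵇ-true l)) (s-skip G₄)))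
    λ l G₄ → s-iflt 11 22 tt tt (rf (env b) 11 tt) refl G₄
     (λ l' G₅ → run-≤ (m≤m+n 1 9) (outside (trans (cong (λ z → not (y / B <ᵇ 3) ∧ (not z ∧ not (A <ᵇ y % B))) (<ᵇ-true l')) (∧-zeroʳ _)) (s-skip G₅)))
     λ l' G₅ → s-iflt 5 23 tt tt (rf (env b) 5 tt) refl G₅
      (λ l'' G₆ → run-≤ (m≤m+n 1 5) (outside (trans (cong (λ z → not (y / B <ᵇ 3) ∧ (not (3 + L <ᵇ y / B) ∧ not z)) (<ᵇ-true l''))
         (trans (cong (not (y / B <ᵇ 3) ∧_) (∧-zeroʳ _)) (∧-zeroʳ _))) (s-skip G₆)))
      λ l'' G₆ → run-map (λ {M'} G → quiet₀ {M} {M'} (keep-setR 25 tt kept-regs) G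
       , trans (fr G 25 tt) (cong bool (sym (trans (cong₂ (λ p q → not p ∧ (not q ∧ not (A <ᵇ y % B))) (<ᵇ-false l) (<ᵇ-false l')) (cong not (<ᵇ-false l''))))) , fr G 22 tt)
       (s-const 25 1 (≤-<-trans (m≤m+n 1 3) (≤-<-trans (m≤m+n 4 _) room)) G₆)
   where
   2B≤ : 2 * B ≤ 2 ^ W
   2B≤ = <⇒≤ (≤-<-trans (*-monoˡ-≤ B (≤-trans (m≤m+n 2 (1 + L)) (<⇒≤ L<R))) n<2^W)
   kept-regs : ∀ {v v' v''} → KeepOn quiet (reg M) (((reg M [ 22 ↦ v ]) [ 23 ↦ v' ]) [ 25 ↦ v'' ])
   kept-regs = keep-setR 25 tt (keep-setR 23 tt (keep-setR 22 tt keep-refl))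
   outside : ∀ {P M₁ k} → isTail y ≡ false → Run P M₁ k (Sy (((reg M [ 22 ↦ y / B ]) [ 23 ↦ y % B ]) [ 25 ↦ 0 ]) (tbl M)) →
    Run P M₁ k (λ M' → Quiet M M' × reg M' 25 ≡ bool (isTail y) × reg M' 22 ≡ y / B)
   outside e r = run-map (λ {M'} G → quiet₀ {M} {M'} kept-regs G , trans (fr G 25 tt) (cong bool (sym e)) , fr G 22 tt) r

  run-rowY : ∀ {y M Es} → y < n → Built M Es → reg M 15 ≡ y →
   Run rowYP M rowY-time (λ M' → Built M' (insertEdges (rawY y) Es) × RFrame 16 M M')
  run-rowY {y} {M} {Es} y< b e15 = run-tail y< b e15 ▸▸ λ {M₁} (q , e25 , e22) →
   let b₁ = built-quiet {M' = M₁} b q in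
   s-ifnz 25 tt e25 (frame-refl {50} {reg M₁})
    (λ ne {M₂} G → let q₂ = quiet-trans q (quiet₀ {M₁} {M₂} keep-refl G)
                       b₂ = built-quiet {M' = M₂} b q₂ in
     s-ifneq 22 14 tt tt (trans (fr G 22 tt) e22) (rf (env b₂) 14 tt) (frame-refl {50} {reg M₂})
      (λ r≢3 {M₃} G₃ → let q₃ = quiet-trans q₂ (quiet₀ {M₂} {M₃} keep-refl G₃)
                           b₃ = built-quiet {M' = M₃} b q₃
                           e15₃ = trans (kp (qr q₃) 15 tt) e15 in
       post (trans (cong (λ z → if z then (if y / B ≡ᵇ 3 then [] else ((y ∸ B , y) ∷ [])) else ((vtx (3 + L) A , y) ∷ [])) (bool≢0 ne)) (cong (λ z → if z then [] else ((y ∸ B , y) ∷ [])) (≢⇒≡ᵇ r≢3)))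
        q₃ (run-edge b₃ (s-sub 20 15 6 tt tt e15₃ (rf (env b₃) 6 tt) (B≤y (bool≢0 ne)) (frame-refl {50} {reg M₃}) ▸▸ λ G₄ →
           run-map (λ {M'} G' → quiet₀ {M₃} {M'} (keep-setR 21 tt (keep-setR 20 tt keep-refl)) G' , fr G' 20 tt , fr G' 21 tt) (s-copy 21 15 tt e15₃ G₄))
         (≤-<-trans (m∸n≤m y B) y<) y<))
      (λ r≡3 {M₃} G₃ → let q₃ = quiet-trans q₂ (quiet₀ {M₂} {M₃} keep-refl G₃) in
       post (trans (cong (λ z → if z then (if y / B ≡ᵇ 3 then [] else ((y ∸ B , y) ∷ [])) else ((vtx (3 + L) A , y) ∷ [])) (bool≢0 ne)) (cong (λ z → if z then [] else ((y ∸ B , y) ∷ [])) (cong (_≡ᵇ 3) r≡3)))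
        q₃ (run-≤ (m≤m+n 1 (5 + emit-time)) (exec-skip ,, (built-quiet b q₃ , rframe-refl)))))
    (λ z {M₂} G → let q₂ = quiet-trans q (quiet₀ {M₁} {M₂} keep-refl G)
                      b₂ = built-quiet {M' = M₂} b q₂
                      e15₂ = trans (kp (qr q₂) 15 tt) e15 in
     run-≤ (m≤n+m _ 4) (post (cong (λ z → if z then (if y / B ≡ᵇ 3 then [] else ((y ∸ B , y) ∷ [])) else ((vtx (3 + L) A , y) ∷ [])) (bool≡0 z))
      q₂ (run-edge b₂ (s-copy 20 8 tt (rf (env b₂) 8 tt) (frame-refl {50} {reg M₂}) ▸▸ λ G₄ →
           run-map (λ {M'} G' → quiet₀ {M₂} {M'} (keep-setR 21 tt (keep-setR 20 tt keep-refl)) G' , fr G' 20 tt , fr G' 21 tt) (s-copy 21 15 tt e15₂ G₄))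
         (vtx< L<R A<B) y<)))
   where
   post : ∀ {P M₁ k es} → rawY y ≡ es → Quiet M M₁ → Run P M₁ k (λ M' → Built M' (insertEdges es Es) × RFrame 20 M₁ M') →
    Run P M₁ k (λ M' → Built M' (insertEdges (rawY y) Es) × RFrame 16 M M')
   post refl q r = run-map (λ (b , F) → b , rframe-weaken 16 tt (rframe-trans (quiet-20 q) F)) r
   B≤y : isTail y ≡ true → B ≤ y
   B≤y t = ≤-trans (≡≤ (sym (*-identityˡ B)) (*-monoˡ-≤ B (≤-trans (m≤m+n 1 2) (≮⇒≥ {y / B} {3} λ l → case trans (sym (cong (λ z → not z ∧ (not (3 + L <ᵇ y / B) ∧ not (A <ᵇ y % B))) (<ᵇ-true {y / B} {3} l))) t of λ ())))) (m/n*n≤m y B)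

  build-time : ℕ
  build-time = (7 + A * (rowU-time + 7)) + ((7 + n * (rowY-time + 7)) + (7 + d * (rowD-time + 7)))

  run-build : ∀ dense {M} → Built M [] → Run (buildP dense) M build-time (λ M' → Built M' (insertEdges (raw dense) []))
  run-build dense {M} b =
   run-emits-for rowU-time rawU tt tt tt tt (<-trans (<-≤-trans A<B B≤n) n<2^W) b (rf (env b) 5 tt)
    (λ s< b' e F → run-rowU s< b' e) ▸▸ λ {M₁} (b₁ , _) →
   run-emits-for rowY-time rawY tt tt tt tt n<2^W b₁ (rf (env b₁) 7 tt) (λ y< b' e F → run-rowY y< b' e) ▸▸ λ {M₂} (b₂ , _) →
   run-map (λ {M₃} b₃ → subst (Built M₃) (sym (trans (insertEdges-++ (forL A rawU) _ []) (insertEdges-++ (forL n rawY) _ (insertEdges (forL A rawU) [])))) b₃) (last dense b₂)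
   where
   last : ∀ dense {M₂ Es} → Built M₂ Es → Run (if dense then forP 16 2 rowDP else skip) M₂ (7 + d * (rowD-time + 7)) (λ M' → Built M' (insertEdges (if dense then forL d rawD else []) Es))
   last true b = run-map proj₁ (run-emits-for rowD-time rawD tt tt tt tt (≤-<-trans d≤B (≤-<-trans B≤n n<2^W)) b (rf (env b) 2 tt) (λ c< b' e F → run-rowD c< b' e))
   last false b = run-≤ (s≤s z≤n) (exec-skip ,, b)

  -- The listed edges are those of the gadget

  private
   <ᵇ-false⁻ : ∀ {m n} → (m <ᵇ n) ≡ false → n ≤ m
   <ᵇ-false⁻ {m} {n} e = ≮⇒≥ λ l → case trans (sym (<ᵇ-true l)) e of λ ()

  tail⁻ : ∀ {y} → isTail y ≡ true → Tail y
  tail⁻ {y} e with ∧-true {not (y / B <ᵇ 3)} e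
  ... | e₁ , e₂ with ∧-true {not (3 + L <ᵇ y / B)} e₂
  ... | e₃ , e₄ = <ᵇ-false⁻ (not-true e₁) , <ᵇ-false⁻ (not-true e₃) , <ᵇ-false⁻ (not-true e₄)

  tail⁺ : ∀ {y} → Tail y → isTail y ≡ true
  tail⁺ {y} (p , q , r) rewrite <ᵇ-false p | <ᵇ-false q | <ᵇ-false r = refl

  rawY⁻ : ∀ {y e} → y < n → e ∈ rawY y → Static (proj₁ e) (proj₂ e)
  rawY⁻ {y} y< p with isTail y in t
  rawY⁻ {y} y< (here refl) | false = back y< λ tl → case trans (sym t) (tail⁺ tl) of λ ()
  rawY⁻ {y} y< p | true with y / B ≡ᵇ 3 in r3
  rawY⁻ {y} y< (here refl) | true | false = subst₂ Static (proj₁ split) (proj₂ split) (along 3≤r r< (proj₂ (proj₂ (tail⁻ {y} t))))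
   where
   3≤q = proj₁ (tail⁻ {y} t)
   3<q : 3 < y / B
   3<q = ≤∧≢⇒< 3≤q λ e → case trans (sym r3) (cong (_≡ᵇ 3) (sym e)) of λ ()
   r = pred (y / B)
   sr : suc r ≡ y / B
   sr = suc-pred (y / B) {{>-nonZero (<-trans (s≤s z≤n) 3<q)}}
   3≤r : 3 ≤ r
   3≤r = s≤s⁻¹ (subst (3 <_) (sym sr) 3<q)
   r< : r < 3 + L
   r< = subst (_≤ 3 + L) (sym sr) (proj₁ (proj₂ (tail⁻ {y} t)))
   split : vtx r (y % B) ≡ y ∸ B × vtx (suc r) (y % B) ≡ y
   split = sym (trans (cong (_∸ B) (trans (sym e₂) (+-assoc B (r * B) (y % B)))) (m+n∸m≡n B _)) , e₂
    where
    e₂ : vtx (suc r) (y % B) ≡ y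
    e₂ = trans (cong (λ q → vtx q (y % B)) sr) (sym (decode y))

  rawY-along : ∀ {r c} → 3 ≤ r → r < 3 + L → c ≤ A → (vtx r c , vtx (suc r) c) ∈ rawY (vtx (suc r) c)
  rawY-along {r} {c} 3≤r r< c≤ = subst ((vtx r c , y) ∈_) (sym raw≡) (here (cong (_, y) (sym sub≡)))
   where
   y = vtx (suc r) c
   c<' = ≤-<-trans c≤ A<B
   tl : Tail (vtx (suc r) c)
   tl = subst (3 ≤_) (sym (vtx-/ (suc r) c<')) (m≤n⇒m≤1+n 3≤r) , subst (_≤ 3 + L) (sym (vtx-/ (suc r) c<')) r< , subst (_≤ A) (sym (vtx-% (suc r) c<')) c≤
   r≢3 : vtx (suc r) c / B ≢ 3
   r≢3 e = <-irrefl (sym (trans (sym (vtx-/ (suc r) c<')) e)) (s≤s 3≤r)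
   raw≡ : rawY y ≡ (y ∸ B , y) ∷ []
   raw≡ = trans (cong (λ t → if t then (if y / B ≡ᵇ 3 then [] else ((y ∸ B , y) ∷ [])) else ((vtx (3 + L) A , y) ∷ [])) (tail⁺ tl))
    (cong (λ t → if t then [] else ((y ∸ B , y) ∷ [])) (≢⇒≡ᵇ r≢3))
   sub≡ : vtx (suc r) c ∸ B ≡ vtx r c
   sub≡ = trans (cong (_∸ B) (+-assoc B (r * B) c)) (m+n∸m≡n B _)

  rawY-back : ∀ {y} → ¬ Tail y → (vtx (3 + L) A , y) ∈ rawY y
  rawY-back {y} nt with isTail y in t
  ... | true = ⊥-elim (nt (tail⁻ {y} t))
  ... | false = here refl

  rawC⁻ : ∀ {s c e} → s < A → c < d → e ∈ rawC s c → Static (proj₁ e) (proj₂ e)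
  rawC⁻ {s} {c} {e} s< c< p with ∈-++⁻ (unless (partSat size lit 0 a s c) (s , vtx 1 c)) p
  ... | inj₁ q with ∈-unless⁻ {partSat size lit 0 a s c} {e} {s , vtx 1 c} q
  ... | f , refl = out s< c< (cong not f)
  rawC⁻ {s} {c} {e} s< c< p | inj₂ q with ∈-unless⁻ {partSat size lit a (a + a) s c} {e} {vtx 2 c , vtx 3 s} q
  ... | f , refl = into s< c< (cong not f)

  raw⁻ : ∀ dense {e} → e ∈ raw dense → Edges (λ _ → dense) (proj₁ e) (proj₂ e)
  raw⁻ dense p with ∈-++⁻ (forL A rawU) p
  raw⁻ dense _ | inj₁ p with ∈-forL⁻ A p
  ... | s , s< , here refl = static (enter s<)
  ... | s , s< , there q with ∈-forL⁻ d q
  ... | c , c< , q' = static (rawC⁻ s< c< q')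
  raw⁻ dense _ | inj₂ p with ∈-++⁻ (forL n rawY) p
  raw⁻ dense _ | inj₂ _ | inj₁ q with ∈-forL⁻ n q
  ... | y , y< , r = static (rawY⁻ y< r)
  raw⁻ true _ | inj₂ _ | inj₂ q with ∈-forL⁻ d q
  ... | c , c< , here refl = dynamic c< refl

  raw⁺ : ∀ dense {x y} → Edges (λ _ → dense) x y → (x , y) ∈ raw dense
  raw⁺ dense (static (enter s<)) = ∈-++⁺ˡ (∈-forL⁺ s< (here refl))
  raw⁺ dense (static (out s< c< f)) = ∈-++⁺ˡ (∈-forL⁺ s< (there (∈-forL⁺ c< (∈-++⁺ˡ (∈-unless⁺ (not-true f))))))
  raw⁺ dense (static (into {s} {c} s< c< f)) = ∈-++⁺ˡ (∈-forL⁺ s< (there (∈-forL⁺ c< (∈-++⁺ʳ (unless (partSat size lit 0 a s c) (s , vtx 1 c)) (∈-unless⁺ (not-true f))))))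
  raw⁺ dense (static (along 3≤r r< c≤)) = ∈-++⁺ʳ (forL A rawU) (∈-++⁺ˡ (∈-forL⁺ (vtx< (<R r<) (≤-<-trans c≤ A<B)) (rawY-along 3≤r r< c≤)))
  raw⁺ dense (static (back y< nt)) = ∈-++⁺ʳ (forL A rawU) (∈-++⁺ˡ (∈-forL⁺ y< (rawY-back nt)))
  raw⁺ true (dynamic c< e) = ∈-++⁺ʳ (forL A rawU) (∈-++⁺ʳ (forL n rawY) (∈-forL⁺ c< (here refl)))
  raw⁺ false (dynamic c< ())

  length-raw : ∀ dense → length (raw dense) ≤ A * suc (d * 2) + (n + d)
  length-raw dense = ≡≤ (length-++ (forL A rawU)) (+-mono-≤ (length-forL A rawU _ λ s _ → s≤s (length-forL d (rawC s) 2 λ c _ → lenC s c))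
   (≡≤ (length-++ (forL n rawY)) (+-mono-≤ (≤≡ (length-forL n rawY 1 λ y _ → lenY y) (*-identityʳ n)) (lenD dense))))
   where
   len-unless : ∀ b e → length (unless b e) ≤ 1
   len-unless true e = z≤n
   len-unless false e = ≤-refl
   lenC : ∀ s c → length (rawC s c) ≤ 2
   lenC s c = ≡≤ (length-++ (unless (partSat size lit 0 a s c) (s , vtx 1 c))) (+-mono-≤ (len-unless (partSat size lit 0 a s c) (s , vtx 1 c)) (len-unless (partSat size lit a (a + a) s c) (vtx 2 c , vtx 3 s)))
   lenY : ∀ y → length (rawY y) ≤ 1
   lenY y with isTail y
   ... | false = ≤-refl
   ... | true with y / B ≡ᵇ 3
   ... | true = z≤n
   ... | false = ≤-refl
   lenD : ∀ dense → length (if dense then forL d rawD else []) ≤ d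
   lenD true = ≤≡ (length-forL d rawD 1 λ _ _ → ≤-refl) (*-identityʳ d)
   lenD false = z≤n

  -- The graph as an input of the dynamic algorithm

  vertex : ℕ → Fin n
  vertex x = x mod n

  toℕ-vertex : ∀ {x} → x < n → toℕ (vertex x) ≡ x
  toℕ-vertex {x} x< = trans (toℕ-fromℕ< (m%n<n x n)) (m<n⇒m%n≡m x<)

  toEdge : Pair → Edge n
  toEdge (x , y) = vertex x , vertex y

  toGraph : List Pair → Digraph n
  toGraph = map toEdge

  toGraph-represents : ∀ {Es E} → All (InRange n) Es → (∀ {e} → e ∈ Es → E (proj₁ e) (proj₂ e)) → (∀ {x y} → E x y → (x , y) ∈ Es) → Represents (toGraph Es) E
  toGraph-represents {Es} {E} range sd cp = represents
   (λ p → let ((x , y) , q , e) = ∈-map⁻ toEdge p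
              (x< , y<) = All.lookup range q
       in subst₂ E (sym (trans (cong (toℕ ∘ proj₁) e) (toℕ-vertex x<))) (sym (trans (cong (toℕ ∘ proj₂) e) (toℕ-vertex y<))) (sd q))
   (λ {x} {y} e → subst (_∈ toGraph Es) (cong₂ _,_ (back-vertex x) (back-vertex y)) (∈-map⁺ toEdge (cp e)))
   where
   back-vertex : ∀ x → vertex (toℕ x) ≡ x
   back-vertex x = toℕ-injective (toℕ-vertex (toℕ<n x))

  toGraph-unique : ∀ {Es} → All (InRange n) Es → Unique Es → Unique (toGraph Es)
  toGraph-unique = unique-map toEdge λ { (p , q) (p' , q') e →
   cong₂ _,_ (trans (sym (toℕ-vertex p)) (trans (cong (toℕ ∘ proj₁) e) (toℕ-vertex p'))) (trans (sym (toℕ-vertex q)) (trans (cong (toℕ ∘ proj₂) e) (toℕ-vertex q'))) }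

  toGraph-input : ∀ {Es} → All (InRange n) Es → ∀ m a → graphInput (toGraph Es) m a ≡ edgeMemory Es m a
  toGraph-input {Es} range = go
   where
   at-graph : (f : ∀ {k} → Edge k → ℕ) (g : Pair → ℕ) → (∀ {e} → InRange n e → f (toEdge e) ≡ g e) → ∀ {Es} → All (InRange n) Es → ∀ i → at 0 (map f (toGraph Es)) i ≡ at 0 (map g Es) i
   at-graph f g h [] i = refl
   at-graph f g h (p ∷ ps) zero = h p
   at-graph f g h (p ∷ ps) (suc i) = at-graph f g h ps i
   go : ∀ m a → graphInput (toGraph Es) m a ≡ edgeMemory Es m a
   go 0 (i ∷ 0 ∷ []) = at-graph (toℕ ∘ proj₁) proj₁ (toℕ-vertex ∘ proj₁) range i
   go 0 (i ∷ 1 ∷ []) = at-graph (toℕ ∘ proj₂) proj₂ (toℕ-vertex ∘ proj₂) range i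
   go 0 [] = refl
   go 0 (_ ∷ []) = refl
   go 0 (_ ∷ suc (suc _) ∷ []) = refl
   go 0 (_ ∷ 0 ∷ _ ∷ _) = refl
   go 0 (_ ∷ 1 ∷ _ ∷ _) = refl
   go 0 (_ ∷ suc (suc _) ∷ _ ∷ _) = refl
   go (suc m) a = refl

  edge : ℕ → Edge n
  edge c = vertex (vtx 1 c) , vertex (vtx 2 c)

  v₁< : ∀ {c} → c < d → vtx 1 c < n
  v₁< c< = vtx< (<R (m≤m+n 1 _)) (c<B c<)

  v₂< : ∀ {c} → c < d → vtx 2 c < n
  v₂< c< = vtx< (<R (m≤m+n 2 _)) (c<B c<)

  vtx₁-injective : ∀ {c c'} → c < d → c' < d → vtx 1 c ≡ vtx 1 c' → c ≡ c'
  vtx₁-injective {c} {c'} c< c'< e = trans (sym (vtx-% 1 (c<B c<))) (trans (cong (_% B) e) (vtx-% 1 (c<B c'<)))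

  -- All edges that leave row 1 are dynamic. Hence the edge from a clause to its copy is present
  -- exactly if it is active, which decides whether it may be inserted or deleted.
  static-row≢1 : ∀ {x y c} → c < d → Static x y → x ≢ vtx 1 c
  static-row≢1 {c = c} c< st e = rows (trans (cong (_/ B) e) (vtx-/ 1 (c<B c<))) st
   where
   rows : ∀ {x y} → x / B ≡ 1 → Static x y → ⊥
   rows r (enter s<) = case trans (sym r) (vtx-/ 0 (<-trans s< A<B)) of λ ()
   rows r (out s< _ _) = case trans (sym r) (vtx-/ 0 (<-trans s< A<B)) of λ ()
   rows r (into _ c< _) = case trans (sym r) (vtx-/ 2 (c<B c<)) of λ ()
   rows r (along {q} 3≤ _ c≤) = <⇒≱ (≤-trans (s≤s (s≤s z≤n)) 3≤) (≤-reflexive (trans (sym (vtx-/ q (≤-<-trans c≤ A<B))) r))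
   rows r (back _ _) = case trans (sym r) (vtx-/ (3 + L) A<B) of λ ()

  dynamic⁻ : ∀ {act c} → c < d → Edges act (vtx 1 c) (vtx 2 c) → act c ≡ true
  dynamic⁻ {act} {c} c< e = go e refl
   where
   go : ∀ {x y} → Edges act x y → x ≡ vtx 1 c → act c ≡ true
   go (static st) e = ⊥-elim (static-row≢1 c< st e)
   go (dynamic {c'} c'< a) e = subst (λ z → act z ≡ true) (vtx₁-injective c'< c< e) a

  edges-cong : ∀ {act act' x y} → (∀ c → c < d → act c ≡ true → act' c ≡ true) → Edges act x y → Edges act' x y
  edges-cong h (static st) = static st
  edges-cong h (dynamic c< a) = dynamic c< (h _ c< a)

  -- Insertions and deletions change the number of edges and of active clauses by the same amount,
  -- so the graph never has more than ℓ₀ + d edges.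
  module Dynamic (ℓ₀ : ℕ) where

   -- The current graph, with the dynamic edges given by act.
   record Good (G : Digraph n) (act : ℕ → Bool) : Set where
    constructor goodGraph
    field
     reps : Represents G (Edges act)
     len≤ : length G ≤ ℓ₀ + countBelow d act

   good-cong : ∀ {G act act'} → (∀ c → c < d → act c ≡ act' c) → Good G act → Good G act'
   good-cong h (goodGraph (represents s c) l) = goodGraph
    (represents (λ p → edges-cong (λ c c< a → trans (sym (h c c<)) a) (s p)) (λ e → c (edges-cong (λ c c< a → trans (h c c<) a) e)))
    (≤≡ l (cong (ℓ₀ +_) (countBelow-cong d h)))

   edge-sound : ∀ {c x y} → c < d → (x , y) ≡ edge c → toℕ x ≡ vtx 1 c × toℕ y ≡ vtx 2 c
   edge-sound c< refl = toℕ-vertex (v₁< c<) , toℕ-vertex (v₂< c<)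

   edge-complete : ∀ {c x y} → c < d → toℕ x ≡ vtx 1 c → toℕ y ≡ vtx 2 c → (x , y) ≡ edge c
   edge-complete c< e e' = cong₂ _,_ (toℕ-injective (trans e (sym (toℕ-vertex (v₁< c<))))) (toℕ-injective (trans e' (sym (toℕ-vertex (v₂< c<)))))

   good-insert : ∀ {G act c} → c < d → act c ≡ false → Good G act → edge c ∉ G × Good (edge c ∷ G) (act [ c ↦ true ])
   good-insert {G} {act} {c} c< a (goodGraph (represents sd cp) l) =
    (λ p → let (e , e') = edge-sound c< refl in case trans (sym a) (dynamic⁻ c< (subst₂ (Edges act) e e' (sd p))) of λ ()) ,
    goodGraph (represents sd' (λ {x} {y} e → cp' e refl refl)) (≤≡ (s≤s l) (trans (sym (+-suc ℓ₀ _)) (cong (ℓ₀ +_) (sym (countBelow-set c< a)))))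
    where
    grow : ∀ c' → c' < d → act c' ≡ true → (act [ c ↦ true ]) c' ≡ true
    grow c' _ e with c ≡ᵇ c'
    ... | true = refl
    ... | false = e
    sd' : ∀ {x y} → (x , y) ∈ edge c ∷ G → Edges (act [ c ↦ true ]) (toℕ x) (toℕ y)
    sd' (here e) = let (p , q) = edge-sound c< e in subst₂ (Edges (act [ c ↦ true ])) (sym p) (sym q) (dynamic c< (↦-same act c))
    sd' (there p) = edges-cong grow (sd p)
    cp' : ∀ {x y x' y'} → Edges (act [ c ↦ true ]) x' y' → x' ≡ toℕ x → y' ≡ toℕ y → (x , y) ∈ edge c ∷ G
    cp' (static st) refl refl = there (cp (static st))
    cp' {x} {y} (dynamic {c'} c'< e) p q with c ≟ c'
    ... | yes refl = here (edge-complete c< (sym p) (sym q))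
    ... | no c≢ = there (cp (subst₂ (Edges act) p q (dynamic c'< (trans (sym (↦-other act c≢)) e))))

   good-delete : ∀ {G act c} → c < d → act c ≡ true → Good G act → edge c ∈ G × Good (remove (edge c) G) (act [ c ↦ false ])
   good-delete {G} {act} {c} c< a (goodGraph (represents sd cp) l) = mem∈ ,
    goodGraph (represents sd' (λ {x} {y} e → cp' e refl refl)) (s≤s⁻¹ (≤-trans (filter-notAll _ G (lose mem∈ λ n → n refl))
     (≤≡ l (trans (cong (ℓ₀ +_) (sym (countBelow-clear c< a))) (+-suc ℓ₀ _)))))
    where
    mem∈ : edge c ∈ G
    mem∈ = cp (let (e , e') = edge-sound c< refl in subst₂ (Edges act) (sym e) (sym e') (dynamic c< a))
    sd' : ∀ {x y} → (x , y) ∈ remove (edge c) G → Edges (act [ c ↦ false ]) (toℕ x) (toℕ y)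
    sd' {x} {y} p with ∈-filter⁻ (λ f → ¬? (≡-dec Fin._≟_ Fin._≟_ f (edge c))) p
    ... | p' , ne = go (sd p') refl refl
     where
     go : ∀ {x' y'} → Edges act x' y' → x' ≡ toℕ x → y' ≡ toℕ y → Edges (act [ c ↦ false ]) (toℕ x) (toℕ y)
     go (static st) refl refl = static st
     go (dynamic {c'} c'< e) p q with c ≟ c'
     ... | yes refl = ⊥-elim (ne (edge-complete c< (sym p) (sym q)))
     ... | no c≢ = subst₂ (Edges (act [ c ↦ false ])) p q (dynamic c'< (trans (↦-other act c≢) e))
    cp' : ∀ {x y x' y'} → Edges (act [ c ↦ false ]) x' y' → x' ≡ toℕ x → y' ≡ toℕ y → (x , y) ∈ remove (edge c) G
    cp' {x} {y} (static st) refl refl = ∈-filter⁺ _ (cp (static st)) λ e → static-row≢1 c< st (proj₁ (edge-sound c< e))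
    cp' {x} {y} (dynamic {c'} c'< e) p q with c ≟ c'
    ... | yes refl = case trans (sym (↦-same act c)) e of λ ()
    ... | no c≢ = ∈-filter⁺ _ (cp (subst₂ (Edges act) p q (dynamic c'< (trans (sym (↦-other act c≢)) e))))
       λ e' → c≢ (vtx₁-injective c< c'< (trans (sym (proj₁ (edge-sound c< e'))) (sym p)))

   operation : Bool → ℕ → DynOp n
   operation v c = if v then insert (edge c) else delete (edge c)

   sweepAt : (ℕ → Bool) → Bool → ℕ → List (DynOp n)
   sweepAt f v c = if f c then operation v c ∷ [] else []

   swept : (ℕ → Bool) → Bool → ℕ → ℕ → (ℕ → Bool) → ℕ → Bool
   swept f v k zero act = act
   swept f v k (suc m) act = swept f v (suc k) m (if f k then act [ k ↦ v ] else act)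

   swept-below : ∀ f v k m act c → c < k → swept f v k m act c ≡ act c
   swept-below f v k zero act c c< = refl
   swept-below f v k (suc m) act c c< with f k
   ... | false = swept-below f v (suc k) m act c (<-trans c< (n<1+n k))
   ... | true = trans (swept-below f v (suc k) m (act [ k ↦ v ]) c (<-trans c< (n<1+n k))) (↦-other act λ e → <⇒≢ c< (sym e))

   swept-value : ∀ f v k m act c → k ≤ c → c < k + m → swept f v k m act c ≡ (if f c then v else act c)
   swept-value f v k zero act c k≤ c< = ⊥-elim (<⇒≱ c< (≡≤ (+-identityʳ k) k≤))
   swept-value f v k (suc m) act c k≤ c< with m≤n⇒m<n∨m≡n k≤
   ... | inj₁ k<c = trans (swept-value f v (suc k) m (if f k then act [ k ↦ v ] else act) c k<c (subst (c <_) (+-suc k m) c<))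
       (cong (λ z → if f c then v else z) (unchanged-at (f k)))
    where
    unchanged-at : ∀ b → (if b then act [ k ↦ v ] else act) c ≡ act c
    unchanged-at true = ↦-other act (<⇒≢ k<c)
    unchanged-at false = refl
   ... | inj₂ refl = trans (swept-below f v (suc k) m _ k (n<1+n k)) (at-k (f k))
    where
    at-k : ∀ b → (if b then act [ k ↦ v ] else act) k ≡ (if b then v else act k)
    at-k true = ↦-same act k
    at-k false = refl

   Permits : Mode → Bool → Set
   Permits mode true = mode ≢ decremental
   Permits mode false = mode ≢ incremental

   -- Each selected edge must be in the opposite state beforehand; then no present edge is inserted
   -- and no absent one deleted. Clauses are visited once, so this survives until their turn.
   sweep-good : ∀ {mode} f v → Permits mode v → ∀ k m {G act} → k + m ≡ d → Good G act → (∀ c → k ≤ c → c < d → f c ≡ true → act c ≡ not v) →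
    Good (apply (upL k m (sweepAt f v)) G) (swept f v k m act) × ValidPrefix mode (ℓ₀ + d) G (upL k m (sweepAt f v))
   sweep-good f v ok k zero k+m g h = g , id
   sweep-good {mode} f v ok k (suc m) {G} {act} k+m g h with f k in fk
   ... | false = sweep-good f v ok (suc k) m (trans (sym (+-suc k m)) k+m) g (λ c k≤ → h c (<⇒≤ k≤))
   ... | true = one v ok refl
    where
    k<d : k < d
    k<d = subst (k <_) k+m (m<m+n k (s≤s z≤n))
    later : ∀ c → suc k ≤ c → c < d → f c ≡ true → (act [ k ↦ v ]) c ≡ not v
    later c k< c< fc = trans (↦-other act (<⇒≢ k<)) (h c (<⇒≤ k<) c< fc)
    one : ∀ v' → Permits mode v' → v' ≡ v →
     Good (apply ((operation v k ∷ []) ++ upL (suc k) m (sweepAt f v)) G) (swept f v (suc k) m (act [ k ↦ v ])) × ValidPrefix mode (ℓ₀ + d) G ((operation v k ∷ []) ++ upL (suc k) m (sweepAt f v))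
    one true ok refl =
     let (e∉ , g') = good-insert k<d (h k ≤-refl k<d fk) g
         (g'' , vp) = sweep-good f true ok (suc k) m (trans (sym (+-suc k m)) k+m) g' later
     in g'' , λ rest → insert ok e∉ (≤-trans (Good.len≤ g') (+-monoʳ-≤ ℓ₀ (countBelow-≤ d _))) (vp rest)
    one false ok refl =
     let (e∈ , g') = good-delete k<d (h k ≤-refl k<d fk) g
         (g'' , vp) = sweep-good f false ok (suc k) m (trans (sym (+-suc k m)) k+m) g' later
     in g'' , λ rest → delete ok e∈ (vp rest)

  -- The phases of the driver

  module Phases (A : DynAlg) (K : ℕ) where
   record Ready (ph : ℕ) (M : Mid) (node : ℕ → List ℕ) (len : ℕ) (s : State) (b : Bool) : Set where
    constructor ready
    field
     renv : Env M
     rw : World V ph M node len s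
     r29 : reg M 29 ≡ bool b

   core : ℕ → Bool
   core r = (r <ᵇ 15) ∨ ((29 ≤ᵇ r) ∧ (r <ᵇ 36))

   <15⇒core : ∀ r → T (r <ᵇ 15) → T (core r)
   <15⇒core r h with r <ᵇ 15
   ... | true = tt

   ready-core : ∀ {ph M M' node len s b} → Ready ph M node len s b → KeepOn core (reg M) (reg M') → tbl M' ≡ tbl M → Ready ph M' node len s b
   ready-core {M' = M'@(mid _ _ _)} (ready env w e) (keepOn k) refl = ready (rframe λ r r< → trans (k r (<15⇒core r r<)) (rf env r r<))
     (world-sy {M' = M'} w (same (k 30 tt) (k 31 tt) (k 32 tt) (k 33 tt) (k 34 tt) (k 35 tt)) frame-refl) (trans (k 29 tt) e)

   quiet-core : ∀ {f g} → KeepOn quiet f g → KeepOn core f g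
   quiet-core k = keepOn λ r r∈ → kp k r (weaker r r∈)
    where
    weaker : ∀ r → T (core r) → T (quiet r)
    weaker r h with r <ᵇ 15 in e
    ... | true = <20⇒quiet r (T-trans {r} {15} {20} (≡true⇒T e) tt)
    ... | false with r <ᵇ 20 | 29 ≤ᵇ r in e'
    ... | true | _ = tt
    ... | false | true = subst (λ z → T (z ∧ (r <ᵇ 36))) (sym (T⇒≡true (≤⇒≤ᵇ (≤-trans (m≤m+n 26 3) (≤ᵇ⇒≤ 29 r (≡true⇒T e')))))) h

   ready-quiet : ∀ {ph M M' node len s b} → Ready ph M node len s b → Quiet M M' → Ready ph M' node len s b
   ready-quiet R (quietly k e) = ready-core R (quiet-core k) e

   ready-evolved : ∀ {ph M M' node len node' len' s s' b} → Ready ph M node len s b → World V ph M' node' len' s' → RFrame 35 M M' → Ready ph M' node' len' s' b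
   ready-evolved (ready env w e) w' f = ready (rframe-trans env (rframe-weaken 15 tt f)) w' (trans (rf f 29 tt) e)

   run-wrapReg : ∀ {ph M node len s x} r → World V ph M node len s → reg M 42 ≡ x → x < 2 ^ W →
    Run (wrapRegP r) M (div-time + 3 + 7) (λ M' → World V ph M' node len (setReg r (wrap V x) s) × Evolved ph M M' node len node len)
   run-wrapReg {x = x} r w e x< = run-mod 2V≤ W<W (World.cs w) e x< ▸▸ λ {M₁} (e42 , H) →
    let w₁ , ev₁ = world-regs {M' = M₁} (ft H) (rframe-weaken 36 tt (frame-rframe H)) w in
    run-map (λ {M₂} (te , f) → let w₂ , ev₂ = world-put (regC r) 0 (wrap V x) w₁ te (rframe-weaken 36 tt f) (λ _ ())
                                       (view-setReg r (wrap V x) (World.vw w₁)) (bounded-setReg r (wrap< V x) (World.bd w₁))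
         in w₂ , evolved-trans ev₁ ev₂)
     (run-put (regC r) 31 42 (inj₁ tt) (World.e34 w₁) (c31 (World.cs w₁)) e42
      (<-≤-trans (s≤s (wrap< V x)) (≤-trans (+-monoˡ-≤ (2 ^ V) (0<2^ V)) (≡≤ (cong (2 ^ V +_) (sym (+-identityʳ (2 ^ V)))) (2P≤ {V} 2V≤ W<W)))))

   arguments-time : ℕ
   arguments-time = 3 + ((div-time + 3 + 7) + (3 + (div-time + 3 + 7)))

   run-arguments : ∀ {ph M node len s b c} → Ready ph M node len s b → reg M 16 ≡ c → c < d →
    Run argumentsP M arguments-time (λ M' → World V ph M' node len (passEdge V (edge c) s) × Evolved ph M M' node len node len)
   run-arguments {ph} {M} {node} {len} {s} {c = c} (ready env w _) e16 c< =
    s-add 42 9 16 tt tt (rf env 9 tt) e16 (<-trans (subst (_< n) (sym (l₂ B c)) (v₂< c<)) n<2^W) (frame-refl {50} {reg M}) ▸▸ λ {M₁} G₁ →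
    let w₁ , ev₁ = world-regs {M' = M₁} (ft G₁) (rframe-trans (rframe-setR 42 tt rframe-refl) (rframe-weaken 36 tt (frame-rframe G₁))) w in
    run-wrapReg 1 w₁ (fr G₁ 42 tt) (<-trans (subst (_< n) (sym (l₂ B c)) (v₂< c<)) n<2^W) ▸▸ λ {M₂} (w₂ , ev₂) →
    let ev₁₂ = evolved-trans ev₁ ev₂ in
    s-add 42 6 16 tt tt (trans (rf (Evolved.regs≡ ev₁₂) 6 tt) (rf env 6 tt)) (trans (rf (Evolved.regs≡ ev₁₂) 16 tt) e16) (<-trans (subst (_< n) (sym (l₁ B c)) (v₁< c<)) n<2^W) (frame-refl {50} {reg M₂}) ▸▸ λ {M₃} G₃ →
    let w₃ , ev₃ = world-regs {M' = M₃} (ft G₃) (rframe-trans (rframe-setR 42 tt rframe-refl) (rframe-weaken 36 tt (frame-rframe G₃))) w₂ in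
    run-map (λ {M₄} (w₄ , ev₄) → subst (World V ph M₄ node len) state≡ w₄ , evolved-trans ev₁₂ (evolved-trans ev₃ ev₄))
     (run-wrapReg 0 w₃ (fr G₃ 42 tt) (<-trans (subst (_< n) (sym (l₁ B c)) (v₁< c<)) n<2^W))
    where
    l₁ : ∀ b c → b + c ≡ 1 * b + c
    l₁ = solve-∀
    l₂ : ∀ b c → b + b + c ≡ 2 * b + c
    l₂ = solve-∀
    state≡ : setReg 0 (wrap V (B + c)) (setReg 1 (wrap V (B + B + c)) s) ≡ passEdge V (edge c) s
    state≡ = cong₂ (λ x y → setReg 0 (wrap V x) (setReg 1 (wrap V y) s)) (trans (l₁ B c) (sym (toℕ-vertex (v₁< c<)))) (trans (l₂ B c) (sym (toℕ-vertex (v₂< c<))))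

   module Simulate (α : ℚ.ℚ) (V≡ : V ≡ wordSize (wordConst A) n) (K< : K < 2 ^ W)
    (insert-consts : ConstsBelow K (onInsert A)) (delete-consts : ConstsBelow K (onDelete A)) (query-consts : ConstsBelow K (onQuery A)) (ℓ₀ : ℕ) where
    open Dynamic ℓ₀

    private
     operation-consts : ∀ v → ConstsBelow K (operationP A v)
     operation-consts true = insert-consts
     operation-consts false = delete-consts

     handles-operation : ∀ v {G s c ops ts} → Handles A α G s (operation v c ∷ ops) ts →
      ∃[ t ] ∃[ ts' ] ∃[ s' ] (ts ≡ t ∷ ts' × V ⊢ operationP A v , passEdge V (edge c) s ⇓[ t ] s' × Handles A α (apply (operation v c ∷ []) G) s' ops ts')
     handles-operation true (insert r h) = _ , _ , _ , refl , subst (λ z → z ⊢ onInsert A , passEdge z _ _ ⇓[ _ ] _) (sym V≡) r , h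
     handles-operation false (delete r h) = _ , _ , _ , refl , subst (λ z → z ⊢ onDelete A , passEdge z _ _ ⇓[ _ ] _) (sym V≡) r , h

    clauseSat : ℕ → ℕ → Bool
    clauseSat w c = partSat size lit (a + a) N w c

    sweep-overhead : ℕ
    sweep-overhead = ((3 + (3 + 3)) + ev-time size≤) + (4 + arguments-time)

    -- The times `ts` of the whole sequence are given in advance by `Handles`. The part `used` that
    -- has been spent pays both for the units of time so far and for the nodes allocated so far.
    record SweepState (ph : ℕ) (M₀ : Mid) (node : ℕ → List ℕ) (len : ℕ) (b : Bool) (G₁ : Digraph n) (rest : List (DynOp n)) (ts : List ℕ)
     (ops : List (DynOp n)) (M : Mid) (τ ov : ℕ) : Set where
     constructor sweepState
     field
      {node'} : ℕ → List ℕ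
      {len'} : ℕ
      {s'} : State
      {G'} : Digraph n
      {ts'} : List ℕ
      {used} : ℕ
      sready : Ready ph M node' len' s' b
      sdrift : Drift ph M₀ M node len node' len'
      shandles : Handles A α G' s' (ops ++ rest) ts'
      sgraph : apply ops G' ≡ G₁
      sused : used + sum ts' ≡ sum ts
      slen : len' ≤ len + used
      stime : τ ≤ used * σ K + ov

    sweep-core : ∀ {ph M₀ node len b G₁ rest ts ops M M' τ ov} → SweepState ph M₀ node len b G₁ rest ts ops M τ ov → KeepOn core (reg M) (reg M') → tbl M' ≡ tbl M →
     SweepState ph M₀ node len b G₁ rest ts ops M' τ ov
    sweep-core (sweepState R D h g u l t) k e = sweepState (ready-core R k e) (drift-trans D (drift-refl e)) h g u l t

    run-sweep : ∀ sel v w {ph M node len s b G rest ts} → Ready ph M node len s b → reg M 15 ≡ w → w < 2 ^ W → len + sum ts < 2 ^ W →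
     Handles A α G s (upL 0 d (sweepAt (λ c → select sel (clauseSat w c)) v) ++ rest) ts →
     ∃[ τ ] Run (sweepP sel (operationP A v)) M (7 + (τ + d * 7))
      (λ M' → SweepState ph M node len b (apply (upL 0 d (sweepAt (λ c → select sel (clauseSat w c)) v)) G) rest ts [] M' τ (d * sweep-overhead) × reg M' 15 ≡ w)
    run-sweep sel v w {ph} {M} {node} {len} {s} {b} {G} {rest} {ts} rdy e15 w< roomT h =
     let (τ , run) = run-for-τ Inv d<2^W (λ ()) (λ ()) (λ ())
          (λ (m , e , st , e15) → m , e , sweep-core st (keep-setR 63 tt keep-refl) refl , e15)
          (λ (m , e , st , e15) → m , e , sweep-core st (keep-setR 16 tt keep-refl) refl , e15)
          body (d , refl , sweepState rdy (drift-refl refl) h refl refl (≤-reflexive (sym (+-identityʳ len))) z≤n , e15) (rf (Ready.renv rdy) 2 tt)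
     in τ , run-map (λ { (zero , e , st , e15') → st , e15' ; (suc m , e , _) → ⊥-elim (<-irrefl (sym e) (m<m+n d (s≤s z≤n))) }) run
     where
     f : ℕ → Bool
     f c = select sel (clauseSat w c)
     Gend = apply (upL 0 d (sweepAt f v)) G
     d<2^W : d < 2 ^ W
     d<2^W = ≤-<-trans d≤B (≤-<-trans (m≤n*m B R {{>-nonZero (≤-<-trans z≤n L<R)}}) n<2^W)
     Inv : ℕ → ℕ → Mid → Set
     Inv k τ M' = ∃[ m ] (k + m ≡ d × SweepState ph M node len b Gend rest ts (upL k m (sweepAt f v)) M' τ (k * sweep-overhead) × reg M' 15 ≡ w)
     bodyP = ((copyP 22 4 ⨾ copyP 23 1 ⨾ copyP 24 15) ⨾ evP) ⨾ nzP 25 ⨾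
       flagP (if sel then argumentsP ⨾ simP (operationP A v) else skip) (if sel then skip else argumentsP ⨾ simP (operationP A v))
     Post : ℕ → ℕ → Mid → Set
     Post k τ M'' = Inv (suc k) τ M'' × reg M'' 16 ≡ k × reg M'' 2 ≡ d
     decide : ∀ {k M' c x} {Q : Mid → Set} → k < d → Env M' → reg M' 30 ≡ W → reg M' 16 ≡ k → reg M' 15 ≡ w → f k ≡ x →
      (∀ {M₂} → Quiet M' M₂ → Run (if x then argumentsP ⨾ simP (operationP A v) else skip) M₂ c Q) →
      Run bodyP M' (((3 + (3 + 3)) + ev-time size≤) + (4 + c)) Q
     decide {k} {M'} {c} {x} {Q} k< env e30 e16 e15 fk r =
      run-ev env e30 e16 k< N≤W w< (s-copy 22 4 tt (rf env 4 tt) (frame-refl {50} {reg M'}) ▸▸ λ G₁ → s-copy 23 1 tt (rf env 1 tt) G₁ ▸▸ λ G₂ →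
        run-map (λ {M₃} G₃ → quiet₀ {M'} {M₃} (keep-setR 24 tt (keep-setR 23 tt (keep-setR 22 tt keep-refl))) G₃ , fr G₃ 22 tt , fr G₃ 23 tt , fr G₃ 24 tt) (s-copy 24 15 tt e15 G₂)) ▸▸
      λ {M₁} (q , e25) → s-ifnz 25 tt e25 (frame-refl {50} {reg M₁})
       (λ ne {M₂} G → yes-branch sel (bool≢0 ne) fk (quiet-trans q (quiet₀ {M₁} {M₂} keep-refl G)))
       (λ z {M₂} G → no-branch sel (bool≡0 z) fk (quiet-trans q (quiet₀ {M₁} {M₂} keep-refl G)))
      where
      yes-branch : ∀ sel' → clauseSat w k ≡ true → select sel' (clauseSat w k) ≡ x → ∀ {M₂} → Quiet M' M₂ → Run (if sel' then argumentsP ⨾ simP (operationP A v) else skip) M₂ c Q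
      yes-branch true p fk q with refl ← trans (sym p) fk = r q
      yes-branch false p fk q with refl ← trans (cong not (sym p)) fk = r q
      no-branch : ∀ sel' → clauseSat w k ≡ false → select sel' (clauseSat w k) ≡ x → ∀ {M₂} → Quiet M' M₂ → Run (if sel' then skip else argumentsP ⨾ simP (operationP A v)) M₂ c Q
      no-branch true p fk q with refl ← trans (sym p) fk = r q
      no-branch false p fk q with refl ← trans (cong not (sym p)) fk = r q
     body : ∀ {k τ M'} → k < d → reg M' 16 ≡ k → reg M' 2 ≡ d → Inv k τ M' → ∃[ c ] Run bodyP M' c (Post k (τ + c))
     body k< e16 e2 (zero , e , _) = ⊥-elim (<⇒≢ k< (trans (sym (+-identityʳ _)) e))
     body {k} {τ} {M'} k< e16 e2 (suc m , e , sweepState {node'} {len'} {s'} {G'} {ts'} {used} rdy' D hd g us l t , e15) =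
      advance (f k) refl (subst (λ z → Handles A α G' s' z ts') (++-assoc (sweepAt f v k) (upL (suc k) m (sweepAt f v)) rest) hd) (trans (sym (apply-++ (sweepAt f v k) _ G')) g)
      where
      k+m = trans (sym (+-suc k m)) e
      e30 = c30 (World.cs (Ready.rw rdy'))
      advance : ∀ x → f k ≡ x → Handles A α G' s' ((if x then operation v k ∷ [] else []) ++ (upL (suc k) m (sweepAt f v) ++ rest)) ts' →
       apply (upL (suc k) m (sweepAt f v)) (apply (if x then operation v k ∷ [] else []) G') ≡ Gend → ∃[ c ] Run bodyP M' c (Post k (τ + c))
      advance false fk hd' g' = _ , decide k< (Ready.renv rdy') e30 e16 e15 fk λ {M₂} q → run-≤ (m≤m+n 1 (arguments-time ∸ 1)) (exec-skip ,,
       ((m , k+m , sweepState (ready-quiet rdy' q) (drift-trans D (drift-refl (qt q))) hd' g' us l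
         (≤≡ (+-monoˡ-≤ sweep-overhead t) (lem (used * σ K) (k * sweep-overhead) sweep-overhead)) , trans (kp (qr q) 15 tt) e15)
       , trans (kp (qr q) 16 tt) e16 , trans (kp (qr q) 2 tt) e2))
       where
       lem : ∀ a b o → a + b + o ≡ a + (o + b)
       lem = solve-∀
      advance true fk hd' g' with handles-operation v hd'
      ... | t₁ , ts'' , s'' , refl , r , hd'' = _ , decide k< (Ready.renv rdy') e30 e16 e15 fk λ {M₂} q →
       let R₂ = ready-quiet {M' = M₂} rdy' q in
       run-arguments R₂ (trans (kp (qr q) 16 tt) e16) k< ▸▸ λ {M₃} (w₃ , ev₃) →
       run-map (λ {M₄} (node₄ , len₄ , w₄ , ev₄ , l₄) →
        let ev = evolved-trans ev₃ ev₄
            fr₄ = rframe-trans (quiet-20 q) (rframe-weaken 20 tt (Evolved.regs≡ ev)) in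
        (m , k+m , sweepState (ready-evolved R₂ w₄ (Evolved.regs≡ ev)) (drift-trans (drift-trans D (drift-refl (qt q))) (evolved-drift ev)) hd'' g'
         (trans (+-assoc used t₁ (sum ts'')) us)
         (≤-trans l₄ (≤≡ (+-monoˡ-≤ t₁ l) (+-assoc len used t₁)))
         (≤≡ (+-monoˡ-≤ _ t) (cost (used * σ K) (k * sweep-overhead) refl)) , trans (rf fr₄ 15 tt) e15)
        , trans (rf fr₄ 16 tt) e16 , trans (rf fr₄ 2 tt) e2)
       (sim-run 2V≤ W<W K< (operationP A v) (operation-consts v) r w₃ (≤-<-trans (≤-trans (+-monoˡ-≤ t₁ l) (≡≤ (+-assoc len used t₁)
        (+-monoʳ-≤ len (≤≡ (+-monoʳ-≤ used (m≤m+n t₁ (sum ts''))) us)))) roomT))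
       where
       cost : ∀ a b → a ≡ used * σ K → a + b + (((3 + (3 + 3)) + ev-time size≤) + (4 + (arguments-time + t₁ * σ K))) ≡ (used + t₁) * σ K + (sweep-overhead + b)
       cost a b refl = trans (lem (used * σ K) b (9 + ev-time size≤) arguments-time t₁ (σ K)) (cong (_+ (sweep-overhead + b)) (lem₂ used t₁ (σ K)))
        where
        lem : ∀ a b e r t s → a + b + (e + (4 + (r + t * s))) ≡ (a + t * s) + ((e + (4 + r)) + b)
        lem = solve-∀
        lem₂ : ∀ u t s → u * s + t * s ≡ (u + t) * s
        lem₂ u t s = sym (*-distribʳ-+ s u t)

    -- Whether the parts w and u of an assignment can be completed.
    solved : ℕ → ℕ → Bool
    solved w u = anyBelow U (λ v → not (anyBelow d (λ c → not (satisfied size lit a N u v w c))))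

    falsified : ℕ → ℕ → Bool
    falsified w c = not (clauseSat w c)

    Gap : Set
    Gap = ∀ P P̂ → fromℕ P̂ ℚ.≤ α ℚ.* fromℕ P → P ≤ 3 + L → P̂ < 3 + 2 * L

    -- `solved` is computable, so its value decides which bound on the eccentricity applies: a
    -- completing v gives the lower bound, and otherwise every v comes with a clause that all three
    -- parts falsify.
    far-solved : ∀ {G w s} → Gap → Good G (falsified w) → CorrectEstimates α G s → ∀ {u} → u < U → far L (mem s 1 (u ∷ [])) ≡ solved w u
    far-solved {G} {w} {s} gap (goodGraph reps _) ok {u} u< with solved w u in e
    ... | true = let (v , v< , all) = anyBelow⁻ U e in
     trans (cong (λ z → far L (mem s 1 (z ∷ []))) (sym (toℕ-vertex u<n))) (estimate-far α L {G} {s} {vertex u} ok λ {e'} →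
      Yes.eccentricity≥ (falsified w) u v u< v< (λ c c< f₁ f₂ f₃ → contra v c (anyBelow-false d (not-true all) c c<) (not-true f₁) (not-true f₂) (not-true f₃)) {G} {vertex u} {e'} reps (toℕ-vertex u<n))
     where
     u<n = <-≤-trans (<-trans u< A<B) (m≤n*m B R {{>-nonZero (≤-<-trans z≤n L<R)}})
     contra : ∀ v c → not (satisfied size lit a N u v w c) ≡ false → partSat size lit 0 a u c ≡ false → partSat size lit a (a + a) v c ≡ false → clauseSat w c ≡ false → ⊥
     contra v c e p q r = case trans (sym (not-false e)) (trans (cong (_∨ (partSat size lit a (a + a) v c ∨ clauseSat w c)) p) (trans (cong (_∨ clauseSat w c) q) r)) of λ ()
    ... | false = trans (cong (λ z → far L (mem s 1 (z ∷ []))) (sym (toℕ-vertex u<n))) (estimate-near α L {G} {s} {vertex u} ok gap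
      (No.walks≤ (falsified w) u u< bad reps (toℕ-vertex u<n)))
     where
     u<n = <-≤-trans (<-trans u< A<B) (m≤n*m B R {{>-nonZero (≤-<-trans z≤n L<R)}})
     bad : ∀ v → v < U → ∃[ c ] (c < d × not (partSat size lit 0 a u c) ≡ true × not (partSat size lit a (a + a) v c) ≡ true × falsified w c ≡ true)
     bad v v< with anyBelow⁻ d (not-false (anyBelow-false U e v v<))
     ... | c , c< , ns =
      let p = partSat size lit 0 a u c
          p' = partSat size lit a (a + a) v c
          q = ∨-conicalʳ p (p' ∨ clauseSat w c) (not-true ns)
      in c , c< , cong not (∨-conicalˡ p _ (not-true ns)) , cong not (∨-conicalˡ p' _ q) , cong not (∨-conicalʳ p' _ q)

    set29 : ∀ {ph M node len s b} c → Ready ph M node len s b → Ready ph (setR 29 (bool c) (setF false M)) node len s c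
    set29 {M = M} c (ready env w _) = ready (rframe-setR 29 tt env) (world-sy w (same refl refl refl refl refl refl) (frame-cong 29 (bool c) frame-refl)) refl

    estimate-time : ℕ
    estimate-time = 1 + ((3 + suc 13) + (4 + (4 + 6)))

    run-estimate : ∀ {ph M node len s b u} → Ready ph M node len s b → reg M 17 ≡ u →
     Run estimateP M estimate-time (λ M' → Ready ph M' node len s (b ∨ far L (mem s 1 (u ∷ []))) × RFrame 29 M M' × tbl M' ≡ tbl M)
    run-estimate {ph} {M} {node} {len} {s} {b} {u} rdy@(ready env w e29) e17 =
     exec-ld 42 0 31 17 {v = tbl M 0 0 u} (λ ()) (λ ()) (cong₂ (tbl M 0) (c31 (World.cs w)) e17) ▸
     (word (tbl M 0 0 u) refl ▸▸ λ {M₁} (e43 , te , f) →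
      let R₁ = ready-core {M' = M₁} rdy (keepOn λ r r∈ → rf f r (core<42 r r∈)) te in
      s-ifnz 43 tt e43 (frame-refl {50} {reg M₁})
       (λ ne {M₂} G → let R₂ = ready-quiet {M' = M₂} R₁ (quiet₀ {M₁} {M₂} keep-refl G) in
        s-iflt 13 43 tt tt (rf (Ready.renv R₂) 13 tt) (trans (fr G 43 tt) e43) (frame-refl {50} {reg M₂})
         (λ l {M₃} G₃ → finish (rframe-trans f (rframe-trans (frame-rframe (frame-weaken (m≤m+n 42 8) G)) (frame-rframe (frame-weaken (m≤m+n 42 8) G₃)))) (trans (ft G₃) (trans (ft G) te))
           (ready-quiet R₂ (quiet₀ {M₂} {M₃} keep-refl G₃)) (cong₂ _∨_ (≢⇒≡ᵇ ne) (<ᵇ-true l)))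
         (λ l {M₃} G₃ → run-≤ (m≤m+n 1 5) (exec-skip ,, (subst (Ready ph M₃ node len s) (sym (trans (cong (b ∨_) (cong₂ _∨_ (≢⇒≡ᵇ ne) (<ᵇ-false l))) (∨-idʳ b)))
            (ready-quiet R₂ (quiet₀ {M₂} {M₃} keep-refl G₃))
           , rframe-weaken 29 tt (rframe-trans f (rframe-trans (frame-rframe (frame-weaken (m≤m+n 42 8) G)) (frame-rframe (frame-weaken (m≤m+n 42 8) G₃)))) , trans (ft G₃) (trans (ft G) te)))))
       (λ z {M₂} G → run-≤ (m≤n+m 6 4) (finish (rframe-trans f (frame-rframe (frame-weaken (m≤m+n 42 8) G))) (trans (ft G) te)
         (ready-quiet {M' = M₂} R₁ (quiet₀ {M₁} {M₂} keep-refl G)) (cong (_∨ (4 + 2 * L ≤ᵇ mem s 1 (u ∷ []))) (cong (_≡ᵇ 0) z)))))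
     where
     core<42 : ∀ r → T (core r) → T (r <ᵇ 42)
     core<42 r h with r <ᵇ 15 in e
     ... | true = T-trans {r} {15} {42} (≡true⇒T e) tt
     ... | false with 29 ≤ᵇ r
     ... | true = T-trans {r} {36} {42} h tt
     ∨-idʳ : ∀ b → b ∨ false ≡ b
     ∨-idʳ true = refl
     ∨-idʳ false = refl
     ∨-trueʳ : ∀ b → b ∨ true ≡ true
     ∨-trueʳ true = refl
     ∨-trueʳ false = refl
     finish : ∀ {M₃ b'} → RFrame 42 M M₃ → tbl M₃ ≡ tbl M → Ready ph M₃ node len s b' → far L (mem s 1 (u ∷ [])) ≡ true →
      Run (constP 29 1) M₃ 6 (λ M' → Ready ph M' node len s (b ∨ far L (mem s 1 (u ∷ []))) × RFrame 29 M M' × tbl M' ≡ tbl M)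
     finish {M₃} f te R₃ e = exec-const 29 1 (≤-<-trans (m≤m+n 1 3) (≤-<-trans (m≤m+n 4 _) room)) ,,
      (subst (Ready ph (setR 29 1 (setF false M₃)) node len s) (sym (trans (cong (b ∨_) e) (∨-trueʳ b))) (set29 true R₃) , rframe-setR 29 tt (rframe-weaken 29 tt f) , te)
     word : ∀ c → tbl M 0 0 u ≡ c → Run (nzP 42 ⨾ flagP (getP (code (memC 1)) 42 43) (zeroP 43)) (setR 42 (tbl M 0 0 u) M) (3 + suc 13)
      (λ M' → reg M' 43 ≡ mem s 1 (u ∷ []) × tbl M' ≡ tbl M × RFrame 42 M M')
     -- Without a node the memory at this address holds 0, the encoding of ∞.
     word zero ec = exec-nz 42 {b = false} (cong (λ z → not (z ≡ᵇ 0)) ec) ▸ run-if false refl (λ ()) λ _ → run-≤ (m≤m+n 3 10)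
      (exec-zero 43 ,, (sym (View.vm⁰ (World.vw w) 1 λ j< e → Trie.child⁰ (World.tr w) (Trie.0<len (World.tr w)) ec j< (trans e (cong (_∷ʳ u) (sym (Trie.root (World.tr w))))))
       , refl , rframe-setR 43 tt (rframe-setR 63 tt (rframe-setR 42 tt rframe-refl))))
     word (suc c) ec = exec-nz 42 {b = true} (cong (λ z → not (z ≡ᵇ 0)) ec) ▸ run-if true refl (λ _ →
      run-map (λ (e , te , f) → trans e (trans (View.vm (World.vw w) 1 (proj₁ ch)) (cong (mem s 1) (trans (proj₂ ch) (cong (_∷ʳ u) (Trie.root (World.tr w))))))
           , te , rframe-trans (rframe-setR 63 tt (rframe-setR 42 tt rframe-refl)) (rframe-weaken 42 tt f))
       (run-get (memC 1) 42 43 tt tt tt (World.e34 w) (c31 (World.cs w)) ec)) (λ ())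
      where ch = Trie.child⁺ (World.tr w) (Trie.0<len (World.tr w)) ec

    check-time : ℕ
    check-time = 7 + U * (estimate-time + 7)

    run-check : ∀ {ph M node len s b} → Ready ph M node len s b →
     Run checkP M check-time (λ M' → Ready ph M' node len s (b ∨ anyBelow U (λ u → far L (mem s 1 (u ∷ [])))) × RFrame 17 M M' × tbl M' ≡ tbl M)
    run-check {ph} {M} {node} {len} {s} {b} rdy = run-for estimate-time Inv
      (<-trans (<-≤-trans A<B (m≤n*m B R {{>-nonZero (≤-<-trans z≤n L<R)}})) n<2^W) (λ ()) (λ ()) (λ ())
      (λ (r , f , e) → ready-core r (keep-setR 63 tt keep-refl) refl , rframe-setR 63 tt f , e)
      (λ (r , f , e) → ready-core r (keep-setR 17 tt keep-refl) refl , rframe-setR 17 tt f , e)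
      (λ {k} {M'} k< e17 e5 (r , f , e) → run-map (λ {M''} (r' , f' , e') →
        (subst (Ready ph M'' node len s) (∨-assoc b (anyBelow k (λ u → far L (mem s 1 (u ∷ []))))) r' , rframe-trans f (rframe-weaken 17 tt f') , trans e' e)
        , trans (rf f' 17 tt) e17 , trans (rf f' 5 tt) e5) (run-estimate r e17))
      (subst (Ready ph M node len s) (sym (∨-idʳ b)) rdy , rframe-refl , refl) (rf (Ready.renv rdy) 5 tt)
     where
     Inv : ℕ → Mid → Set
     Inv k M' = Ready ph M' node len s (b ∨ anyBelow k (λ u → far L (mem s 1 (u ∷ [])))) × RFrame 17 M M' × tbl M' ≡ tbl M
     ∨-assoc : ∀ b c {e} → (b ∨ c) ∨ e ≡ b ∨ (c ∨ e)
     ∨-assoc true c = refl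
     ∨-assoc false c = refl
     ∨-idʳ : ∀ b → b ∨ false ≡ b
     ∨-idʳ true = refl
     ∨-idʳ false = refl

    handles-query : ∀ {G : Digraph n} {s ops ts} → Handles A α G s (query ∷ ops) ts →
     ∃[ t ] ∃[ ts' ] ∃[ s' ] (ts ≡ t ∷ ts' × V ⊢ onQuery A , s ⇓[ t ] s' × CorrectEstimates α G s' × Handles A α G s' ops ts')
    handles-query (query r ok h) = _ , _ , _ , refl , subst (λ z → z ⊢ onQuery A , _ ⇓[ _ ] _) (sym V≡) r , ok , h

    phase-overhead : ℕ
    phase-overhead = d * sweep-overhead + ((7 + d * 7) + check-time)

    sweepOps : (sel v : Bool) → ℕ → List (DynOp n)
    sweepOps sel v w = upL 0 d (sweepAt (λ c → select sel (clauseSat w c)) v)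

    run-phase : Gap → ∀ sel v w {ph M node len s b G rest ts} → Ready ph M node len s b → reg M 15 ≡ w → w < 2 ^ W → len + sum ts < 2 ^ W →
     Handles A α G s (sweepOps sel v w ++ (query ∷ rest)) ts → Good (apply (sweepOps sel v w) G) (falsified w) →
     ∃[ T ] Run (phaseP A sel v) M T (λ M' → SweepState ph M node len (b ∨ anyBelow U (solved w)) (apply (sweepOps sel v w) G) rest ts [] M' T phase-overhead × reg M' 15 ≡ w)
    run-phase gap sel v w {ph} {M} {node} {len} {s} {b} {G} {rest} {ts} rdy e15 w< roomT h good
     with run-sweep sel v w rdy e15 w< roomT h
    ... | τ , _,,_ {M₁} e (sweepState {len' = len₁} {s' = s₁} {used = used} rdy₁ D h₁ refl us l t , e15₁) with handles-query h₁
    ... | tq , ts₂ , s₂ , refl , r , ok , h₂ =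
     (7 + (τ + d * 7)) + (tq * σ K + check-time) , (e ▸
      (sim-run 2V≤ W<W K< (onQuery A) query-consts r (Ready.rw rdy₁) (≤-<-trans (≤-trans len≤ (+-monoʳ-≤ len used≤)) roomT) ▸▸
       λ {M₂} (node₃ , len₃ , w₃ , ev₃ , l₃) →
      run-map (λ {M₃} (rdy₄ , f₄ , te₄) →
       sweepState (subst (λ z → Ready ph M₃ node₃ len₃ s₂ (b ∨ z)) (anyBelow-cong U λ u u< → far-solved {s = s₂} gap good ok u<) rdy₄)
        (drift-trans D (drift-trans (evolved-drift ev₃) (drift-refl te₄))) h₂ refl
        (trans (+-assoc used tq (sum ts₂)) us) (≤-trans l₃ len≤)
        (≤≡ (+-monoˡ-≤ (tq * σ K + check-time) (+-monoʳ-≤ 7 (+-monoˡ-≤ (d * 7) t))) (time₁ used tq (σ K) (d * sweep-overhead) (d * 7) check-time))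
       , trans (rf f₄ 15 tt) (trans (rf (Evolved.regs≡ ev₃) 15 tt) e15₁))
       (run-check (ready-evolved rdy₁ w₃ (Evolved.regs≡ ev₃)))))
     where
     len≤ : len₁ + tq ≤ len + (used + tq)
     len≤ = ≤≡ (+-monoˡ-≤ tq l) (+-assoc len used tq)
     used≤ : used + tq ≤ sum ts
     used≤ = ≤≡ (+-monoʳ-≤ used (m≤m+n tq (sum ts₂))) us

    answer : ℕ → Bool
    answer k = anyBelow k (λ w → anyBelow U (solved w))

    none all : ℕ → Bool
    none _ = false
    all _ = true

    fullOps : ℕ → List (DynOp n)
    fullOps w = sweepOps false true w ++ (query ∷ sweepOps false false w)

    inserted : ∀ {mode w G} → mode ≢ decremental → Good G none → Good (apply (sweepOps false true w) G) (falsified w) × ValidPrefix mode (ℓ₀ + d) G (sweepOps false true w)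
    inserted {mode} {w} {G} ok g with sweep-good {mode} (falsified w) true ok 0 d refl g (λ _ _ _ _ → refl)
    ... | g' , vp = good-cong (λ c c< → trans (swept-value (falsified w) true 0 d none c z≤n c<) (value (falsified w c))) g' , vp
     where
     value : ∀ b → (if b then true else false) ≡ b
     value true = refl
     value false = refl

    deleted : ∀ {mode w G} → mode ≢ incremental → Good G (falsified w) → Good (apply (sweepOps false false w) G) none × ValidPrefix mode (ℓ₀ + d) G (sweepOps false false w)
    deleted {mode} {w} {G} ok g with sweep-good {mode} (falsified w) false ok 0 d refl g (λ _ _ _ e → e)
    ... | g' , vp = good-cong (λ c c< → trans (swept-value (falsified w) false 0 d (falsified w) c z≤n c<) (value (falsified w c))) g' , vp
     where
     value : ∀ b → (if b then false else b) ≡ false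
     value true = refl
     value false = refl

    thinned : ∀ {mode w G} → mode ≢ incremental → Good G all → Good (apply (sweepOps true false w) G) (falsified w) × ValidPrefix mode (ℓ₀ + d) G (sweepOps true false w)
    thinned {mode} {w} {G} ok g with sweep-good {mode} (clauseSat w) false ok 0 d refl g (λ _ _ _ _ → refl)
    ... | g' , vp = good-cong (λ c c< → trans (swept-value (clauseSat w) false 0 d all c z≤n c<) (value (clauseSat w c))) g' , vp
     where
     value : ∀ b → (if b then false else true) ≡ not b
     value true = refl
     value false = refl

    full-good : ∀ {w G} → Good G none → Good (apply (fullOps w) G) none
    full-good {w} {G} g = subst (λ H → Good H none) (sym (apply-++ (sweepOps false true w) _ G))
     (proj₁ (deleted {fullyDynamic} {w} (λ ()) (proj₁ (inserted {fullyDynamic} {w} (λ ()) g))))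

    -- Between two values of w no dynamic edge is present, so the sequences for successive w can be
    -- concatenated.
    full-valid : ∀ k m {G} → Good G none → Valid fullyDynamic (ℓ₀ + d) G (upL k m fullOps)
    full-valid k zero g = []
    full-valid k (suc m) {G} g = subst (Valid fullyDynamic (ℓ₀ + d) G) (sym (trans (++-assoc (sweepOps false true k) _ _) refl))
     (proj₂ ins (query (proj₂ del (subst (λ H → Valid fullyDynamic (ℓ₀ + d) H (upL (suc k) m fullOps)) (apply-++ (sweepOps false true k) _ G) (full-valid (suc k) m (full-good {k} g))))))
     where
     ins = inserted {fullyDynamic} {k} (λ ()) g
     del = deleted {fullyDynamic} {k} (λ ()) (proj₁ ins)

    full-overhead : ℕ
    full-overhead = phase-overhead + (7 + (d * sweep-overhead + d * 7))

    -- The time is stated in terms of `sum ts`, the only quantity that an amortized guarantee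
    -- controls.
    run-full : Gap → Φ < 2 ^ W → ∀ {M node len s G ts} → Ready 0 M node len s false → Good G none → len + sum ts < 2 ^ W →
     Handles A α G s (upL 0 Φ fullOps) ts →
     Run (fullP A) M (7 + ((sum ts * σ K + Φ * full-overhead) + Φ * 7)) (λ M' → reg M' 29 ≡ bool (answer Φ))
    run-full gap Φ< {M} {node} {len} {s} {G} {ts} rdy good roomT h =
     let (τ , run) = run-for-τ Inv Φ< (λ ()) (λ ()) (λ ())
          (λ { (m , e , sweepState r D hd g us l t , gd) → m , e , sweep-core (sweepState r D hd g us l t) (keep-setR 63 tt keep-refl) refl , gd })
          (λ { (m , e , sweepState r D hd g us l t , gd) → m , e , sweep-core (sweepState r D hd g us l t) (keep-setR 15 tt keep-refl) refl , gd })
          body (Φ , refl , sweepState rdy (drift-refl refl) (subst (λ ops → Handles A α G s ops ts) (sym (++-identityʳ _)) h) refl refl (≤-reflexive (sym (+-identityʳ len))) z≤n , good)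
          (rf (Ready.renv rdy) 0 tt)
     in run-≤ (+-monoʳ-≤ 7 (+-monoˡ-≤ (Φ * 7) (final (Run.post run)))) (run-map (λ { (m , e , st , _) → Ready.r29 (SweepState.sready st) }) run)
     where
     Gend = apply (upL 0 Φ fullOps) G
     Inv : ℕ → ℕ → Mid → Set
     Inv k τ M' = ∃[ m ] (k + m ≡ Φ × Σ[ st ∈ SweepState 0 M node len (answer k) Gend [] ts (upL k m fullOps) M' τ (k * full-overhead) ] Good (SweepState.G' st) none)
     final : ∀ {τ M'} → Inv Φ τ M' → τ ≤ sum ts * σ K + Φ * full-overhead
     final (_ , _ , sweepState {ts' = ts'} {used = used} _ _ _ _ us _ t , _) =
      ≤-trans t (+-monoˡ-≤ (Φ * full-overhead) (*-monoˡ-≤ (σ K) (≤≡ (m≤m+n used (sum ts')) us)))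
     body : ∀ {k τ M'} → k < Φ → reg M' 15 ≡ k → reg M' 0 ≡ Φ → Inv k τ M' →
      ∃[ c ] Run (phaseP A false true ⨾ sweepP false (onDelete A)) M' c (λ M'' → Inv (suc k) (τ + c) M'' × reg M'' 15 ≡ k × reg M'' 0 ≡ Φ)
     body k< _ _ (zero , e , _) = ⊥-elim (<⇒≢ k< (trans (sym (+-identityʳ _)) e))
     body {k} {τ} {M'} k< e15 e0 (suc m , e , sweepState {node'} {len'} {s'} {G'} {ts'} {used} rdy' D hd g us l t , gd) =
      first (run-phase gap false true k {rest = rest₁} rdy' e15 (<-trans k< Φ<) room' (subst (λ ops → Handles A α G' s' ops ts') assoc hd) (proj₁ ins))
      where
      rest₂ rest₁ : List (DynOp n)
      rest₂ = upL (suc k) m fullOps ++ []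
      rest₁ = sweepOps false false k ++ rest₂
      ins = inserted {fullyDynamic} {k} (λ ()) gd
      G₁ G₂ : Digraph n
      G₁ = apply (sweepOps false true k) G'
      G₂ = apply (sweepOps false false k) G₁
      assoc : upL k (suc m) fullOps ++ [] ≡ sweepOps false true k ++ (query ∷ rest₁)
      assoc = trans (++-assoc (fullOps k) _ []) (++-assoc (sweepOps false true k) _ _)
      room' : len' + sum ts' < 2 ^ W
      room' = ≤-<-trans (≤-trans (+-monoˡ-≤ (sum ts') l) (≡≤ (+-assoc len used (sum ts')) (+-monoʳ-≤ len (≤-reflexive us)))) roomT
      graph≡ : apply (upL (suc k) m fullOps) G₂ ≡ Gend
      graph≡ = trans (sym (trans (apply-++ (fullOps k) _ G') (cong (apply (upL (suc k) m fullOps)) (apply-++ (sweepOps false true k) _ G')))) g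
      Result : Set
      Result = ∃[ c ] Run (phaseP A false true ⨾ sweepP false (onDelete A)) M' c (λ M'' → Inv (suc k) (τ + c) M'' × reg M'' 15 ≡ k × reg M'' 0 ≡ Φ)
      first : ∃[ T ] Run (phaseP A false true) M' T (λ M'' → SweepState 0 M' node' len' (answer (suc k)) G₁ rest₁ ts' [] M'' T phase-overhead × reg M'' 15 ≡ k) → Result
      first (T₁ , _,,_ {M₁} e₁ (sweepState {node₁} {len₁} {s₁} {ts' = ts₁} {used = used₁} rdy₁ D₁ h₁ refl us₁ l₁ t₁ , e15₁)) =
       second (run-sweep false false k rdy₁ e15₁ (<-trans k< Φ<) room₁ h₁)
       where
       room₁ : len₁ + sum ts₁ < 2 ^ W
       room₁ = ≤-<-trans (≤-trans (+-monoˡ-≤ (sum ts₁) (≤-trans l₁ (+-monoˡ-≤ used₁ l))) (≡≤ (sum₁ len used used₁ (sum ts₁))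
         (+-monoʳ-≤ len (≤-reflexive (trans (cong (used +_) us₁) us))))) roomT
       second : ∃[ τ₂ ] Run (sweepP false (onDelete A)) M₁ (7 + (τ₂ + d * 7)) (λ M'' → SweepState 0 M₁ node₁ len₁ (answer (suc k)) G₂ rest₂ ts₁ [] M'' τ₂ (d * sweep-overhead) × reg M'' 15 ≡ k) → Result
       second (τ₂ , _,,_ {M₂} e₂ (sweepState {len' = len₂} {ts' = ts₂} {used = used₂} rdy₂ D₂ h₂ refl us₂ l₂ t₂ , e15₂)) =
        T₁ + (7 + (τ₂ + d * 7)) , (exec-⨾ e₁ e₂ ,, ((m , trans (sym (+-suc k m)) e , sweepState rdy₂ (drift-trans D (drift-trans D₁ D₂)) h₂ graph≡
          (trans (sum₁ used used₁ used₂ (sum ts₂)) (trans (cong (λ z → used + (used₁ + z)) us₂) (trans (cong (used +_) us₁) us)))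
          (≤-trans l₂ (≤≡ (+-monoˡ-≤ used₂ (≤-trans l₁ (+-monoˡ-≤ used₁ l))) (sum₂ len used used₁ used₂)))
          (≤≡ (+-mono-≤ t (+-mono-≤ t₁ (+-monoʳ-≤ 7 (+-monoˡ-≤ (d * 7) t₂))))
           (time₂ used used₁ used₂ (σ K) (k * full-overhead) phase-overhead (d * sweep-overhead) (d * 7)))
         , proj₁ (deleted {fullyDynamic} {k} (λ ()) (proj₁ ins))) , e15₂ , rf (Ready.renv rdy₂) 0 tt))

    -- Between the phases of the rollback driver row 0 holds the state after
    -- preprocessing, and later rows are still empty.
    record Saved (M : Mid) (s : State) (k : ℕ) (bound : ℕ) : Set where
     constructor saved
     field
      {node} : ℕ → List ℕ
      {len} : ℕ
      senv : Env M
      s29 : reg M 29 ≡ bool (answer k)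
      str : Trie (tbl M) node len
      sview : View 0 (tbl M) node len s
      snext : suc (reg M 35) ≡ len
      sconst : Constants V M
      sbound : Bounded V s
      sempty : ∀ c ph i → k < ph → tbl M (code c) ph i ≡ 0
      slen≤ : len ≤ bound

    saved-core : ∀ {M M' s k b} → Saved M s k b → KeepOn core (reg M) (reg M') → tbl M' ≡ tbl M → Saved M' s k b
    saved-core {M' = mid _ _ _} (saved env e tr vw nx (constants c0 c1 c2 c3) bd em l) (keepOn k) refl =
     saved (rframe λ r r< → trans (k r (<15⇒core r r<)) (rf env r r<)) (trans (k 29 tt) e) tr vw (trans (cong suc (k 35 tt)) nx)
      (constants (trans (k 30 tt) c0) (trans (k 31 tt) c1) (trans (k 32 tt) c2) (trans (k 33 tt) c3)) bd em l

    rollback-overhead : ℕ → ℕ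
    rollback-overhead Tw = Tw * σ K + (6 + phase-overhead)

    -- Every w continues from the same state s, so the bound Tw for one short sequence is used Φ
    -- times. Only the trie survives a phase, and it grows by at most Tw nodes in each.
    run-rollback : Gap → Φ < 2 ^ W → ∀ sel v {M node len s G Tw} → Ready 0 M node len s false → (∀ c {ph} i → ph ≢ 0 → tbl M (code c) ph i ≡ 0) →
     len + Φ * Tw < 2 ^ W → (∀ w → w < Φ → Good (apply (sweepOps sel v w) G) (falsified w)) →
     (∀ w → w < Φ → ∃[ ts ] (Handles A α G s (sweepOps sel v w ++ (query ∷ [])) ts × sum ts ≤ Tw)) →
     Run (rollbackP A sel v) M (7 + (Φ * rollback-overhead Tw + Φ * 7)) (λ M' → reg M' 29 ≡ bool (answer Φ))
    run-rollback gap Φ< sel v {M} {node} {len} {s} {G} {Tw} rdy@(ready env w e29) empty roomT good handles =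
     let (τ , run) = run-for-τ Inv Φ< (λ ()) (λ ()) (λ ())
          (λ (sv , t) → saved-core sv (keep-setR 63 tt keep-refl) refl , t)
          (λ (sv , t) → saved-core sv (keep-setR 15 tt keep-refl) refl , t)
          body (saved env e29 (World.tr w) (World.vw w) (World.nx w) (World.cs w) (World.bd w) (λ c ph i l → empty c i (λ e → <⇒≢ l (sym e))) (≤-reflexive (sym (+-identityʳ len))) , z≤n)
          (rf env 0 tt)
     in run-≤ (+-monoʳ-≤ 7 (+-monoˡ-≤ (Φ * 7) (proj₂ (Run.post run)))) (run-map (λ (sv , _) → Saved.s29 sv) run)
     where
     Inv : ℕ → ℕ → Mid → Set
     Inv k τ M' = Saved M' s k (len + k * Tw) × τ ≤ k * rollback-overhead Tw
     body : ∀ {k τ M'} → k < Φ → reg M' 15 ≡ k → reg M' 0 ≡ Φ → Inv k τ M' →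
      ∃[ c ] Run ((copyP 34 15 ⨾ incP 34) ⨾ phaseP A sel v) M' c (λ M'' → Inv (suc k) (τ + c) M'' × reg M'' 15 ≡ k × reg M'' 0 ≡ Φ)
     body {k} {τ} {M'} k< e15 e0 (saved {node'} {len'} env' e29' tr vw nx cs@(constants c0 c1 c2 c3) bd em l , t) =
      conclude (run-phase gap sel v k {M = M₁} {rest = []} rdy₁ e15 (<-trans k< Φ<) room₁ (proj₁ (proj₂ (handles k k<))) (good k k<))
      where
      ts : List ℕ
      ts = proj₁ (handles k k<)
      sum≤ : sum ts ≤ Tw
      sum≤ = proj₂ (proj₂ (handles k k<))
      M₁ : Mid
      M₁ = setR 34 (suc k) (setF false (setR 34 (reg M' 15) (setF false M')))
      rdy₁ : Ready (suc k) M₁ node' len' s (answer k)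
      -- Row k + 1 is still empty, so it shows the state saved in row 0.
      rdy₁ = ready (rframe-setR 34 tt (rframe-setR 34 tt env')) (world tr (view-rephase (λ c i → em c (suc k) i (n<1+n k)) vw) nx (constants c0 c1 c2 c3) refl bd) e29'
      grow≤ : ∀ {x} → x ≤ Tw → len' + x ≤ len + suc k * Tw
      grow≤ x≤ = ≤≡ (+-mono-≤ l x≤) (trans (+-assoc len (k * Tw) Tw) (cong (len +_) (+-comm (k * Tw) Tw)))
      room₁ : len' + sum ts < 2 ^ W
      room₁ = ≤-<-trans (≤-trans (grow≤ sum≤) (+-monoʳ-≤ len (*-monoˡ-≤ Tw k<))) roomT
      conclude : ∃[ T ] Run (phaseP A sel v) M₁ T (λ M'' → SweepState (suc k) M₁ node' len' (answer k ∨ anyBelow U (solved k)) (apply (sweepOps sel v k) G) [] ts [] M'' T phase-overhead × reg M'' 15 ≡ k) →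
       ∃[ c ] Run ((copyP 34 15 ⨾ incP 34) ⨾ phaseP A sel v) M' c (λ M'' → Inv (suc k) (τ + c) M'' × reg M'' 15 ≡ k × reg M'' 0 ≡ Φ)
      conclude (T₁ , _,,_ {M₂} e₁ (sweepState {node₂} {len₂} {ts' = ts₂} {used = used} (ready env₂ w₂ e29₂) (drift ext rows) _ _ us l₂ t₂ , e15₂)) =
       6 + T₁ , (exec-⨾ (exec-⨾ (exec-copy 34 15) (exec-inc 34 e15 (≤-<-trans k< Φ<))) e₁ ,,
        ((saved env₂ e29₂ (World.tr w₂)
          -- The phase wrote to row k + 1 only; row 0 still shows s, now over a larger trie.
          (view-extend tr (Trie.inj (World.tr w₂)) ext (λ c i → rows c {0} i λ ()) (λ c i → rows c {0} i λ ()) vw) (World.nx w₂) (World.cs w₂) bd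
          (λ c ph i l → trans (rows c {ph} i (λ e → <⇒≢ l (sym e))) (em c ph i (<-trans (n<1+n k) l)))
          (≤-trans l₂ (grow≤ used≤))
         , ≤≡ (+-mono-≤ t (+-monoʳ-≤ 6 (≤-trans t₂ (+-monoˡ-≤ phase-overhead (*-monoˡ-≤ (σ K) used≤)))))
           (sum₃ (k * rollback-overhead Tw) (Tw * σ K) phase-overhead))
         , e15₂ , rf env₂ 0 tt))
       where
       used≤ : used ≤ Tw
       used≤ = ≤-trans (m≤m+n used (sum ts₂)) (≡≤ us sum≤)

 -- Initialization of the parameters

 module Initial (q K L ρ cA : ℕ) {{q≢0 : NonZero q}} where
  a A lgN g b B ℓ V' Φ : ℕ
  a = N / q
  A = 2 ^ a
  lgN = lg N
  g = K * lgN + suc K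
  b = g + a
  B = 2 ^ b
  ℓ = ρ + b
  V' = cA * suc ℓ
  Φ = 2 ^ (N ∸ (a + a))

  record Fits : Set where
   field
    consts≤ : 2 * (q + K + L + ρ + cA + 10) ≤ W
    2a≤N : a + a ≤ N
    N<W : N < W
    d<W : d < 2 ^ W
    ℓ≤ : ℓ + ℓ + 3 ≤ W
    V≤ : suc (V' + V') ≤ W
    L< : 3 + L < 2 ^ ρ

  lg-time init₁-time init₂-time : ℕ
  lg-time = 6 + (7 + N * (10 + 7))
  init₁-time = 1 + (1 + (1 + (3 * 3 + (3 * 4 + (3 * suc (3 + L) + (3 * suc (3 + 2 * L) + (3 * suc q + ((div-time + 3) + (3 + ((pow-time W + 3) + (3 + (3 + lg-time))))))))))))
  init₂-time = 3 * suc K + ((mul-time + 3) + (3 * suc (suc K) + (3 + (3 + ((pow-time W + 3) + (3 + (3 + ((mul-time + 3) + (3 + (3 * suc ρ + (3 +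
   ((pow-time W + 3) + (3 + (3 * suc cA + ((mul-time + 3) + ((pow-time W + 3) + (3 + (pow-time W + 3))))))))))))))))))

  f₁ : ℕ → ℕ
  f₁ = ((((((((((((((λ _ → 0) [ 1 ↦ N ]) [ 2 ↦ d ]) [ 30 ↦ W ]) [ 12 ↦ 2 ]) [ 14 ↦ 3 ]) [ 11 ↦ 3 + L ]) [ 13 ↦ 3 + 2 * L ]) [ 40 ↦ q ]) [ 3 ↦ a ]) [ 4 ↦ a + a ]) [ 5 ↦ A ]) [ 40 ↦ N ]) [ 40 ↦ suc N ])

  record Initialized (M : Mid) : Set where
   field
    i-env : ∀ r → T (r <ᵇ 15) → reg M r ≡ at 0 (Φ ∷ N ∷ d ∷ a ∷ a + a ∷ A ∷ B ∷ 2 ^ ℓ ∷ (3 + L) * B + A ∷ B + B ∷ B + B + B ∷ 3 + L ∷ 2 ∷ 3 + 2 * L ∷ 3 ∷ []) r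
    i28 : reg M 28 ≡ 0
    i30 : reg M 30 ≡ W
    i31 : reg M 31 ≡ 0
    i32 : reg M 32 ≡ 2 ^ V'
    i33 : reg M 33 ≡ V'
    i34 : reg M 34 ≡ 0
    i35 : reg M 35 ≡ 0
    i-tbl : tbl M ≡ λ _ _ _ → 0

  module _ (fits : Fits) where
   open Fits fits
   private
    W<W : W < 2 ^ W
    W<W = n<2^n W

    <2^W : ∀ {x} → x ≤ W → x < 2 ^ W
    <2^W x≤ = ≤-<-trans x≤ W<W

    2x≤2^x : ∀ x → 2 * x ≤ 2 ^ x
    2x≤2^x zero = z≤n
    2x≤2^x (suc x) = *-monoʳ-≤ 2 (n<2^n x)

    2c≤ : ∀ {c} → c ≤ q + K + L + ρ + cA + 10 → 2 * c ≤ W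
    2c≤ c≤ = ≤-trans (*-monoʳ-≤ 2 c≤) consts≤

    c≤ : ∀ {c} → c ≤ q + K + L + ρ + cA + 10 → c ≤ W
    c≤ {c} h = ≤-trans (m≤m+n c _) (2c≤ h)

    q≤ : q ≤ q + K + L + ρ + cA + 10
    q≤ = ≤≡ (m≤m+n q _) (l q K L ρ cA)
     where
     l : ∀ q K L ρ c → q + (K + L + ρ + c + 10) ≡ q + K + L + ρ + c + 10
     l = solve-∀
    sK≤ : suc K ≤ q + K + L + ρ + cA + 10
    sK≤ = ≤≡ (m≤m+n (suc K) _) (l q K L ρ cA)
     where
     l : ∀ q K L ρ c → suc K + (q + L + ρ + c + 9) ≡ q + K + L + ρ + c + 10
     l = solve-∀
    L≤ : 3 + L ≤ q + K + L + ρ + cA + 10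
    L≤ = ≤≡ (m≤m+n (3 + L) _) (l q K L ρ cA)
     where
     l : ∀ q K L ρ c → 3 + L + (q + K + ρ + c + 7) ≡ q + K + L + ρ + c + 10
     l = solve-∀
    ρ≤ : ρ ≤ q + K + L + ρ + cA + 10
    ρ≤ = ≤≡ (m≤m+n ρ _) (l q K L ρ cA)
     where
     l : ∀ q K L ρ c → ρ + (q + K + L + c + 10) ≡ q + K + L + ρ + c + 10
     l = solve-∀
    cA≤ : cA ≤ q + K + L + ρ + cA + 10
    cA≤ = ≤≡ (m≤m+n cA _) (l q K L ρ cA)
     where
     l : ∀ q K L ρ c → c + (q + K + L + ρ + 10) ≡ q + K + L + ρ + c + 10
     l = solve-∀
    5≤ : 5 ≤ q + K + L + ρ + cA + 10
    5≤ = ≤-trans (m≤m+n 5 5) (m≤n+m 10 _)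

    2L≤ : 3 + 2 * L ≤ W
    2L≤ = ≤-trans (≤≡ (+-monoˡ-≤ (2 * L) (m≤m+n 3 3)) (sym (*-distribˡ-+ 2 3 L))) (2c≤ L≤)

    a≤N : a ≤ N
    a≤N = m/n≤m N q

    b≤ℓ : b ≤ ℓ
    b≤ℓ = m≤n+m b ρ

    ℓ<W : ℓ < W
    ℓ<W = ≤-trans (≤≡ (≡≤ (+-comm 1 ℓ) (+-monoʳ-≤ ℓ (≤-trans (m≤n+m 1 2) (m≤n+m 3 ℓ)))) (sym (+-assoc ℓ ℓ 3))) ℓ≤

    b<W : b < W
    b<W = ≤-<-trans b≤ℓ ℓ<W

    V<W : V' < W
    V<W = ≤-trans (s≤s (m≤m+n V' V')) V≤

    A≤B : A ≤ B
    A≤B = ^-monoʳ-≤ 2 (m≤n+m a g)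

    special< : (3 + L) * B + A < 2 ^ W
    special< = ≤-<-trans (≤-trans (+-monoʳ-≤ ((3 + L) * B) A≤B) (≡≤ (+-comm _ B) (≤≡ (*-monoˡ-≤ B L<) (sym (^-distribˡ-+-* 2 ρ b))))) (^-monoʳ-< 2 (s≤s (s≤s z≤n)) ℓ<W)

    3B≤ : B + B + B ≤ (3 + L) * B
    3B≤ = ≡≤ (l B) (*-monoˡ-≤ B (m≤m+n 3 L))
     where
     l : ∀ b → b + b + b ≡ 3 * b
     l = solve-∀

    3B< : B + B + B < 2 ^ W
    3B< = ≤-<-trans (≤-trans 3B≤ (m≤m+n _ A)) special<

    g≤ℓ : g ≤ ℓ
    g≤ℓ = ≤-trans (m≤m+n g a) b≤ℓ

   run-lg : ∀ {f t M} → f 1 ≡ N → f 40 ≡ suc N → f 41 ≡ 0 → Sy f t M →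
    Run lgP M lg-time (λ M' → FrameOn 43 ((f [ 41 ↦ lgN ]) [ 42 ↦ 2 ^ lgN ]) t (reg M') (tbl M'))
   run-lg {f} {t} {M} e1 e40 e41 F =
    s-const 42 1 (<2^W (c≤ (≤-trans (s≤s z≤n) 5≤))) F ▸▸ λ {M₁} G →
    run-for 10 Inv (<2^W (<⇒≤ N<W)) (λ ()) (λ ()) (λ ()) (frame-setR 63 tt) (frame-setR 43 tt) body
     (frame-trans (frame-cong 42 1 (frame-base 41 e41 frame-refl)) (frame-weaken (m≤m+n 43 7) G)) (trans (fr G 1 tt) e1)
    where
    state : ℕ → ℕ → ℕ
    state k = (f [ 41 ↦ lgLoop N k ]) [ 42 ↦ 2 ^ lgLoop N k ]
    Inv : ℕ → Mid → Set
    Inv k M' = FrameOn 43 (state k) t (reg M') (tbl M')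
    next-true : ∀ {k} → 2 ^ lgLoop N k < suc N → lgLoop N (suc k) ≡ suc (lgLoop N k)
    next-true {k} l = cong (λ z → if z then suc (lgLoop N k) else lgLoop N k) (<ᵇ-true l)
    next-false : ∀ {k} → suc N ≤ 2 ^ lgLoop N k → lgLoop N (suc k) ≡ lgLoop N k
    next-false {k} l = cong (λ z → if z then suc (lgLoop N k) else lgLoop N k) (<ᵇ-false l)
    collapse : ∀ {e v e' v' r} → FrameOn 43 ((((f [ 41 ↦ e ]) [ 42 ↦ v ]) [ 42 ↦ v' ]) [ 41 ↦ e' ]) t r t → FrameOn 43 ((f [ 41 ↦ e' ]) [ 42 ↦ v' ]) t r t
    collapse {e} {v} {e'} {v'} F = frame (λ i i< → trans (fr F i i<) (swap i)) refl
     where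
     swap : ∀ i → ((((f [ 41 ↦ e ]) [ 42 ↦ v ]) [ 42 ↦ v' ]) [ 41 ↦ e' ]) i ≡ ((f [ 41 ↦ e' ]) [ 42 ↦ v' ]) i
     swap i with 41 ≟ i | 42 ≟ i
     ... | yes refl | _ = refl
     ... | no _ | yes refl = refl
     ... | no n | no n' rewrite ≢⇒≡ᵇ n | ≢⇒≡ᵇ n' = refl
    body : ∀ {k M'} → k < N → reg M' 43 ≡ k → reg M' 1 ≡ N → Inv k M' →
     Run (ltP 42 40 ⨾ flagP (addP 42 42 42 ⨾ incP 41) skip) M' 10 (λ M'' → Inv (suc k) M'' × reg M'' 43 ≡ k × reg M'' 1 ≡ N)
    body {k} {M'} k< e43 e1' H = s-iflt 42 40 tt tt (fr H 42 tt) (trans (fr H 40 tt) e40) (frame-refl {50} {reg M'})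
     (λ l {M₂} G₂ → s-add 42 42 42 tt tt (fr H 42 tt) (fr H 42 tt) (small l) G₂ ▸▸ λ G₃ →
      run-map (λ {M₄} G₄ → grown-by {M₄} (next-true {k} l) H G₄ , trans (fr G₄ 43 tt) e43 , trans (fr G₄ 1 tt) e1')
       (s-inc 41 tt (fr H 41 tt) (<2^W (≤-trans (≤-trans (s≤s (lgLoop-≤ N k)) k<) (<⇒≤ N<W))) G₃))
     (λ l {M₂} G₂ → run-≤ (m≤m+n 1 5) (exec-skip ,,
      (frame-trans (subst (λ e → FrameOn 43 ((f [ 41 ↦ e ]) [ 42 ↦ 2 ^ e ]) t (reg M') (tbl M')) (sym (next-false {k} l)) H) (frame-weaken (m≤m+n 43 7) G₂) , trans (fr G₂ 43 tt) e43 , trans (fr G₂ 1 tt) e1')))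
     where
     small : 2 ^ lgLoop N k < suc N → 2 ^ lgLoop N k + 2 ^ lgLoop N k < 2 ^ W
     small l = <-≤-trans (+-mono-< (≤-<-trans (s≤s⁻¹ l) N<W) (≤-<-trans (s≤s⁻¹ l) N<W)) (≡≤ (cong (W +_) (sym (+-identityʳ W))) (2x≤2^x W))
     grown-by : ∀ {M₄} → lgLoop N (suc k) ≡ suc (lgLoop N k) → Inv k M' →
      FrameOn 50 ((reg M' [ 42 ↦ 2 ^ lgLoop N k + 2 ^ lgLoop N k ]) [ 41 ↦ suc (lgLoop N k) ]) (tbl M') (reg M₄) (tbl M₄) → Inv (suc k) M₄
     grown-by {M₄} e H@(frame h refl) G = subst (λ e → FrameOn 43 ((f [ 41 ↦ e ]) [ 42 ↦ 2 ^ e ]) t (reg M₄) (tbl M₄)) (sym e)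
      (subst (λ v → FrameOn 43 ((f [ 41 ↦ suc (lgLoop N k) ]) [ 42 ↦ v ]) t (reg M₄) (tbl M₄)) (cong (2 ^ lgLoop N k +_) (sym (+-identityʳ _)))
       (frame-trans (collapse (frame-cong 41 _ (frame-cong 42 _ H))) (frame-weaken (m≤m+n 43 7) G)))

   run-init₁ : ∀ {P Q k} → (∀ {M} → FrameOn 43 ((f₁ [ 41 ↦ lgN ]) [ 42 ↦ 2 ^ lgN ]) (λ _ _ _ → 0) (reg M) (tbl M) → Run P M k Q) →
    Run ((importNP 1 ⨾ importdP 2 ⨾ importWP 30 ⨾ constP 12 2 ⨾ constP 14 3 ⨾ constP 11 (3 + L) ⨾ constP 13 (3 + 2 * L) ⨾
     constP 40 q ⨾ divTo 3 1 40 ⨾ addP 4 3 3 ⨾ powTo 5 3 30 ⨾ copyP 40 1 ⨾ incP 40 ⨾ lgP) ⨾ P) emptyMid (init₁-time + k) Q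
   run-init₁ continue = (exec-importN 1 N<2^W ▸ exec-importd 2 d<W ▸ exec-importW 30 W<W ▸
    (s-const 12 2 (<2^W (c≤ (≤-trans (m≤m+n 2 3) 5≤))) (frame-refl {50} {reg M₀}) ▸▸ λ G → s-const 14 3 (<2^W (c≤ (≤-trans (m≤m+n 3 2) 5≤))) G ▸▸ λ G →
     s-const 11 (3 + L) (<2^W (c≤ L≤)) G ▸▸ λ G → s-const 13 (3 + 2 * L) (<2^W 2L≤) G ▸▸ λ G →
     s-const 40 q (<2^W (c≤ q≤)) G ▸▸ λ G → s-div 3 1 40 tt tt W<W refl (refl {x = N}) (refl {x = q}) N<2^W (≤-trans (2c≤ q≤) (<⇒≤ W<W)) G ▸▸ λ G →
     s-add 4 3 3 tt tt refl refl (≤-<-trans 2a≤N N<2^W) G ▸▸ λ G → s-pow 5 3 tt W<W refl refl (≤-<-trans a≤N N<W) G ▸▸ λ G →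
     s-copy 40 1 tt refl G ▸▸ λ G → s-inc 40 tt refl (<2^W N<W) G ▸▸ λ G → run-lg refl refl refl G)) ▸▸ λ F → continue F
    where
    N<2^W : N < 2 ^ W
    N<2^W = <2^W (<⇒≤ N<W)
    M₀ = setR 30 W (setR 2 d (setR 1 N emptyMid))

   run-init : Run (initP q K L ρ cA) emptyMid (init₁-time + init₂-time) Initialized
   run-init = run-init₁ λ {M} F →
    s-const 44 K (<2^W (≤-trans (n≤1+n K) (c≤ sK≤))) (frame-refl {50} {reg M}) ▸▸ λ G →
    s-mul 41 44 41 tt tt W<W (fr F 30 tt) (refl {x = K}) (fr F 41 tt) (<2^W (≤-trans (n≤1+n K) (c≤ sK≤))) (<2^W (<⇒≤ (≤-<-trans (≤-trans (m≤m+n (K * lgN) (suc K)) g≤ℓ) ℓ<W))) G ▸▸ λ G →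
    s-const 44 (suc K) (<2^W (c≤ sK≤)) G ▸▸ λ G → s-add 41 41 44 tt tt (refl {x = K * lgN}) (refl {x = suc K}) (<2^W (<⇒≤ (≤-<-trans g≤ℓ ℓ<W))) G ▸▸ λ G →
    s-add 41 41 3 tt tt (refl {x = g}) (fr F 3 tt) (<2^W (<⇒≤ b<W)) G ▸▸ λ G → s-pow 6 41 tt W<W (fr F 30 tt) (refl {x = b}) b<W G ▸▸ λ G →
    s-add 9 6 6 tt tt (refl {x = B}) (refl {x = B}) (≤-<-trans (m≤m+n (B + B) B) 3B<) G ▸▸ λ G → s-add 10 9 6 tt tt (refl {x = B + B}) (refl {x = B}) 3B< G ▸▸ λ G →
    s-mul 8 11 6 tt tt W<W (fr F 30 tt) (fr F 11 tt) (refl {x = B}) (<2^W (c≤ L≤)) (≤-<-trans (m≤m+n _ A) special<) G ▸▸ λ G →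
    s-add 8 8 5 tt tt (refl {x = (3 + L) * B}) (fr F 5 tt) special< G ▸▸ λ G → s-const 44 ρ (<2^W (c≤ ρ≤)) G ▸▸ λ G →
    s-add 41 44 41 tt tt (refl {x = ρ}) (refl {x = b}) (<2^W (<⇒≤ ℓ<W)) G ▸▸ λ G → s-pow 7 41 tt W<W (fr F 30 tt) (refl {x = ℓ}) ℓ<W G ▸▸ λ G →
    s-inc 41 tt (refl {x = ℓ}) (<2^W ℓ<W) G ▸▸ λ G → s-const 44 cA (<2^W (c≤ cA≤)) G ▸▸ λ G →
    s-mul 33 44 41 tt tt W<W (fr F 30 tt) (refl {x = cA}) (refl {x = suc ℓ}) (<2^W (c≤ cA≤)) (<2^W (<⇒≤ V<W)) G ▸▸ λ G →
    s-pow 32 33 tt W<W (fr F 30 tt) (refl {x = V'}) V<W G ▸▸ λ G → s-sub 41 1 4 tt tt (fr F 1 tt) (fr F 4 tt) 2a≤N G ▸▸ λ G →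
    run-map (λ {M'} H → record
     { i-env = λ
      { 0 _ → fr H 0 tt ; 1 _ → trans (fr H 1 tt) (fr F 1 tt) ; 2 _ → trans (fr H 2 tt) (fr F 2 tt) ; 3 _ → trans (fr H 3 tt) (fr F 3 tt)
      ; 4 _ → trans (fr H 4 tt) (fr F 4 tt) ; 5 _ → trans (fr H 5 tt) (fr F 5 tt) ; 6 _ → fr H 6 tt ; 7 _ → fr H 7 tt ; 8 _ → fr H 8 tt
      ; 9 _ → fr H 9 tt ; 10 _ → fr H 10 tt ; 11 _ → trans (fr H 11 tt) (fr F 11 tt) ; 12 _ → trans (fr H 12 tt) (fr F 12 tt)
      ; 13 _ → trans (fr H 13 tt) (fr F 13 tt) ; 14 _ → trans (fr H 14 tt) (fr F 14 tt)
      ; (suc (suc (suc (suc (suc (suc (suc (suc (suc (suc (suc (suc (suc (suc (suc _))))))))))))))) () }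
     ; i28 = trans (fr H 28 tt) (fr F 28 tt) ; i30 = trans (fr H 30 tt) (fr F 30 tt) ; i31 = trans (fr H 31 tt) (fr F 31 tt)
     ; i32 = fr H 32 tt ; i33 = fr H 33 tt ; i34 = trans (fr H 34 tt) (fr F 34 tt) ; i35 = trans (fr H 35 tt) (fr F 35 tt)
     ; i-tbl = trans (ft H) (ft F) })
     (s-pow 0 41 tt W<W (fr F 30 tt) (refl {x = N ∸ (a + a)}) (≤-<-trans (m∸n≤m N (a + a)) N<W) G)

 -- Running times as powers of X

 module Costs (X : ℕ) (64≤X : 64 ≤ X) (W≤X : W ≤ X) where
  open Powers X 64≤X public

  private
   wᵇ : Bd 1 1 W
   wᵇ = varᵇ W≤X

   infixr 6 _+₁_
   _+₁_ : ∀ k {i Y a} {{_ : NonZero Y}} {h : T (k ≤ᵇ 64)} → Bd i Y a → Bd (suc (1 ⊔ i)) Y (k + a)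
   _+₁_ k {h = h} p = #ᵇ k {h = h} +ᵇ p

   forBitsᵇ : ∀ {b} → Bd 20 1 b → Bd 25 1 (forBits-time b)
   forBitsᵇ p = exponentᵇ 25 (2 +₁ sucᵇ (wᵇ *ᵇ sucᵇ (p +ᵇ #ᵇ 3)))

   pushᵇ : Bd 4 1 push-time
   pushᵇ = exponentᵇ 4 (2 +₁ sucᵇ (wᵇ *ᵇ #ᵇ 9))

   keyᵇ : Bd 6 1 key-time
   keyᵇ = exponentᵇ 6 (2 +₁ (pushᵇ +ᵇ pushᵇ))

   ldᵇ : Bd 25 1 ld-time
   ldᵇ = forBitsᵇ (exponentᵇ 20 (keyᵇ +ᵇ (sucᵇ (sucᵇ (wᵇ +ᵇ wᵇ)) +ᵇ #ᵇ 4)))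

   stᵇ : Bd 25 1 st-time
   stᵇ = forBitsᵇ (exponentᵇ 20 (4 +₁ (keyᵇ +ᵇ sucᵇ (sucᵇ (wᵇ +ᵇ wᵇ)))))

   exportᵇ : Bd 4 1 export-time
   exportᵇ = exponentᵇ 4 (3 +₁ sucᵇ (wᵇ *ᵇ #ᵇ 10))

   fbᵇ : ∀ c → {h : T (c ≤ᵇ 64)} → Bd 25 1 (forBits-time c)
   fbᵇ c {h} = forBitsᵇ (exponentᵇ 20 (#ᵇ c {h = h}))

  κᵇ : Bd 40 1 κ
  κᵇ = exponentᵇ 40 ((((((1 +₁ fbᵇ 13) +ᵇ ldᵇ) +ᵇ stᵇ) +ᵇ (2 +₁ fbᵇ 10)) +ᵇ (exportᵇ +ᵇ (1 +₁ (1 +₁ (2 +₁ fbᵇ 10))))) +ᵇ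
   (exportᵇ +ᵇ (1 +₁ (1 +₁ (exportᵇ +ᵇ (1 +₁ (3 +₁ fbᵇ 10)))))))

  mulᵇ : Bd 4 1 mul-time
  mulᵇ = exponentᵇ 4 (6 +₁ (7 +₁ (wᵇ *ᵇ #ᵇ 17)))

  divᵇ : Bd 4 1 div-time
  divᵇ = exponentᵇ 4 (9 +₁ (7 +₁ (wᵇ *ᵇ #ᵇ 30)))

  powᵇ : Bd 4 1 (pow-time W)
  powᵇ = exponentᵇ 4 (6 +₁ (7 +₁ (wᵇ *ᵇ #ᵇ 14)))

  σᵇ : ∀ {K} → K ≤ X → Bd 10 1 (σ K)
  σᵇ K≤ = exponentᵇ 10 (60 +₁ (((10 +₁ (mulᵇ +ᵇ (divᵇ +ᵇ powᵇ))) +ᵇ (divᵇ +ᵇ #ᵇ 3)) +ᵇ ((#ᵇ 3 *ᵇ sucᵇ (varᵇ K≤)) +ᵇ divᵇ)))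

  private
   div₃ : Bd 5 1 (div-time + 3)
   div₃ = divᵇ +ᵇ #ᵇ 3

   literalᵇ : Bd 20 1 literal-time
   literalᵇ = exponentᵇ 20 (1 +₁ (div₃ +ᵇ (div₃ +ᵇ (4 +₁ (4 +₁ (3 +₁ ((powᵇ +ᵇ #ᵇ 3) +ᵇ (div₃ +ᵇ (div₃ +ᵇ #ᵇ 10)))))))))

  evᵇ : ∀ {S} → S ≤ X → Bd 25 1 (ev-time S)
  evᵇ S≤ = exponentᵇ 25 (3 +₁ (1 +₁ (7 +₁ (varᵇ S≤ *ᵇ (literalᵇ +ᵇ #ᵇ 7)))))

  emitᵇ : Bd 25 1 emit-time
  emitᵇ = exponentᵇ 25 (1 +₁ (3 +₁ sucᵇ (6 +₁ (1 +₁ (3 +₁ (3 +₁ (12 +₁ (3 +₁ (endᵇ 3 +ᵇ (endᵇ 6 +ᵇ #ᵇ 3))))))))))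
   where
   endᵇ : ∀ c {h : T (c ≤ᵇ 64)} → Bd 12 1 (3 + (c + (12 + (3 + (3 + (div-time + 3 + 7))))))
   endᵇ c {h} = exponentᵇ 12 (3 +₁ (#ᵇ c {h = h} +ᵇ (12 +₁ (3 +₁ (3 +₁ (div₃ +ᵇ #ᵇ 7))))))

  argumentsᵇ : Bd 12 1 (3 + ((div-time + 3 + 7) + (3 + (div-time + 3 + 7))))
  argumentsᵇ = exponentᵇ 12 (3 +₁ ((div₃ +ᵇ #ᵇ 7) +ᵇ (3 +₁ (div₃ +ᵇ #ᵇ 7))))

 -- The decision procedure for satisfiability

 module Solver (A : DynAlg) (Cw q K L ρ : ℕ) {{q≢0 : NonZero q}} (F : CNF N) (short : IsKCNF K F)
  (d≡ : d ≡ length F) (W≡ : W ≡ suc N * Cw) (inp≡ : ∀ m a → inp m a ≡ cnfInput F m a) (sN< : suc N < 2 ^ w) (Cw< : Cw < 2 ^ w) where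
  open Initial q K L ρ (wordConst A) hiding (A)

  prologue-ends : ∀ ω → Ends w (prologueP Cw) (startSAT w F ω) 8 (Rep emptyMid)
  prologue-ends ω = step const (step arith (step arith (step const (step const (step arith (step arith (ends const
   (rep (wrap-bool false) reg-W (trans (plus-0 (wrap w N) (wrap< w N)) N≡) (trans (plus-0 (wrap w (length F)) (wrap< w _)) (trans (cong (wrap w) (sym d≡)) (wrap-id {w} d<)))
    (λ r i _ → trans (wrap-bool false) (cong bool (sym (bit-0 i)))) (λ _ → 0<2^ W)
    (λ t x y i _ _ _ → trans (wrap-bool false) (cong bool (sym (bit-0 i)))) (λ _ _ _ → 0<2^ W) (λ _ → input 0 _) (λ _ → input 1 _)))))))))
   where
   plus-0 : ∀ x → x < 2 ^ w → wrap w (x + wrap w 0) ≡ x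
   plus-0 x x< = trans (cong (λ o → wrap w (x + o)) (wrap-bool false)) (trans (cong (wrap w) (+-identityʳ x)) (wrap-id {w} x<))
   N≡ : wrap w N ≡ N
   N≡ = wrap-id {w} N<
   reg-W : wrap w (wrap w (wrap w (wrap w N + wrap w 0) + wrap w 1) * wrap w Cw) ≡ W
   reg-W = trans (cong₂ (λ x y → wrap w (x * y)) (wrap-suc (trans (plus-0 (wrap w N) (wrap< w N)) N≡) sN<) (wrap-id {w} Cw<)) (trans (cong (wrap w) (sym W≡)) (wrap-id {w} W<))
   input : ∀ m a → wrap w (cnfInput F m a) ≡ inp m a
   input m a = trans (cong (wrap w) (sym (inp≡ m a))) (wrap-id {w} (inp< m a))

  module _ (fits : Fits) (A<B : 2 ^ a < B) (d≤B : d ≤ B) (room : 4 + 3 * ((2 ^ ρ * B) * (2 ^ ρ * B)) < 2 ^ W) (inp≤W : K + 2 * N ≤ W) where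
   open Fits fits

   S : Setup
   S = record
    { Φ = Φ ; a = a ; A = 2 ^ a ; B = B ; R = 2 ^ ρ ; L = L ; V = V'
    ; B≢0 = m^n≢0 2 b ; n≢0 = m*n≢0 (2 ^ ρ) B {{m^n≢0 2 ρ}} {{m^n≢0 2 b}}
    ; roomy = record { W<W = n<2^n W ; inp<W = λ m a → ≤-<-trans (≡≤ (inp≡ m a) (≤-trans (cnfInput≤ F short m a) inp≤W)) (n<2^n W)
             ; 4≤ = <⇒≤ (≤-<-trans (m≤m+n 4 _) room) }
    ; A<B = A<B ; d≤B = d≤B ; L<R = L< ; 2a≤N = 2a≤N ; A≡ = refl ; N≤W = <⇒≤ N<W ; 2V≤ = V≤ ; room = room
    ; size≤ = K + 2 * N ; size-bound = λ c _ → ≡≤ (inp≡ 0 (c ∷ [])) (cnfInput≤ F short 0 (c ∷ [])) }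

   open Setup S using (n; n<2^W; L<R; roomy; environment; Env; raw; n≢0)
   open Setting S hiding (U; module Phases)
   open Roomy roomy

   n≡ : n ≡ 2 ^ ℓ
   n≡ = sym (^-distribˡ-+-* 2 ρ b)

   -- The number of vertices is the power 2 ^ ℓ, so the logarithm in the word length of the dynamic
   -- algorithm is ℓ, which the machine has at hand.
   V≡ : V' ≡ wordSize (wordConst A) n
   V≡ = cong (λ e → wordConst A * suc e) (trans (sym (⌊log₂[2^n]⌋≡n ℓ)) (cong ⌊log₂_⌋ (sym n≡)))

   Es : Bool → List Pair
   Es dense = insertEdges (raw dense) []

   initial-built : ∀ {M} → Initialized M → Built M []
   initial-built {mid r _ f} (record { i-env = e ; i28 = e28 ; i30 = e30 ; i31 = e31 ; i32 = e32 ; i33 = e33 ; i34 = e34 ; i35 = e35 ; i-tbl = refl }) = built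
    (rframe λ r r< → trans (e r r<) (cong (λ z → at 0 (Φ ∷ N ∷ d ∷ a ∷ a + a ∷ 2 ^ a ∷ B ∷ z ∷ (3 + L) * B + 2 ^ a ∷ B + B ∷ B + B + B ∷ 3 + L ∷ 2 ∷ 3 + 2 * L ∷ 3 ∷ []) r) (sym n≡)))
    (edgeWorld {enode = λ _ → []} {1}
     (world
      (trie refl (s≤s z≤n) (λ { (s≤s z≤n) (s≤s z≤n) _ → refl }) (λ { _ () }) (λ { _ _ _ () }) (λ _ → inj₁ refl) (λ _ → refl) (λ _ _ _ → refl))
      (view (λ _ → refl) (λ _ → s≤s z≤n) (λ _ → refl) (λ m _ → sym (empty m [])) (λ m {a} _ → empty m a))
      (cong suc e35) (constants e30 e31 e32 e33) e34 (bnd (λ _ → 0<2^ V') (λ m a → wrap< V' (edgeMemory [] m a)) (λ _ → refl)))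
     ≤-refl (λ _ _ _ → refl) (λ ()) (λ n → ⊥-elim (n refl)) e28 [] [])
    where
    empty : ∀ m a → wrap V' (edgeMemory [] m a) ≡ 0
    empty m a = trans (cong (wrap V') (edgeMemory-[] m a)) (wrap-id {V'} (0<2^ V'))

   module _ (Kc : ℕ) where
    open Setting.Phases S A Kc using (Ready; ready; ready-evolved; run-wrapReg)

    start-time : ℕ
    start-time = 3 + (3 + ((div-time + 3 + 7) + (3 + (div-time + 3 + 7))))

    record Started (M : Mid) (Es : List Pair) : Set where
     constructor started
     field
      {snode} : ℕ → List ℕ
      {slen} : ℕ
      sready : Ready 0 M snode slen (startGraph V' (toGraph Es) (λ _ → false)) false
      srows : ∀ c {ph} i → ph ≢ 0 → tbl M (code c) ph i ≡ 0
      slen≤ : slen ≤ suc (3 * length Es)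

    run-start : ∀ {M Es} → Built M Es → Run startP M start-time (λ M' → Started M' Es)
    run-start {M} {Es} (built env (edgeWorld {node} {len} w len≤ rows _ _ count uniq rg)) =
     exec-zero 29 ▸ (s-copy 42 28 tt count (frame-refl {50} {reg M₀}) ▸▸ λ {M₁} G₁ →
     let w₁ , ev₁ = world-regs {M' = M₁} (ft G₁) (rframe-trans (rframe-setR 42 tt rframe-refl) (rframe-weaken 36 tt (frame-rframe G₁))) w₀ in
     run-wrapReg 1 w₁ (fr G₁ 42 tt) count<2^W ▸▸ λ {M₂} (w₂ , ev₂) →
     let ev₁₂ = evolved-trans ev₁ ev₂ in
     s-copy 42 7 tt (trans (rf (Evolved.regs≡ ev₁₂) 7 tt) (rf env₀ 7 tt)) (frame-refl {50} {reg M₂}) ▸▸ λ {M₃} G₃ →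
     let w₃ , ev₃ = world-regs {M' = M₃} (ft G₃) (rframe-trans (rframe-setR 42 tt rframe-refl) (rframe-weaken 36 tt (frame-rframe G₃))) w₂ in
     run-map (λ {M₄} (w₄ , ev₄) → let ev = evolved-trans ev₁₂ (evolved-trans ev₃ ev₄) in
      started (ready-evolved {M = M₀} {M' = M₄} (ready env₀ w₀ refl) (world-≗ regs≡ (λ _ → refl) mem≡ (λ _ → refl) w₄) (Evolved.regs≡ ev))
       (λ c i ph≢0 → trans (Evolved.rows ev c i ph≢0) (rows c i ph≢0)) len≤)
      (run-wrapReg 0 w₃ (fr G₃ 42 tt) n<2^W))
     where
     M₀ = setR 29 0 (setF false M)
     env₀ : Env M₀
     env₀ = rframe-setR 29 tt env
     w₀ : World V' 0 M₀ node len (edgeState V' Es)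
     w₀ = world-sy {M' = M₀} w (same refl refl refl refl refl refl) frame-refl
     count<2^W : length Es < 2 ^ W
     count<2^W = ≤-<-trans (edges-bound n {{n≢0}} Es uniq rg) (≤-<-trans (≤-trans (m≤m+n (n * n) _) (m≤n+m (3 * (n * n)) 4)) room)
     regs≡ : ∀ r → regs (setReg 0 (wrap V' n) (setReg 1 (wrap V' (length Es)) (edgeState V' Es))) r ≡ regs (startGraph V' (toGraph Es) (λ _ → false)) r
     regs≡ r = cong (λ l → regs (setReg 0 (wrap V' n) (setReg 1 (wrap V' l) (edgeState V' Es))) r) (sym (length-map toEdge Es))
     mem≡ : ∀ m a → wrap V' (edgeMemory Es m a) ≡ wrap V' (graphInput (toGraph Es) m a)
     mem≡ m a = cong (wrap V') (sym (toGraph-input rg m a))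

   answers : Bool
   answers = anyBelow Φ (λ w → anyBelow (2 ^ a) (λ u → anyBelow (2 ^ a) (λ v → not (anyBelow d (λ c → not (satisfied size lit a N u v w c))))))

   private
    module E = Encoding F a 2a≤N

   answers-cong : ∀ {u v w} c → satisfied size lit a N u v w c ≡ satisfied E.size E.lit a N u v w c
   answers-cong {u} {v} {w} c = cong₂ _∨_ (part 0 a u) (cong₂ _∨_ (part a (a + a) v) (part (a + a) N w))
    where
    part : ∀ lo hi val → partSat size lit lo hi val c ≡ partSat E.size E.lit lo hi val c
    part lo hi val = trans (cong (λ k → anyBelow k (λ j → holds lo hi val (lit c j))) (inp≡ 0 (c ∷ [])))
     (anyBelow-cong (E.size c) λ j _ → cong (holds lo hi val) (inp≡ 1 (c ∷ j ∷ [])))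

   correct : ∀ s → regs s 0 ≡ bool answers → CorrectAnswer F s
   correct s e with answers in eqn
   ... | true = let (w , _ , e₁) = anyBelow⁻ Φ eqn
                    (u , _ , e₂) = anyBelow⁻ (2 ^ a) e₁
                    (v , _ , e₃) = anyBelow⁻ (2 ^ a) e₂ in
    inj₁ (e , E.satisfiable⁺ u v w λ c c<F → let c< = subst (c <_) (sym d≡) c<F in trans (sym (answers-cong {u} {v} {w} c)) (not-false (anyBelow-false d (not-true e₃) c c<)))
   ... | false = inj₂ (e , λ sat →
    let (u , v , w , u< , v< , w< , all) = E.satisfiable⁻ sat
        e₃ = anyBelow-false (2 ^ a) (anyBelow-false (2 ^ a) (anyBelow-false Φ eqn w w<) u u<) v v<
        (c , c< , e₄) = anyBelow⁻ d (not-false e₃)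
    in case trans (sym e₄) (cong not (trans (answers-cong {u} {v} {w} c) (all c (subst (c <_) d≡ c<)))) of λ ())

   ℓ₀ : ℕ
   ℓ₀ = 2 ^ a * suc (d * 2) + (n + d)

   initial : Bool → Digraph n
   initial dense = toGraph (Es dense)

   module _ {dense : Bool} {M : Mid} (b : Built M (Es dense)) where
    open EdgeWorld (Built.edw b)

    initial-unique : Unique (initial dense)
    initial-unique = toGraph-unique erange euniq

    Es≤n² : length (Es dense) ≤ n * n
    Es≤n² = edges-bound n {{n≢0}} (Es dense) euniq erange

    initial-good : Dynamic.Good ℓ₀ (initial dense) (λ _ → dense)
    initial-good = Dynamic.goodGraph
     (toGraph-represents erange (λ e∈ → [ raw⁻ dense , (λ ()) ]′ (∈-insertEdges⁻ (raw dense) e∈)) (λ e → ∈-insertEdges⁺ (raw dense) (inj₁ (raw⁺ dense e))))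
     (≤-trans initial≤ (m≤m+n ℓ₀ _))
     where
     initial≤ : length (initial dense) ≤ ℓ₀
     initial≤ = ≡≤ (length-map toEdge (Es dense)) (≤-trans (length-insertEdges (raw dense) [])
      (≡≤ (+-identityʳ _) (length-raw dense)))

   init-time : ℕ
   init-time = init₁-time + init₂-time

   run-graph : ∀ dense → Run (initP q K L ρ (wordConst A) ⨾ buildP dense) emptyMid (init-time + build-time) (λ M → Built M (Es dense))
   run-graph dense = run-init fits ▸▸ λ I → run-build dense (initial-built I)

   -- Uniqueness and size of the initial graph are invariants of the builder. They are needed before
   -- the dynamic algorithm can be invoked, and the final state of the builder's `Run` supplies
   -- them.
   initial-built-at : ∀ dense → Σ[ M ∈ Mid ] Built M (Es dense)
   initial-built-at dense = _ , Run.post (run-graph dense)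

   module Simulated (Kc : ℕ) (Kc< : Kc < 2 ^ W) (pc : ConstsBelow Kc (preprocess A))
    (ic : ConstsBelow Kc (onInsert A)) (dc : ConstsBelow Kc (onDelete A)) (qc : ConstsBelow Kc (onQuery A)) (α : ℚ.ℚ) where
    open Setting.Phases S A Kc using (module Ready; Ready; ready-evolved)
    open Setting.Phases.Simulate S A Kc α V≡ Kc< ic dc qc ℓ₀
    open Dynamic ℓ₀

    units : ℕ → ℕ → ℕ
    units t mainTime = init-time + (build-time + (start-time Kc + (t * σ Kc + (mainTime + 3))))

    Preprocessed : Bool → ℕ → State → Set
    Preprocessed dense t s = wordSize (wordConst A) n ⊢ preprocess A , startGraph (wordSize (wordConst A) n) (initial dense) (λ _ → false) ⇓[ t ] s

    solve : ∀ dense main mainTime {t₀ t s₀} → Preprocessed dense t₀ s₀ → t₀ ≤ t → suc (3 * (n * n)) + t < 2 ^ W →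
     (∀ {M node len} → Ready 0 M node len s₀ false → (∀ c {ph} i → ph ≢ 0 → tbl M (code c) ph i ≡ 0) → len ≤ suc (3 * (n * n)) + t₀ →
      Run main M mainTime (λ M' → reg M' 29 ≡ bool answers)) →
     ∀ ω → Ends w (solverP Cw q K L ρ A dense main) (startSAT w F ω) (8 + units t mainTime * κ) (CorrectAnswer F)
    solve dense main mainTime {t₀} {t} {s₀} pre t₀≤ roomT phases ω = ends-⨾ (prologue-ends ω) λ R →
     ends-map (λ { {s} (M , R' , e) → correct s (trans (Rep.r0 R') (cong bool e)) }) (finish whole R)
     where
     P = initP q K L ρ (wordConst A) ⨾ buildP dense ⨾ startP ⨾ simP (preprocess A) ⨾ main ⨾ nzP 29
     pre' : V' ⊢ preprocess A , startGraph V' (initial dense) (λ _ → false) ⇓[ t₀ ] s₀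
     pre' = subst (λ z → z ⊢ preprocess A , startGraph z (initial dense) (λ _ → false) ⇓[ t₀ ] s₀) (sym V≡) pre
     whole : Run P emptyMid (units t mainTime) (λ M' → flag M' ≡ answers)
     whole = run-init fits ▸▸ λ I → run-build dense (initial-built I) ▸▸ λ {M₁} b' → run-start Kc b' ▸▸
      λ (started {node} {len} rdy rows len≤) →
      let len≤' = ≤-trans len≤ (s≤s (*-monoʳ-≤ 3 (Es≤n² {dense} {M₁} b'))) in
      run-≤ (*-monoˡ-≤ (σ Kc) t₀≤) (sim-run V≤ W<W Kc< (preprocess A) pc pre' (Ready.rw rdy) (≤-<-trans (+-mono-≤ len≤' t₀≤) roomT)) ▸▸
      λ (node' , len' , w' , ev , l≤) →
      phases (ready-evolved rdy w' (Evolved.regs≡ ev)) (λ c i ph≢0 → trans (Evolved.rows ev c i ph≢0) (rows c i ph≢0)) (≤-trans l≤ (+-monoˡ-≤ t₀ len≤')) ▸▸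
      λ {M'} e29 → exec-nz 29 {b = answers} (trans (cong (λ z → not (z ≡ᵇ 0)) e29) (test answers)) ,, refl
      where
      test : ∀ b → not (bool b ≡ᵇ 0) ≡ b
      test true = refl
      test false = refl
     finish : Run P emptyMid (units t mainTime) (λ M' → flag M' ≡ answers) → ∀ {S'} → Rep emptyMid S' → Ends w P S' (units t mainTime * κ) (λ s → Σ[ M ∈ Mid ] (Rep M s × flag M ≡ answers))
     finish (e ,, q) R = ends-map (λ R' → _ , R' , q) (e .run R)

    private
     cost-sweep : ∀ u c sel v w → opsCost u c (sweepOps sel v w) ≤ d * u
     cost-sweep u c sel v w = cost-upL u c u 0 d (sweepAt (λ c' → select sel (clauseSat w c')) v) λ j → one (select sel (clauseSat w j)) v j
      where
      one : ∀ b v j → opsCost u c (if b then operation v j ∷ [] else []) ≤ u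
      one false v j = z≤n
      one true true j = ≤-reflexive (+-identityʳ u)
      one true false j = ≤-reflexive (+-identityʳ u)

    budgetΦ : ℕ → ℕ → ℕ → ℕ
    budgetΦ p u c = p + Φ * (d * u + (c + d * u))

    loop-time : ℕ → ℕ
    loop-time t = 7 + ((t * σ Kc + Φ * (full-overhead + 6)) + Φ * 7)

    initial-length : ∀ {dense M} → Built M (Es dense) → length (initial dense) ≤ ℓ₀ + d
    initial-length {dense} {M} b = ≤-trans (Good.len≤ (initial-good {dense} {M} b)) (+-monoʳ-≤ ℓ₀ (countBelow-≤ d _))

    Solves : Bool → Prog → ℕ → Set
    Solves dense main t = ∀ ω → Ends w (solverP Cw q K L ρ A dense main) (startSAT w F ω) (8 + units t (loop-time t) * κ) (CorrectAnswer F)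

    record Served (mode : Mode) (bound : TimeBound) (dense : Bool) (m p u c : ℕ) : Set where
     constructor served
     field
      {t₀} : ℕ
      {s₀} : State
      pre : Preprocessed dense t₀ s₀
      serve : ∀ ops → Valid mode m (initial dense) ops → ∃[ ts ] (Handles A α (initial dense) s₀ ops ts × bound p u c t₀ ops ts)

    -- The algorithm is invoked with the coins that are all `false`, matching the simulation of
    -- `flip`.
    serving : ∀ {mode} {bound : TimeBound} {dense m p u c} → ℓ₀ + d ≤ m n → Approximates mode bound α m p u c A → Served mode bound dense (m n) (p n) (u n) (c n)
    serving {dense = dense} m≥ approx =
     let M₀ , b₀ = initial-built-at dense
         t₀ , s₀ , pre , serve = approx n (initial dense) (initial-unique {dense} {M₀} b₀) (≤-trans (initial-length {dense} {M₀} b₀) m≥) (λ _ → false)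
     in served pre serve

    good-at : ∀ dense → Good (initial dense) (λ _ → dense)
    good-at dense = initial-good {dense} {proj₁ (initial-built-at dense)} (proj₂ (initial-built-at dense))

    module _ (gap : Gap) (Φ< : Φ < 2 ^ W) {m p u c : ℕ} (m≥ : ℓ₀ + d ≤ m) (roomT : suc (3 * (n * n)) + budgetΦ p u c < 2 ^ W) where

     private
      t : ℕ
      t = budgetΦ p u c

     -- `serve` is applied once, to the operations for all w together, so that the amortized bound
     -- limits the total time.
     solve-full : Served fullyDynamic Amortized false m p u c → Solves false (fullP A) t
     solve-full (served {t₀} {s₀} pre serve) = timed (serve (upL 0 Φ fullOps) (valid-≤ m≥ (full-valid 0 Φ (good-at false))))
      where
      phase : ∀ w → opsCost u c (fullOps w) ≤ d * u + (c + d * u)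
      phase w = ≡≤ (cost-++ u c (sweepOps false true w) _) (+-mono-≤ (cost-sweep u c false true w) (+-monoʳ-≤ c (cost-sweep u c false false w)))
      timed : ∃[ ts ] (Handles A α (initial false) s₀ (upL 0 Φ fullOps) ts × Amortized p u c t₀ (upL 0 Φ fullOps) ts) → Solves false (fullP A) t
      timed (ts , h , am) = solve false (fullP A) (loop-time t) {t₀} {t} pre (≤-trans (m≤m+n t₀ (sum ts)) total) roomT
        λ {M} {node} {len} rdy _ len≤ → run-≤ (+-monoʳ-≤ 7 (+-monoˡ-≤ (Φ * 7) (+-mono-≤ (*-monoˡ-≤ (σ Kc) (≤-trans (m≤n+m (sum ts) t₀) total)) (*-monoʳ-≤ Φ (m≤m+n full-overhead 6)))))
         (run-full gap Φ< rdy (good-at false) (≤-<-trans (≤-trans (+-monoˡ-≤ (sum ts) len≤) (≡≤ (+-assoc (suc (3 * (n * n))) t₀ (sum ts)) (+-monoʳ-≤ (suc (3 * (n * n))) total))) roomT) h)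
       where
       total : t₀ + sum ts ≤ t
       total = ≤-trans am (+-monoʳ-≤ p (cost-upL u c (d * u + (c + d * u)) 0 Φ fullOps phase))

     -- `serve` is applied to each w separately, as an alternative continuation after the same
     -- preprocessing. Worst-case bounds limit each of these short sequences.
     solve-rollback : ∀ {mode sel v dense} →
      (∀ {w G} → Good G (λ _ → dense) → Good (apply (sweepOps sel v w) G) (falsified w) × ValidPrefix mode (ℓ₀ + d) G (sweepOps sel v w)) →
      Served mode WorstCase dense m p u c → Solves dense (rollbackP A sel v) t
     solve-rollback {mode} {sel} {v} {dense} sweeps (served {t₀} {s₀} pre serve) =
      solve dense (rollbackP A sel v) (loop-time t) {t₀} {t} pre (≤-trans t₀≤ (m≤m+n p _)) roomT
        λ {M} {node} {len} rdy rows len≤ → run-≤ (+-monoʳ-≤ 7 (+-monoˡ-≤ (Φ * 7) faster))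
         (run-rollback gap Φ< sel v rdy rows (≤-<-trans (≤-trans (+-monoˡ-≤ (Φ * Tw) len≤) (≡≤ (+-assoc (suc (3 * (n * n))) t₀ (Φ * Tw)) (+-monoʳ-≤ (suc (3 * (n * n))) (+-mono-≤ t₀≤ (*-monoʳ-≤ Φ Tw≤))))) roomT)
          (λ w _ → proj₁ (sweeps {w} (good-at dense))) λ w _ → handled w)
      where
      Tw : ℕ
      Tw = d * u + c
      t₀≤ : t₀ ≤ p
      -- The bound on preprocessing comes with a sequence of operations; the empty one yields it.
      t₀≤ = proj₁ (proj₂ (proj₂ (serve [] [])))
      Tw≤ : Tw ≤ d * u + (c + d * u)
      Tw≤ = +-monoʳ-≤ (d * u) (m≤m+n c _)
      handled : ∀ w → ∃[ ts ] (Handles A α (initial dense) s₀ (sweepOps sel v w ++ (query ∷ [])) ts × sum ts ≤ Tw)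
      handled w = let (ts , h , _ , pw) = serve (sweepOps sel v w ++ (query ∷ [])) (valid-≤ m≥ (proj₂ (sweeps {w} (good-at dense)) (query []))) in
       ts , h , ≤-trans (sum-mono pw) (≡≤ (cost-++ u c (sweepOps sel v w) _) (+-mono-≤ (cost-sweep u c sel v w) (≤-reflexive (+-identityʳ c))))
      faster : Φ * rollback-overhead Tw ≤ t * σ Kc + Φ * (full-overhead + 6)
      faster = ≡≤ (trans (*-distribˡ-+ Φ (Tw * σ Kc) (6 + phase-overhead)) (cong (_+ Φ * (6 + phase-overhead)) (sym (*-assoc Φ Tw (σ Kc)))))
       (+-mono-≤ (*-monoˡ-≤ (σ Kc) (≤-trans (*-monoʳ-≤ Φ Tw≤) (m≤n+m _ p))) (*-monoʳ-≤ Φ (≡≤ (+-comm 6 phase-overhead) (+-monoˡ-≤ 6 (m≤m+n phase-overhead _)))))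

     solve-mode : ∀ mode → Served mode (boundFor mode) (denseFor mode) m p u c → Solves (denseFor mode) (phasesFor mode A) t
     solve-mode fullyDynamic = solve-full
     solve-mode incremental = solve-rollback {incremental} {false} {true} {false} (λ {w} → inserted {incremental} {w} λ ())
     solve-mode decremental = solve-rollback {decremental} {true} {false} {true} (λ {w} → thinned {decremental} {w} λ ())

    module _ (X : ℕ) (64≤X : 64 ≤ X) (W≤X : W ≤ X) (d≤X : d ≤ X) (N≤X : N ≤ X) (inp≤X : K + 2 * N ≤ X) (Kc≤X : Kc ≤ X)
     (q≤X : q ≤ X) (L≤X : 3 + 2 * L ≤ X) (ρ≤X : ρ ≤ X) (cA≤X : wordConst A ≤ X) where
     open Costs X 64≤X W≤X

     private
      instance
       2^a≢0 : NonZero (2 ^ a)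
       2^a≢0 = m^n≢0 2 a

      dᵇ : Bd 1 1 d
      dᵇ = varᵇ d≤X

      K≤X : K ≤ X
      K≤X = ≤-trans (m≤m+n K _) inp≤X

      L≤X' : 3 + L ≤ X
      L≤X' = ≤-trans (+-monoʳ-≤ 3 (m≤m+n L _)) L≤X

      sweepᵇ : Bd 30 1 sweep-overhead
      sweepᵇ = exponentᵇ 30 ((#ᵇ 9 +ᵇ evᵇ inp≤X) +ᵇ (#ᵇ 4 +ᵇ argumentsᵇ))

      phaseᵇ : Bd 40 (2 ^ a) phase-overhead
      phaseᵇ = exponentᵇ 40 (liftᵇ (dᵇ *ᵇ sweepᵇ) +ᵇ (liftᵇ (#ᵇ 7 +ᵇ (dᵇ *ᵇ #ᵇ 7)) +ᵇ (#ᵇ 7 +ᵇ (unitᵇ ≤-refl *ᵇ #ᵇ 39))))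

      fullᵇ : Bd 50 (2 ^ a) (full-overhead + 6)
      fullᵇ = exponentᵇ 50 ((phaseᵇ +ᵇ liftᵇ (#ᵇ 7 +ᵇ ((dᵇ *ᵇ sweepᵇ) +ᵇ (dᵇ *ᵇ #ᵇ 7)))) +ᵇ #ᵇ 6)

      cᵇ : ∀ {c} → c ≤ X → Bd 5 1 (3 * suc c)
      cᵇ c≤ = exponentᵇ 5 (#ᵇ 3 *ᵇ sucᵇ (varᵇ c≤))

      power₃ : Bd 5 1 (pow-time W + 3)
      power₃ = exponentᵇ 5 (powᵇ +ᵇ #ᵇ 3)

      mul₃ : Bd 5 1 (mul-time + 3)
      mul₃ = exponentᵇ 5 (mulᵇ +ᵇ #ᵇ 3)

      div₃ : Bd 5 1 (div-time + 3)
      div₃ = exponentᵇ 5 (divᵇ +ᵇ #ᵇ 3)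

      init₁ᵇ : Bd 40 1 init₁-time
      init₁ᵇ = exponentᵇ 40 (#ᵇ 1 +ᵇ #ᵇ 1 +ᵇ #ᵇ 1 +ᵇ #ᵇ 9 +ᵇ #ᵇ 12 +ᵇ cᵇ L≤X' +ᵇ cᵇ L≤X +ᵇ cᵇ q≤X +ᵇ div₃ +ᵇ #ᵇ 3 +ᵇ power₃ +ᵇ #ᵇ 3 +ᵇ #ᵇ 3 +ᵇ
       #ᵇ 6 +ᵇ #ᵇ 7 +ᵇ varᵇ N≤X *ᵇ #ᵇ 17)

      init₂ᵇ : Bd 60 1 init₂-time
      init₂ᵇ = exponentᵇ 60 (cᵇ K≤X +ᵇ mul₃ +ᵇ exponentᵇ 6 (#ᵇ 3 *ᵇ sucᵇ (sucᵇ (varᵇ K≤X))) +ᵇ #ᵇ 3 +ᵇ #ᵇ 3 +ᵇ power₃ +ᵇ #ᵇ 3 +ᵇ #ᵇ 3 +ᵇ mul₃ +ᵇ #ᵇ 3 +ᵇ cᵇ ρ≤X +ᵇ #ᵇ 3 +ᵇ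
       power₃ +ᵇ #ᵇ 3 +ᵇ cᵇ cA≤X +ᵇ mul₃ +ᵇ power₃ +ᵇ #ᵇ 3 +ᵇ power₃)

      startᵇ : Bd 20 1 (start-time Kc)
      startᵇ = exponentᵇ 20 (#ᵇ 3 +ᵇ #ᵇ 3 +ᵇ (div₃ +ᵇ #ᵇ 7) +ᵇ #ᵇ 3 +ᵇ (div₃ +ᵇ #ᵇ 7))

      condᵇ : Bd 32 1 cond₁-time
      condᵇ = exponentᵇ 32 ((#ᵇ 9 +ᵇ evᵇ inp≤X) +ᵇ (#ᵇ 4 +ᵇ (#ᵇ 1 +ᵇ (#ᵇ 6 +ᵇ emitᵇ))))

      rowUᵇ : Bd 45 1 (rowU-time + 7)
      rowUᵇ = exponentᵇ 45 (((#ᵇ 6 +ᵇ emitᵇ) +ᵇ (#ᵇ 7 +ᵇ dᵇ *ᵇ ((condᵇ +ᵇ condᵇ) +ᵇ #ᵇ 7))) +ᵇ #ᵇ 7)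

      rowYᵇ : Bd 45 1 (rowY-time + 7)
      rowYᵇ = exponentᵇ 45 (((div₃ +ᵇ div₃ +ᵇ #ᵇ 21) +ᵇ (#ᵇ 4 +ᵇ #ᵇ 4 +ᵇ (#ᵇ 6 +ᵇ emitᵇ))) +ᵇ #ᵇ 7)

      rowDᵇ : Bd 45 1 (rowD-time + 7)
      rowDᵇ = exponentᵇ 45 ((#ᵇ 6 +ᵇ emitᵇ) +ᵇ #ᵇ 7)

     -- Everything but the simulated time t, the number n of vertices and the Φ A estimates
     -- inspected is polynomial in X; t covers preprocessing and all operations. The exponent is a
     -- ceiling from the rules for `Bd`.
     total-cost : ∀ t → 8 + units t (loop-time t) * κ ≤ X ^ 110 * (t + (n + Φ * 2 ^ a))
     total-cost t = ≤bd (exponentᵇ 110 (#ᵇ 8 +ᵇ (liftᵇ (init₁ᵇ +ᵇ init₂ᵇ) +ᵇ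
       ((#ᵇ 7 +ᵇ unitᵇ A≤ *ᵇ rowUᵇ) +ᵇ ((#ᵇ 7 +ᵇ unitᵇ n≤ *ᵇ rowYᵇ) +ᵇ (#ᵇ 7 +ᵇ liftᵇ (dᵇ *ᵇ rowDᵇ)))) +ᵇ liftᵇ startᵇ +ᵇ
       unitᵇ (m≤m+n t _) *ᵇ σᵇ Kc≤X +ᵇ (#ᵇ 7 +ᵇ ((unitᵇ (m≤m+n t _) *ᵇ σᵇ Kc≤X +ᵇ growᵇ Φ≤ (widenᵇ (2 ^ a) Φ fullᵇ)) +ᵇ unitᵇ (≤-trans (m≤m*n Φ (2 ^ a)) Φ≤) *ᵇ #ᵇ 7)) +ᵇ #ᵇ 3) *ᵇ κᵇ))
      where
      Φ≤ : Φ * 2 ^ a ≤ t + (n + Φ * 2 ^ a)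
      Φ≤ = ≤-trans (m≤n+m _ n) (m≤n+m _ t)
      n≤ : n ≤ t + (n + Φ * 2 ^ a)
      n≤ = ≤-trans (m≤m+n n _) (m≤n+m _ t)
      A≤ : 2 ^ a ≤ t + (n + Φ * 2 ^ a)
      A≤ = ≤-trans (m≤n*m (2 ^ a) Φ {{m^n≢0 2 (N ∸ (a + a))}}) Φ≤
      instance
       Ξ≢0 : NonZero (t + (n + Φ * 2 ^ a))
       Ξ≢0 = >-nonZero (≤-trans (0<2^ a) A≤)

     solve-within : ∀ mode {m p u c T} → Gap → Φ < 2 ^ W → ℓ₀ + d ≤ m n → suc (3 * (n * n)) + budgetΦ (p n) (u n) (c n) < 2 ^ W →
      X ^ 110 * (budgetΦ (p n) (u n) (c n) + (n + Φ * 2 ^ a)) ≤ T → Approximates mode (boundFor mode) α m p u c A →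
      ∀ ω → Ends w (solverP Cw q K L ρ A (denseFor mode) (phasesFor mode A)) (startSAT w F ω) T (CorrectAnswer F)
     solve-within mode {m} {p} {u} {c} gap Φ< m≥ roomT T≥ approx ω =
      ends-≤ (≤-trans (total-cost (budgetΦ (p n) (u n) (c n))) T≥) (solve-mode gap Φ< m≥ roomT mode (serving {bound = boundFor mode} m≥ approx) ω)

-- Comparison with 2 ^ N in exponents

^-distribʳ-* : ∀ n x y → (x * y) ^ n ≡ x ^ n * y ^ n
^-distribʳ-* zero x y = refl
^-distribʳ-* (suc n) x y = trans (cong (x * y *_) (^-distribʳ-* n x y)) (l x y (x ^ n) (y ^ n))
 where
 l : ∀ x y a b → x * y * (a * b) ≡ x * a * (y * b)
 l = solve-∀

^-cancelˡ-≤ : ∀ D .{{_ : NonZero D}} {x y} → x ^ D ≤ y ^ D → x ≤ y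
^-cancelˡ-≤ D {x} {y} h = ≮⇒≥ λ y<x → <⇒≱ (^-monoˡ-< D y<x) h

<2^suc-log : ∀ n → n < 2 ^ suc ⌊log₂ n ⌋
<2^suc-log n = ≰⇒> λ h → <-irrefl refl (≡≤ (sym (⌊log₂[2^n]⌋≡n (suc ⌊log₂ n ⌋))) (⌊log₂⌋-mono-≤ h))

-- For a ^ D ≤ x ^ D * E one may think of a ≤ x * E ^ (1 / D).
root-sum : ∀ D E {a b x y} → a ^ D ≤ x ^ D * E → b ^ D ≤ y ^ D * E → (a + b) ^ D ≤ (2 * (x + y)) ^ D * E
root-sum D E {a} {b} {x} {y} p q = [ larger b a y x q (+-comm b a) (+-comm y x) , larger a b x y p refl refl ]′ (≤-total a b)
 where
 larger : ∀ a b x y → a ^ D ≤ x ^ D * E → ∀ {s z} → a + b ≡ s → x + y ≡ z → b ≤ a → s ^ D ≤ (2 * z) ^ D * E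
 larger a b x y p refl refl b≤a = begin
  (a + b) ^ D ≤⟨ ^-monoˡ-≤ D (≤≡ (+-monoʳ-≤ a b≤a) (cong (a +_) (sym (+-identityʳ a)))) ⟩
  (2 * a) ^ D ≡⟨ ^-distribʳ-* D 2 a ⟩
  2 ^ D * a ^ D ≤⟨ *-monoʳ-≤ (2 ^ D) p ⟩
  2 ^ D * (x ^ D * E) ≡⟨ sym (*-assoc (2 ^ D) (x ^ D) E) ⟩
  2 ^ D * x ^ D * E ≡⟨ cong (_* E) (sym (^-distribʳ-* D 2 x)) ⟩
  (2 * x) ^ D * E ≤⟨ *-monoˡ-≤ E (^-monoˡ-≤ D (*-monoʳ-≤ 2 (m≤m+n x y))) ⟩
  (2 * (x + y)) ^ D * E ∎
  where open ≤-Reasoning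

-- The phases: with a ≈ N / q, D = k q, A = 2 ^ a and Φ A ² = 2 ^ N.
module Exponents (N q k t : ℕ) (q≡ : q ≡ suc t) (1≤t : 1 ≤ t) (1≤k : 1 ≤ k) (a : ℕ) (aq≤N : a * q ≤ N) (N≤ : N ≤ a * q + q) (2a≤N : a + a ≤ N) where

 -- The D-th root of E is 2 ^ (N (1 - 1 / D)), the running time to be reached. Bounds are stated for
 -- D-th powers to stay within integers.
 D A Φ E : ℕ
 D = k * q
 A = 2 ^ a
 Φ = 2 ^ (N ∸ (a + a))
 E = 2 ^ (N * (D ∸ 1))

 private
  ^D' : ∀ x → x ^ D ≡ (x ^ k) ^ q
  ^D' x = sym (^-*-assoc x k q)

  A^q≤ : A ^ q ≤ 2 ^ N
  A^q≤ = ≡≤ (^-*-assoc 2 a q) (^-monoʳ-≤ 2 aq≤N)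

  ≤A^q : 2 ^ N ≤ A ^ q * 2 ^ q
  ≤A^q = ≤≡ (^-monoʳ-≤ 2 N≤) (trans (^-distribˡ-+-* 2 (a * q) q) (cong (_* 2 ^ q) (sym (^-*-assoc 2 a q))))

  kt<D : suc (k * t) ≤ D
  kt<D = ≤≡ (+-monoˡ-≤ (k * t) 1≤k) (trans (sym (*-suc k t)) (cong (k *_) (sym q≡)))

  D≡ : suc (D ∸ 1) ≡ D
  D≡ = trans (+-comm 1 (D ∸ 1)) (m∸n+n≡m (≤-trans (s≤s z≤n) kt<D))

  ≤E : ∀ {e} → e < D → 2 ^ (N * e) ≤ E
  ≤E {e} e< = ^-monoʳ-≤ 2 (*-monoʳ-≤ N (s≤s⁻¹ (subst (suc e ≤_) (sym D≡) e<)))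

  E*2^N : E * 2 ^ N ≡ 2 ^ (N * D)
  E*2^N = trans (sym (^-distribˡ-+-* 2 (N * (D ∸ 1)) N)) (cong (2 ^_) (trans (trans (+-comm _ N) (sym (*-suc N (D ∸ 1)))) (cong (N *_) D≡)))

  q≤D : q ≤ D
  q≤D = m≤n*m q k {{>-nonZero 1≤k}}

  2^D≢0 : NonZero (2 ^ N)
  2^D≢0 = m^n≢0 2 N

 -- A ^ q ≤ 2 ^ N, and s is at most t = q - 1, so A ^ s stays below 2 ^ N by the factor 2 ^ (N / q)
 -- or more. This is why q exceeds the exponent of preprocessing.
 power-bound : ∀ {s y Z} → s ≤ t → y ≤ Z * A ^ s → y ^ D ≤ Z ^ D * E
 power-bound {s} {y} {Z} s≤ y≤ = begin
  y ^ D ≤⟨ ^-monoˡ-≤ D y≤ ⟩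
  (Z * A ^ s) ^ D ≡⟨ ^-distribʳ-* D Z (A ^ s) ⟩
  Z ^ D * (A ^ s) ^ D ≡⟨ cong (Z ^ D *_) (trans (^-*-assoc A s D) (trans (cong (A ^_) (l s k q)) (sym (^-*-assoc A q (k * s))))) ⟩
  Z ^ D * (A ^ q) ^ (k * s) ≤⟨ *-monoʳ-≤ (Z ^ D) (≤≡ (^-monoˡ-≤ (k * s) A^q≤) (^-*-assoc 2 N (k * s))) ⟩
  Z ^ D * 2 ^ (N * (k * s)) ≤⟨ *-monoʳ-≤ (Z ^ D) (≤E (≤-<-trans (*-monoʳ-≤ k s≤) kt<D)) ⟩
  Z ^ D * E ∎
  where
  open ≤-Reasoning
  l : ∀ s k q → s * (k * q) ≡ q * (k * s)
  l = solve-∀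

 ΦA² : Φ * (A * A) ≡ 2 ^ N
 ΦA² = trans (cong (Φ *_) (sym (^-distribˡ-+-* 2 a a))) (trans (sym (^-distribˡ-+-* 2 (N ∸ (a + a)) (a + a))) (cong (2 ^_) (m∸n+n≡m 2a≤N)))

 -- A factor A ^ q, which is about 2 ^ N, is saved.
 saving-bound : ∀ {y Z} → y ^ k * A ≤ Z ^ k * (2 ^ N) ^ k → y ^ D ≤ (2 * Z) ^ D * E
 saving-bound {y} {Z} h = *-cancelʳ-≤ (y ^ D) ((2 * Z) ^ D * E) (2 ^ N) {{2^D≢0}} (begin
  -- Rounding N / q down loses a factor of at most 2 ^ q, which the 2 in `2 * Z` absorbs.
  y ^ D * 2 ^ N ≤⟨ *-monoʳ-≤ (y ^ D) ≤A^q ⟩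
  y ^ D * (A ^ q * 2 ^ q) ≡⟨ sym (*-assoc (y ^ D) (A ^ q) (2 ^ q)) ⟩
  y ^ D * A ^ q * 2 ^ q ≡⟨ cong (λ z → z * A ^ q * 2 ^ q) (^D' y) ⟩
  (y ^ k) ^ q * A ^ q * 2 ^ q ≡⟨ cong (_* 2 ^ q) (sym (^-distribʳ-* q (y ^ k) A)) ⟩
  (y ^ k * A) ^ q * 2 ^ q ≤⟨ *-mono-≤ (^-monoˡ-≤ q h) (^-monoʳ-≤ 2 q≤D) ⟩
  (Z ^ k * (2 ^ N) ^ k) ^ q * 2 ^ D ≡⟨ cong (_* 2 ^ D) (trans (^-distribʳ-* q (Z ^ k) _) (cong₂ _*_ (sym (^D' Z)) (trans (sym (^D' (2 ^ N))) (^-*-assoc 2 N D)))) ⟩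
  Z ^ D * 2 ^ (N * D) * 2 ^ D ≡⟨ cong (λ z → Z ^ D * z * 2 ^ D) (sym E*2^N) ⟩
  Z ^ D * (E * 2 ^ N) * 2 ^ D ≡⟨ l (Z ^ D) E (2 ^ N) (2 ^ D) ⟩
  2 ^ D * Z ^ D * E * 2 ^ N ≡⟨ cong (λ z → z * E * 2 ^ N) (sym (^-distribʳ-* D 2 Z)) ⟩
  (2 * Z) ^ D * E * 2 ^ N ∎)
  where
  open ≤-Reasoning
  l : ∀ z e n d → z * (e * n) * d ≡ d * z * e * n
  l = solve-∀

 ΦA-bound : (Φ * A) ^ D ≤ 2 ^ D * E
 ΦA-bound = saving-bound {Φ * A} {1} (begin
  (Φ * A) ^ k * A ≤⟨ *-monoʳ-≤ ((Φ * A) ^ k) (≡≤ (sym (*-identityʳ A)) (^-monoʳ-≤ A {{m^n≢0 2 a}} 1≤k)) ⟩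
  (Φ * A) ^ k * A ^ k ≡⟨ sym (^-distribʳ-* k (Φ * A) A) ⟩
  (Φ * A * A) ^ k ≡⟨ cong (_^ k) (trans (*-assoc Φ A A) ΦA²) ⟩
  (2 ^ N) ^ k ≡⟨ sym (trans (cong (_* (2 ^ N) ^ k) (^-zeroˡ k)) (*-identityˡ _)) ⟩
  1 ^ k * (2 ^ N) ^ k ∎)
  where open ≤-Reasoning

 -- Here v is about n ^ (2 - 1 / k) and n is A up to the factor X. As Φ A ² = 2 ^ N, the saving over
 -- all phases is the k-th root of A.
 Φv-bound : ∀ {v Q X n} → n ≤ X * A → 1 ≤ X → v ^ k ≤ Q ^ k * n ^ (2 * k ∸ 1) → (Φ * v) ^ D ≤ (2 * (Q * (X * X))) ^ D * E
 Φv-bound {v} {Q} {X} {n} n≤ 1≤X v≤ = saving-bound {Φ * v} {Q * (X * X)} (begin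
  (Φ * v) ^ k * A ≡⟨ cong (_* A) (^-distribʳ-* k Φ v) ⟩
  Φ ^ k * v ^ k * A ≤⟨ *-monoˡ-≤ A (*-monoʳ-≤ (Φ ^ k) (≤-trans v≤ (*-monoʳ-≤ (Q ^ k) (≤≡ (^-monoˡ-≤ (2 * k ∸ 1) n≤) (^-distribʳ-* (2 * k ∸ 1) X A))))) ⟩
  Φ ^ k * (Q ^ k * (X ^ (2 * k ∸ 1) * A ^ (2 * k ∸ 1))) * A ≤⟨ *-monoˡ-≤ A (*-monoʳ-≤ (Φ ^ k) (*-monoʳ-≤ (Q ^ k) (*-monoˡ-≤ (A ^ (2 * k ∸ 1)) (^-monoʳ-≤ X {{>-nonZero 1≤X}} (m∸n≤m (2 * k) 1))))) ⟩
  Φ ^ k * (Q ^ k * (X ^ (2 * k) * A ^ (2 * k ∸ 1))) * A ≡⟨ l (Φ ^ k) (Q ^ k) (X ^ (2 * k)) (A ^ (2 * k ∸ 1)) A ⟩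
  Q ^ k * X ^ (2 * k) * (Φ ^ k * (A * A ^ (2 * k ∸ 1))) ≡⟨ cong (λ z → Q ^ k * X ^ (2 * k) * (Φ ^ k * A ^ z)) (trans (+-comm 1 _) (m∸n+n≡m (≤-trans 1≤k (m≤m+n k _)))) ⟩
  Q ^ k * X ^ (2 * k) * (Φ ^ k * A ^ (2 * k)) ≡⟨ cong₂ (λ y z → Q ^ k * y * (Φ ^ k * z)) (square X) (square A) ⟩
  Q ^ k * (X * X) ^ k * (Φ ^ k * (A * A) ^ k) ≡⟨ cong₂ _*_ (sym (^-distribʳ-* k Q (X * X))) (trans (sym (^-distribʳ-* k Φ (A * A))) (cong (_^ k) ΦA²)) ⟩
  (Q * (X * X)) ^ k * (2 ^ N) ^ k ∎)
  where
  open ≤-Reasoning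
  l : ∀ f q x y a → f * (q * (x * y)) * a ≡ q * x * (f * (a * y))
  l = solve-∀
  square : ∀ x → x ^ (2 * k) ≡ (x * x) ^ k
  square x = trans (sym (^-*-assoc x 2 k)) (cong (λ z → (x * z) ^ k) (*-identityʳ x))

 -- Each addition of two bounds costs a factor 4 ≤ X. The summands are preprocessing, operations,
 -- graph and estimates, and preprocessing has the largest factor X ^ (t + 1).
 total-bound : ∀ {p v n P Q X} → 4 ≤ X → P ≤ X → Q ≤ X → n ≤ X * A → p ≤ P * n ^ t → v ^ k ≤ Q ^ k * n ^ (2 * k ∸ 1) →
  (p + (Φ * v + (n + Φ * A))) ^ D ≤ (X ^ (7 + t)) ^ D * E
 total-bound {p} {v} {n} {P} {Q} {X} 4≤X P≤X Q≤X n≤ p≤ v≤ =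
  join (≤-refl {6 + t}) (raise (m≤n+m (suc t) 5) (power-bound {t} {p} {X ^ suc t} ≤-refl p≤'))
   (join (≤-refl {5 + t}) (raise (m≤m+n 4 (1 + t)) (widen Φv≤ (Φv-bound {v} {Q} {X} {n} n≤ (≤-trans (s≤s z≤n) 4≤X) v≤)))
    (join (≤-refl {4 + t}) (raise (m≤m+n 1 (3 + t)) (power-bound {1} {n} {X ^ 1} 1≤t (≤≡ n≤ (cong₂ _*_ (sym (*-identityʳ X)) (sym (*-identityʳ A))))))
     (raise (m≤m+n 1 (3 + t)) (widen (≤≡ (≤-trans (m≤m+n 2 2) 4≤X) (sym (*-identityʳ X))) ΦA-bound))))
  where
  X≢0 : NonZero X
  X≢0 = >-nonZero (≤-trans (s≤s z≤n) 4≤X)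
  widen : ∀ {y x z} → x ≤ z → y ^ D ≤ x ^ D * E → y ^ D ≤ z ^ D * E
  widen x≤ h = ≤-trans h (*-monoˡ-≤ E (^-monoˡ-≤ D x≤))
  raise : ∀ {y i j} → i ≤ j → y ^ D ≤ (X ^ i) ^ D * E → y ^ D ≤ (X ^ j) ^ D * E
  raise {y} {i} {j} i≤ = widen {y} {X ^ i} {X ^ j} (^-monoʳ-≤ X {{X≢0}} i≤)
  join : ∀ {y z i j} → j ≤ i → y ^ D ≤ (X ^ i) ^ D * E → z ^ D ≤ (X ^ j) ^ D * E → (y + z) ^ D ≤ (X ^ suc i) ^ D * E
  join {y} {z} {i} {j} j≤ h h' = widen {y + z} {2 * (X ^ i + X ^ i)} {X ^ suc i}
   (≡≤ (l (X ^ i)) (*-monoˡ-≤ (X ^ i) 4≤X)) (root-sum D E h (raise {z} {j} {i} j≤ h'))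
   where
   l : ∀ x → 2 * (x + x) ≡ 4 * x
   l = solve-∀
  p≤' : p ≤ X ^ suc t * A ^ t
  p≤' = ≤-trans p≤ (≤≡ (*-mono-≤ P≤X (≤≡ (^-monoˡ-≤ t n≤) (^-distribʳ-* t X A))) (sym (*-assoc X (X ^ t) (A ^ t))))
  Φv≤ : 2 * (Q * (X * X)) ≤ X ^ 4
  Φv≤ = ≤≡ (*-mono-≤ (≤-trans (m≤m+n 2 2) 4≤X) (*-monoˡ-≤ (X * X) Q≤X)) (l X)
   where
   l : ∀ x → x * (x * (x * x)) ≡ x * (x * (x * (x * 1)))
   l = solve-∀

-- A phase has polynomially many operations; their number moves into the power of x, which turns the
-- exponent 110 into 112.
absorb : ∀ e x .{{_ : NonZero x}} {p Φ v r ops} → ops ≤ x * x * v → x ^ e * (p + Φ * ops + r) ≤ x ^ (e + 2) * (p + (Φ * v + r))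
absorb e x {p} {Φ} {v} {r} {ops} h = begin
 x ^ e * (p + Φ * ops + r) ≤⟨ *-monoʳ-≤ (x ^ e) (+-mono-≤ (+-mono-≤ (m≤n*m p (x * x) {{m*n≢0 x x}}) (*-monoʳ-≤ Φ h)) (m≤n*m r (x * x) {{m*n≢0 x x}})) ⟩
 x ^ e * (x * x * p + Φ * (x * x * v) + x * x * r) ≡⟨ l (x ^ e) x p Φ v r ⟩
 x ^ e * (x * (x * 1)) * (p + (Φ * v + r)) ≡⟨ cong (_* (p + (Φ * v + r))) (sym (^-distribˡ-+-* x e 2)) ⟩
 x ^ (e + 2) * (p + (Φ * v + r)) ∎
 where
 open ≤-Reasoning
 l : ∀ y x p f v r → y * (x * x * p + f * (x * x * v) + x * x * r) ≡ y * (x * (x * 1)) * (p + (f * v + r))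
 l = solve-∀

-- Choice of the constants

-- The bounds p ≤ P nᵗ and u + c ≤ Q n ^ (2 - 1 / k) on the times of an
-- algorithm turn into a decision procedure for K-SAT.
module Reduction (A : DynAlg) (k t L K P Q : ℕ) (1≤k : 1 ≤ k) (1≤t : 1 ≤ t) (p u c : ℕ → ℕ)
 (p≤ : ∀ n → 1 ≤ n → p n ≤ P * n ^ t) (v≤ : ∀ n → 1 ≤ n → (u n + c n) ^ k ≤ Q ^ k * n ^ (2 * k ∸ 1)) where

 -- `Cw` adds up all demands on the width W = (N + 1) Cw, and `Cx` all demands on X. `λ₀` satisfies
 -- ℓ ≤ (N + 1) λ₀, `E₀` covers the logarithm of the simulated time, and ρ = 3 + L gives 2 ^ ρ > 3 +
 -- L rows.
 q ρ cA Kc λ₀ E₀ Cw Cx wc : ℕ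
 q = suc t
 ρ = 3 + L
 cA = wordConst A
 Kc = constSum (preprocess A) + (constSum (onInsert A) + (constSum (onDelete A) + constSum (onQuery A)))
 λ₀ = ρ + K + suc K + 1
 E₀ = λ₀ * (t + 5) + (P + Q + 7)
 Cw = 2 * (q + K + L + ρ + cA + 10) + ((2 * λ₀ + 3) + ((1 + 2 * (cA * suc λ₀)) + ((K + 2) + (Kc + (1 + E₀)))))
 Cx = 2 ^ ρ * (2 ^ K * 2 ^ suc K) + (Cw + (64 + ((K + 2) + (Kc + (q + ((3 + 2 * L) + (ρ + (cA + (P + Q)))))))))
 wc = Cx + suc K

 X : ℕ → ℕ
 X N = Cx * suc N ^ suc K

 X≡ : ∀ N → X N ≡ Cx * suc N ^ suc K
 X≡ N = refl

 nv : ℕ → ℕ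
 nv N = 2 ^ ρ * 2 ^ (K * lg N + suc K + N / q)

 T' : ℕ → ℕ
 T' N = X N ^ 112 * (p (nv N) + (2 ^ (N ∸ (N / q + N / q)) * (u (nv N) + c (nv N)) + (nv N + 2 ^ (N ∸ (N / q + N / q)) * 2 ^ (N / q))))

 skip₁ : ∀ {x y} z → x ≤ y → x ≤ z + y
 skip₁ z x≤ = ≤-trans x≤ (m≤n+m _ z)

 module Bounds (N : ℕ) where
  a lgN g b B ℓ A' Φ n W : ℕ
  a = N / q
  lgN = lg N
  g = K * lgN + suc K
  b = g + a
  B = 2 ^ b
  ℓ = ρ + b
  A' = 2 ^ a
  Φ = 2 ^ (N ∸ (a + a))
  n = 2 ^ ρ * B
  W = suc N * Cw

  in-W : ∀ {x} → x ≤ Cw → suc N * x ≤ W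
  in-W = *-monoʳ-≤ (suc N)

  ≤W : ∀ {x} → x ≤ Cw → x ≤ W
  ≤W {x} x≤ = ≤-trans (m≤n*m x (suc N)) (in-W x≤)

  C₁≤ : 2 * (q + K + L + ρ + cA + 10) ≤ Cw
  C₁≤ = m≤m+n _ _
  C₂≤ : 2 * λ₀ + 3 ≤ Cw
  C₂≤ = skip₁ (2 * (q + K + L + ρ + cA + 10)) (m≤m+n _ _)
  C₃≤ : 1 + 2 * (cA * suc λ₀) ≤ Cw
  C₃≤ = skip₁ (2 * (q + K + L + ρ + cA + 10)) (skip₁ (2 * λ₀ + 3) (m≤m+n _ _))
  C₄≤ : K + 2 ≤ Cw
  C₄≤ = skip₁ (2 * (q + K + L + ρ + cA + 10)) (skip₁ (2 * λ₀ + 3) (skip₁ (1 + 2 * (cA * suc λ₀)) (m≤m+n _ _)))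
  C₅≤ : Kc + (1 + E₀) ≤ Cw
  C₅≤ = skip₁ (2 * (q + K + L + ρ + cA + 10)) (skip₁ (2 * λ₀ + 3) (skip₁ (1 + 2 * (cA * suc λ₀)) (skip₁ (K + 2) ≤-refl)))
  1≤Cw : 1 ≤ Cw
  1≤Cw = ≤-trans (skip₁ Kc (m≤m+n 1 E₀)) C₅≤

  a≤N : a ≤ N
  a≤N = m/n≤m N q

  aq≤N : a * q ≤ N
  aq≤N = m/n*n≤m N q

  N≤aq+q : N ≤ a * q + q
  N≤aq+q = ≡≤ (trans (m≡m%n+[m/n]*n N q) (+-comm (N % q) _)) (+-monoʳ-≤ (a * q) (<⇒≤ (m%n<n N q)))

  2a≤N : a + a ≤ N
  2a≤N = ≡≤ (l a) (≤-trans (*-monoʳ-≤ a (s≤s 1≤t)) aq≤N)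
   where
   l : ∀ a → a + a ≡ a * 2
   l = solve-∀

  ℓ≤ : ℓ ≤ suc N * λ₀
  ℓ≤ = ≤-trans (+-monoʳ-≤ ρ (+-mono-≤ (+-monoˡ-≤ (suc K) (*-monoʳ-≤ K (lgLoop-≤ N N))) a≤N))
   (≤≡ (m≤m+n _ (suc K + N * (ρ + suc K))) (l ρ K N))
   where
   l : ∀ ρ K N → ρ + (K * N + suc K + N) + (suc K + N * (ρ + suc K)) ≡ suc N * (ρ + K + suc K + 1)
   l = solve-∀

  2ℓ≤ : ℓ + ℓ + 3 ≤ W
  2ℓ≤ = ≤-trans (≤≡ (+-mono-≤ (+-mono-≤ ℓ≤ ℓ≤) (m≤n*m 3 (suc N))) (l (suc N) λ₀)) (in-W C₂≤)
   where
   l : ∀ n x → n * x + n * x + n * 3 ≡ n * (2 * x + 3)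
   l = solve-∀

  2V≤ : suc (cA * suc ℓ + cA * suc ℓ) ≤ W
  2V≤ = ≤-trans (+-mono-≤ (m≤n*m 1 (suc N)) (+-mono-≤ V≤ V≤)) (≡≤ (l (suc N) (cA * suc λ₀)) (in-W C₃≤))
   where
   l : ∀ n x → n * 1 + (n * x + n * x) ≡ n * (1 + 2 * x)
   l = solve-∀
   l' : ∀ c n x → c * (n * suc x) ≡ n * (c * suc x)
   l' = solve-∀
   V≤ : cA * suc ℓ ≤ suc N * (cA * suc λ₀)
   V≤ = ≤≡ (*-monoʳ-≤ cA (≤≡ (+-mono-≤ (m≤m+n 1 N) ℓ≤) (sym (*-suc (suc N) λ₀)))) (l' cA (suc N) λ₀)

  N<W : N < W
  N<W = ≡≤ (sym (*-identityʳ (suc N))) (in-W 1≤Cw)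

  inp≤W : K + 2 * N ≤ W
  inp≤W = ≤-trans (≤≡ (m≤m+n _ (N * K + 2)) (l K N)) (in-W C₄≤)
   where
   l : ∀ K N → K + 2 * N + (N * K + 2) ≡ suc N * (K + 2)
   l = solve-∀

  Kc<2^W : Kc < 2 ^ W
  Kc<2^W = ≤-<-trans (≤W (≤-trans (m≤m+n Kc _) C₅≤)) (n<2^n W)

  Φ<2^W : Φ < 2 ^ W
  Φ<2^W = ^-monoʳ-< 2 (s≤s (s≤s z≤n)) (≤-<-trans (m∸n≤m N (a + a)) N<W)

  n≡ : n ≡ 2 ^ ℓ
  n≡ = sym (^-distribˡ-+-* 2 ρ b)

  1≤n : 1 ≤ n
  1≤n = subst (1 ≤_) (sym n≡) (0<2^ ℓ)

  B≤n : B ≤ n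
  B≤n = m≤n*m B (2 ^ ρ) {{m^n≢0 2 ρ}}

  A<B : A' < B
  A<B = ^-monoʳ-< 2 (s≤s (s≤s z≤n)) (m<n+m a (≤-trans (s≤s z≤n) (m≤n+m (suc K) (K * lgN))))

  n²≡ : n * n ≡ 2 ^ (ℓ + ℓ)
  n²≡ = trans (cong₂ _*_ n≡ n≡) (sym (^-distribˡ-+-* 2 ℓ ℓ))

  4n² : ∀ {x} → x ≤ 4 * (n * n) → x ≤ 2 ^ (2 + (ℓ + ℓ))
  4n² x≤ = ≤≡ x≤ (trans (cong (4 *_) n²≡) (*-assoc 2 2 (2 ^ (ℓ + ℓ))))

  -- 4 + 3 n ² ≤ 7 n ² < 8 n ² = 2 ^ (2 ℓ + 3), and 2 ℓ + 3 ≤ W.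
  room : 4 + 3 * (n * n) < 2 ^ W
  room = <-≤-trans (≤-<-trans (+-monoˡ-≤ (3 * (n * n)) (≡≤ (sym (*-identityʳ 4)) (*-monoʳ-≤ 4 1≤n²)))
   (≤-<-trans (≤-reflexive (trans (l (n * n)) (cong (7 *_) n²≡))) (*-monoˡ-< (2 ^ (ℓ + ℓ)) {{m^n≢0 2 (ℓ + ℓ)}} (n<1+n 7))))
   (≡≤ (trans (*-comm 8 (2 ^ (ℓ + ℓ))) (sym (^-distribˡ-+-* 2 (ℓ + ℓ) 3))) (^-monoʳ-≤ 2 2ℓ≤))
   where
   1≤n² : 1 ≤ n * n
   1≤n² = *-mono-≤ 1≤n 1≤n
   l : ∀ x → 4 * x + 3 * x ≡ 7 * x
   l = solve-∀

  v≤n² : u n + c n ≤ Q * (n * n)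
  v≤n² = ^-cancelˡ-≤ k {{>-nonZero 1≤k}} (≤-trans (v≤ n 1≤n) (≤≡ (*-monoʳ-≤ (Q ^ k) (^-monoʳ-≤ n {{>-nonZero 1≤n}} (m∸n≤m (2 * k) 1)))
   (trans (cong (Q ^ k *_) (trans (sym (^-*-assoc n 2 k)) (cong (λ z → (n * z) ^ k) (*-identityʳ n)))) (sym (^-distribʳ-* k Q (n * n))))))

  ops≤ : ∀ d z → 2 * d + 1 ≤ z → d * u n + (c n + d * u n) ≤ z * (u n + c n)
  ops≤ d z h = ≤-trans (≤≡ (m≤m+n _ (u n + 2 * d * c n)) (l d (u n) (c n))) (*-monoˡ-≤ (u n + c n) h)
   where
   l : ∀ d u c → d * u + (c + d * u) + (u + 2 * d * c) ≡ (2 * d + 1) * (u + c)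
   l = solve-∀

  -- The trie may receive one node per simulated step, so the total simulated time has to fit into W
  -- digits. This is linear in N because all factors are powers 2 ^ O(N).
  room-for : ∀ d → d ≤ B → suc (3 * (n * n)) + (p n + Φ * (d * u n + (c n + d * u n))) < 2 ^ W
  room-for d d≤ = <-≤-trans (≤-<-trans (+-mono-≤ part₁ (+-mono-≤ part₂ part₃)) (≤-<-trans (≤-reflexive (l₃ (2 ^ e)))
    (*-monoˡ-< (2 ^ e) {{m^n≢0 2 e}} (n<1+n 3)))) (≡≤ (*-assoc 2 2 (2 ^ e)) (^-monoʳ-≤ 2 {x = 2 + e} e≤))
   where
   e₁ e₂ e₃ e : ℕ
   e₁ = 2 + (ℓ + ℓ)
   e₂ = P + ℓ * t
   e₃ = N + ((2 + ℓ) + (Q + (ℓ + ℓ)))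
   e = e₁ + (e₂ + e₃)
   l₃ : ∀ x → x + (x + x) ≡ 3 * x
   l₃ = solve-∀
   part₁ : suc (3 * (n * n)) ≤ 2 ^ e
   part₁ = ≤-trans (4n² (+-monoˡ-≤ (3 * (n * n)) (*-mono-≤ 1≤n 1≤n))) (^-monoʳ-≤ 2 (m≤m+n e₁ _))
   part₂ : p n ≤ 2 ^ e
   part₂ = ≤-trans (p≤ n 1≤n) (≤-trans (*-mono-≤ (<⇒≤ (n<2^n P)) (≤-reflexive (trans (cong (_^ t) n≡) (^-*-assoc 2 ℓ t))))
    (≡≤ (sym (^-distribˡ-+-* 2 P (ℓ * t))) (^-monoʳ-≤ 2 (≤-trans (m≤m+n e₂ e₃) (m≤n+m _ e₁)))))
   2d+1≤ : 2 * d + 1 ≤ 4 * n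
   2d+1≤ = ≤-trans (+-mono-≤ (*-monoʳ-≤ 2 (≤-trans d≤ B≤n)) 1≤n) (≤≡ (m≤m+n _ n) (l n))
    where
    l : ∀ n → 2 * n + n + n ≡ 4 * n
    l = solve-∀
   part₃ : Φ * (d * u n + (c n + d * u n)) ≤ 2 ^ e
   part₃ = ≤-trans (*-mono-≤ (^-monoʳ-≤ 2 (m∸n≤m N (a + a))) (≤-trans (ops≤ d (4 * n) 2d+1≤)
     (*-mono-≤ (≤-reflexive (trans (cong (4 *_) n≡) (*-assoc 2 2 (2 ^ ℓ)))) (≤-trans v≤n² (*-mono-≤ (<⇒≤ (n<2^n Q)) (≤-reflexive n²≡))))))
    (≡≤ (trans (cong (2 ^ N *_) (trans (cong (2 ^ (2 + ℓ) *_) (sym (^-distribˡ-+-* 2 Q (ℓ + ℓ)))) (sym (^-distribˡ-+-* 2 (2 + ℓ) (Q + (ℓ + ℓ)))))) (sym (^-distribˡ-+-* 2 N ((2 + ℓ) + (Q + (ℓ + ℓ))))))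
     (^-monoʳ-≤ 2 (≤-trans (m≤n+m e₃ e₂) (m≤n+m _ e₁))))
   e≤ : 2 + e ≤ W
   e≤ = ≡≤ (l ℓ t N P Q) (≤-trans (+-mono-≤ (*-monoˡ-≤ (t + 5) ℓ≤) (≤-trans (+-monoʳ-≤ (P + Q + 6) (n≤1+n N)) (≤≡ (m≤m+n _ (N * (P + Q + 6))) (l' N (P + Q + 6)))))
    (≡≤ (l'' (suc N) λ₀ (t + 5) (P + Q)) (in-W (≤-trans (skip₁ Kc (n≤1+n E₀)) C₅≤))))
    where
    l : ∀ ℓ t N P Q → 2 + ((2 + (ℓ + ℓ)) + ((P + ℓ * t) + (N + ((2 + ℓ) + (Q + (ℓ + ℓ)))))) ≡ ℓ * (t + 5) + (P + Q + 6 + N)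
    l = solve-∀
    l' : ∀ N x → x + suc N + N * x ≡ suc N * (x + 1)
    l' = solve-∀
    l'' : ∀ n x y z → n * x * y + n * (z + 6 + 1) ≡ n * (x * y + (z + 7))
    l'' = solve-∀

  in-X : ∀ {x} → x ≤ Cx → x * suc N ≤ X N
  in-X x≤ = ≤≡ (*-mono-≤ x≤ (m≤m*n (suc N) (suc N ^ K) {{m^n≢0 (suc N) K}})) (sym (X≡ N))

  ≤X : ∀ {x} → x ≤ Cx → x ≤ X N
  ≤X {x} x≤ = ≤-trans (m≤m*n x (suc N)) (in-X x≤)

  Cx₁ : ∀ {x} → x ≤ Cw + (64 + ((K + 2) + (Kc + (q + ((3 + 2 * L) + (ρ + (cA + (P + Q)))))))) → x ≤ Cx
  Cx₁ = skip₁ (2 ^ ρ * (2 ^ K * 2 ^ suc K))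

  Cx₃ : ∀ {x} → x ≤ (K + 2) + (Kc + (q + ((3 + 2 * L) + (ρ + (cA + (P + Q)))))) → x ≤ Cx
  Cx₃ h = Cx₁ (skip₁ Cw (skip₁ 64 h))

  Cx₅ : ∀ {x} → x ≤ q + ((3 + 2 * L) + (ρ + (cA + (P + Q)))) → x ≤ Cx
  Cx₅ h = Cx₃ (skip₁ (K + 2) (skip₁ Kc h))

  Cx₇ : ∀ {x} → x ≤ ρ + (cA + (P + Q)) → x ≤ Cx
  Cx₇ h = Cx₅ (skip₁ q (skip₁ (3 + 2 * L) h))

  64≤X : 64 ≤ X N
  64≤X = ≤X (Cx₁ (skip₁ Cw (m≤m+n 64 _)))

  Cw≤X : Cw ≤ X N
  Cw≤X = ≤X (Cx₁ (m≤m+n Cw _))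

  W≤X : W ≤ X N
  W≤X = ≡≤ (*-comm (suc N) Cw) (in-X (Cx₁ (m≤m+n Cw _)))

  sN≤X : suc N ≤ X N
  sN≤X = ≡≤ (sym (*-identityˡ (suc N))) (in-X (Cx₁ (skip₁ Cw (m≤m+n 1 _))))

  inp≤X : K + 2 * N ≤ X N
  inp≤X = ≤-trans (≤≡ (m≤m+n _ (N * K + 2)) (l K N)) (in-X (Cx₃ (m≤m+n (K + 2) _)))
   where
   l : ∀ K N → K + 2 * N + (N * K + 2) ≡ (K + 2) * suc N
   l = solve-∀

  2^g≤ : 2 ^ ρ * 2 ^ g ≤ X N
  2^g≤ = ≤-trans (*-monoʳ-≤ (2 ^ ρ) (≡≤ (^-distribˡ-+-* 2 (K * lgN) (suc K)) (*-monoˡ-≤ (2 ^ suc K)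
    (≡≤ (trans (cong (2 ^_) (*-comm K lgN)) (sym (^-*-assoc 2 lgN K))) (≤≡ (^-monoˡ-≤ K (2^lgLoop-≤ N N)) (^-distribʳ-* K 2 (suc N)))))))
   (≡≤ (l (2 ^ ρ) (2 ^ K) (suc N ^ K) (2 ^ suc K)) (≤≡ (*-mono-≤ (m≤m+n (2 ^ ρ * (2 ^ K * 2 ^ suc K)) _) (m≤n*m (suc N ^ K) (suc N))) (sym (X≡ N))))
   where
   l : ∀ r x y z → r * (x * y * z) ≡ r * (x * z) * y
   l = solve-∀

  n≤XA : n ≤ X N * A'
  n≤XA = ≡≤ (trans (cong (2 ^ ρ *_) (^-distribˡ-+-* 2 g a)) (sym (*-assoc (2 ^ ρ) (2 ^ g) A'))) (*-monoˡ-≤ A' 2^g≤)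

  X<2^w : X N < 2 ^ wordSize wc N
  X<2^w = ≤-<-trans (≤-reflexive (X≡ N)) (<-≤-trans (<-≤-trans (*-monoˡ-< (suc N ^ suc K) {{m^n≢0 (suc N) (suc K)}} (n<2^n Cx)) (*-monoʳ-≤ (2 ^ Cx) s^≤)) (≡≤ (sym (^-distribˡ-+-* 2 Cx (s * suc K))) (^-monoʳ-≤ 2 (≤≡ (+-monoˡ-≤ (s * suc K) (m≤m*n Cx s)) (l Cx s (suc K))))))
   where
   s = suc ⌊log₂ N ⌋
   s^≤ : suc N ^ suc K ≤ 2 ^ (s * suc K)
   s^≤ = ≤≡ (^-monoˡ-≤ (suc K) (<2^suc-log N)) (^-*-assoc 2 s (suc K))
   l : ∀ x s y → x * s + s * y ≡ (x + y) * s
   l = solve-∀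

  -- 2 N + 1 ≤ 2 ^ (lg N + 1), so K lg N + K digits count the clauses. The further 1 in g makes A <
  -- B hold even for K = 0.
  clauses : ∀ {d} → d ≤ suc (2 * N) ^ K → d ≤ 2 ^ g
  clauses d≤ = ≤-trans d≤ (≤-trans (^-monoˡ-≤ K (≤-trans (s≤s (≤≡ (n≤1+n (2 * N)) refl)) (≡≤ (sym (*-suc 2 N)) (*-monoʳ-≤ 2 (N<2^lg N)))))
   (≡≤ (^-*-assoc 2 (suc lgN) K) (^-monoʳ-≤ 2 (≡≤ (trans (+-comm K (lgN * K)) (cong (_+ K) (*-comm lgN K))) (+-monoʳ-≤ (K * lgN) (n≤1+n K))))))

  2^g≤B : 2 ^ g ≤ B
  2^g≤B = ^-monoʳ-≤ 2 (m≤m+n g a)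

  -- The padding pays off here: d A ≤ 2 ^ g A = B ≤ n. The last summand d leaves room for all
  -- dynamic edges, and the sum is the origin of the edge bound 6 n.
  edges≤ : ∀ {d} → d ≤ 2 ^ g → A' * suc (d * 2) + (n + d) + d ≤ 6 * n
  edges≤ {d} d≤ = ≤≡ (+-mono-≤ (+-mono-≤ (≡≤ (l A' d) (+-mono-≤ (<⇒≤ (<-≤-trans A<B B≤n)) (*-monoʳ-≤ 2 (≤-trans (*-monoˡ-≤ A' d≤) (≡≤ (sym (^-distribˡ-+-* 2 g a)) B≤n)))))
    (+-monoʳ-≤ n d≤n)) d≤n) (l' n)
   where
   d≤n : d ≤ n
   d≤n = ≤-trans d≤ (≤-trans 2^g≤B B≤n)
   l : ∀ a d → a * suc (d * 2) ≡ a + 2 * (d * a)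
   l = solve-∀
   l' : ∀ n → n + 2 * n + (n + n) + n ≡ 6 * n
   l' = solve-∀

  time≤ : ∀ {d} → d ≤ X N → X N ^ 110 * (p n + Φ * (d * u n + (c n + d * u n)) + (n + Φ * A')) ≤ T' N
  time≤ {d} d≤ = absorb 110 (X N) {{>-nonZero (≤-trans (s≤s z≤n) 64≤X)}} {p n} {Φ} {u n + c n} {n + Φ * A'} (ops≤ d (X N * X N)
   (≤-trans (+-mono-≤ (*-monoʳ-≤ 2 d≤) (≤-trans (s≤s z≤n) 64≤X)) (≡≤ (l (X N)) (*-monoˡ-≤ (X N) (≤-trans (m≤m+n 3 61) 64≤X)))))
   where
   l : ∀ x → 2 * x + x ≡ 3 * x
   l = solve-∀

  -- The exponent 119 + t is 112 from the cost of the simulation plus 7 + t from `total-bound`.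
  T'-bound : T' N ^ (k * q) ≤ (Cx ^ (119 + t) * suc N ^ (suc K * (119 + t))) ^ (k * q) * 2 ^ (N * (k * q ∸ 1))
  T'-bound = ≡≤ (^-distribʳ-* (k * q) (X N ^ 112) _) (≤-trans (*-monoʳ-≤ ((X N ^ 112) ^ (k * q)) total) (≤-reflexive
    (trans (sym (*-assoc ((X N ^ 112) ^ (k * q)) _ _)) (cong (_* 2 ^ (N * (k * q ∸ 1))) (trans (sym (^-distribʳ-* (k * q) (X N ^ 112) (X N ^ (7 + t)))) (cong (_^ (k * q)) exponent))))))
   where
   total = Exponents.total-bound N q k t refl 1≤t 1≤k a aq≤N N≤aq+q 2a≤N {p n} {u n + c n} {n} {P} {Q} {X N} (≤-trans (m≤m+n 4 60) 64≤X)
    (≤X (Cx₇ (skip₁ ρ (skip₁ cA (m≤m+n P Q))))) (≤X (Cx₇ (skip₁ ρ (skip₁ cA (m≤n+m Q P))))) n≤XA (p≤ n 1≤n) (v≤ n 1≤n)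
   exponent : X N ^ 112 * X N ^ (7 + t) ≡ Cx ^ (119 + t) * suc N ^ (suc K * (119 + t))
   exponent = trans (sym (^-distribˡ-+-* (X N) 112 (7 + t))) (trans (trans (cong (_^ (119 + t)) (X≡ N)) (^-distribʳ-* (119 + t) Cx (suc N ^ suc K))) (cong (Cx ^ (119 + t) *_) (^-*-assoc (suc N) (suc K) (119 + t))))

-- From a dynamic algorithm to a decision procedure

NearGap : ℕ → ℚ.ℚ → Set
NearGap L α = ∀ P P̂ → fromℕ P̂ ℚ.≤ α ℚ.* fromℕ P → P ≤ 3 + L → P̂ < 3 + 2 * L

-- The answer is correct for every coin sequence, so all of them count as good and the error
-- probability is 0.
decides : ∀ {K c P T} → (∀ {N} (F : CNF N) → IsKCNF K F → ∀ ω → Ends (wordSize c N) P (startSAT (wordSize c N) F ω) (T N) (CorrectAnswer F)) →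
 DecidesSAT K c P T
decides {T = T} h N F short = full , ≤≡ (*-monoˡ-≤ (2 ^ T N) (n≤1+n 2)) (cong (3 *_) (sym (∣⊤∣≡n (2 ^ T N)))) ,
 λ ω → let (t , s , r , t≤ , ok) = h F short (digits (toℕ ω)) in t , s , r , t≤ , λ _ → ok

module Decision (A : DynAlg) (k t L K P Q : ℕ) (1≤k : 1 ≤ k) (1≤t : 1 ≤ t) (p u c : ℕ → ℕ)
 (p≤ : ∀ n → 1 ≤ n → p n ≤ P * n ^ t) (v≤ : ∀ n → 1 ≤ n → (u n + c n) ^ k ≤ Q ^ k * n ^ (2 * k ∸ 1))
 (α : ℚ.ℚ) (gap : NearGap L α) where
 open Reduction A k t L K P Q 1≤k 1≤t p u c p≤ v≤

 preprocess-consts : ConstsBelow Kc (preprocess A)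
 preprocess-consts = consts-below (preprocess A) (m≤m+n _ _)

 insert-consts : ConstsBelow Kc (onInsert A)
 insert-consts = consts-below (onInsert A) (skip₁ (constSum (preprocess A)) (m≤m+n _ _))

 delete-consts : ConstsBelow Kc (onDelete A)
 delete-consts = consts-below (onDelete A) (skip₁ (constSum (preprocess A)) (skip₁ (constSum (onInsert A)) (m≤m+n _ _)))

 query-consts : ConstsBelow Kc (onQuery A)
 query-consts = consts-below (onQuery A) (skip₁ (constSum (preprocess A)) (skip₁ (constSum (onInsert A)) (m≤n+m _ (constSum (onDelete A)))))

 module At {N : ℕ} (F : CNF N) (short : IsKCNF K F) where
  open Bounds N

  d : ℕ
  d = length F

  d≤ : d ≤ 2 ^ g
  d≤ = clauses (clauses≤ K F short)

  2^g≤X : 2 ^ g ≤ X N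
  2^g≤X = ≤-trans (m≤n*m (2 ^ g) (2 ^ ρ) {{m^n≢0 2 ρ}}) 2^g≤

  d≤B : d ≤ B
  d≤B = ≤-trans d≤ 2^g≤B

  <2^w : ∀ {x} → x ≤ X N → x < 2 ^ wordSize wc N
  <2^w x≤ = ≤-<-trans x≤ X<2^w

  W<2^w : W < 2 ^ wordSize wc N
  W<2^w = <2^w W≤X

  sN<2^w : suc N < 2 ^ wordSize wc N
  sN<2^w = <2^w sN≤X

  2<2^w : 2 < 2 ^ wordSize wc N
  2<2^w = <2^w (≤-trans (m≤m+n 2 62) 64≤X)

  Cw<2^w : Cw < 2 ^ wordSize wc N
  Cw<2^w = <2^w Cw≤X

  d<2^w : d < 2 ^ wordSize wc N
  d<2^w = <2^w (≤-trans d≤ 2^g≤X)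

  inp<2^w : K + 2 * N < 2 ^ wordSize wc N
  inp<2^w = <2^w inp≤X

  cfg : Config
  cfg = record { w = wordSize wc N ; W = W ; N = N ; d = d ; inp = cnfInput F ; W< = W<2^w ; 2< = 2<2^w
         ; N< = <-trans (n<1+n N) sN<2^w ; d< = d<2^w ; inp< = λ m a → ≤-<-trans (cnfInput≤ F short m a) inp<2^w }

  fits : Machine.Initial.Fits cfg q K L ρ cA
  fits = record { consts≤ = ≤W C₁≤ ; 2a≤N = 2a≤N ; N<W = N<W ; d<W = ≤-<-trans d≤ (^-monoʳ-< 2 (s≤s (s≤s z≤n)) g<W) ; ℓ≤ = 2ℓ≤ ; V≤ = 2V≤ ; L< = n<2^n (3 + L) }
   where
   g<W : g < W
   g<W = ≤-trans (s≤s (≤-trans (m≤m+n g a) (m≤n+m b ρ))) (≤-trans (≡≤ (+-comm 1 ℓ) (≤≡ (+-monoʳ-≤ ℓ (m≤n+m 1 (ℓ + 2))) (trans (cong (ℓ +_) (+-assoc ℓ 2 1)) (sym (+-assoc ℓ ℓ 3))))) 2ℓ≤)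

 decide : ∀ mode → Approximates mode (boundFor mode) α (6 *_) p u c A → DecidesSAT K wc (solverP Cw q K L ρ A (denseFor mode) (phasesFor mode A)) T'
 decide mode approx = decides {K} {wc} {_} {T'} run
  where
  run : ∀ {N} (F : CNF N) → IsKCNF K F → ∀ ω →
   Ends (wordSize wc N) (solverP Cw q K L ρ A (denseFor mode) (phasesFor mode A)) (startSAT (wordSize wc N) F ω) (T' N) (CorrectAnswer F)
  run {N} F short = Machine.Solver.Simulated.solve-within cfg A Cw q K L ρ F short refl refl (λ _ _ → refl) sN<2^w Cw<2^w
   fits A<B d≤B room inp≤W Kc Kc<2^W preprocess-consts insert-consts delete-consts query-consts α
   (X N) 64≤X W≤X (≤-trans d≤ 2^g≤X) (≤-trans (n≤1+n N) sN≤X) inp≤X (≤X (Cx₃ (skip₁ (K + 2) (m≤m+n Kc _)))) (≤X (Cx₅ (m≤m+n q _)))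
   (≤X (Cx₅ (skip₁ q (m≤m+n (3 + 2 * L) _)))) (≤X (Cx₇ (m≤m+n ρ _))) (≤X (Cx₇ (skip₁ ρ (m≤m+n cA _))))
   mode {6 *_} {p} {u} {c} gap Φ<2^W (edges≤ d≤) (room-for d d≤B) (time≤ (≤-trans d≤ 2^g≤X)) approx
   where
   open Bounds N
   open At F short

-- Rational exponents

num⁺ : ℚ.ℚ → ℕ
num⁺ r = ℤ.∣ ℚ.↥ r ℤ.⊔ ℤ.0ℤ ∣

num⁺-≤ : ∀ r {i d m} → ℚ.toℚᵘ r ℚᵘ.≃ ℚᵘ.mkℚᵘ i d → i ℤ.≤ ℤ.+ m → num⁺ r * suc d ≤ m * ℚ.↧ₙ r
num⁺-≤ (ℚ.mkℚ (ℤ.+ a) e _) {i} {d} {m} (ℚᵘ.*≡* eqn) i≤ = subst (λ z → z * suc d ≤ m * suc e) (sym (⊔-identityʳ a))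
 (ℤ.drop‿+≤+ (ℤ.≤-trans (ℤ.≤-reflexive (trans (ℤ.pos-* a (suc d)) eqn)) (ℤ.≤-trans (ℤ.*-monoʳ-≤-nonNeg (ℤ.+ suc e) i≤) (ℤ.≤-reflexive (sym (ℤ.pos-* m (suc e)))))))
num⁺-≤ (ℚ.mkℚ ℤ.-[1+ a ] e _) _ _ = z≤n

-- Denominators are at least 1, so a positive rational is at most its numerator. This replaces the
-- exponent of the preprocessing time by an integer.
num⁺-abs : ∀ r → num⁺ r * 1 ≤ ℤ.∣ ℚ.↥ r ∣ * ℚ.↧ₙ r
num⁺-abs (ℚ.mkℚ (ℤ.+ a) e _) = *-mono-≤ (≤-reflexive (⊔-identityʳ a)) (s≤s z≤n)
num⁺-abs (ℚ.mkℚ ℤ.-[1+ a ] e _) = z≤n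

numerator≥1 : ∀ r → ℚ.0ℚ ℚ.< r → 1 ≤ ℤ.∣ ℚ.↥ r ∣
numerator≥1 r 0<r = go r {{ℚ.positive 0<r}}
 where
 go : ∀ r {{_ : ℚ.Positive r}} → 1 ≤ ℤ.∣ ℚ.↥ r ∣
 go (ℚ.mkℚ (ℤ.+ suc a) _ _) = s≤s z≤n

toℚᵘ-homo-sub : ∀ x y → ℚ.toℚᵘ (x ℚ.- y) ℚᵘ.≃ ℚ.toℚᵘ x ℚᵘ.- ℚ.toℚᵘ y
toℚᵘ-homo-sub x y = ℚᵘ.≃-trans (ℚ.toℚᵘ-homo-+ x (ℚ.- y)) (ℚᵘ.+-congʳ (ℚ.toℚᵘ x) (ℚ.toℚᵘ-homo‿- y))

-- With a denominator j of ε, the number 2 - ε is at most (2 j - 1) / j.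
two-minus : ∀ ε → ℚ.0ℚ ℚ.< ε → ∃[ i ] (ℚ.toℚᵘ (2ℚ ℚ.- ε) ℚᵘ.≃ ℚᵘ.mkℚᵘ i (pred (ℚ.↧ₙ ε)) × i ℤ.≤ ℤ.+ (2 * ℚ.↧ₙ ε ∸ 1))
two-minus ε 0<ε = go ε {{ℚ.positive 0<ε}}
 where
 go : ∀ ε {{_ : ℚ.Positive ε}} → ∃[ i ] (ℚ.toℚᵘ (2ℚ ℚ.- ε) ℚᵘ.≃ ℚᵘ.mkℚᵘ i (pred (ℚ.↧ₙ ε)) × i ℤ.≤ ℤ.+ (2 * ℚ.↧ₙ ε ∸ 1))
 go ε@(ℚ.mkℚ (ℤ.+ suc s) j' _) = i , ℚᵘ.≃-trans (toℚᵘ-homo-sub 2ℚ ε) (ℚᵘ.≃-reflexive (cong (ℚᵘ.mkℚᵘ i) (+-identityʳ j'))) , i≤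
  where
  i : ℤ.ℤ
  i = ℤ.+ 2 ℤ.* ℤ.+ suc j' ℤ.+ ℤ.-[1+ s ] ℤ.* ℤ.+ 1
  i≤ : i ℤ.≤ ℤ.+ (2 * suc j' ∸ 1)
  i≤ = ℤ.≤-trans (ℤ.≤-reflexive (cong₂ ℤ._+_ (sym (ℤ.pos-* 2 (suc j'))) (ℤ.*-identityʳ ℤ.-[1+ s ]))) (ℤ.+-monoʳ-≤ (ℤ.+ (2 * suc j')) {ℤ.-[1+ s ]} {ℤ.-[1+ 0 ]} (ℤ.-≤- z≤n))

-- The distances 3 + L and 3 + 2 L are told apart if L is a multiple of a
-- denominator of ε.
near-gap : ∀ ε → ℚ.0ℚ ℚ.< ε → NearGap (3 * ℚ.↧ₙ ε) (2ℚ ℚ.- ε)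
near-gap ε 0<ε P P̂ h P≤ = *-cancelʳ-< j P̂ (3 + 2 * (3 * j)) (≤-<-trans (scaled (two-minus ε 0<ε)) (≤-<-trans (*-monoʳ-≤ (2 * j ∸ 1) P≤) (strict j')))
 where
 j' j : ℕ
 j' = pred (ℚ.↧ₙ ε)
 j = suc j'
 -- For J = suc j and L = 3 J, the left side is (2 J - 1) (3 + L) = 6 J ² + 3 J - 3 and the right
 -- side (3 + 2 L) J = 6 J ² + 3 J.
 strict : ∀ j → (2 * suc j ∸ 1) * (3 + 3 * suc j) < (3 + 2 * (3 * suc j)) * suc j
 strict j = ≤≡ (m≤m+n _ 2) (l j)
  where
  l : ∀ j → suc ((j + (suc j + 0)) * (3 + 3 * suc j)) + 2 ≡ (3 + 2 * (3 * suc j)) * suc j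
  l = solve-∀
 scaled : ∃[ i ] (ℚ.toℚᵘ (2ℚ ℚ.- ε) ℚᵘ.≃ ℚᵘ.mkℚᵘ i j' × i ℤ.≤ ℤ.+ (2 * j ∸ 1)) → P̂ * j ≤ (2 * j ∸ 1) * P
 scaled (i , α≃ , i≤) = ℤ.drop‿+≤+ (begin
  ℤ.+ (P̂ * j) ≡⟨ ℤ.pos-* P̂ j ⟩
  ℤ.+ P̂ ℤ.* ℤ.+ j ≡⟨ cong (λ z → ℤ.+ P̂ ℤ.* ℤ.+ suc z) (sym (*-identityʳ j')) ⟩
  ℤ.+ P̂ ℤ.* ℤ.+ suc (j' * 1) ≡⟨ cong (λ z → ℤ.+ P̂ ℤ.* ℤ.+ z) (one j') ⟩
  ℤ.+ P̂ ℤ.* ℤ.+ (suc j' * 1) ≤⟨ ℚᵘ.drop-*≤* compared ⟩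
  i ℤ.* ℤ.+ P ℤ.* ℤ.+ 1 ≡⟨ ℤ.*-identityʳ _ ⟩
  i ℤ.* ℤ.+ P ≤⟨ ℤ.*-monoʳ-≤-nonNeg (ℤ.+ P) i≤ ⟩
  ℤ.+ (2 * j ∸ 1) ℤ.* ℤ.+ P ≡⟨ sym (ℤ.pos-* (2 * j ∸ 1) P) ⟩
  ℤ.+ ((2 * j ∸ 1) * P) ∎)
  where
  open ℤ.≤-Reasoning
  one : ∀ x → suc (x * 1) ≡ suc x * 1
  one x = refl
  compared : ℚᵘ.mkℚᵘ (ℤ.+ P̂) 0 ℚᵘ.≤ ℚᵘ.mkℚᵘ i j' ℚᵘ.* ℚᵘ.mkℚᵘ (ℤ.+ P) 0
  compared = ℚᵘ.≤-respˡ-≃ (ℚ.toℚᵘ-fromℚᵘ (ℚᵘ.mkℚᵘ (ℤ.+ P̂) 0)) (ℚᵘ.≤-respʳ-≃ (ℚᵘ.≃-trans (ℚ.toℚᵘ-homo-* (2ℚ ℚ.- ε) (fromℕ P))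
   (ℚᵘ.*-cong α≃ (ℚ.toℚᵘ-fromℚᵘ (ℚᵘ.mkℚᵘ (ℤ.+ P) 0)))) (ℚ.toℚᵘ-mono-≤ h))

finite-sum : (ℕ → ℕ) → ℕ → ℕ
finite-sum f zero = 0
finite-sum f (suc n) = f n + finite-sum f n

≤finite-sum : ∀ f {m n} → m < n → f m ≤ finite-sum f n
≤finite-sum f {m} {suc n} m< with m≤n⇒m<n∨m≡n (s≤s⁻¹ m<)
... | inj₁ m<n = ≤-trans (≤finite-sum f m<n) (m≤n+m _ (f n))
... | inj₂ refl = m≤m+n (f m) _

-- Values below the threshold n₀ are absorbed into the constant by adding up these finitely many
-- values. Raising to the power d + 1 clears the denominator of the exponent.
O-bound : ∀ {f} r {d m} → num⁺ r * suc d ≤ m * ℚ.↧ₙ r → f =O[n^ r ] → ∃[ C ] ∀ n → 1 ≤ n → f n ^ suc d ≤ C ^ suc d * n ^ m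
O-bound {f} r {d} {m} r≤ (C , n₀ , f≤) = C + finite-sum f n₀ , λ n 1≤n → [ small n 1≤n , large n 1≤n ]′ (<-≤-connex n n₀)
 where
 e = ℚ.↧ₙ r
 small : ∀ n → 1 ≤ n → n < n₀ → f n ^ suc d ≤ (C + finite-sum f n₀) ^ suc d * n ^ m
 small n 1≤n n< = ≤-trans (^-monoˡ-≤ (suc d) (≤-trans (≤finite-sum f n<) (m≤n+m _ C))) (m≤m*n _ (n ^ m) {{m^n≢0 n m {{>-nonZero 1≤n}}}})
 large : ∀ n → 1 ≤ n → n₀ ≤ n → f n ^ suc d ≤ (C + finite-sum f n₀) ^ suc d * n ^ m
 large n 1≤n n₀≤ = ≤-trans (^-cancelˡ-≤ e (begin
  (f n ^ suc d) ^ e ≡⟨ swap (f n) (suc d) e ⟩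
  (f n ^ e) ^ suc d ≤⟨ ^-monoˡ-≤ (suc d) (≤-trans (m≤m*n (f n ^ e) (n ^ ℤ.∣ ℚ.↥ r ℤ.⊓ ℤ.0ℤ ∣) {{m^n≢0 n ℤ.∣ ℚ.↥ r ℤ.⊓ ℤ.0ℤ ∣ {{>-nonZero 1≤n}}}}) (f≤ n n₀≤)) ⟩
  (C ^ e * n ^ num⁺ r) ^ suc d ≡⟨ ^-distribʳ-* (suc d) (C ^ e) _ ⟩
  (C ^ e) ^ suc d * (n ^ num⁺ r) ^ suc d ≡⟨ cong₂ _*_ (swap C e (suc d)) (^-*-assoc n (num⁺ r) (suc d)) ⟩
  (C ^ suc d) ^ e * n ^ (num⁺ r * suc d) ≤⟨ *-monoʳ-≤ ((C ^ suc d) ^ e) (^-monoʳ-≤ n {{>-nonZero 1≤n}} r≤) ⟩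
  (C ^ suc d) ^ e * n ^ (m * e) ≡⟨ cong ((C ^ suc d) ^ e *_) (sym (^-*-assoc n m e)) ⟩
  (C ^ suc d) ^ e * (n ^ m) ^ e ≡⟨ sym (^-distribʳ-* e (C ^ suc d) (n ^ m)) ⟩
  (C ^ suc d * n ^ m) ^ e ∎)) (*-monoˡ-≤ (n ^ m) (^-monoˡ-≤ (suc d) (m≤m+n C _)))
  where
  open ≤-Reasoning
  swap : ∀ x a b → (x ^ a) ^ b ≡ (x ^ b) ^ a
  swap x a b = trans (^-*-assoc x a b) (trans (cong (x ^_) (*-comm a b)) (sym (^-*-assoc x b a)))

-- The rational is stored in lowest terms that are not computed here; its equality with D / (D + 1)
-- as a fraction is enough to compare powers.
one-minus : ∀ D {x c b} → x ^ suc D ≤ c ^ suc D * b ^ D → x ≤ c ∙ b ^ℚ (ℚ.1ℚ ℚ.- ℤ.+ 1 ℚ./ suc D)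
one-minus D {x} {c} {b} h = go (ℚ.1ℚ ℚ.- ℤ.+ 1 ℚ./ suc D) (ℚᵘ.≃-trans (toℚᵘ-homo-sub ℚ.1ℚ (ℤ.+ 1 ℚ./ suc D))
  (ℚᵘ.+-congʳ (ℚ.toℚᵘ ℚ.1ℚ) (ℚᵘ.-‿cong (ℚ.toℚᵘ-fromℚᵘ (ℚᵘ.mkℚᵘ (ℤ.+ 1) D)))))
 where
 go : ∀ r → ℚ.toℚᵘ r ℚᵘ.≃ ℚᵘ.mkℚᵘ (ℤ.+ 1) 0 ℚᵘ.- ℚᵘ.mkℚᵘ (ℤ.+ 1) D → x ≤ c ∙ b ^ℚ r
 go (ℚ.mkℚ (ℤ.+ a) e _) (ℚᵘ.*≡* eqn) = subst₂ (λ y z → x ^ suc e * b ^ y ≤ c ^ suc e * b ^ z) (sym (⊓-zeroʳ a)) (sym (⊔-identityʳ a))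
  (≡≤ (*-identityʳ (x ^ suc e)) (^-cancelˡ-≤ (suc D) (begin
   (x ^ suc e) ^ suc D ≡⟨ swap x (suc e) (suc D) ⟩
   (x ^ suc D) ^ suc e ≤⟨ ^-monoˡ-≤ (suc e) h ⟩
   (c ^ suc D * b ^ D) ^ suc e ≡⟨ ^-distribʳ-* (suc e) (c ^ suc D) (b ^ D) ⟩
   (c ^ suc D) ^ suc e * (b ^ D) ^ suc e ≡⟨ cong₂ _*_ (swap c (suc D) (suc e)) (trans (^-*-assoc b D (suc e)) (trans (cong (b ^_) (sym ratio)) (sym (^-*-assoc b a (suc D))))) ⟩
   (c ^ suc e) ^ suc D * (b ^ a) ^ suc D ≡⟨ sym (^-distribʳ-* (suc D) (c ^ suc e) (b ^ a)) ⟩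
   (c ^ suc e * b ^ a) ^ suc D ∎)))
  where
  open ≤-Reasoning
  swap : ∀ x a b → (x ^ a) ^ b ≡ (x ^ b) ^ a
  swap x a b = trans (^-*-assoc x a b) (trans (cong (x ^_) (*-comm a b)) (sym (^-*-assoc x b a)))
  ratio : a * suc D ≡ D * suc e
  ratio = trans (cong (a *_) (sym (+-identityʳ (suc D)))) (trans (ℤ.+-injective (trans (ℤ.pos-* a (suc (D + 0))) (trans eqn (sym (ℤ.pos-* (D + 0) (suc e)))))) (cong (_* suc e) (+-identityʳ D)))
 go (ℚ.mkℚ ℤ.-[1+ a ] e _) (ℚᵘ.*≡* eqn) = contradiction (trans eqn (sym (ℤ.pos-* (D + 0) (suc e)))) λ ()

theorem3p5 : (t ε ε' : ℚ.ℚ) → ℚ.0ℚ ℚ.< t → ℚ.0ℚ ℚ.< ε → ℚ.0ℚ ℚ.< ε' → SETH →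
  Σ[ m ∈ (ℕ → ℕ) ] m =Õ[n] ×
   ¬ HasAlgorithm fullyDynamic Amortized (2ℚ ℚ.- ε) m t (2ℚ ℚ.- ε') (2ℚ ℚ.- ε') ×
   ¬ HasAlgorithm incremental WorstCase (2ℚ ℚ.- ε) m t (2ℚ ℚ.- ε') (2ℚ ℚ.- ε') ×
   ¬ HasAlgorithm decremental WorstCase (2ℚ ℚ.- ε) m t (2ℚ ℚ.- ε') (2ℚ ℚ.- ε')
-- A linear number of edges, with the factor 6 from `edges≤`.
theorem3p5 t ε ε' 0<t 0<ε 0<ε' seth = (6 *_) , (6 , 0 , 0 , λ n _ → ≤-reflexive (sym (*-identityʳ (6 * n)))) ,
 refute fullyDynamic , refute incremental , refute decremental
 where
 k' t' D' L : ℕ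
 k' = pred (ℚ.↧ₙ ε')
 t' = ℤ.∣ ℚ.↥ t ∣
 -- Chosen so that suc D' = k q with k = suc k' and q = suc t'. The hypothesis is applied with the
 -- saving 1 / (k q) in the exponent.
 D' = t' + k' * suc t'
 L = 3 * ℚ.↧ₙ ε

 hard : ∃[ K ] ¬ (∃[ c ] ∃[ P ] ∃[ T ] DecidesSAT K c P T × (∃[ A ] ∃[ B ] ∀ N → T N ≤ A * suc N ^ B ∙ 2 ^ N ^ℚ (ℚ.1ℚ ℚ.- ℤ.+ 1 ℚ./ suc D')))
 hard = seth (ℤ.+ 1 ℚ./ suc D') (ℚ.positive⁻¹ (ℤ.+ 1 ℚ./ suc D') {{ℚ.normalize-pos 1 (suc D')}})

 K : ℕ
 K = proj₁ hard

 record Bounded-times (p u c : ℕ → ℕ) : Set where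
  field
   P Q : ℕ
   p≤ : ∀ n → 1 ≤ n → p n ≤ P * n ^ t'
   v≤ : ∀ n → 1 ≤ n → (u n + c n) ^ suc k' ≤ Q ^ suc k' * n ^ (2 * suc k' ∸ 1)

 bounded-times : ∀ {p u c} → p =O[n^ t ] → u =O[n^ 2ℚ ℚ.- ε' ] → c =O[n^ 2ℚ ℚ.- ε' ] → Bounded-times p u c
 bounded-times {p} {u} {c} p=O u=O c=O = record
  { P = proj₁ pO ; Q = 2 * (proj₁ uO + proj₁ cO)
  ; p≤ = λ n 1≤n → subst₂ (λ x y → x ≤ y * n ^ t') (*-identityʳ (p n)) (*-identityʳ (proj₁ pO)) (proj₂ pO n 1≤n)
  ; v≤ = λ n 1≤n → root-sum (suc k') (n ^ (2 * suc k' ∸ 1)) {u n} {c n} {proj₁ uO} {proj₁ cO} (proj₂ uO n 1≤n) (proj₂ cO n 1≤n) }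
  where
  exponent : num⁺ (2ℚ ℚ.- ε') * suc k' ≤ (2 * suc k' ∸ 1) * ℚ.↧ₙ (2ℚ ℚ.- ε')
  exponent = let (_ , ≃ , i≤) = two-minus ε' 0<ε' in num⁺-≤ (2ℚ ℚ.- ε') ≃ i≤
  pO : ∃[ C ] ∀ n → 1 ≤ n → p n ^ 1 ≤ C ^ 1 * n ^ t'
  pO = O-bound {p} t {0} {t'} (num⁺-abs t) p=O
  uO : ∃[ C ] ∀ n → 1 ≤ n → u n ^ suc k' ≤ C ^ suc k' * n ^ (2 * suc k' ∸ 1)
  uO = O-bound {u} (2ℚ ℚ.- ε') {k'} {2 * suc k' ∸ 1} exponent u=O
  cO : ∃[ C ] ∀ n → 1 ≤ n → c n ^ suc k' ≤ C ^ suc k' * n ^ (2 * suc k' ∸ 1)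
  cO = O-bound {c} (2ℚ ℚ.- ε') {k'} {2 * suc k' ∸ 1} exponent c=O

 refute : ∀ mode → ¬ HasAlgorithm mode (boundFor mode) (2ℚ ℚ.- ε) (6 *_) t (2ℚ ℚ.- ε') (2ℚ ℚ.- ε')
 refute mode (A , p , u , c , approx , p=O , u=O , c=O) =
  proj₂ hard (wc , _ , T' , decide mode approx , Cx ^ (119 + t') , suc K * (119 + t') , λ N →
   one-minus D' {T' N} {Cx ^ (119 + t') * suc N ^ (suc K * (119 + t'))} {2 ^ N} (≤≡ (Bounds.T'-bound N)
    (cong ((Cx ^ (119 + t') * suc N ^ (suc K * (119 + t'))) ^ suc D' *_) (sym (^-*-assoc 2 N D')))))
  where
  open Bounded-times (bounded-times {p} {u} {c} p=O u=O c=O)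
  open Reduction A (suc k') t' L K P Q (s≤s z≤n) (numerator≥1 t 0<t) p u c p≤ v≤ using (T'; Cx; wc; module Bounds)
  open Decision A (suc k') t' L K P Q (s≤s z≤n) (numerator≥1 t 0<t) p u c p≤ v≤ (2ℚ ℚ.- ε) (near-gap ε 0<ε) using (decide)
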